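{- Let $d \ge 3$ be a fixed integer and let $n \to \infty$ over integers with $dn$ even. Let $\mathbb{G}(n,d)$ be a random $d$-regular graph on $n$ vertices, and let $T(\mathbb{G}(n,d))$ be the broadcast time of the push model on it. Then, with probability $1-o(1)$, $$ |T(\mathbb{G}(n,d)) - C_d\ln n| = O((\ln\ln n)^2), \qquad\text{where}\qquad C_d = \frac1{\ln(2(1-\frac1d))} - \frac1{d\ln(1 - \frac1d)}.$$
   Context: $\mathbb{G}(n,d)$ denotes a graph drawn uniformly at random from the set of all (simple) $d$-regular graphs on the vertex set $\{1,\dots,n\}$. Push model: initially a single vertex holds a piece of information (by symmetry, which vertex is irrelevant). In each round, every informed vertex independently chooses a neighbor uniformly at random and transmits the information to it, which then becomes informed. The broadcast time is the number of rounds until all vertices are informed. The probability is over both the random graph and the random choices of the protocol; asymptotic notation refers to $n\to\infty$ with $d$ fixed. -}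

module Defs where

open import Data.Bool.Base using (Bool; true; false; if_then_else_; T)
open import Data.Fin.Base using (Fin)
import Data.Fin.Properties as Fin
open import Data.Fin.Subset using (Subset; _∈_; _∉_; ⊤; ⁅_⁆; ∣_∣; inside; outside)
open import Data.Fin.Subset.Properties using (_∈?_)
open import Data.Integer.Base as ℤ using (+_)
import Data.Integer.Properties as ℤ
open import Data.List.Base using (List; []; _∷_; allFin; cartesianProductWith; filter; foldr; length; map)
open import Data.Maybe.Base using (Maybe; just; nothing; maybe; _<∣>_)
open import Data.Nat.Base as ℕ using (ℕ; zero; suc)
import Data.Nat.Properties as ℕ
open import Data.Product.Base using (_×_; _,_; ∃-syntax; proj₁; proj₂)
open import Data.Rational.Base as ℚ using (ℚ; 0ℚ; 1ℚ; ½)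
import Data.Rational.Properties as ℚ
open import Data.Rational.Solver using (module +-*-Solver)
import Data.Rational.Unnormalised.Base as ℚᵘ
import Data.Rational.Unnormalised.Properties as ℚᵘ
open import Data.Sum.Base using (inj₁; inj₂)
open import Data.Vec.Base using (Vec; []; _∷_; lookup; replicate; tabulate)
import Data.Vec.Properties as Vec
import Data.Bool.Properties as Bool
open import Relation.Binary.PropositionalEquality using (_≡_; _≢_; refl; sym; trans; cong; cong₂; subst; subst₂)
open import Relation.Nullary.Decidable.Core using (Dec; yes; no; ⌊_⌋; _×-dec_; _⊎-dec_; _→-dec_; ¬?)
open import Relation.Nullary.Negation.Core using (contradiction)

module Sequence where

  open import Data.Rational.Base using (_+_; _*_; _-_; -_; _≤_; _<_) renaming (∣_∣ to abs)
  open +-*-Solver using (solve; con; _:+_; _:*_; _:-_; :-_; _:=_)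

  record Cauchy (x : ℕ → ℚ) : Set where
    field
      modulus : ∀ ε → 0ℚ < ε →
        ∃[ N ] (∀ m n → N ℕ.≤ m → N ℕ.≤ n → abs (x m - x n) ≤ ε)

  open Cauchy public

  Eventually : (ℕ → Set) → Set
  Eventually P = ∃[ N ] (∀ n → N ℕ.≤ n → P n)

  -- 0 ↦ 0; only its values at nonzero arguments matter.
  recip : ℚ → ℚ
  recip p with p ℚ.≟ 0ℚ
  ... | yes _   = 0ℚ
  ... | no  p≢0 = ℚ.1/_ p {{ℚ.≢-nonZero p≢0}}

  infixr 8 _^_
  _^_ : ℚ → ℕ → ℚ
  q ^ zero  = 1ℚ
  q ^ suc k = q * q ^ k

  coeff : ℕ → ℚ
  coeff k = + 1 ℚ./ suc (2 ℕ.* k)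

  -- Σ_{k<n} wᵏ/(2k+1)
  series : ℕ → ℚ → ℚ
  series zero    w = 0ℚ
  series (suc n) w = series n w + coeff n * w ^ n

  möbius : ℚ → ℚ
  möbius q = (q - 1ℚ) * recip (q + 1ℚ)

  -- Partial sums of ln q = 2 artanh z = 2 Σₖ z²ᵏ⁺¹/(2k+1), z = (q - 1)/(q + 1),
  -- which converge locally uniformly on q > 0.
  lnApprox : ℕ → ℚ → ℚ
  lnApprox n q = (1ℚ + 1ℚ) * (möbius q * series n (möbius q * möbius q))

  0≤1 : 0ℚ ≤ 1ℚ
  0≤1 = ℚ.nonNegative⁻¹ 1ℚ

  0<1 : 0ℚ < 1ℚ
  0<1 = ℚ.positive⁻¹ 1ℚ

  0<⇒≢0 : ∀ {p} → 0ℚ < p → p ≢ 0ℚ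
  0<⇒≢0 0<p p≡0 = ℚ.<⇒≢ 0<p (sym p≡0)

  +-pos : ∀ {p q} → 0ℚ < p → 0ℚ < q → 0ℚ < p + q
  +-pos {p} {q} 0<p 0<q = subst (_< p + q) (ℚ.+-identityˡ 0ℚ) (ℚ.+-mono-< 0<p 0<q)

  +-nonNeg : ∀ {p q} → 0ℚ ≤ p → 0ℚ ≤ q → 0ℚ ≤ p + q
  +-nonNeg {p} {q} 0≤p 0≤q = subst (_≤ p + q) (ℚ.+-identityˡ 0ℚ) (ℚ.+-mono-≤ 0≤p 0≤q)

  *-pos : ∀ {p q} → 0ℚ < p → 0ℚ < q → 0ℚ < p * q
  *-pos {p} {q} 0<p 0<q =
    ℚ.positive⁻¹ (p * q) {{ℚ.pos*pos⇒pos p {{ℚ.positive 0<p}} q {{ℚ.positive 0<q}}}}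

  *-monoˡ : ∀ {p q} r → 0ℚ ≤ r → p ≤ q → r * p ≤ r * q
  *-monoˡ r 0≤r = ℚ.*-monoˡ-≤-nonNeg r {{ℚ.nonNegative 0≤r}}

  *-monoʳ : ∀ {p q} r → 0ℚ ≤ r → p ≤ q → p * r ≤ q * r
  *-monoʳ r 0≤r = ℚ.*-monoʳ-≤-nonNeg r {{ℚ.nonNegative 0≤r}}

  *-mono : ∀ {p q r s} → 0ℚ ≤ p → p ≤ q → 0ℚ ≤ r → r ≤ s → p * r ≤ q * s
  *-mono {p} {q} {r} {s} 0≤p p≤q 0≤r r≤s =
    ℚ.≤-trans (*-monoʳ r 0≤r p≤q) (*-monoˡ q (ℚ.≤-trans 0≤p p≤q) r≤s)

  *-nonNeg : ∀ {p q} → 0ℚ ≤ p → 0ℚ ≤ q → 0ℚ ≤ p * q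
  *-nonNeg {p} {q} 0≤p 0≤q = subst (_≤ p * q) (ℚ.*-zeroʳ p) (*-monoˡ p 0≤p 0≤q)

  0≤q-p⇒p≤q : ∀ {p q} → 0ℚ ≤ q - p → p ≤ q
  0≤q-p⇒p≤q {p} {q} h =
    subst₂ _≤_ (ℚ.+-identityˡ p) (solve 2 (λ p q → (q :- p) :+ p := q) refl p q)
      (ℚ.+-monoˡ-≤ p h)

  p≤q⇒0≤q-p : ∀ {p q} → p ≤ q → 0ℚ ≤ q - p
  p≤q⇒0≤q-p {p} {q} h = subst (_≤ q - p) (ℚ.+-inverseʳ p) (ℚ.+-monoˡ-≤ (- p) h)

  p<q⇒0<q-p : ∀ {p q} → p < q → 0ℚ < q - p
  p<q⇒0<q-p {p} {q} h = subst (_< q - p) (ℚ.+-inverseʳ p) (ℚ.+-monoˡ-< (- p) h)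

  p≤p+q : ∀ {p q} → 0ℚ ≤ q → p ≤ p + q
  p≤p+q {p} {q} 0≤q = subst (_≤ p + q) (ℚ.+-identityʳ p) (ℚ.+-monoʳ-≤ p 0≤q)

  sq-nonNeg : ∀ p → 0ℚ ≤ p * p
  sq-nonNeg p with ℚ.≤-total 0ℚ p
  ... | inj₁ 0≤p = *-nonNeg 0≤p 0≤p
  ... | inj₂ p≤0 = subst (0ℚ ≤_) (solve 1 (λ p → (:- p) :* (:- p) := p :* p) refl p)
                     (*-nonNeg (ℚ.neg-antimono-≤ p≤0) (ℚ.neg-antimono-≤ p≤0))

  p≤abs : ∀ p → p ≤ abs p
  p≤abs p with ℚ.≤-total 0ℚ p
  ... | inj₁ 0≤p = ℚ.≤-reflexive (sym (ℚ.0≤p⇒∣p∣≡p 0≤p))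
  ... | inj₂ p≤0 = ℚ.≤-trans p≤0 (ℚ.0≤∣p∣ p)

  abs-pos : ∀ {p} → p ≢ 0ℚ → 0ℚ < abs p
  abs-pos {p} p≢0 = ℚ.≰⇒> λ ∣p∣≤0 →
    p≢0 (ℚ.∣p∣≡0⇒p≡0 p (ℚ.≤-antisym ∣p∣≤0 (ℚ.0≤∣p∣ p)))

  abs-sym : ∀ p q → abs (p - q) ≡ abs (q - p)
  abs-sym p q = trans (sym (ℚ.∣-p∣≡∣p∣ (p - q)))
    (cong abs (solve 2 (λ p q → :- (p :- q) := q :- p) refl p q))

  abs-tri : ∀ p q r → abs (p - r) ≤ abs (p - q) + abs (q - r)
  abs-tri p q r = subst (λ t → abs t ≤ abs (p - q) + abs (q - r))
    (solve 3 (λ p q r → (p :- q) :+ (q :- r) := p :- r) refl p q r)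
    (ℚ.∣p+q∣≤∣p∣+∣q∣ (p - q) (q - r))

  abs-diff : ∀ p q → abs p ≤ abs (p - q) + abs q
  abs-diff p q = subst (λ t → abs t ≤ abs (p - q) + abs q)
    (solve 2 (λ p q → (p :- q) :+ q := p) refl p q)
    (ℚ.∣p+q∣≤∣p∣+∣q∣ (p - q) q)

  abs-sub : ∀ p q → abs p - abs q ≤ abs (p - q)
  abs-sub p q = 0≤q-p⇒p≤q (subst (0ℚ ≤_)
    (solve 3 (λ a b c → (c :+ b) :- a := c :- (a :- b)) refl (abs p) (abs q) (abs (p - q)))
    (p≤q⇒0≤q-p (abs-diff p q)))

  abs-abs : ∀ p q → abs (abs p - abs q) ≤ abs (p - q)
  abs-abs p q with ℚ.∣p∣≡p∨∣p∣≡-p (abs p - abs q)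
  ... | inj₁ e = subst (_≤ abs (p - q)) (sym e) (abs-sub p q)
  ... | inj₂ e = subst₂ _≤_
    (sym (trans e (solve 2 (λ a b → :- (a :- b) := b :- a) refl (abs p) (abs q))))
    (abs-sym q p) (abs-sub q p)

  *-recip : ∀ p → p ≢ 0ℚ → p * recip p ≡ 1ℚ
  *-recip p p≢0 with p ℚ.≟ 0ℚ
  ... | yes p≡0 = contradiction p≡0 p≢0
  ... | no  p≢0 = ℚ.*-inverseʳ p {{ℚ.≢-nonZero p≢0}}

  recip-pos : ∀ {p} → 0ℚ < p → 0ℚ < recip p
  recip-pos {p} 0<p = ℚ.≰⇒> λ r≤0 → ℚ.<⇒≢ 0<1 (ℚ.≤-antisym 0≤1
    (subst₂ _≤_ (*-recip p (0<⇒≢0 0<p)) (ℚ.*-zeroʳ p) (*-monoˡ p (ℚ.<⇒≤ 0<p) r≤0)))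

  inv-anti : ∀ {p q i j} → 0ℚ ≤ i → 0ℚ ≤ j → p ≤ q → p * i ≡ 1ℚ → q * j ≡ 1ℚ → j ≤ i
  inv-anti {p} {q} {i} {j} 0≤i 0≤j p≤q pi qj =
    subst₂ _≤_ eq₁ eq₂ (*-monoʳ i 0≤i (*-monoˡ j 0≤j p≤q))
    where
    eq₁ : j * p * i ≡ j
    eq₁ = trans (ℚ.*-assoc j p i) (trans (cong (j *_) pi) (ℚ.*-identityʳ j))
    eq₂ : j * q * i ≡ i
    eq₂ = trans (cong (_* i) (trans (ℚ.*-comm j q) qj)) (ℚ.*-identityˡ i)

  abs-recip-≤ : ∀ {p δ} → 0ℚ < δ → δ ≤ abs p → abs (recip p) ≤ recip δ
  abs-recip-≤ {p} {δ} 0<δ δ≤p =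
    inv-anti (ℚ.<⇒≤ (recip-pos 0<δ)) (ℚ.0≤∣p∣ (recip p)) δ≤p
      (*-recip δ (0<⇒≢0 0<δ))
      (trans (sym (ℚ.∣p*q∣≡∣p∣*∣q∣ p (recip p))) (cong abs (*-recip p p≢0)))
    where
    p≢0 : p ≢ 0ℚ
    p≢0 refl = ℚ.<⇒≢ (ℚ.<-≤-trans 0<δ δ≤p) refl

  const-cauchy : ∀ q → Cauchy (λ _ → q)
  const-cauchy q .modulus ε 0<ε = 0 , λ _ _ _ _ →
    subst (_≤ ε) (cong abs (sym (ℚ.+-inverseʳ q))) (ℚ.<⇒≤ 0<ε)

  lipschitz : ∀ {x y z} c → 0ℚ < c → Cauchy x → Cauchy y →
    ∃[ K ] (∀ m n → K ℕ.≤ m → K ℕ.≤ n →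
      abs (z m - z n) ≤ c * (abs (x m - x n) + abs (y m - y n))) →
    Cauchy z
  lipschitz {x} {y} {z} c 0<c cx cy (K , h) .modulus ε 0<ε =
    K ℕ.⊔ (N₁ ℕ.⊔ N₂) , λ m n p q →
      let K≤ = ℕ.m≤m⊔n K (N₁ ℕ.⊔ N₂)
          N≤ = ℕ.m≤n⊔m K (N₁ ℕ.⊔ N₂)
          N₁≤ = ℕ.≤-trans (ℕ.m≤m⊔n N₁ N₂) N≤
          N₂≤ = ℕ.≤-trans (ℕ.m≤n⊔m N₁ N₂) N≤
      in ℚ.≤-trans (h m n (ℕ.≤-trans K≤ p) (ℕ.≤-trans K≤ q))
        (subst (c * (abs (x m - x n) + abs (y m - y n)) ≤_) total
          (*-monoˡ c (ℚ.<⇒≤ 0<c) (ℚ.+-mono-≤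
            (h₁ m n (ℕ.≤-trans N₁≤ p) (ℕ.≤-trans N₁≤ q))
            (h₂ m n (ℕ.≤-trans N₂≤ p) (ℕ.≤-trans N₂≤ q)))))
    where
    η : ℚ
    η = ½ * (recip c * ε)
    0<η : 0ℚ < η
    0<η = *-pos (ℚ.positive⁻¹ ½) (*-pos (recip-pos 0<c) 0<ε)
    total : c * (η + η) ≡ ε
    total = trans
      (solve 3 (λ c r e → c :* (con ½ :* (r :* e) :+ con ½ :* (r :* e)) := (c :* r) :* e)
        refl c (recip c) ε)
      (trans (cong (_* ε) (*-recip c (0<⇒≢0 0<c))) (ℚ.*-identityˡ ε))
    N₁ = proj₁ (modulus cx η 0<η)
    h₁ = proj₂ (modulus cx η 0<η)
    N₂ = proj₁ (modulus cy η 0<η)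
    h₂ = proj₂ (modulus cy η 0<η)

  bounded : ∀ {x} → Cauchy x →
    ∃[ B ] (0ℚ < B × Eventually (λ n → abs (x n) ≤ B))
  bounded {x} cx with modulus cx 1ℚ 0<1
  ... | N , h = 1ℚ + abs (x N) ,
    ℚ.<-≤-trans 0<1 (p≤p+q (ℚ.0≤∣p∣ (x N))) ,
    N , λ n N≤n → ℚ.≤-trans (abs-diff (x n) (x N))
      (ℚ.+-monoˡ-≤ (abs (x N)) (h n N N≤n ℕ.≤-refl))

  +-cauchy : ∀ {x y} → Cauchy x → Cauchy y → Cauchy (λ n → x n + y n)
  +-cauchy {x} {y} cx cy = lipschitz {x} {y} {λ n → x n + y n} 1ℚ 0<1 cx cy (0 , λ m n _ _ →
    subst₂ _≤_
      (cong abs (solve 4 (λ a b c d → (a :- b) :+ (c :- d) := (a :+ c) :- (b :+ d)) refl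
        (x m) (x n) (y m) (y n)))
      (sym (ℚ.*-identityˡ _))
      (ℚ.∣p+q∣≤∣p∣+∣q∣ (x m - x n) (y m - y n)))

  neg-cauchy : ∀ {x} → Cauchy x → Cauchy (λ n → - x n)
  neg-cauchy {x} cx .modulus ε 0<ε with modulus cx ε 0<ε
  ... | N , h = N , λ m n p q → subst (_≤ ε)
    (trans (abs-sym (x m) (x n))
      (cong abs (solve 2 (λ a b → b :- a := (:- a) :- (:- b)) refl (x m) (x n))))
    (h m n p q)

  abs-cauchy : ∀ {x} → Cauchy x → Cauchy (λ n → abs (x n))
  abs-cauchy {x} cx .modulus ε 0<ε with modulus cx ε 0<ε
  ... | N , h = N , λ m n p q → ℚ.≤-trans (abs-abs (x m) (x n)) (h m n p q)

  *-lipschitz : ∀ {B D} a b c d → 0ℚ ≤ B → 0ℚ ≤ D → abs a ≤ B → abs d ≤ D →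
    abs (a * c - b * d) ≤ (B + D) * (abs (a - b) + abs (c - d))
  *-lipschitz {B} {D} a b c d 0≤B 0≤D a≤B d≤D = ℚ.≤-trans h (ℚ.≤-trans (ℚ.+-mono-≤ h₁ h₂) h₃)
    where
    u v : ℚ
    u = abs (a - b)
    v = abs (c - d)
    0≤u : 0ℚ ≤ u
    0≤u = ℚ.0≤∣p∣ (a - b)
    0≤v : 0ℚ ≤ v
    0≤v = ℚ.0≤∣p∣ (c - d)
    h : abs (a * c - b * d) ≤ abs (a * (c - d)) + abs ((a - b) * d)
    h = subst (λ t → abs t ≤ abs (a * (c - d)) + abs ((a - b) * d))
      (solve 4 (λ a b c d → a :* (c :- d) :+ (a :- b) :* d := a :* c :- b :* d) refl a b c d)
      (ℚ.∣p+q∣≤∣p∣+∣q∣ (a * (c - d)) ((a - b) * d))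
    h₁ : abs (a * (c - d)) ≤ B * v
    h₁ = subst (_≤ B * v) (sym (ℚ.∣p*q∣≡∣p∣*∣q∣ a (c - d))) (*-monoʳ v 0≤v a≤B)
    h₂ : abs ((a - b) * d) ≤ u * D
    h₂ = subst (_≤ u * D) (sym (ℚ.∣p*q∣≡∣p∣*∣q∣ (a - b) d)) (*-monoˡ u 0≤u d≤D)
    h₃ : B * v + u * D ≤ (B + D) * (u + v)
    h₃ = subst (B * v + u * D ≤_)
      (solve 4 (λ B D u v → (B :* v :+ u :* D) :+ (B :* u :+ D :* v)
                            := (B :+ D) :* (u :+ v)) refl B D u v)
      (p≤p+q (+-nonNeg (*-nonNeg 0≤B 0≤u) (*-nonNeg 0≤D 0≤v)))

  *-cauchy : ∀ {x y} → Cauchy x → Cauchy y → Cauchy (λ n → x n * y n)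
  *-cauchy {x} {y} cx cy =
    lipschitz {x} {y} {λ n → x n * y n} (B + D) (+-pos {B} {D} 0<B 0<D) cx cy (M ℕ.⊔ N , close)
    where
    B D : ℚ
    B = proj₁ (bounded cx)
    D = proj₁ (bounded cy)
    0<B : 0ℚ < B
    0<B = proj₁ (proj₂ (bounded cx))
    0<D : 0ℚ < D
    0<D = proj₁ (proj₂ (bounded cy))
    M N : ℕ
    M = proj₁ (proj₂ (proj₂ (bounded cx)))
    N = proj₁ (proj₂ (proj₂ (bounded cy)))
    close : ∀ m n → M ℕ.⊔ N ℕ.≤ m → M ℕ.⊔ N ℕ.≤ n →
      abs (x m * y m - x n * y n) ≤ (B + D) * (abs (x m - x n) + abs (y m - y n))
    close m n p q = *-lipschitz {B} {D} (x m) (x n) (y m) (y n) (ℚ.<⇒≤ 0<B) (ℚ.<⇒≤ 0<D)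
        (proj₂ (proj₂ (proj₂ (bounded cx))) m (ℕ.≤-trans (ℕ.m≤m⊔n M N) p))
        (proj₂ (proj₂ (proj₂ (bounded cy))) n (ℕ.≤-trans (ℕ.m≤n⊔m M N) q))

  recip-lipschitz : ∀ {δ} p q → 0ℚ < δ → δ ≤ abs p → δ ≤ abs q →
    abs (recip p - recip q) ≤ recip δ * recip δ * abs (p - q)
  recip-lipschitz {δ} p q 0<δ δ≤p δ≤q = subst (_≤ recip δ * recip δ * abs (p - q)) (sym eq′)
    (*-monoʳ (abs (p - q)) (ℚ.0≤∣p∣ (p - q))
      (*-mono (ℚ.0≤∣p∣ i) (abs-recip-≤ 0<δ δ≤p) (ℚ.0≤∣p∣ j) (abs-recip-≤ 0<δ δ≤q)))
    where
    i j : ℚ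
    i = recip p
    j = recip q
    nz : ∀ p → δ ≤ abs p → p ≢ 0ℚ
    nz p δ≤p refl = ℚ.<⇒≢ (ℚ.<-≤-trans 0<δ δ≤p) refl
    eq : i - j ≡ (q - p) * (i * j)
    eq = trans
      (cong₂ _-_
        (trans (sym (ℚ.*-identityʳ i)) (cong (i *_) (sym (*-recip q (nz q δ≤q)))))
        (trans (sym (ℚ.*-identityʳ j)) (cong (j *_) (sym (*-recip p (nz p δ≤p))))))
      (solve 4 (λ a b i j → i :* (b :* j) :- j :* (a :* i) := (b :- a) :* (i :* j))
        refl p q i j)
    eq′ : abs (i - j) ≡ abs i * abs j * abs (p - q)
    eq′ = trans (cong abs eq) (trans (ℚ.∣p*q∣≡∣p∣*∣q∣ (q - p) (i * j))
      (trans (cong₂ _*_ (abs-sym q p) (ℚ.∣p*q∣≡∣p∣*∣q∣ i j))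
        (ℚ.*-comm (abs (p - q)) (abs i * abs j))))

  recip-cauchy : ∀ {x δ} → 0ℚ < δ → Eventually (λ n → δ ≤ abs (x n)) →
    Cauchy x → Cauchy (λ n → recip (x n))
  recip-cauchy {x} {δ} 0<δ (K , h) cx =
    lipschitz {x} {λ _ → 0ℚ} {λ n → recip (x n)} (recip δ * recip δ) (*-pos (recip-pos 0<δ) (recip-pos 0<δ)) cx (const-cauchy 0ℚ)
      (K , λ m n p q → subst (abs (recip (x m) - recip (x n)) ≤_)
        (cong (recip δ * recip δ *_) (sym (ℚ.+-identityʳ (abs (x m - x n)))))
        (recip-lipschitz (x m) (x n) 0<δ (h m p) (h n q)))

  diagonal-cauchy : (a : ℕ → ℕ → ℚ) → (∀ N → Cauchy (a N)) →
    (∀ ε → 0ℚ < ε →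
      ∃[ K ] (∀ N n → K ℕ.≤ N → K ℕ.≤ n → abs (a N n - a K n) ≤ ε)) →
    Cauchy (λ n → a n n)
  diagonal-cauchy a ca tail .modulus ε 0<ε = K ℕ.⊔ M , λ m n p q →
    let K≤ = ℕ.m≤m⊔n K M
        M≤ = ℕ.m≤n⊔m K M
        Km = ℕ.≤-trans K≤ p
        Kn = ℕ.≤-trans K≤ q
    in subst (abs (a m m - a n n) ≤_) total
      (ℚ.≤-trans (abs-tri (a m m) (a K m) (a n n)) (ℚ.+-mono-≤ (hK m m Km Km)
        (ℚ.≤-trans (abs-tri (a K m) (a K n) (a n n)) (ℚ.+-mono-≤
          (hM m n (ℕ.≤-trans M≤ p) (ℕ.≤-trans M≤ q))
          (subst (_≤ η) (abs-sym (a n n) (a K n)) (hK n n Kn Kn))))))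
    where
    ⅓ : ℚ
    ⅓ = + 1 ℚ./ 3
    η : ℚ
    η = ⅓ * ε
    0<η : 0ℚ < η
    0<η = *-pos (ℚ.positive⁻¹ ⅓) 0<ε
    total : η + (η + η) ≡ ε
    total = solve 1 (λ e → con ⅓ :* e :+ (con ⅓ :* e :+ con ⅓ :* e) := e) refl ε
    K = proj₁ (tail η 0<η)
    hK = proj₂ (tail η 0<η)
    M = proj₁ (modulus (ca K) η 0<η)
    hM = proj₂ (modulus (ca K) η 0<η)

  fromℕ : ℕ → ℚ
  fromℕ n = + n ℚ./ 1

  fromℕ-suc : ∀ n → fromℕ (suc n) ≡ 1ℚ + fromℕ n
  fromℕ-suc n = ℚ.toℚᵘ-injective (ℚᵘ.≃-trans (ℚ.toℚᵘ-fromℚᵘ (ℚᵘ.mkℚᵘ (+ suc n) 0))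
    (ℚᵘ.≃-sym (ℚᵘ.≃-trans (ℚ.toℚᵘ-homo-+ 1ℚ (fromℕ n))
      (ℚᵘ.≃-trans (ℚᵘ.+-congʳ (ℚ.toℚᵘ 1ℚ) (ℚ.toℚᵘ-fromℚᵘ (ℚᵘ.mkℚᵘ (+ n) 0)))
        (ℚᵘ.*≡* (cong (ℤ._* + 1) (cong (ℤ._+_ (+ 1)) (ℤ.*-identityʳ (+ n)))))))))

  fromℕ-mono : ∀ {m n} → m ℕ.≤ n → fromℕ m ≤ fromℕ n
  fromℕ-mono {m} {n} m≤n = ℚ.toℚᵘ-cancel-≤
    (ℚᵘ.≤-respˡ-≃ (ℚᵘ.≃-sym (ℚ.toℚᵘ-fromℚᵘ (ℚᵘ.mkℚᵘ (+ m) 0)))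
      (ℚᵘ.≤-respʳ-≃ (ℚᵘ.≃-sym (ℚ.toℚᵘ-fromℚᵘ (ℚᵘ.mkℚᵘ (+ n) 0)))
        (ℚᵘ.*≤* (ℤ.*-monoʳ-≤-nonNeg (+ 1) (ℤ.+≤+ m≤n)))))

  archimedes : ∀ q → ∃[ N ] q ≤ fromℕ N
  archimedes q@(ℚ.mkℚ i d _) = N , ℚ.toℚᵘ-cancel-≤
    (ℚᵘ.≤-respʳ-≃ (ℚᵘ.≃-sym (ℚ.toℚᵘ-fromℚᵘ (ℚᵘ.mkℚᵘ (+ N) 0))) (ℚᵘ.*≤* i≤))
    where
    N = ℤ.∣ i ∣
    i≤∣i∣ : ∀ i → i ℤ.≤ + ℤ.∣ i ∣
    i≤∣i∣ (+ n) = ℤ.≤-refl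
    i≤∣i∣ ℤ.-[1+ n ] = ℤ.-≤+
    i≤ : i ℤ.* + 1 ℤ.≤ + N ℤ.* + suc d
    i≤ = subst₂ ℤ._≤_ (sym (ℤ.*-identityʳ i)) (ℤ.pos-* N (suc d))
      (ℤ.≤-trans (i≤∣i∣ i) (ℤ.+≤+ (ℕ.m≤m*n N (suc d))))

  ^-nonNeg : ∀ {w} → 0ℚ ≤ w → ∀ n → 0ℚ ≤ w ^ n
  ^-nonNeg 0≤w zero    = 0≤1
  ^-nonNeg 0≤w (suc n) = *-nonNeg 0≤w (^-nonNeg 0≤w n)

  ^-mono : ∀ {w r} → 0ℚ ≤ w → w ≤ r → ∀ n → w ^ n ≤ r ^ n
  ^-mono 0≤w w≤r zero    = ℚ.≤-refl
  ^-mono 0≤w w≤r (suc n) = *-mono 0≤w w≤r (^-nonNeg 0≤w n) (^-mono 0≤w w≤r n)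

  bernoulli : ∀ σ → 0ℚ ≤ σ → 0ℚ ≤ 1ℚ - σ → ∀ n →
    (1ℚ - σ) ^ n * (1ℚ + fromℕ n * σ) ≤ 1ℚ
  bernoulli σ 0≤σ 0≤r zero = ℚ.≤-reflexive
    (solve 1 (λ s → con 1ℚ :* (con 1ℚ :+ con 0ℚ :* s) := con 1ℚ) refl σ)
  bernoulli σ 0≤σ 0≤r (suc n) = ℚ.≤-trans (0≤q-p⇒p≤q
      (subst (0ℚ ≤_) eq (*-nonNeg (^-nonNeg 0≤r n)
        (*-nonNeg (+-nonNeg 0≤1 0≤n) (sq-nonNeg σ)))))
    (bernoulli σ 0≤σ 0≤r n)
    where
    0≤n : 0ℚ ≤ fromℕ n
    0≤n = fromℕ-mono {0} {n} ℕ.z≤n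
    eq : (1ℚ - σ) ^ n * ((1ℚ + fromℕ n) * (σ * σ)) ≡
         (1ℚ - σ) ^ n * (1ℚ + fromℕ n * σ)
           - (1ℚ - σ) ^ suc n * (1ℚ + fromℕ (suc n) * σ)
    eq = trans
      (solve 3 (λ P N s → P :* ((con 1ℚ :+ N) :* (s :* s)) :=
          P :* (con 1ℚ :+ N :* s)
            :- ((con 1ℚ :- s) :* P) :* (con 1ℚ :+ (con 1ℚ :+ N) :* s))
        refl ((1ℚ - σ) ^ n) (fromℕ n) σ)
      (cong (λ t → (1ℚ - σ) ^ n * (1ℚ + fromℕ n * σ)
                     - (1ℚ - σ) ^ suc n * (1ℚ + t * σ)) (sym (fromℕ-suc n)))

  decay : ∀ σ → 0ℚ < σ → 0ℚ ≤ 1ℚ - σ → ∀ η → 0ℚ < η →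
    Eventually (λ n → (1ℚ - σ) ^ n ≤ η)
  decay σ 0<σ 0≤r η 0<η = N , λ n N≤n →
    let P = (1ℚ - σ) ^ n
        0≤P = ^-nonNeg 0≤r n
        F = 1ℚ + fromℕ n * σ
        1≤Fη : 1ℚ ≤ F * η
        1≤Fη = subst₂ _≤_ (*-recip (σ * η) (0<⇒≢0 0<ση))
          (solve 3 (λ n s e → s :* e :* n :+ e := (con 1ℚ :+ n :* s) :* e) refl (fromℕ n) σ η)
          (ℚ.≤-trans (*-monoˡ (σ * η) (ℚ.<⇒≤ 0<ση) (ℚ.≤-trans hN (fromℕ-mono N≤n)))
            (p≤p+q (ℚ.<⇒≤ 0<η)))
    in ℚ.≤-trans
         (subst₂ _≤_ (ℚ.*-identityʳ P) (sym (ℚ.*-assoc P F η)) (*-monoˡ P 0≤P 1≤Fη))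
         (subst (P * F * η ≤_) (ℚ.*-identityˡ η)
           (*-monoʳ η (ℚ.<⇒≤ 0<η) (bernoulli σ (ℚ.<⇒≤ 0<σ) 0≤r n)))
    where
    0<ση = *-pos 0<σ 0<η
    N = proj₁ (archimedes (recip (σ * η)))
    hN = proj₂ (archimedes (recip (σ * η)))

  unit-pos : ∀ n → 0ℚ < + 1 ℚ./ suc n
  unit-pos n = ℚ.positive⁻¹ (+ 1 ℚ./ suc n) {{ℚ.normalize-pos 1 (suc n)}}

  unit-anti : ∀ {m n} → m ℕ.≤ n → + 1 ℚ./ suc n ≤ + 1 ℚ./ suc m
  unit-anti {m} {n} m≤n = ℚ.toℚᵘ-cancel-≤
    (ℚᵘ.≤-respˡ-≃ (ℚᵘ.≃-sym (ℚ.toℚᵘ-fromℚᵘ (ℚᵘ.mkℚᵘ (+ 1) n)))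
      (ℚᵘ.≤-respʳ-≃ (ℚᵘ.≃-sym (ℚ.toℚᵘ-fromℚᵘ (ℚᵘ.mkℚᵘ (+ 1) m)))
        (ℚᵘ.*≤* (subst₂ ℤ._≤_ (sym (ℤ.*-identityˡ (+ suc m))) (sym (ℤ.*-identityˡ (+ suc n)))
          (ℤ.+≤+ (ℕ.s≤s m≤n))))))

  coeff-nonNeg : ∀ k → 0ℚ ≤ coeff k
  coeff-nonNeg k = ℚ.<⇒≤ (unit-pos (2 ℕ.* k))

  coeff≤1 : ∀ k → coeff k ≤ 1ℚ
  coeff≤1 k = unit-anti {0} {2 ℕ.* k} ℕ.z≤n

  series-step : ∀ {w} → 0ℚ ≤ w → ∀ n → series n w ≤ series (suc n) w
  series-step 0≤w n = p≤p+q (*-nonNeg (coeff-nonNeg n) (^-nonNeg 0≤w n))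

  series-mono : ∀ {w} → 0ℚ ≤ w → ∀ K j → series K w ≤ series (j ℕ.+ K) w
  series-mono 0≤w K zero    = ℚ.≤-refl
  series-mono 0≤w K (suc j) = ℚ.≤-trans (series-mono 0≤w K j) (series-step 0≤w (j ℕ.+ K))

  1≤series : ∀ {w} → 0ℚ ≤ w → ∀ n → 1ℚ ≤ series (suc n) w
  1≤series {w} 0≤w n = subst (λ k → 1ℚ ≤ series k w) (ℕ.+-comm n 1) (series-mono 0≤w 1 n)

  series-tail : ∀ {w σ} → 0ℚ ≤ w → 0ℚ ≤ σ → w ≤ 1ℚ - σ → ∀ K j →
    (series (j ℕ.+ K) w - series K w) * σ ≤ (1ℚ - σ) ^ K - (1ℚ - σ) ^ (j ℕ.+ K)
  series-tail {w} {σ} 0≤w 0≤σ w≤r K zero = ℚ.≤-reflexive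
    (solve 3 (λ a s b → (a :- a) :* s := b :- b) refl (series K w) σ ((1ℚ - σ) ^ K))
  series-tail {w} {σ} 0≤w 0≤σ w≤r K (suc j) = subst₂ _≤_
    (solve 4 (λ a b c s → (a :- b) :* s :+ c :* s := ((a :+ c) :- b) :* s) refl
      (series m w) (series K w) (coeff m * w ^ m) σ)
    (solve 3 (λ p q s → (p :- q) :+ q :* s := p :- (con 1ℚ :- s) :* q) refl
      ((1ℚ - σ) ^ K) ((1ℚ - σ) ^ m) σ)
    (ℚ.+-mono-≤ (series-tail 0≤w 0≤σ w≤r K j)
      (*-monoʳ σ 0≤σ (subst (coeff m * w ^ m ≤_) (ℚ.*-identityˡ ((1ℚ - σ) ^ m))
        (*-mono (coeff-nonNeg m) (coeff≤1 m) (^-nonNeg 0≤w m) (^-mono 0≤w w≤r m)))))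
    where m = j ℕ.+ K

  ^-cauchy : ∀ {x} → Cauchy x → ∀ k → Cauchy (λ n → x n ^ k)
  ^-cauchy cx zero    = const-cauchy 1ℚ
  ^-cauchy cx (suc k) = *-cauchy cx (^-cauchy cx k)

  series-cauchy : ∀ {x} → Cauchy x → ∀ k → Cauchy (λ n → series k (x n))
  series-cauchy cx zero    = const-cauchy 0ℚ
  series-cauchy cx (suc k) =
    +-cauchy (series-cauchy cx k) (*-cauchy (const-cauchy (coeff k)) (^-cauchy cx k))

  series-diagonal : ∀ {w σ} → 0ℚ < σ → Cauchy w →
    Eventually (λ n → 0ℚ ≤ w n × w n ≤ 1ℚ - σ) → Cauchy (λ n → series n (w n))
  series-diagonal {w} {σ} 0<σ cw (M , hM) =
    diagonal-cauchy (λ N n → series N (w n)) (series-cauchy cw) tail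
    where
    0≤r : 0ℚ ≤ 1ℚ - σ
    0≤r = ℚ.≤-trans (proj₁ (hM M ℕ.≤-refl)) (proj₂ (hM M ℕ.≤-refl))
    tail : ∀ ε → 0ℚ < ε → ∃[ K ] (∀ N n → K ℕ.≤ N → K ℕ.≤ n →
      abs (series N (w n) - series K (w n)) ≤ ε)
    tail ε 0<ε = K , close
      where
      0<εσ : 0ℚ < ε * σ
      0<εσ = *-pos {ε} {σ} 0<ε 0<σ
      L : ℕ
      L = proj₁ (decay σ 0<σ 0≤r (ε * σ) 0<εσ)
      hL : ∀ n → L ℕ.≤ n → (1ℚ - σ) ^ n ≤ ε * σ
      hL = proj₂ (decay σ 0<σ 0≤r (ε * σ) 0<εσ)
      K : ℕ
      K = M ℕ.⊔ L
      close : ∀ N n → K ℕ.≤ N → K ℕ.≤ n → abs (series N (w n) - series K (w n)) ≤ ε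
      close N n K≤N K≤n = subst (λ N → abs (series N (w n) - series K (w n)) ≤ ε)
        (ℕ.m∸n+n≡m K≤N) (go (N ℕ.∸ K))
        where
        0≤w = proj₁ (hM n (ℕ.≤-trans (ℕ.m≤m⊔n M L) K≤n))
        w≤r = proj₂ (hM n (ℕ.≤-trans (ℕ.m≤m⊔n M L) K≤n))
        go : ∀ j → abs (series (j ℕ.+ K) (w n) - series K (w n)) ≤ ε
        go j = subst (_≤ ε) (sym (ℚ.0≤p⇒∣p∣≡p (p≤q⇒0≤q-p (series-mono 0≤w K j))))
          (ℚ.*-cancelʳ-≤-pos σ {{ℚ.positive 0<σ}}
            (ℚ.≤-trans (series-tail 0≤w (ℚ.<⇒≤ 0<σ) w≤r K j)
              (ℚ.≤-trans
                (0≤q-p⇒p≤q (subst (0ℚ ≤_)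
                  (solve 2 (λ p q → q := p :- (p :- q)) refl ((1ℚ - σ) ^ K) ((1ℚ - σ) ^ (j ℕ.+ K)))
                  (^-nonNeg 0≤r (j ℕ.+ K))))
                (hL K (ℕ.m≤n⊔m M L)))))

  lnApprox-cauchy : ∀ {x δ} → 0ℚ < δ → Eventually (λ n → δ ≤ x n) → Cauchy x →
    Cauchy (λ n → lnApprox n (x n))
  lnApprox-cauchy {x} {δ} 0<δ (K , hK) cx =
    *-cauchy (const-cauchy (1ℚ + 1ℚ)) (*-cauchy cz
      (series-diagonal 0<σ (*-cauchy cz cz) (K ℕ.⊔ M , λ n p →
        sq-nonNeg (z n) ,
        bound n (ℕ.≤-trans (ℕ.m≤m⊔n K M) p) (ℕ.≤-trans (ℕ.m≤n⊔m K M) p))))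
    where
    B : ℚ
    B = proj₁ (bounded cx)
    0<B : 0ℚ < B
    0<B = proj₁ (proj₂ (bounded cx))
    M : ℕ
    M = proj₁ (proj₂ (proj₂ (bounded cx)))
    hM : ∀ n → M ℕ.≤ n → abs (x n) ≤ B
    hM = proj₂ (proj₂ (proj₂ (bounded cx)))
    z : ℕ → ℚ
    z n = möbius (x n)
    0<x+1 : ∀ n → K ℕ.≤ n → 0ℚ < x n + 1ℚ
    0<x+1 n p = +-pos (ℚ.<-≤-trans 0<δ (hK n p)) 0<1
    1≤x+1 : ∀ n → K ℕ.≤ n → 1ℚ ≤ abs (x n + 1ℚ)
    1≤x+1 n p = ℚ.≤-trans
      (subst (1ℚ ≤_) (ℚ.+-comm 1ℚ (x n)) (p≤p+q (ℚ.≤-trans (ℚ.<⇒≤ 0<δ) (hK n p))))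
      (p≤abs (x n + 1ℚ))
    cz : Cauchy z
    cz = *-cauchy (+-cauchy cx (const-cauchy (- 1ℚ)))
           (recip-cauchy 0<1 (K , 1≤x+1) (+-cauchy cx (const-cauchy 1ℚ)))
    b : ℚ
    b = recip (B + 1ℚ)
    0<b : 0ℚ < b
    0<b = recip-pos (+-pos 0<B 0<1)
    σ : ℚ
    σ = δ * (b * b)
    0<σ : 0ℚ < σ
    0<σ = *-pos 0<δ (*-pos 0<b 0<b)
    -- 1 - z² = 4x/(x+1)² ≥ δ/(B+1)²
    bound : ∀ n → K ℕ.≤ n → M ℕ.≤ n → z n * z n ≤ 1ℚ - σ
    bound n p q = 0≤q-p⇒p≤q (subst (0ℚ ≤_) eq
        (+-nonNeg (p≤q⇒0≤q-p σ≤t) (+-nonNeg 0≤t (+-nonNeg 0≤t 0≤t))))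
      where
      i = recip (x n + 1ℚ)
      t = x n * (i * i)
      0<i : 0ℚ < i
      0<i = recip-pos (0<x+1 n p)
      0≤t : 0ℚ ≤ t
      0≤t = *-nonNeg (ℚ.≤-trans (ℚ.<⇒≤ 0<δ) (hK n p)) (*-nonNeg (ℚ.<⇒≤ 0<i) (ℚ.<⇒≤ 0<i))
      [x+1]i≡1 : (x n + 1ℚ) * i ≡ 1ℚ
      [x+1]i≡1 = *-recip (x n + 1ℚ) (0<⇒≢0 (0<x+1 n p))
      b≤i : b ≤ i
      b≤i = inv-anti (ℚ.<⇒≤ 0<i) (ℚ.<⇒≤ 0<b)
        (ℚ.+-monoˡ-≤ 1ℚ (ℚ.≤-trans (p≤abs (x n)) (hM n q))) [x+1]i≡1
        (*-recip (B + 1ℚ) (0<⇒≢0 (+-pos 0<B 0<1)))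
      σ≤t : σ ≤ t
      σ≤t = *-mono (ℚ.<⇒≤ 0<δ) (hK n p) (*-nonNeg (ℚ.<⇒≤ 0<b) (ℚ.<⇒≤ 0<b))
        (*-mono (ℚ.<⇒≤ 0<b) b≤i (ℚ.<⇒≤ 0<b) b≤i)
      eq : (t - σ) + (t + (t + t)) ≡ (1ℚ - σ) - z n * z n
      eq = trans
        (solve 3 (λ x i s →
            (x :* (i :* i) :- s) :+ (x :* (i :* i) :+ (x :* (i :* i) :+ x :* (i :* i)))
            := (((x :+ con 1ℚ) :* i) :* ((x :+ con 1ℚ) :* i) :- s)
                 :- ((x :- con 1ℚ) :* i) :* ((x :- con 1ℚ) :* i))
          refl (x n) i σ)
        (cong (λ u → (u * u - σ) - z n * z n) [x+1]i≡1)

  lnApprox-pos : ∀ {q} → 1ℚ < q → 0ℚ < möbius q ×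
    Eventually (λ n → möbius q ≤ lnApprox n q)
  lnApprox-pos {q} 1<q = 0<z , 1 , bound
    where
    z = möbius q
    0<z : 0ℚ < z
    0<z = *-pos (p<q⇒0<q-p 1<q) (recip-pos (+-pos (ℚ.<-trans 0<1 1<q) 0<1))
    bound : ∀ n → 1 ℕ.≤ n → z ≤ lnApprox n q
    bound (suc n) _ = subst (z ≤_)
      (solve 2 (λ z s → z :* s :+ z :* s := (con (1ℚ + 1ℚ)) :* (z :* s)) refl
        z (series (suc n) (z * z)))
      (ℚ.≤-trans z≤zs (p≤p+q (ℚ.≤-trans (ℚ.<⇒≤ 0<z) z≤zs)))
      where
      z≤zs : z ≤ z * series (suc n) (z * z)
      z≤zs = subst (_≤ z * series (suc n) (z * z)) (ℚ.*-identityʳ z)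
        (*-monoˡ z (ℚ.<⇒≤ 0<z) (1≤series (sq-nonNeg z) n))

  lnApprox-apart : ∀ {q} → 0ℚ < q → q ≢ 1ℚ → 0ℚ < abs (möbius q) ×
    Eventually (λ n → abs (möbius q) ≤ abs (lnApprox n q))
  lnApprox-apart {q} 0<q q≢1 = abs-pos z≢0 , 1 , bound
    where
    z = möbius q
    0<q+1 : 0ℚ < q + 1ℚ
    0<q+1 = +-pos 0<q 0<1
    z≢0 : z ≢ 0ℚ
    z≢0 z≡0 = q≢1 (trans
      (solve 1 (λ q → q := (q :- con 1ℚ) :* con 1ℚ :+ con 1ℚ) refl q)
      (trans (cong (λ u → (q - 1ℚ) * u + 1ℚ) (sym (*-recip (q + 1ℚ) (0<⇒≢0 0<q+1))))
        (trans (solve 2 (λ q i → (q :- con 1ℚ) :* ((q :+ con 1ℚ) :* i) :+ con 1ℚ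
                               := (q :+ con 1ℚ) :* ((q :- con 1ℚ) :* i) :+ con 1ℚ) refl
                 q (recip (q + 1ℚ)))
          (trans (cong (λ u → (q + 1ℚ) * u + 1ℚ) z≡0)
            (solve 1 (λ q → (q :+ con 1ℚ) :* con 0ℚ :+ con 1ℚ := con 1ℚ) refl q)))))
    bound : ∀ n → 1 ℕ.≤ n → abs z ≤ abs (lnApprox n q)
    bound (suc n) _ = subst₂ _≤_ (ℚ.*-identityʳ (abs z)) (sym eq)
        (*-monoˡ (abs z) (ℚ.0≤∣p∣ z) (ℚ.≤-trans 1≤s (p≤p+q 0≤s)))
      where
      s = series (suc n) (z * z)
      1≤s : 1ℚ ≤ s
      1≤s = 1≤series (sq-nonNeg z) n
      0≤s : 0ℚ ≤ s
      0≤s = ℚ.≤-trans 0≤1 1≤s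
      eq : abs (lnApprox (suc n) q) ≡ abs z * (s + s)
      eq = trans
        (cong abs (solve 2 (λ z s → con (1ℚ + 1ℚ) :* (z :* s) := z :* (s :+ s)) refl z s))
        (trans (ℚ.∣p*q∣≡∣p∣*∣q∣ z (s + s))
          (cong (abs z *_) (ℚ.0≤p⇒∣p∣≡p (+-nonNeg 0≤s 0≤s))))

open Sequence using (Cauchy; Eventually)

-- Real numbers are Cauchy sequences of rationals; ≡ is finer than equality of reals, and
-- only the order _≤_ is used to compare them.
record ℝ : Set where
  constructor mkℝ
  field
    seq    : ℕ → ℚ
    cauchy : Cauchy seq

open ℝ public

infix  4 _≤_
infix  8 -_
infixl 7 _*_
infixl 6 _+_ _-_

_≤_ : ℝ → ℝ → Set
x ≤ y = ∀ ε → 0ℚ ℚ.< ε → Eventually (λ n → seq x n ℚ.≤ seq y n ℚ.+ ε)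

Positive : ℝ → Set
Positive x = ∃[ δ ] (0ℚ ℚ.< δ × Eventually (λ n → δ ℚ.≤ seq x n))

-- Apartness from zero.
NonZero : ℝ → Set
NonZero x = ∃[ δ ] (0ℚ ℚ.< δ × Eventually (λ n → δ ℚ.≤ ℚ.∣ seq x n ∣))

fromℚ : ℚ → ℝ
fromℚ q = mkℝ (λ _ → q) (Sequence.const-cauchy q)

fromℕ : ℕ → ℝ
fromℕ n = fromℚ (+ n ℚ./ 1)

_+_ : ℝ → ℝ → ℝ
x + y = mkℝ (λ n → seq x n ℚ.+ seq y n) (Sequence.+-cauchy (cauchy x) (cauchy y))

-_ : ℝ → ℝ
- x = mkℝ (λ n → ℚ.- seq x n) (Sequence.neg-cauchy (cauchy x))

_-_ : ℝ → ℝ → ℝ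
x - y = x + (- y)

_*_ : ℝ → ℝ → ℝ
x * y = mkℝ (λ n → seq x n ℚ.* seq y n) (Sequence.*-cauchy (cauchy x) (cauchy y))

abs : ℝ → ℝ
abs x = mkℝ (λ n → ℚ.∣ seq x n ∣) (Sequence.abs-cauchy (cauchy x))

inv : (x : ℝ) → NonZero x → ℝ
inv x (_ , 0<δ , h) =
  mkℝ (λ n → Sequence.recip (seq x n)) (Sequence.recip-cauchy 0<δ h (cauchy x))

ln : (x : ℝ) → Positive x → ℝ
ln x (_ , 0<δ , h) =
  mkℝ (λ n → Sequence.lnApprox n (seq x n)) (Sequence.lnApprox-cauchy 0<δ h (cauchy x))

fromℚ-positive : ∀ {q} → 0ℚ ℚ.< q → Positive (fromℚ q)
fromℚ-positive {q} 0<q = q , 0<q , 0 , λ _ _ → ℚ.≤-refl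

positive⇒nonZero : ∀ x → Positive x → NonZero x
positive⇒nonZero x (δ , 0<δ , N , h) =
  δ , 0<δ , N , λ n N≤n → ℚ.≤-trans (h n N≤n) (Sequence.p≤abs (seq x n))

*-nonZero : ∀ x y → NonZero x → NonZero y → NonZero (x * y)
*-nonZero x y (δ , 0<δ , M , h) (η , 0<η , N , k) =
  δ ℚ.* η , Sequence.*-pos 0<δ 0<η , M ℕ.⊔ N , λ n p →
    subst (δ ℚ.* η ℚ.≤_) (sym (ℚ.∣p*q∣≡∣p∣*∣q∣ (seq x n) (seq y n)))
      (Sequence.*-mono (ℚ.<⇒≤ 0<δ) (h n (ℕ.≤-trans (ℕ.m≤m⊔n M N) p))
                       (ℚ.<⇒≤ 0<η) (k n (ℕ.≤-trans (ℕ.m≤n⊔m M N) p)))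

lnℚ : (q : ℚ) → 0ℚ ℚ.< q → ℝ
lnℚ q 0<q = ln (fromℚ q) (fromℚ-positive 0<q)

lnℚ-nonZero : ∀ q (0<q : 0ℚ ℚ.< q) → q ≢ 1ℚ → NonZero (lnℚ q 0<q)
lnℚ-nonZero q 0<q q≢1 = ℚ.∣ Sequence.möbius q ∣ , Sequence.lnApprox-apart 0<q q≢1

module Ratio (d : ℕ) (3≤d : 3 ℕ.≤ d) where

  instance
    d≢0 : ℕ.NonZero d
    d≢0 = ℕ.>-nonZero (ℕ.≤-trans (ℕ.s≤s ℕ.z≤n) 3≤d)

  1-1/d 2[1-1/d] : ℚ
  1-1/d    = 1ℚ ℚ.- + 1 ℚ./ d
  2[1-1/d] = (+ 2 ℚ./ 1) ℚ.* 1-1/d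

  0<1/d : 0ℚ ℚ.< + 1 ℚ./ d
  0<1/d = ℚ.positive⁻¹ (+ 1 ℚ./ d) {{ℚ.normalize-pos 1 d}}

  1/d≤1/3 : ∀ e .{{_ : ℕ.NonZero e}} → 3 ℕ.≤ e → + 1 ℚ./ e ℚ.≤ + 1 ℚ./ 3
  1/d≤1/3 (suc e) (ℕ.s≤s 2≤e) = Sequence.unit-anti 2≤e

  2/3≤1-1/d : + 2 ℚ./ 3 ℚ.≤ 1-1/d
  2/3≤1-1/d = ℚ.+-monoʳ-≤ 1ℚ (ℚ.neg-antimono-≤ (1/d≤1/3 d 3≤d))

  0<1-1/d : 0ℚ ℚ.< 1-1/d
  0<1-1/d = ℚ.<-≤-trans (ℚ.positive⁻¹ (+ 2 ℚ./ 3)) 2/3≤1-1/d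

  1-1/d≢1 : 1-1/d ≢ 1ℚ
  1-1/d≢1 = ℚ.<⇒≢ (ℚ.+-monoʳ-< 1ℚ (ℚ.neg-antimono-< 0<1/d))

  1<2[1-1/d] : 1ℚ ℚ.< 2[1-1/d]
  1<2[1-1/d] = ℚ.<-≤-trans
    (subst (ℚ._< + 4 ℚ./ 3) (ℚ.+-identityʳ 1ℚ)
      (ℚ.+-monoʳ-< 1ℚ (ℚ.positive⁻¹ (+ 1 ℚ./ 3))))
    (Sequence.*-monoˡ (+ 2 ℚ./ 1) (ℚ.nonNegative⁻¹ (+ 2 ℚ./ 1)) 2/3≤1-1/d)

  0<2[1-1/d] : 0ℚ ℚ.< 2[1-1/d]
  0<2[1-1/d] = ℚ.<-trans Sequence.0<1 1<2[1-1/d]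

  ln[2[1-1/d]] ln[1-1/d] : ℝ
  ln[2[1-1/d]] = lnℚ 2[1-1/d] 0<2[1-1/d]
  ln[1-1/d]    = lnℚ 1-1/d 0<1-1/d

  ln[2[1-1/d]]≢0 : NonZero ln[2[1-1/d]]
  ln[2[1-1/d]]≢0 = lnℚ-nonZero 2[1-1/d] 0<2[1-1/d] λ e → ℚ.<⇒≢ 1<2[1-1/d] (sym e)

  0<d : 0ℚ ℚ.< + d ℚ./ 1
  0<d = ℚ.positive⁻¹ (+ d ℚ./ 1) {{ℚ.normalize-pos d 1}}

  d*ln[1-1/d]≢0 : NonZero (fromℕ d * ln[1-1/d])
  d*ln[1-1/d]≢0 = *-nonZero (fromℕ d) ln[1-1/d]
    (positive⇒nonZero (fromℕ d) (fromℚ-positive 0<d))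
    (lnℚ-nonZero 1-1/d 0<1-1/d 1-1/d≢1)

C : (d : ℕ) → 3 ℕ.≤ d → ℝ
C d 3≤d = inv ln[2[1-1/d]] ln[2[1-1/d]]≢0 - inv (fromℕ d * ln[1-1/d]) d*ln[1-1/d]≢0
  where open Ratio d 3≤d

1<fromℕ : ∀ {n} → 2 ℕ.≤ n → 1ℚ ℚ.< + n ℚ./ 1
1<fromℕ 2≤n = ℚ.<-≤-trans
  (ℚ.+-monoʳ-< 1ℚ (ℚ.positive⁻¹ 1ℚ)) (Sequence.fromℕ-mono 2≤n)

lnℕ : (n : ℕ) → 2 ℕ.≤ n → ℝ
lnℕ n 2≤n = lnℚ (+ n ℚ./ 1) (ℚ.<-trans Sequence.0<1 (1<fromℕ 2≤n))

lnlnℕ : (n : ℕ) → 2 ℕ.≤ n → ℝ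
lnlnℕ n 2≤n = ln (lnℕ n 2≤n) (_ , Sequence.lnApprox-pos (1<fromℕ 2≤n))

-- A digraph on Fin n, given by the out-neighbourhood of each vertex.
Graph : ℕ → Set
Graph n = Vec (Subset n) n

Regular : ∀ {n} → ℕ → Graph n → Set
Regular d G =
    (∀ u v → v ∈ lookup G u → u ∈ lookup G v)
  × (∀ u → u ∉ lookup G u)
  × (∀ u → ∣ lookup G u ∣ ≡ d)

regular? : ∀ {n} d (G : Graph n) → Dec (Regular d G)
regular? d G =
        Fin.all? (λ u → Fin.all? λ v → (v ∈? lookup G u) →-dec (u ∈? lookup G v))
  ×-dec Fin.all? (λ u → ¬? (u ∈? lookup G u))
  ×-dec Fin.all? (λ u → ∣ lookup G u ∣ ℕ.≟ d)

product : ∀ {A : Set} {n} → Vec (List A) n → List (Vec A n)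
product []         = [] ∷ []
product (xs ∷ xss) = cartesianProductWith _∷_ xs (product xss)

-- Every simple d-regular graph on Fin n, listed once.
regularGraphs : (n d : ℕ) → List (Graph n)
regularGraphs n d = filter (regular? d)
  (product (replicate n (product (replicate n (inside ∷ outside ∷ [])))))

-- The choices of one round: entry u is the neighbour contacted by u. A choice is drawn
-- for uninformed vertices too, but it has no effect.
Round : ℕ → Set
Round n = Vec (Fin n) n

neighbours : ∀ {n} → Graph n → Fin n → List (Fin n)
neighbours {n} G u = filter (_∈? lookup G u) (allFin n)

-- Uniform choice from a product of lists amounts to independent uniform choices from
-- each factor.
rounds : ∀ {n} → Graph n → List (Round n)
rounds G = product (tabulate (neighbours G))

-- The first t rounds, latest first.
History : ℕ → ℕ → Set
History n t = Vec (Round n) t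

histories : ∀ {n} → Graph n → (t : ℕ) → List (History n t)
histories G t = product (replicate t (rounds G))

push : ∀ {n} → Round n → Subset n → Subset n
push c I = tabulate λ w →
  ⌊ (w ∈? I) ⊎-dec Fin.any? (λ u → (u ∈? I) ×-dec (lookup c u Fin.≟ w)) ⌋

informed : ∀ {n t} → Fin n → History n t → Subset n
informed v []       = ⁅ v ⁆
informed v (c ∷ cs) = push c (informed v cs)

completedNow : ∀ {n t} → Fin n → History n t → Maybe ℕ
completedNow {t = t} v cs =
  if ⌊ Vec.≡-dec Bool._≟_ (informed v cs) ⊤ ⌋ then just t else nothing

-- The least number of rounds after which all vertices are informed, if it is at most t.
broadcastTime : ∀ {n t} → Fin n → History n t → Maybe ℕ
broadcastTime v []       = completedNow v []
broadcastTime v (c ∷ cs) = broadcastTime v cs <∣> completedNow v (c ∷ cs)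

average : ∀ {A : Set} → (A → ℚ) → List A → ℚ
average f []          = 0ℚ
average f xs@(_ ∷ ys) = foldr ℚ._+_ 0ℚ (map f xs) ℚ.* (+ 1 ℚ./ suc (length ys))

indicator : Bool → ℚ
indicator b = if b then 1ℚ else 0ℚ

-- P(T ≤ t and T ∈ A) for the broadcast time T from v on a uniformly random d-regular
-- graph; this event depends on the first t rounds only.
probability : ∀ {n} → ℕ → Fin n → ℕ → (ℕ → Bool) → ℚ
probability {n} d v t A =
  average (λ G → average (λ cs → indicator (maybe A false (broadcastTime v cs))) (histories G t))
          (regularGraphs n d)

-- P(E T) ≥ p. Since E need not be decidable, it is bounded from inside by a decidable A,
-- and T by a horizon t. For E confined to finitely many values this is classically
-- equivalent to P(E T) ≥ p.
ProbabilityAtLeast : ∀ {n} → ℕ → Fin n → (ℕ → Set) → ℚ → Set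
ProbabilityAtLeast d v E p =
  ∃[ t ] ∃[ A ] ((∀ s → T (A s) → E s) × p ℚ.≤ probability d v t A)

{-# OPTIONS --safe #-}

-- Write q = 1 - 1/d and r = 2q, and let Λ be the binary logarithm of n.
--
-- Lower bound. In every d-regular graph the informed set I spans at least |I| - 1 edges, so at most
-- (d - 2)|I| + 2 edges leave it and a round multiplies E|I| by at most about r. After log_r(n/Λ) rounds
-- half of the vertices are still uninformed, and each of them is then called by nobody during t further
-- rounds with probability at least q^(dt); these events are negatively correlated, so Chebyshev's
-- inequality shows that some vertex is spared up to time t = log_(1/q)(n/Λ)/d.
--
-- Upper bound. A switching argument and a union bound show that in a typical graph all sets of at most
-- about √(nΛ) vertices span at most (1 + O(1/Λ)) times as many edges as a tree. There the generating
-- function E z^|I| obeys a recursion that, in the variable ω with z = 1/(1 + ω), is multiplication by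
-- r - O(1/Λ): informing about √(nΛ) vertices takes half of log_r n rounds up to O(log Λ). The same holds
-- backwards in time for the set B of vertices from which information would reach a given vertex w, except
-- that B may first stay {w} for log_(1/q)(n)/d rounds, which is what a union bound over w costs.
-- Finally, the laws of I and B (conditioned on their final values) are invariant under switchings that
-- move edges leaving I to the neighbourhood of B, so typically order Λ many paths of length two join I
-- to B and one of them is used within two rounds.
--
-- The logarithms enter through inequalities between powers of r, 1/q, Λ and n, which are translated into
-- a statement about the power series defining ln by its approximate additivity.

module Submission where

open import Algebra.Bundles using (module CommutativeRing)
import Algebra.Properties.Semiring.Sum as SemiringSum
open import Data.Bool.Base using (Bool; true; false; if_then_else_; T; not; _∧_; _∨_)
import Data.Bool.Properties as Bool
open import Data.Fin.Base using (Fin; zero; suc)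
open import Data.Fin.Permutation using (Permutation; permutation; _⟨$⟩ʳ_)
import Data.Fin.Properties as Fin
open import Data.Fin.Subset using (Subset; ⊤; ⁅_⁆; ∣_∣; inside; outside)
open import Data.Fin.Subset.Properties using (_∈?_)
import Data.Integer.Base as ℤ
import Data.Integer.Properties as ℤ
open import Data.List.Base using (List; []; _∷_; _++_; allFin; cartesianProductWith; filter; foldr; length; map; tabulate)
open import Data.List.Membership.Propositional using (_∈_)
open import Data.List.Membership.Propositional.Properties using (∈-∃++; ∈-++⁻; ∈-++⁺ˡ; ∈-++⁺ʳ; ∈-cartesianProductWith⁺; ∈-filter⁺; ∈-filter⁻)
import Data.List.Properties as List
import Data.List.Relation.Unary.All as All
open import Data.List.Relation.Unary.Any using (here; there)
open import Data.List.Relation.Unary.Unique.Propositional using (Unique; []; _∷_)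
import Data.List.Relation.Unary.Unique.Propositional.Properties as Unique
open import Data.Maybe.Base using (Maybe; just; nothing; maybe; _<∣>_)
open import Data.Nat.Base as ℕ using (ℕ; zero; suc)
open import Data.Nat.Divisibility using (_∣_)
import Data.Nat.Properties as ℕ
open import Data.Nat.Tactic.RingSolver using () renaming (solve-∀ to ℕ-solve-∀)
open import Data.Product.Base using (_×_; _,_; ∃-syntax; proj₁; proj₂; Σ-syntax)
open import Data.Rational.Base as ℚ using (ℚ; 0ℚ; 1ℚ; ½)
import Data.Rational.Properties as ℚ
open import Data.Rational.Solver using (module +-*-Solver)
import Data.Rational.Unnormalised.Base as ℚᵘ
import Data.Rational.Unnormalised.Properties as ℚᵘ
open import Data.Sum.Base using (_⊎_; inj₁; inj₂)
open import Data.Vec.Base as Vec using (Vec; []; _∷_; lookup)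
import Data.Vec.Properties as Vec
open import Function.Base using (_∘_; id)
open import Relation.Binary.PropositionalEquality using (_≡_; _≢_; refl; sym; trans; cong; cong₂; subst; subst₂; module ≡-Reasoning)
open import Relation.Nullary.Decidable using (isYes≗does)
open import Relation.Nullary.Decidable.Core using (Dec; yes; no; does; _×-dec_; _⊎-dec_; ¬?)
open import Relation.Nullary.Negation.Core using (¬_; contradiction)
open import Relation.Unary using (Decidable)
open import Defs using (module Sequence; average; indicator; product; Graph; Round; History; rounds; histories; push; informed; Regular; regular?; regularGraphs; broadcastTime; completedNow; probability)

-- The obstacle is the accumulation of errors. Of order `Λ` rounds are run, so a total error of
-- O(log `Λ`) rounds only allows a loss of `1 + O(1/Λ)` per round. Hence sets may span at most a
-- fraction `1/M` of excess edges, with `M` a constant multiple of `Λ`. The union bound gives this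
-- only for sizes `m` with `m * 2^(O(M)) ≤ n`, never for linear sizes, so a forward and a backward
-- exploration are both stopped near `√(nΛ)` and then joined. That the product of the two sizes is
-- of order `nΛ` and not `n` makes joining fail with probability exponentially small in `Λ`, which
-- survives a sum over all targets and all pairs of leaving times. The variable `ω` has no
-- second-order loss: with `x = ω / (d(1 + ω))` one has `(1 + ω)(1 + (d - 2)x) = 1 + rω` exactly, so
-- a single starting value `1/(2m)` serves for the whole growth. The graph is uniform on a list of
-- simple graphs, so every statement about it is a comparison of weights under switchings. Forward,
-- joining and backward rounds form disjoint blocks of the history and are independent given the
-- graph.

module Rationals where

 open import Data.Rational.Base public using (_+_; _*_; _-_; -_; _≤_; _<_)
 open import Data.Rational.Properties public using (≤-trans; ≤-reflexive; <⇒≤; *-identityʳ; nonNegative⁻¹; *-identityˡ; ≤-refl; +-mono-≤; +-monoˡ-≤; *-zeroˡ; *-assoc; +-identityˡ; *-comm; <-≤-trans; +-monoʳ-≤; *-zeroʳ; positive⁻¹; *-distribˡ-+; +-comm; neg-antimono-≤; +-identityʳ; module ≤-Reasoning)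
 open Sequence public using (recip; recip-pos; *-mono; *-monoˡ; *-monoʳ; *-nonNeg; +-nonNeg; 0≤1; 0<1; p≤p+q; _^_; ^-nonNeg; ^-mono; *-pos; p≤q⇒0≤q-p; sq-nonNeg; 0≤q-p⇒p≤q)
 open +-*-Solver public using (solve; con; _:+_; _:*_; _:-_; :-_; _:=_)

 2ℚ : ℚ
 2ℚ = 1ℚ + 1ℚ

-- Inequalities for rational powers and reciprocals, discrete logarithms.

module RationalArithmetic where

 open Rationals
 open Sequence

 <⇒≱ : ∀ {p q} → p < q → ¬ (q ≤ p)
 <⇒≱ p<q q≤p = ℚ.<-irrefl refl (<-≤-trans p<q q≤p)

 ≤-by : ∀ {p q} r → 0ℚ ≤ r → p + r ≡ q → p ≤ q
 ≤-by {p} r 0≤r e = subst (p ≤_) e (p≤p+q 0≤r)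

 1≤⇒0≤ : ∀ {x} → 1ℚ ≤ x → 0ℚ ≤ x
 1≤⇒0≤ = ≤-trans 0≤1

 *-cancelʳ : ∀ {p q} r → 0ℚ < r → p * r ≤ q * r → p ≤ q
 *-cancelʳ r 0<r = ℚ.*-cancelʳ-≤-pos r {{ℚ.positive 0<r}}

 *-cancelˡ : ∀ {p q} r → 0ℚ < r → r * p ≤ r * q → p ≤ q
 *-cancelˡ r 0<r = ℚ.*-cancelˡ-≤-pos r {{ℚ.positive 0<r}}

 p≤q*p : ∀ {p q} → 0ℚ ≤ p → 1ℚ ≤ q → p ≤ q * p
 p≤q*p {p} {q} 0≤p 1≤q = subst (_≤ q * p) (*-identityˡ p) (*-monoʳ p 0≤p 1≤q)

 p*q≤p : ∀ {p q} → 0ℚ ≤ p → q ≤ 1ℚ → p * q ≤ p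
 p*q≤p {p} {q} 0≤p q≤1 = subst (p * q ≤_) (*-identityʳ p) (*-monoˡ p 0≤p q≤1)

 1≤* : ∀ {p q} → 1ℚ ≤ p → 1ℚ ≤ q → 1ℚ ≤ p * q
 1≤* {p} {q} 1≤p 1≤q = ≤-trans 1≤q (p≤q*p (1≤⇒0≤ 1≤q) 1≤p)

 -- Kept abstract so that unification never unfolds the normalisation of fractions.
 abstract
  ι : ℕ → ℚ
  ι = fromℕ

  ι≡fromℕ : ∀ n → ι n ≡ fromℕ n
  ι≡fromℕ n = refl

  ι-0 : ι 0 ≡ 0ℚ
  ι-0 = refl

  ι-1 : ι 1 ≡ 1ℚ
  ι-1 = refl

  ι-suc : ∀ n → ι (suc n) ≡ 1ℚ + ι n
  ι-suc = fromℕ-suc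

  ι-mono : ∀ {m n} → m ℕ.≤ n → ι m ≤ ι n
  ι-mono = fromℕ-mono

  ι-archimedes : ∀ q → ∃[ N ] q ≤ ι N
  ι-archimedes = archimedes

  0≤ι : ∀ n → 0ℚ ≤ ι n
  0≤ι n = fromℕ-mono {0} {n} ℕ.z≤n

  1≤ι : ∀ {n} → 1 ℕ.≤ n → 1ℚ ≤ ι n
  1≤ι = fromℕ-mono

  0<ι : ∀ {n} → 1 ℕ.≤ n → 0ℚ < ι n
  0<ι h = <-≤-trans 0<1 (1≤ι h)

  ι-+ : ∀ m n → ι (m ℕ.+ n) ≡ ι m + ι n
  ι-+ zero n = sym (+-identityˡ (ι n))
  ι-+ (suc m) n = trans (fromℕ-suc (m ℕ.+ n)) (trans (cong (1ℚ +_) (ι-+ m n))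
   (trans (sym (ℚ.+-assoc 1ℚ (ι m) (ι n))) (cong (_+ ι n) (sym (fromℕ-suc m)))))

  ι-* : ∀ m n → ι (m ℕ.* n) ≡ ι m * ι n
  ι-* zero n = sym (*-zeroˡ (ι n))
  ι-* (suc m) n = trans (ι-+ n (m ℕ.* n)) (trans (cong (ι n +_) (ι-* m n))
   (trans (solve 2 (λ a b → b :+ a :* b := (con 1ℚ :+ a) :* b) refl (ι m) (ι n))
    (cong (_* ι n) (sym (fromℕ-suc m)))))

  ι-^ : ∀ m k → ι (m ℕ.^ k) ≡ ι m ^ k
  ι-^ m zero = refl
  ι-^ m (suc k) = trans (ι-* m (m ℕ.^ k)) (cong (ι m *_) (ι-^ m k))

  ι-cancel-≤ : ∀ {m n} → ι m ≤ ι n → m ℕ.≤ n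
  ι-cancel-≤ {m} {n} h with m ℕ.≤? n
  ... | yes m≤n = m≤n
  ... | no m≰n = contradiction (≤-trans (fromℕ-mono (ℕ.≰⇒> m≰n)) h)
   (<⇒≱ (subst₂ _<_ (+-identityˡ (ι n)) (sym (fromℕ-suc n)) (ℚ.+-monoˡ-< (ι n) 0<1)))

 ^-+ : ∀ x m n → x ^ (m ℕ.+ n) ≡ x ^ m * x ^ n
 ^-+ x zero n = sym (*-identityˡ (x ^ n))
 ^-+ x (suc m) n = trans (cong (x *_) (^-+ x m n)) (sym (*-assoc x (x ^ m) (x ^ n)))

 1^ : ∀ n → 1ℚ ^ n ≡ 1ℚ
 1^ zero = refl
 1^ (suc n) = trans (*-identityˡ (1ℚ ^ n)) (1^ n)

 *-^ : ∀ x y n → (x * y) ^ n ≡ x ^ n * y ^ n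
 *-^ x y zero = refl
 *-^ x y (suc n) = trans (cong (x * y *_) (*-^ x y n))
  (solve 4 (λ a b c d → a :* b :* (c :* d) := a :* c :* (b :* d)) refl x y (x ^ n) (y ^ n))

 ^-* : ∀ x m n → x ^ (m ℕ.* n) ≡ (x ^ m) ^ n
 ^-* x m zero = cong (x ^_) (ℕ.*-zeroʳ m)
 ^-* x m (suc n) = trans (cong (x ^_) (ℕ.*-suc m n))
  (trans (^-+ x m (m ℕ.* n)) (cong (x ^ m *_) (^-* x m n)))

 0<^ : ∀ {x} → 0ℚ < x → ∀ n → 0ℚ < x ^ n
 0<^ 0<x zero = 0<1
 0<^ 0<x (suc n) = *-pos 0<x (0<^ 0<x n)

 1≤^ : ∀ {x} → 1ℚ ≤ x → ∀ n → 1ℚ ≤ x ^ n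
 1≤^ 1≤x zero = ≤-refl
 1≤^ 1≤x (suc n) = 1≤* 1≤x (1≤^ 1≤x n)

 ^≤1 : ∀ {x} → 0ℚ ≤ x → x ≤ 1ℚ → ∀ n → x ^ n ≤ 1ℚ
 ^≤1 {x} 0≤x x≤1 n = subst (x ^ n ≤_) (1^ n) (^-mono 0≤x x≤1 n)

 ^-mono-exp : ∀ {x m n} → 1ℚ ≤ x → m ℕ.≤ n → x ^ m ≤ x ^ n
 ^-mono-exp {x} {m} {n} 1≤x m≤n =
  subst (λ k → x ^ m ≤ x ^ k) (ℕ.m+[n∸m]≡n m≤n)
   (subst₂ _≤_ (*-identityʳ (x ^ m)) (sym (^-+ x m (n ℕ.∸ m)))
    (*-monoˡ (x ^ m) (^-nonNeg (1≤⇒0≤ 1≤x) m) (1≤^ 1≤x (n ℕ.∸ m))))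

 ^-anti-exp : ∀ {x m n} → 0ℚ ≤ x → x ≤ 1ℚ → m ℕ.≤ n → x ^ n ≤ x ^ m
 ^-anti-exp {x} {m} {n} 0≤x x≤1 m≤n =
  subst (λ k → x ^ k ≤ x ^ m) (ℕ.m+[n∸m]≡n m≤n)
   (subst (_≤ x ^ m) (sym (^-+ x m (n ℕ.∸ m)))
    (p*q≤p (^-nonNeg 0≤x m) (^≤1 0≤x x≤1 (n ℕ.∸ m))))

 bernoulli⁺ : ∀ x → 0ℚ ≤ x → ∀ n → 1ℚ + ι n * x ≤ (1ℚ + x) ^ n
 bernoulli⁺ x 0≤x zero = ≤-reflexive
  (trans (cong (λ u → 1ℚ + u * x) ι-0)
   (solve 1 (λ x → con 1ℚ :+ con 0ℚ :* x := con 1ℚ) refl x))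
 bernoulli⁺ x 0≤x (suc n) = ≤-trans
  (≤-by (ι n * (x * x)) (*-nonNeg (0≤ι n) (sq-nonNeg x))
   (trans (cong (λ u → (1ℚ + u * x) + ι n * (x * x)) (ι-suc n))
    (solve 2 (λ x n → (con 1ℚ :+ (con 1ℚ :+ n) :* x) :+ n :* (x :* x) :=
             (con 1ℚ :+ x) :* (con 1ℚ :+ n :* x)) refl x (ι n))))
  (*-monoˡ (1ℚ + x) (+-nonNeg 0≤1 0≤x) (bernoulli⁺ x 0≤x n))

 bernoulli⁻ : ∀ x → 0ℚ ≤ x → x ≤ 1ℚ → ∀ n → 1ℚ - ι n * x ≤ (1ℚ - x) ^ n
 bernoulli⁻ x 0≤x x≤1 zero = ≤-reflexive
  (trans (cong (λ u → 1ℚ - u * x) ι-0)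
   (solve 1 (λ x → con 1ℚ :- con 0ℚ :* x := con 1ℚ) refl x))
 bernoulli⁻ x 0≤x x≤1 (suc n) = ≤-trans
  (≤-by (ι n * (x * x)) (*-nonNeg (0≤ι n) (sq-nonNeg x))
   (trans (cong (λ u → (1ℚ - u * x) + ι n * (x * x)) (ι-suc n))
    (solve 2 (λ x n → (con 1ℚ :- (con 1ℚ :+ n) :* x) :+ n :* (x :* x) :=
             (con 1ℚ :- x) :* (con 1ℚ :- n :* x)) refl x (ι n))))
  (*-monoˡ (1ℚ - x) (p≤q⇒0≤q-p x≤1) (bernoulli⁻ x 0≤x x≤1 n))

 -- (1 + x)ⁿ ≤ 1/(1 - x)ⁿ ≤ 1/(1 - nx)
 ^-≤2 : ∀ x n → 0ℚ ≤ x → x ≤ 1ℚ → ι n * x ≤ ½ → (1ℚ + x) ^ n ≤ 1ℚ + 1ℚ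
 ^-≤2 x n 0≤x x≤1 h = *-cancelʳ ½ (positive⁻¹ ½) (≤-trans
  (*-monoˡ ((1ℚ + x) ^ n) (^-nonNeg (+-nonNeg 0≤1 0≤x) n) (≤-trans
   (≤-by (½ - ι n * x) (p≤q⇒0≤q-p h)
    (solve 1 (λ a → con ½ :+ (con ½ :- a) := con 1ℚ :- a) refl (ι n * x)))
   (bernoulli⁻ x 0≤x x≤1 n)))
  (subst (_≤ 1ℚ) (*-^ (1ℚ + x) (1ℚ - x) n)
   (^≤1 (*-nonNeg (+-nonNeg 0≤1 0≤x) (p≤q⇒0≤q-p x≤1))
    (≤-by (x * x) (sq-nonNeg x)
     (solve 1 (λ x → (con 1ℚ :+ x) :* (con 1ℚ :- x) :+ x :* x := con 1ℚ) refl x)) n)))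

 recip-*ˡ : ∀ {p} → 0ℚ < p → recip p * p ≡ 1ℚ
 recip-*ˡ {p} 0<p = trans (*-comm (recip p) p) (*-recip p (0<⇒≢0 0<p))

 recip-*ʳ : ∀ {p} → 0ℚ < p → p * recip p ≡ 1ℚ
 recip-*ʳ {p} 0<p = *-recip p (0<⇒≢0 0<p)

 inverse-unique : ∀ {p i j} → p * i ≡ 1ℚ → p * j ≡ 1ℚ → i ≡ j
 inverse-unique {p} {i} {j} pi pj = trans (sym (*-identityʳ i)) (trans (cong (i *_) (sym pj))
  (trans (solve 3 (λ p i j → i :* (p :* j) := (p :* i) :* j) refl p i j)
   (trans (cong (_* j) pi) (*-identityˡ j))))

 recip-anti : ∀ {p q} → 0ℚ < p → p ≤ q → recip q ≤ recip p
 recip-anti 0<p p≤q = inv-anti (<⇒≤ (recip-pos 0<p)) (<⇒≤ (recip-pos 0<q)) p≤q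
  (recip-*ʳ 0<p) (recip-*ʳ 0<q)
  where 0<q = <-≤-trans 0<p p≤q

 recip≤1 : ∀ {p} → 1ℚ ≤ p → recip p ≤ 1ℚ
 recip≤1 1≤p = recip-anti 0<1 1≤p

 ≤*recip : ∀ {p q r} → 0ℚ < r → p * r ≤ q → p ≤ q * recip r
 ≤*recip {p} {q} {r} 0<r h = subst (_≤ q * recip r)
  (trans (*-assoc p r (recip r)) (trans (cong (p *_) (recip-*ʳ 0<r)) (*-identityʳ p)))
  (*-monoʳ (recip r) (<⇒≤ (recip-pos 0<r)) h)

 *recip≤ : ∀ {p q r} → 0ℚ < r → p ≤ q * r → p * recip r ≤ q
 *recip≤ {p} {q} {r} 0<r h = subst (p * recip r ≤_)
  (trans (*-assoc q r (recip r)) (trans (cong (q *_) (recip-*ʳ 0<r)) (*-identityʳ q)))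
  (*-monoʳ (recip r) (<⇒≤ (recip-pos 0<r)) h)

 abstract
  -- Averages and the coefficients of the logarithm are normalised fractions, while the proof
  -- computes with `recip`. Passing through unnormalised rationals once keeps normalisation out of
  -- everything else.
  1/suc≡recip : ∀ k → ℤ.+ 1 ℚ./ suc k ≡ recip (ι (suc k))
  1/suc≡recip k = inverse-unique {fromℕ (suc k)} {ℤ.+ 1 ℚ./ suc k} {recip (fromℕ (suc k))}
   eq (recip-*ʳ {fromℕ (suc k)} (0<ι {suc k} (ℕ.z<s)))
   where
   eq : fromℕ (suc k) * (ℤ.+ 1 ℚ./ suc k) ≡ 1ℚ
   eq = ℚ.toℚᵘ-injective (ℚᵘ.≃-trans (ℚ.toℚᵘ-homo-* (fromℕ (suc k)) (ℤ.+ 1 ℚ./ suc k))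
    (ℚᵘ.≃-trans (ℚᵘ.*-cong (ℚ.toℚᵘ-fromℚᵘ (ℚᵘ.mkℚᵘ (ℤ.+ suc k) 0))
      (ℚ.toℚᵘ-fromℚᵘ (ℚᵘ.mkℚᵘ (ℤ.+ 1) k)))
     (ℚᵘ.*≡* (trans (ℤ.*-identityʳ (ℤ.+ suc k ℤ.* ℤ.+ 1))
      (trans (ℤ.*-comm (ℤ.+ suc k) (ℤ.+ 1))
       (cong (λ u → ℤ.+ 1 ℤ.* ℤ.+ u) (sym (ℕ.+-identityʳ (suc k)))))))))

 -- A downward search from `N`, so `P` need not be monotone.
 lastTrue : ∀ {P : ℕ → Set} → (∀ k → Dec (P k)) → P 0 → ∀ N → ¬ P N →
  ∃[ k ] (P k × ¬ P (suc k))
 lastTrue P? p0 zero ¬p = contradiction p0 ¬p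
 lastTrue P? p0 (suc N) ¬p with P? N
 ... | yes p = N , p , ¬p
 ... | no ¬q = lastTrue P? p0 N ¬q

 -- x ≥ 1 + 1/c exceeds Y after at most cY steps.
 logarithm : ∀ x c → 1 ℕ.≤ c → 1ℚ + recip (ι c) ≤ x → ∀ Y → 1ℚ ≤ Y →
  ∃[ k ] (x ^ k ≤ Y × Y < x ^ suc k)
 logarithm x c 1≤c h Y 1≤Y =
  let k , p , ¬p = lastTrue (λ k → x ^ k ℚ.≤? Y) 1≤Y (c ℕ.* N) (<⇒≱ big)
  in k , p , ℚ.≰⇒> ¬p
  where
  N = proj₁ (ι-archimedes Y)
  0<c = 0<ι 1≤c
  0≤1/c = <⇒≤ (recip-pos 0<c)
  big : Y < x ^ (c ℕ.* N)
  big = <-≤-trans (ℚ.≤-<-trans (proj₂ (ι-archimedes Y))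
    (subst₂ _<_ (+-identityˡ (ι N)) (cong (1ℚ +_) (sym eq)) (ℚ.+-monoˡ-< (ι N) 0<1)))
   (≤-trans (bernoulli⁺ (recip (ι c)) 0≤1/c (c ℕ.* N))
    (^-mono (+-nonNeg 0≤1 0≤1/c) h (c ℕ.* N)))
   where
   eq : ι (c ℕ.* N) * recip (ι c) ≡ ι N
   eq = trans (cong (_* recip (ι c)) (ι-* c N))
    (trans (solve 3 (λ a b i → a :* b :* i := b :* (a :* i)) refl (ι c) (ι N) (recip (ι c)))
     (trans (cong (ι N *_) (recip-*ʳ 0<c)) (*-identityʳ (ι N))))

open RationalArithmetic

-- Finite sums, averages over lists and comparison along injections.

module FiniteSums where

 open Rationals
 open Sequence

 module ℚSum = SemiringSum (CommutativeRing.semiring ℚ.+-*-commutativeRing)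

 private variable
  n : ℕ
  A B : Set

 ∑ : (Fin n → ℕ) → ℕ
 ∑ {zero} f = 0
 ∑ {suc n} f = f zero ℕ.+ ∑ (f ∘ suc)

 ∑ℚ : (Fin n → ℚ) → ℚ
 ∑ℚ {zero} f = 0ℚ
 ∑ℚ {suc n} f = f zero + ∑ℚ (f ∘ suc)

 ∑-cong : {f g : Fin n → ℕ} → (∀ i → f i ≡ g i) → ∑ f ≡ ∑ g
 ∑-cong {zero} h = refl
 ∑-cong {suc n} h = cong₂ ℕ._+_ (h zero) (∑-cong (h ∘ suc))

 ∑-+ : (f g : Fin n → ℕ) → ∑ (λ i → f i ℕ.+ g i) ≡ ∑ f ℕ.+ ∑ g
 ∑-+ {zero} f g = refl
 ∑-+ {suc n} f g = trans (cong (f zero ℕ.+ g zero ℕ.+_) (∑-+ (f ∘ suc) (g ∘ suc)))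
  (ℕ-interchange (f zero) (g zero) (∑ (f ∘ suc)) (∑ (g ∘ suc)))
  where
  ℕ-interchange : ∀ a b c d → a ℕ.+ b ℕ.+ (c ℕ.+ d) ≡ (a ℕ.+ c) ℕ.+ (b ℕ.+ d)
  ℕ-interchange = ℕ-solve-∀

 *-distribˡ-∑ : ∀ c (f : Fin n → ℕ) → c ℕ.* ∑ f ≡ ∑ (λ i → c ℕ.* f i)
 *-distribˡ-∑ {zero} c f = ℕ.*-zeroʳ c
 *-distribˡ-∑ {suc n} c f = trans (ℕ.*-distribˡ-+ c (f zero) _) (cong (c ℕ.* f zero ℕ.+_) (*-distribˡ-∑ c (f ∘ suc)))

 *-distribʳ-∑ : ∀ c (f : Fin n → ℕ) → ∑ f ℕ.* c ≡ ∑ (λ i → f i ℕ.* c)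
 *-distribʳ-∑ c f = trans (ℕ.*-comm (∑ f) c) (trans (*-distribˡ-∑ c f) (∑-cong λ i → ℕ.*-comm c (f i)))

 ∑-zero : (f : Fin n → ℕ) → (∀ i → f i ≡ 0) → ∑ f ≡ 0
 ∑-zero {zero} f h = refl
 ∑-zero {suc n} f h = cong₂ ℕ._+_ (h zero) (∑-zero (f ∘ suc) (h ∘ suc))

 ∑-swap : ∀ {m} (f : Fin m → Fin n → ℕ) → ∑ (λ i → ∑ (f i)) ≡ ∑ (λ j → ∑ (λ i → f i j))
 ∑-swap {n = n} {m = zero} f = sym (∑-zero {n} (λ _ → 0) λ _ → refl)
 ∑-swap {m = suc m} f = trans (cong (∑ (f zero) ℕ.+_) (∑-swap (f ∘ suc))) (sym (∑-+ (f zero) _))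

 ∑ℚ-cong : {f g : Fin n → ℚ} → (∀ i → f i ≡ g i) → ∑ℚ f ≡ ∑ℚ g
 ∑ℚ-cong {zero} h = refl
 ∑ℚ-cong {suc n} h = cong₂ _+_ (h zero) (∑ℚ-cong (h ∘ suc))

 ∑ℚ-+ : (f g : Fin n → ℚ) → ∑ℚ (λ i → f i + g i) ≡ ∑ℚ f + ∑ℚ g
 ∑ℚ-+ {zero} f g = refl
 ∑ℚ-+ {suc n} f g = trans (cong (f zero + g zero +_) (∑ℚ-+ (f ∘ suc) (g ∘ suc)))
  (solve 4 (λ a b c d → a :+ b :+ (c :+ d) := (a :+ c) :+ (b :+ d)) refl
   (f zero) (g zero) (∑ℚ (f ∘ suc)) (∑ℚ (g ∘ suc)))

 *-distribˡ-∑ℚ : ∀ c (f : Fin n → ℚ) → c * ∑ℚ f ≡ ∑ℚ (λ i → c * f i)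
 *-distribˡ-∑ℚ {zero} c f = *-zeroʳ c
 *-distribˡ-∑ℚ {suc n} c f = trans (*-distribˡ-+ c (f zero) _) (cong (c * f zero +_) (*-distribˡ-∑ℚ c (f ∘ suc)))

 *-distribʳ-∑ℚ : ∀ c (f : Fin n → ℚ) → ∑ℚ f * c ≡ ∑ℚ (λ i → f i * c)
 *-distribʳ-∑ℚ c f = trans (*-comm (∑ℚ f) c) (trans (*-distribˡ-∑ℚ c f) (∑ℚ-cong λ i → *-comm c (f i)))

 ∑ℚ-zero : (f : Fin n → ℚ) → (∀ i → f i ≡ 0ℚ) → ∑ℚ f ≡ 0ℚ
 ∑ℚ-zero {zero} f h = refl
 ∑ℚ-zero {suc n} f h = cong₂ _+_ (h zero) (∑ℚ-zero (f ∘ suc) (h ∘ suc))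

 ∑ℚ-swap : ∀ {m} (f : Fin m → Fin n → ℚ) → ∑ℚ (λ i → ∑ℚ (f i)) ≡ ∑ℚ (λ j → ∑ℚ (λ i → f i j))
 ∑ℚ-swap {n = n} {m = zero} f = sym (∑ℚ-zero {n} (λ _ → 0ℚ) λ _ → refl)
 ∑ℚ-swap {m = suc m} f = trans (cong (∑ℚ (f zero) +_) (∑ℚ-swap (f ∘ suc))) (sym (∑ℚ-+ (f zero) _))

 ∑ℚ≡sum : (f : Fin n → ℚ) → ∑ℚ f ≡ ℚSum.sum f
 ∑ℚ≡sum {zero} f = refl
 ∑ℚ≡sum {suc n} f = cong (f zero +_) (∑ℚ≡sum (f ∘ suc))

 ∑ℚ-permute : (f : Fin n → ℚ) (π : Permutation n n) → ∑ℚ f ≡ ∑ℚ (λ i → f (π ⟨$⟩ʳ i))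
 ∑ℚ-permute f π = trans (∑ℚ≡sum f) (trans (ℚSum.sum-permute f π) (sym (∑ℚ≡sum (λ i → f (π ⟨$⟩ʳ i)))))

 𝟙 : Bool → ℕ
 𝟙 true = 1
 𝟙 false = 0

 𝟙≤1 : ∀ b → 𝟙 b ℕ.≤ 1
 𝟙≤1 true = ℕ.≤-refl
 𝟙≤1 false = ℕ.z≤n

 𝟙-∧ : ∀ a b → 𝟙 (a ∧ b) ≡ 𝟙 a ℕ.* 𝟙 b
 𝟙-∧ true b = sym (ℕ.+-identityʳ (𝟙 b))
 𝟙-∧ false b = refl

 𝟙-not : ∀ b → 𝟙 b ℕ.+ 𝟙 (not b) ≡ 1
 𝟙-not true = refl
 𝟙-not false = refl

 ∑-mono : {f g : Fin n → ℕ} → (∀ i → f i ℕ.≤ g i) → ∑ f ℕ.≤ ∑ g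
 ∑-mono {zero} h = ℕ.z≤n
 ∑-mono {suc n} h = ℕ.+-mono-≤ (h zero) (∑-mono (h ∘ suc))

 ∑-const : ∀ n c → ∑ {n} (λ _ → c) ≡ n ℕ.* c
 ∑-const zero c = refl
 ∑-const (suc n) c = cong (c ℕ.+_) (∑-const n c)

 term≤∑ : (f : Fin n → ℕ) → ∀ i → f i ℕ.≤ ∑ f
 term≤∑ f zero = ℕ.m≤m+n (f zero) _
 term≤∑ f (suc i) = ℕ.≤-trans (term≤∑ (f ∘ suc) i) (ℕ.m≤n+m _ (f zero))

 _≡ᵇ_ : Fin n → Fin n → Bool
 x ≡ᵇ y = does (x Fin.≟ y)

 ≡ᵇ⇒≡ : {x y : Fin n} → (x ≡ᵇ y) ≡ true → x ≡ y
 ≡ᵇ⇒≡ {x = x} {y} h with x Fin.≟ y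
 ... | yes e = e

 ≡ᵇ-refl : (x : Fin n) → (x ≡ᵇ x) ≡ true
 ≡ᵇ-refl x with x Fin.≟ x
 ... | yes _ = refl
 ... | no ≢ = contradiction refl ≢

 ≢⇒≡ᵇ : {x y : Fin n} → x ≢ y → (x ≡ᵇ y) ≡ false
 ≢⇒≡ᵇ {x = x} {y} h with x Fin.≟ y
 ... | yes e = contradiction e h
 ... | no _ = refl

 ∑-δ : (x : Fin n) (f : Fin n → ℕ) → ∑ (λ y → 𝟙 (x ≡ᵇ y) ℕ.* f y) ≡ f x
 ∑-δ {suc n} zero f = trans (cong₂ ℕ._+_ (ℕ.+-identityʳ (f zero)) (∑-zero {n} (λ _ → 0) λ i → refl)) (ℕ.+-identityʳ (f zero))
 ∑-δ {suc n} (suc x) f = trans (∑-cong λ y → cong (λ b → 𝟙 b ℕ.* f (suc y)) (lemma y)) (∑-δ x (f ∘ suc))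
  where
  lemma : ∀ y → (suc x ≡ᵇ suc y) ≡ (x ≡ᵇ y)
  lemma y with x Fin.≟ y
  ... | yes _ = refl
  ... | no _ = refl

 ∑-δ₁ : (x : Fin n) → ∑ (λ y → 𝟙 (x ≡ᵇ y)) ≡ 1
 ∑-δ₁ x = trans (∑-cong λ y → sym (ℕ.*-identityʳ (𝟙 (x ≡ᵇ y)))) (∑-δ x (λ _ → 1))

 card≡∑ : (S : Subset n) → ∣ S ∣ ≡ ∑ (λ x → 𝟙 (lookup S x))
 card≡∑ [] = refl
 card≡∑ (true ∷ S) = cong suc (card≡∑ S)
 card≡∑ (false ∷ S) = card≡∑ S

 ∑ℚ-mono : {f g : Fin n → ℚ} → (∀ i → f i ≤ g i) → ∑ℚ f ≤ ∑ℚ g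
 ∑ℚ-mono {zero} h = ≤-refl
 ∑ℚ-mono {suc n} h = +-mono-≤ (h zero) (∑ℚ-mono (h ∘ suc))

 ∑ℚ-nonNeg : {f : Fin n → ℚ} → (∀ i → 0ℚ ≤ f i) → 0ℚ ≤ ∑ℚ f
 ∑ℚ-nonNeg {zero} h = ≤-refl
 ∑ℚ-nonNeg {suc n} h = +-nonNeg (h zero) (∑ℚ-nonNeg (h ∘ suc))

 term≤∑ℚ : (f : Fin n → ℚ) → (∀ i → 0ℚ ≤ f i) → ∀ i → f i ≤ ∑ℚ f
 term≤∑ℚ f h zero = p≤p+q (∑ℚ-nonNeg (h ∘ suc))
 term≤∑ℚ f h (suc i) = ≤-trans (term≤∑ℚ (f ∘ suc) (h ∘ suc) i)
  (subst (_≤ ∑ℚ f) (+-identityˡ _) (+-monoˡ-≤ _ (h zero)))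

 ∑ℚ-const : ∀ n c → ∑ℚ {n} (λ _ → c) ≡ ι n * c
 ∑ℚ-const zero c = sym (trans (cong (_* c) ι-0) (*-zeroˡ c))
 ∑ℚ-const (suc n) c = trans (cong (c +_) (∑ℚ-const n c))
  (trans (solve 2 (λ c n → c :+ n :* c := (con 1ℚ :+ n) :* c) refl c (ι n)) (cong (_* c) (sym (ι-suc n))))

 ι-∑ : (f : Fin n → ℕ) → ι (∑ f) ≡ ∑ℚ (λ i → ι (f i))
 ι-∑ {zero} f = ι-0
 ι-∑ {suc n} f = trans (ι-+ (f zero) (∑ (f ∘ suc))) (cong (ι (f zero) +_) (ι-∑ (f ∘ suc)))

 indicator≡ι : ∀ b → indicator b ≡ ι (𝟙 b)
 indicator≡ι true = sym ι-1
 indicator≡ι false = sym ι-0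

 0≤indicator : ∀ b → 0ℚ ≤ indicator b
 0≤indicator true = 0≤1
 0≤indicator false = ≤-refl

 indicator≤1 : ∀ b → indicator b ≤ 1ℚ
 indicator≤1 true = ≤-refl
 indicator≤1 false = 0≤1

 Σ : (A → ℚ) → List A → ℚ
 Σ f xs = foldr _+_ 0ℚ (map f xs)

 Σ-cong : {f g : A → ℚ} → (∀ x → f x ≡ g x) → ∀ xs → Σ f xs ≡ Σ g xs
 Σ-cong h [] = refl
 Σ-cong h (x ∷ xs) = cong₂ _+_ (h x) (Σ-cong h xs)

 Σ-mono : {f g : A → ℚ} → ∀ xs → (∀ x → x ∈ xs → f x ≤ g x) → Σ f xs ≤ Σ g xs
 Σ-mono [] h = ≤-refl
 Σ-mono (x ∷ xs) h = +-mono-≤ (h x (here refl)) (Σ-mono xs λ y y∈ → h y (there y∈))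

 Σ-0 : ∀ (xs : List A) → Σ (λ _ → 0ℚ) xs ≡ 0ℚ
 Σ-0 [] = refl
 Σ-0 (x ∷ xs) = trans (+-identityˡ _) (Σ-0 xs)

 Σ-nonNeg : {f : A → ℚ} → (∀ x → 0ℚ ≤ f x) → ∀ xs → 0ℚ ≤ Σ f xs
 Σ-nonNeg {f = f} h xs = subst (_≤ Σ f xs) (Σ-0 xs) (Σ-mono xs λ x _ → h x)

 Σ-+ : (f g : A → ℚ) → ∀ xs → Σ (λ x → f x + g x) xs ≡ Σ f xs + Σ g xs
 Σ-+ f g [] = refl
 Σ-+ f g (x ∷ xs) = trans (cong (f x + g x +_) (Σ-+ f g xs))
  (solve 4 (λ a b c d → a :+ b :+ (c :+ d) := (a :+ c) :+ (b :+ d)) refl (f x) (g x) (Σ f xs) (Σ g xs))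

 Σ-*ˡ : ∀ c (f : A → ℚ) xs → Σ (λ x → c * f x) xs ≡ c * Σ f xs
 Σ-*ˡ c f [] = sym (*-zeroʳ c)
 Σ-*ˡ c f (x ∷ xs) = trans (cong (c * f x +_) (Σ-*ˡ c f xs)) (sym (*-distribˡ-+ c (f x) (Σ f xs)))

 Σ-*ʳ : ∀ c (f : A → ℚ) xs → Σ (λ x → f x * c) xs ≡ Σ f xs * c
 Σ-*ʳ c f xs = trans (Σ-cong (λ x → *-comm (f x) c) xs) (trans (Σ-*ˡ c f xs) (*-comm c (Σ f xs)))

 Σ-++ : (f : A → ℚ) → ∀ xs ys → Σ f (xs ++ ys) ≡ Σ f xs + Σ f ys
 Σ-++ f [] ys = sym (+-identityˡ (Σ f ys))
 Σ-++ f (x ∷ xs) ys = trans (cong (f x +_) (Σ-++ f xs ys)) (sym (ℚ.+-assoc (f x) (Σ f xs) (Σ f ys)))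

 Σ-map : (f : B → ℚ) (g : A → B) → ∀ xs → Σ f (map g xs) ≡ Σ (f ∘ g) xs
 Σ-map f g [] = refl
 Σ-map f g (x ∷ xs) = cong (f (g x) +_) (Σ-map f g xs)

 Σ-swap : (f : A → B → ℚ) → ∀ xs ys → Σ (λ x → Σ (f x) ys) xs ≡ Σ (λ y → Σ (λ x → f x y) xs) ys
 Σ-swap f [] ys = sym (Σ-0 ys)
 Σ-swap f (x ∷ xs) ys = trans (cong (Σ (f x) ys +_) (Σ-swap f xs ys))
  (sym (Σ-+ (f x) (λ y → Σ (λ x → f x y) xs) ys))

 Σ-∑-swap : (f : A → Fin n → ℚ) → ∀ xs → Σ (λ x → ∑ℚ (f x)) xs ≡ ∑ℚ (λ i → Σ (λ x → f x i) xs)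
 Σ-∑-swap {n = zero} f xs = Σ-0 xs
 Σ-∑-swap {n = suc n} f xs = trans (Σ-+ (λ x → f x zero) (λ x → ∑ℚ (f x ∘ suc)) xs)
  (cong (Σ (λ x → f x zero) xs +_) (Σ-∑-swap (λ x → f x ∘ suc) xs))

 Σ-const : ∀ c (xs : List A) → Σ (λ _ → c) xs ≡ ι (length xs) * c
 Σ-const c [] = sym (trans (cong (_* c) ι-0) (*-zeroˡ c))
 Σ-const c (x ∷ xs) = trans (cong (c +_) (Σ-const c xs))
  (trans (solve 2 (λ c n → c :+ n :* c := (con 1ℚ :+ n) :* c) refl c (ι (length xs)))
   (cong (_* c) (sym (ι-suc (length xs)))))

 Σ-filter : ∀ {P : A → Set} (P? : Decidable P) (f : A → ℚ) xs →
  Σ f (filter P? xs) ≡ Σ (λ x → indicator (does (P? x)) * f x) xs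
 Σ-filter P? f [] = refl
 Σ-filter P? f (x ∷ xs) with P? x
 ... | yes _ = cong₂ _+_ (sym (*-identityˡ (f x))) (Σ-filter P? f xs)
 ... | no _ = trans (Σ-filter P? f xs) (sym (trans (cong (_+ _) (*-zeroˡ (f x))) (+-identityˡ _)))

 Σ-tabulate : (f : A → ℚ) (g : Fin n → A) → Σ f (tabulate g) ≡ ∑ℚ (f ∘ g)
 Σ-tabulate {n = zero} f g = refl
 Σ-tabulate {n = suc n} f g = cong (f (g zero) +_) (Σ-tabulate f (g ∘ suc))

 Σ-cartesian : ∀ {C : Set} (f : C → ℚ) (_⊗_ : A → B → C) xs ys →
  Σ f (cartesianProductWith _⊗_ xs ys) ≡ Σ (λ x → Σ (λ y → f (x ⊗ y)) ys) xs
 Σ-cartesian f _⊗_ [] ys = refl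
 Σ-cartesian f _⊗_ (x ∷ xs) ys = trans (Σ-++ f (map (x ⊗_) ys) _)
  (cong₂ _+_ (Σ-map f (x ⊗_) ys) (Σ-cartesian f _⊗_ xs ys))

 -- Each `x` claims its own place `φ x` in `ys`. The place is deleted before the induction
 -- continues, and injectivity keeps the later images away from it. Terms with `f x ≤ 0` claim
 -- nothing, which is how graphs that admit no switching are passed over.
 Σ-injection : {xs : List A} → Unique xs → ∀ {ys : List B} {f : A → ℚ} {g : B → ℚ} (φ : A → B) →
  (∀ {x y} → φ x ≡ φ y → x ≡ y) → (∀ y → 0ℚ ≤ g y) →
  (∀ x → x ∈ xs → f x ≤ 0ℚ ⊎ (φ x ∈ ys × f x ≤ g (φ x))) → Σ f xs ≤ Σ g ys
 Σ-injection [] {ys} φ inj 0≤g h = Σ-nonNeg 0≤g ys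
 Σ-injection {xs = x ∷ xs} (x∉ ∷ u) {ys} {f} {g} φ inj 0≤g h with h x (here refl)
 ... | inj₁ fx≤0 = subst (f x + Σ f xs ≤_) (+-identityˡ (Σ g ys))
  (+-mono-≤ fx≤0 (Σ-injection u {ys} {f} {g} φ inj 0≤g λ y y∈ → h y (there y∈)))
 ... | inj₂ (φx∈ , fx≤) with ∈-∃++ φx∈
 ... | as , bs , refl = subst (f x + Σ f xs ≤_) eq
  (+-mono-≤ fx≤ (Σ-injection u {as ++ bs} {f} {g} φ inj 0≤g rest))
  where
  eq : g (φ x) + Σ g (as ++ bs) ≡ Σ g (as ++ φ x ∷ bs)
  eq = trans (cong (g (φ x) +_) (Σ-++ g as bs))
   (trans (solve 3 (λ a b c → a :+ (b :+ c) := b :+ (a :+ c)) refl (g (φ x)) (Σ g as) (Σ g bs))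
    (sym (Σ-++ g as (φ x ∷ bs))))
  remove : ∀ {z} → z ∈ as ++ φ x ∷ bs → z ≢ φ x → z ∈ as ++ bs
  remove z∈ z≢ with ∈-++⁻ as z∈
  ... | inj₁ z∈as = ∈-++⁺ˡ z∈as
  ... | inj₂ (here e) = contradiction e z≢
  ... | inj₂ (there z∈bs) = ∈-++⁺ʳ as z∈bs
  rest : ∀ y → y ∈ xs → f y ≤ 0ℚ ⊎ (φ y ∈ as ++ bs × f y ≤ g (φ y))
  rest y y∈ with h y (there y∈)
  ... | inj₁ fy≤0 = inj₁ fy≤0
  ... | inj₂ (φy∈ , fy≤) = inj₂ (remove φy∈ (λ e → All.lookup x∉ y∈ (sym (inj e))) , fy≤)

 average≡ : (f : A → ℚ) → ∀ xs → 1 ℕ.≤ length xs → average f xs ≡ Σ f xs * recip (ι (length xs))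
 average≡ f (x ∷ xs) _ = cong (Σ f (x ∷ xs) *_) (1/suc≡recip (length xs))

 average-scale : (f : A → ℚ) → ∀ xs → ι (length xs) * average f xs ≡ Σ f xs
 average-scale f [] = trans (cong (_* 0ℚ) ι-0) refl
 average-scale f (x ∷ xs) = trans (cong (ι (suc (length xs)) *_) (average≡ f (x ∷ xs) (ℕ.z<s)))
  (trans (solve 3 (λ l s i → l :* (s :* i) := s :* (l :* i)) refl (ι (suc (length xs))) (Σ f (x ∷ xs)) (recip (ι (suc (length xs)))))
   (trans (cong (Σ f (x ∷ xs) *_) (recip-*ʳ (0<ι (ℕ.z<s)))) (*-identityʳ _)))

 average-cong : {f g : A → ℚ} → (∀ x → f x ≡ g x) → ∀ xs → average f xs ≡ average g xs
 average-cong h [] = refl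
 average-cong h (x ∷ xs) = cong (_* (ℤ.+ 1 ℚ./ suc (length xs))) (Σ-cong h (x ∷ xs))

 length-cartesian : ∀ {C : Set} {_⊗_ : A → B → C} xs ys →
  length (cartesianProductWith _⊗_ xs ys) ≡ length xs ℕ.* length ys
 length-cartesian [] ys = refl
 length-cartesian {_⊗_ = _⊗_} (x ∷ xs) ys = trans (List.length-++ (map (x ⊗_) ys))
  (cong₂ ℕ._+_ (List.length-map (x ⊗_) ys) (length-cartesian xs ys))

 -- This identity is the independence of the choices, since rounds and histories are uniform on
 -- products. If `ys` is empty both sides are 0 by the convention for `average`.
 average-cartesian : ∀ {C : Set} (f : C → ℚ) (_⊗_ : A → B → C) xs ys →
  average f (cartesianProductWith _⊗_ xs ys) ≡ average (λ x → average (λ y → f (x ⊗ y)) ys) xs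
 average-cartesian f _⊗_ [] ys = refl
 average-cartesian f _⊗_ (x ∷ xs) [] = trans (cong (average f) (nil xs)) (sym (trans
   (cong (_* (ℤ.+ 1 ℚ./ suc (length xs))) (Σ-0 (x ∷ xs))) (*-zeroˡ (ℤ.+ 1 ℚ./ suc (length xs)))))
  where
  nil : ∀ xs → cartesianProductWith _⊗_ xs [] ≡ []
  nil [] = refl
  nil (x ∷ xs) = nil xs
 average-cartesian f _⊗_ xs@(_ ∷ xs′) ys@(y ∷ ys′) =
  trans (average≡ f zs 1≤zs)
   (trans (cong₂ _*_ (Σ-cartesian f _⊗_ xs ys) (cong (λ k → recip (ι k)) len))
    (trans (cong₂ _*_ (trans (Σ-cong (λ x → sym (average-scale (λ y → f (x ⊗ y)) ys)) xs)
         (Σ-*ˡ (ι l) (λ x → average (λ y → f (x ⊗ y)) ys) xs)) refl)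
     (trans (reorder (Σ (λ x → average (λ y → f (x ⊗ y)) ys) xs))
      (sym (average≡ (λ x → average (λ y → f (x ⊗ y)) ys) xs (ℕ.z<s))))))
  where
  zs = cartesianProductWith _⊗_ xs ys
  k = length xs
  l = length ys
  len : length zs ≡ k ℕ.* l
  len = length-cartesian xs ys
  1≤zs : 1 ℕ.≤ length zs
  1≤zs = subst (1 ℕ.≤_) (sym len) (ℕ.z<s)
  0<k : 0ℚ < ι k
  0<k = 0<ι (ℕ.z<s)
  0<l : 0ℚ < ι l
  0<l = 0<ι (ℕ.z<s)
  split : recip (ι (k ℕ.* l)) ≡ recip (ι k) * recip (ι l)
  split = inverse-unique {ι (k ℕ.* l)} (recip-*ʳ (0<ι (ℕ.z<s)))
   (trans (cong (_* (recip (ι k) * recip (ι l))) (ι-* k l))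
    (trans (solve 4 (λ a b i j → a :* b :* (i :* j) := (a :* i) :* (b :* j)) refl (ι k) (ι l) (recip (ι k)) (recip (ι l)))
     (cong₂ _*_ (recip-*ʳ 0<k) (recip-*ʳ 0<l))))
  reorder : ∀ s → ι l * s * recip (ι (k ℕ.* l)) ≡ s * recip (ι k)
  reorder s = trans (cong (ι l * s *_) split)
   (trans (solve 4 (λ l s i j → l :* s :* (i :* j) := s :* i :* (l :* j)) refl (ι l) s (recip (ι k)) (recip (ι l)))
    (trans (cong (s * recip (ι k) *_) (recip-*ʳ 0<l)) (*-identityʳ _)))

 product-unique : ∀ {m} (xss : Vec (List A) m) → (∀ i → Unique (lookup xss i)) → Unique (product xss)
 product-unique [] h = All.[] ∷ []
 product-unique (xs ∷ xss) h = Unique.cartesianProductWith⁺ _∷_ Vec.∷-injective (h zero) (product-unique xss (h ∘ suc))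

 product-complete : ∀ {m} (xss : Vec (List A) m) (v : Vec A m) → (∀ i → lookup v i ∈ lookup xss i) → v ∈ product xss
 product-complete [] [] h = here refl
 product-complete (xs ∷ xss) (x ∷ v) h = ∈-cartesianProductWith⁺ _∷_ (h zero) (product-complete xss v (h ∘ suc))

open FiniteSums

-- The push process forwards and backwards, and expectations over its rounds.

module Processes where

 private variable
  n k t : ℕ

 Compatible : Vec (Subset n) k → Vec (Fin n) k → Set
 Compatible W c = ∀ u → lookup (lookup W u) (lookup c u) ≡ true

 pre : Round n → Subset n → Subset n
 pre c W = Vec.tabulate λ u → lookup W u ∨ lookup W (lookup c u)

 -- The vertices from which information travels to W during the rounds cs.
 back : History n t → Subset n → Subset n
 back [] W = W
 back (c ∷ cs) W = back cs (pre c W)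

 bool-cases : ∀ b → b ≡ true ⊎ b ≡ false
 bool-cases true = inj₁ refl
 bool-cases false = inj₂ refl

 true≢false : ∀ {b} → b ≡ true → b ≡ false → ∀ {A : Set} → A
 true≢false refl ()

 ∨-true⁻ : ∀ {a b} → a ∨ b ≡ true → a ≡ true ⊎ b ≡ true
 ∨-true⁻ {true} _ = inj₁ refl
 ∨-true⁻ {false} h = inj₂ h

 ∨-trueˡ : ∀ {a b} → a ≡ true → a ∨ b ≡ true
 ∨-trueˡ refl = refl

 ∨-trueʳ : ∀ {a b} → b ≡ true → a ∨ b ≡ true
 ∨-trueʳ {true} _ = refl
 ∨-trueʳ {false} h = h

 does-true : ∀ {P : Set} (P? : Dec P) → does P? ≡ true → P
 does-true (yes p) _ = p

 true-does : ∀ {P : Set} (P? : Dec P) → P → does P? ≡ true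
 true-does (yes _) _ = refl
 true-does (no ¬p) p = contradiction p ¬p

 does-false : ∀ {P : Set} (P? : Dec P) → does P? ≡ false → ¬ P
 does-false (no ¬p) _ = ¬p

 false-does : ∀ {P : Set} (P? : Dec P) → ¬ P → does P? ≡ false
 false-does (yes p) ¬p = contradiction p ¬p
 false-does (no _) _ = refl

 pre-lookup : ∀ (c : Round n) W u → lookup (pre c W) u ≡ lookup W u ∨ lookup W (lookup c u)
 pre-lookup c W u = Vec.lookup∘tabulate _ u

 push⁻ : ∀ (c : Round n) I w → lookup (push c I) w ≡ true →
  lookup I w ≡ true ⊎ ∃[ u ] (lookup I u ≡ true × lookup c u ≡ w)
 push⁻ c I w h with does-true ((w ∈? I) ⊎-dec Fin.any? (λ u → (u ∈? I) ×-dec (lookup c u Fin.≟ w)))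
            (trans (sym (isYes≗does _)) (trans (sym (Vec.lookup∘tabulate _ w)) h))
 ... | inj₁ w∈I = inj₁ (Vec.[]=⇒lookup w∈I)
 ... | inj₂ (u , u∈I , e) = inj₂ (u , Vec.[]=⇒lookup u∈I , e)

 push⁺ : ∀ (c : Round n) I w → lookup I w ≡ true ⊎ ∃[ u ] (lookup I u ≡ true × lookup c u ≡ w) →
  lookup (push c I) w ≡ true
 push⁺ c I w h = trans (Vec.lookup∘tabulate _ w) (trans (isYes≗does _)
  (true-does ((w ∈? I) ⊎-dec Fin.any? (λ u → (u ∈? I) ×-dec (lookup c u Fin.≟ w))) (to h)))
  where
  to : _ → _
  to (inj₁ e) = inj₁ (Vec.lookup⇒[]= w I e)
  to (inj₂ (u , e , e′)) = inj₂ (u , Vec.lookup⇒[]= u I e , e′)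

 push-old : ∀ (c : Round n) I {w} → lookup I w ≡ true → lookup (push c I) w ≡ true
 push-old c I h = push⁺ c I _ (inj₁ h)

 push-new : ∀ (c : Round n) I {u} → lookup I u ≡ true → lookup (push c I) (lookup c u) ≡ true
 push-new c I h = push⁺ c I _ (inj₂ (_ , h , refl))

 pre-old : ∀ (c : Round n) W {u} → lookup W u ≡ true → lookup (pre c W) u ≡ true
 pre-old c W {u} h = trans (pre-lookup c W u) (∨-trueˡ h)

 subset-ext : {X Y : Subset n} → (∀ x → lookup X x ≡ lookup Y x) → X ≡ Y
 subset-ext {X = X} {Y} h = trans (sym (Vec.tabulate∘lookup X)) (trans (Vec.tabulate-cong h) (Vec.tabulate∘lookup Y))

 bool-ext : ∀ {a b} → (a ≡ true → b ≡ true) → (b ≡ true → a ≡ true) → a ≡ b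
 bool-ext {true} {b} f g = sym (f refl)
 bool-ext {false} {true} f g = g refl
 bool-ext {false} {false} f g = refl

 Disjoint : Subset n → Subset n → Set
 Disjoint X Y = ∀ x → lookup X x ≡ true → lookup Y x ≡ false

 disjoint? : (X Y : Subset n) → Dec (Disjoint X Y)
 disjoint? X Y = Fin.all? λ x → impl (lookup X x) (lookup Y x)
  where
  impl : ∀ a b → Dec (a ≡ true → b ≡ false)
  impl false _ = yes λ ()
  impl true false = yes λ _ → refl
  impl true true = no λ h → true≢false refl (h refl)

 disj : Subset n → Subset n → Bool
 disj X Y = does (disjoint? X Y)

 pre-push : ∀ (c : Round n) W I → Disjoint W (push c I) → Disjoint (pre c W) I
 pre-push c W I h u e with ∨-true⁻ (trans (sym (pre-lookup c W u)) e) | bool-cases (lookup I u)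
 ... | _ | inj₂ f = f
 ... | inj₁ a | inj₁ f = true≢false (push-old c I f) (h u a)
 ... | inj₂ a | inj₁ f = true≢false (push-new c I f) (h (lookup c u) a)

 -- Of time reversal only this direction is needed: an uninformed target forces its whole backward
 -- set to be uninformed earlier. Histories list the latest round first, so `as` are the later
 -- rounds and `back` undoes them from the head.
 back-informed : ∀ {s} v (as : History n s) (cs : History n t) W →
  Disjoint W (informed v (as Vec.++ cs)) → Disjoint (back as W) (informed v cs)
 back-informed v [] cs W h = h
 back-informed v (a ∷ as) cs W h = back-informed v as cs (pre a W) (pre-push a W (informed v (as Vec.++ cs)) h)

 open Rationals

 ∏ : (Fin k → ℚ) → ℚ
 ∏ {zero} f = 1ℚ
 ∏ {suc k} f = f zero * ∏ (f ∘ suc)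

 ∏-nonNeg : {f : Fin k → ℚ} → (∀ i → 0ℚ ≤ f i) → 0ℚ ≤ ∏ f
 ∏-nonNeg {zero} h = 0≤1
 ∏-nonNeg {suc k} h = *-nonNeg (h zero) (∏-nonNeg (h ∘ suc))

 ∏-mono : {f g : Fin k → ℚ} → (∀ i → 0ℚ ≤ f i) → (∀ i → f i ≤ g i) → ∏ f ≤ ∏ g
 ∏-mono {zero} 0≤f h = ℚ.≤-refl
 ∏-mono {suc k} 0≤f h = *-mono (0≤f zero) (h zero) (∏-nonNeg (0≤f ∘ suc)) (∏-mono (0≤f ∘ suc) (h ∘ suc))

 ∏-cong : {f g : Fin k → ℚ} → (∀ i → f i ≡ g i) → ∏ f ≡ ∏ g
 ∏-cong {zero} h = refl
 ∏-cong {suc k} h = cong₂ _*_ (h zero) (∏-cong (h ∘ suc))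

 ∏-^ : ∀ x (e : Fin k → ℕ) → ∏ (λ i → x ^ e i) ≡ x ^ ∑ e
 ∏-^ {zero} x e = refl
 ∏-^ {suc k} x e = trans (cong (x ^ e zero *_) (∏-^ x (e ∘ suc))) (sym (^-+ x (e zero) (∑ (e ∘ suc))))

 module Expectation (d : ℕ) (1≤d : 1 ℕ.≤ d) where

  δ : ℚ
  δ = recip (ι d)

  0<δ : 0ℚ < δ
  0<δ = recip-pos (0<ι 1≤d)

  0≤δ : 0ℚ ≤ δ
  0≤δ = ℚ.<⇒≤ 0<δ

  δ*d : δ * ι d ≡ 1ℚ
  δ*d = recip-*ˡ (0<ι 1≤d)

  δ≤1 : δ ≤ 1ℚ
  δ≤1 = recip≤1 (1≤ι 1≤d)

  -- An expectation only when `∣ S ∣ ≡ d`, see `E₁-const`. With the factor `δ` instead of `1/∣ S ∣`,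
  -- linearity and the exchange of two such sums hold for arbitrary `S` without a degree condition.
  E₁ : Subset n → (Fin n → ℚ) → ℚ
  E₁ S g = δ * ∑ℚ (λ x → indicator (lookup S x) * g x)

  E₁-cong : ∀ (S : Subset n) {f g} → (∀ x → lookup S x ≡ true → f x ≡ g x) → E₁ S f ≡ E₁ S g
  E₁-cong S {f} {g} h = cong (δ *_) (∑ℚ-cong pt)
   where
   pt : ∀ x → indicator (lookup S x) * f x ≡ indicator (lookup S x) * g x
   pt x with lookup S x | h x
   ... | true | e = cong (1ℚ *_) (e refl)
   ... | false | _ = trans (ℚ.*-zeroˡ (f x)) (sym (ℚ.*-zeroˡ (g x)))

  E₁-mono : ∀ (S : Subset n) {f g} → (∀ x → lookup S x ≡ true → f x ≤ g x) → E₁ S f ≤ E₁ S g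
  E₁-mono S {f} {g} h = *-monoˡ δ 0≤δ (∑ℚ-mono pt)
   where
   pt : ∀ x → indicator (lookup S x) * f x ≤ indicator (lookup S x) * g x
   pt x with lookup S x | h x
   ... | true | e = *-monoˡ 1ℚ 0≤1 (e refl)
   ... | false | _ = ℚ.≤-reflexive (trans (ℚ.*-zeroˡ (f x)) (sym (ℚ.*-zeroˡ (g x))))

  E₁-+ : ∀ (S : Subset n) f g → E₁ S (λ x → f x + g x) ≡ E₁ S f + E₁ S g
  E₁-+ S f g = trans (cong (δ *_) (trans (∑ℚ-cong λ x → ℚ.*-distribˡ-+ (indicator (lookup S x)) (f x) (g x))
   (∑ℚ-+ (λ x → indicator (lookup S x) * f x) (λ x → indicator (lookup S x) * g x)))) (ℚ.*-distribˡ-+ δ _ _)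

  E₁-* : ∀ (S : Subset n) c f → E₁ S (λ x → c * f x) ≡ c * E₁ S f
  E₁-* S c f = trans (cong (δ *_) (trans
    (∑ℚ-cong λ x → solve 3 (λ i c f → i :* (c :* f) := c :* (i :* f)) refl (indicator (lookup S x)) c (f x))
    (sym (*-distribˡ-∑ℚ c (λ x → indicator (lookup S x) * f x)))))
   (solve 3 (λ d c s → d :* (c :* s) := c :* (d :* s)) refl δ c (∑ℚ (λ x → indicator (lookup S x) * f x)))

  E₁-const : ∀ (S : Subset n) → ∣ S ∣ ≡ d → ∀ c → E₁ S (λ _ → c) ≡ c
  E₁-const S h c = trans (cong (δ *_) (trans (sym (*-distribʳ-∑ℚ c (λ x → indicator (lookup S x))))
    (cong (_* c) (trans (∑ℚ-cong λ x → indicator≡ι (lookup S x))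
     (trans (sym (ι-∑ (λ x → 𝟙 (lookup S x)))) (cong ι (trans (sym (card≡∑ S)) h)))))))
   (trans (sym (ℚ.*-assoc δ (ι d) c)) (trans (cong (_* c) δ*d) (ℚ.*-identityˡ c)))

  E₁-swap : ∀ {m} (S : Subset n) (S′ : Subset m) (f : Fin n → Fin m → ℚ) →
   E₁ S (λ x → E₁ S′ (f x)) ≡ E₁ S′ (λ y → E₁ S (λ x → f x y))
  E₁-swap S S′ f = cong (δ *_) (trans
   (∑ℚ-cong λ x → trans (solve 3 (λ i d s → i :* (d :* s) := d :* (i :* s)) refl (indicator (lookup S x)) δ _)
    (cong (δ *_) (trans (*-distribˡ-∑ℚ (indicator (lookup S x)) (λ y → indicator (lookup S′ y) * f x y))
     (∑ℚ-cong λ y → solve 3 (λ i j f → i :* (j :* f) := j :* (i :* f)) refl (indicator (lookup S x)) (indicator (lookup S′ y)) (f x y)))))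
   (trans (sym (*-distribˡ-∑ℚ δ (λ x → ∑ℚ (λ y → indicator (lookup S′ y) * (indicator (lookup S x) * f x y)))))
    (trans (cong (δ *_) (∑ℚ-swap (λ x y → indicator (lookup S′ y) * (indicator (lookup S x) * f x y))))
     (trans (*-distribˡ-∑ℚ δ (λ y → ∑ℚ (λ x → indicator (lookup S′ y) * (indicator (lookup S x) * f x y))))
      (∑ℚ-cong λ y → trans (cong (δ *_) (sym (*-distribˡ-∑ℚ (indicator (lookup S′ y)) (λ x → indicator (lookup S x) * f x y))))
       (solve 3 (λ d i s → d :* (i :* s) := i :* (d :* s)) refl δ (indicator (lookup S′ y)) (∑ℚ (λ x → indicator (lookup S x) * f x y))))))))

  Ex : Vec (Subset n) k → (Vec (Fin n) k → ℚ) → ℚ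
  Ex [] f = f []
  Ex (S ∷ W) f = E₁ S (λ x → Ex W (λ c → f (x ∷ c)))

  Ex-cong : ∀ (W : Vec (Subset n) k) {f g} → (∀ c → Compatible W c → f c ≡ g c) → Ex W f ≡ Ex W g
  Ex-cong [] h = h [] λ ()
  Ex-cong (S ∷ W) h = E₁-cong S λ x e → Ex-cong W λ c comp → h (x ∷ c) λ { zero → e ; (suc u) → comp u }

  Ex-mono : ∀ (W : Vec (Subset n) k) {f g} → (∀ c → Compatible W c → f c ≤ g c) → Ex W f ≤ Ex W g
  Ex-mono [] h = h [] λ ()
  Ex-mono (S ∷ W) h = E₁-mono S λ x e → Ex-mono W λ c comp → h (x ∷ c) λ { zero → e ; (suc u) → comp u }

  Ex-+ : ∀ (W : Vec (Subset n) k) f g → Ex W (λ c → f c + g c) ≡ Ex W f + Ex W g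
  Ex-+ [] f g = refl
  Ex-+ (S ∷ W) f g = trans (E₁-cong S λ x _ → Ex-+ W (f ∘ (x ∷_)) (g ∘ (x ∷_))) (E₁-+ S _ _)

  Ex-* : ∀ (W : Vec (Subset n) k) a f → Ex W (λ c → a * f c) ≡ a * Ex W f
  Ex-* [] a f = refl
  Ex-* (S ∷ W) a f = trans (E₁-cong S λ x _ → Ex-* W a (f ∘ (x ∷_))) (E₁-* S a _)

  Degrees : Vec (Subset n) k → Set
  Degrees W = ∀ u → ∣ lookup W u ∣ ≡ d

  Ex-const : ∀ (W : Vec (Subset n) k) → Degrees W → ∀ a → Ex W (λ _ → a) ≡ a
  Ex-const [] h a = refl
  Ex-const (S ∷ W) h a = trans (E₁-cong S λ x _ → Ex-const W (h ∘ suc) a) (E₁-const S (h zero) a)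

  E₁-Ex-swap : ∀ {m} (S : Subset m) (W : Vec (Subset n) k) (f : Fin m → Vec (Fin n) k → ℚ) →
   E₁ S (λ x → Ex W (f x)) ≡ Ex W (λ c → E₁ S (λ x → f x c))
  E₁-Ex-swap S [] f = refl
  E₁-Ex-swap S (S′ ∷ W) f = trans (E₁-swap S S′ _) (E₁-cong S′ λ y _ → E₁-Ex-swap S W λ x c → f x (y ∷ c))

  Ex-swap : ∀ {m l} (V : Vec (Subset m) l) (W : Vec (Subset n) k) (f : Vec (Fin m) l → Vec (Fin n) k → ℚ) →
   Ex V (λ b → Ex W (f b)) ≡ Ex W (λ c → Ex V (λ b → f b c))
  Ex-swap [] W f = refl
  Ex-swap (S ∷ V) W f = trans (E₁-cong S λ x _ → Ex-swap V W λ b → f (x ∷ b)) (E₁-Ex-swap S W (λ x c → Ex V (λ b → f (x ∷ b) c)))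

  Ex-∏ : ∀ (W : Vec (Subset n) k) (f : Fin k → Fin n → ℚ) →
   Ex W (λ c → ∏ (λ u → f u (lookup c u))) ≡ ∏ (λ u → E₁ (lookup W u) (f u))
  Ex-∏ [] f = refl
  Ex-∏ (S ∷ W) f = trans (E₁-cong S λ x _ → trans (Ex-* W (f zero x) (λ c → ∏ (λ u → f (suc u) (lookup c u))))
    (trans (ℚ.*-comm (f zero x) _) (cong (_* f zero x) (Ex-∏ W (f ∘ suc)))))
   (trans (E₁-* S (∏ (λ u → E₁ (lookup W u) (f (suc u)))) (f zero)) (ℚ.*-comm _ (E₁ S (f zero))))

  neighbourList : Subset n → List (Fin n)
  neighbourList S = filter (_∈? S) (allFin _)

  ∈?-lookup : (S : Subset n) (x : Fin n) → does (x ∈? S) ≡ lookup S x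
  ∈?-lookup S x = bool-ext (λ h → Vec.[]=⇒lookup (does-true (x ∈? S) h)) (λ h → true-does (x ∈? S) (Vec.lookup⇒[]= x S h))

  Σ-neighbours : (S : Subset n) (f : Fin n → ℚ) → Σ f (neighbourList S) ≡ ∑ℚ (λ x → indicator (lookup S x) * f x)
  Σ-neighbours S f = trans (Σ-filter (_∈? S) f (allFin _)) (trans (Σ-tabulate (λ x → indicator (does (x ∈? S)) * f x) id)
   (∑ℚ-cong λ x → cong (λ b → indicator b * f x) (∈?-lookup S x)))

  length-neighbours : (S : Subset n) → length (neighbourList S) ≡ ∣ S ∣
  length-neighbours S = ℕ.≤-antisym (ι-cancel-≤ (ℚ.≤-reflexive eq)) (ι-cancel-≤ (ℚ.≤-reflexive (sym eq)))
   where
   eq : ι (length (neighbourList S)) ≡ ι ∣ S ∣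
   eq = trans (sym (trans (Σ-const 1ℚ (neighbourList S)) (ℚ.*-identityʳ _)))
    (trans (Σ-neighbours S (λ _ → 1ℚ))
     (trans (∑ℚ-cong λ x → trans (ℚ.*-identityʳ _) (indicator≡ι (lookup S x)))
      (trans (sym (ι-∑ (λ x → 𝟙 (lookup S x)))) (cong ι (sym (card≡∑ S))))))

  average-neighbours : (S : Subset n) → ∣ S ∣ ≡ d → (f : Fin n → ℚ) → average f (neighbourList S) ≡ E₁ S f
  average-neighbours S h f = trans (average≡ f (neighbourList S) (subst (1 ℕ.≤_) (sym len) 1≤d))
   (trans (cong₂ _*_ (Σ-neighbours S f) (cong (recip ∘ ι) len)) (ℚ.*-comm _ δ))
   where
   len : length (neighbourList S) ≡ d
   len = trans (length-neighbours S) h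

  average-product : (W : Vec (Subset n) k) → Degrees W → (f : Vec (Fin n) k → ℚ) →
   average f (product (Vec.tabulate (λ u → neighbourList (lookup W u)))) ≡ Ex W f
  average-product [] h f = trans (cong (_* (ℤ.+ 1 ℚ./ 1)) (ℚ.+-identityʳ (f []))) (ℚ.*-identityʳ (f []))
  average-product (S ∷ W) h f = trans (average-cartesian f _∷_ (neighbourList S) _)
   (trans (average-cong (λ x → average-product W (h ∘ suc) (f ∘ (x ∷_))) (neighbourList S))
    (average-neighbours S (h zero) _))

  EH : Graph n → ∀ t → (History n t → ℚ) → ℚ
  EH G zero f = f []
  EH G (suc t) f = Ex G (λ c → EH G t (λ cs → f (c ∷ cs)))

  average-histories : (G : Graph n) → Degrees G → ∀ t (f : History n t → ℚ) →
   average f (histories G t) ≡ EH G t f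
  average-histories G h zero f = trans (cong (_* (ℤ.+ 1 ℚ./ 1)) (ℚ.+-identityʳ (f []))) (ℚ.*-identityʳ (f []))
  average-histories G h (suc t) f = trans (average-cartesian f _∷_ (rounds G) _)
   (trans (average-cong (λ c → average-histories G h t (f ∘ (c ∷_))) (rounds G))
    (average-product G h _))

  EH-mono : (G : Graph n) → ∀ t {f g} → (∀ cs → f cs ≤ g cs) → EH G t f ≤ EH G t g
  EH-mono G zero h = h []
  EH-mono G (suc t) h = Ex-mono G λ c _ → EH-mono G t λ cs → h (c ∷ cs)

  EH-cong : (G : Graph n) → ∀ t {f g} → (∀ cs → f cs ≡ g cs) → EH G t f ≡ EH G t g
  EH-cong G zero h = h []
  EH-cong G (suc t) h = Ex-cong G λ c _ → EH-cong G t λ cs → h (c ∷ cs)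

  EH-+ : (G : Graph n) → ∀ t f g → EH G t (λ cs → f cs + g cs) ≡ EH G t f + EH G t g
  EH-+ G zero f g = refl
  EH-+ G (suc t) f g = trans (Ex-cong G λ c _ → EH-+ G t (f ∘ (c ∷_)) (g ∘ (c ∷_))) (Ex-+ G _ _)

  EH-* : (G : Graph n) → ∀ t a f → EH G t (λ cs → a * f cs) ≡ a * EH G t f
  EH-* G zero a f = refl
  EH-* G (suc t) a f = trans (Ex-cong G λ c _ → EH-* G t a (f ∘ (c ∷_))) (Ex-* G a _)

  EH-const : (G : Graph n) → Degrees G → ∀ t a → EH G t (λ _ → a) ≡ a
  EH-const G h zero a = refl
  EH-const G h (suc t) a = trans (Ex-cong G λ c _ → EH-const G h t a) (Ex-const G h a)

  EH-∑ : (G : Graph n) → Degrees G → ∀ t {m} (f : Fin m → History n t → ℚ) →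
   EH G t (λ cs → ∑ℚ (λ i → f i cs)) ≡ ∑ℚ (λ i → EH G t (f i))
  EH-∑ G h t {zero} f = EH-const G h t 0ℚ
  EH-∑ G h t {suc m} f = trans (EH-+ G t (f zero) (λ cs → ∑ℚ (λ i → f (suc i) cs)))
   (cong (EH G t (f zero) +_) (EH-∑ G h t (f ∘ suc)))

  Ex-EH-swap : (G : Graph n) (W : Vec (Subset n) k) → ∀ t (f : Vec (Fin n) k → History n t → ℚ) →
   Ex W (λ c → EH G t (f c)) ≡ EH G t (λ cs → Ex W (λ c → f c cs))
  Ex-EH-swap G W zero f = refl
  Ex-EH-swap G W (suc t) f = trans (Ex-swap W G _) (Ex-cong G λ b _ → Ex-EH-swap G W t (λ c cs → f c (b ∷ cs)))

  EH-swap : (G : Graph n) → ∀ s t (f : History n s → History n t → ℚ) →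
   EH G s (λ as → EH G t (f as)) ≡ EH G t (λ cs → EH G s (λ as → f as cs))
  EH-swap G zero t f = refl
  EH-swap G (suc s) t f = trans (Ex-cong G λ c _ → EH-swap G s t (λ as → f (c ∷ as))) (Ex-EH-swap G G t (λ c cs → EH G s (λ as → f (c ∷ as) cs)))

  EH-++ : (G : Graph n) → ∀ s t (f : History n (s ℕ.+ t) → ℚ) →
   EH G (s ℕ.+ t) f ≡ EH G s (λ as → EH G t (λ cs → f (as Vec.++ cs)))
  EH-++ G zero t f = refl
  EH-++ G (suc s) t f = Ex-cong G λ c _ → EH-++ G s t (f ∘ (c ∷_))

  -- The transition operator of a Markov chain on subsets. With `next` as a parameter, the forward
  -- process (`push`) and the backward one (`pre`) share the estimates on growth and first passage.
  module Kernel (G : Graph n) (next : Round n → Subset n → Subset n) where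

   K : (Subset n → ℚ) → Subset n → ℚ
   K f X = Ex G (λ c → f (next c X))

   Kᵗ : ℕ → (Subset n → ℚ) → Subset n → ℚ
   Kᵗ zero f X = f X
   Kᵗ (suc t) f X = K (Kᵗ t f) X

   Kᵗ-mono : ∀ t {f g} → (∀ X → f X ≤ g X) → ∀ X → Kᵗ t f X ≤ Kᵗ t g X
   Kᵗ-mono zero h X = h X
   Kᵗ-mono (suc t) h X = Ex-mono G λ c _ → Kᵗ-mono t h (next c X)

   Kᵗ-cong : ∀ t {f g} → (∀ X → f X ≡ g X) → ∀ X → Kᵗ t f X ≡ Kᵗ t g X
   Kᵗ-cong zero h X = h X
   Kᵗ-cong (suc t) h X = Ex-cong G λ c _ → Kᵗ-cong t h (next c X)

   Kᵗ-+ : ∀ t f g X → Kᵗ t (λ Y → f Y + g Y) X ≡ Kᵗ t f X + Kᵗ t g X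
   Kᵗ-+ zero f g X = refl
   Kᵗ-+ (suc t) f g X = trans (Ex-cong G λ c _ → Kᵗ-+ t f g (next c X)) (Ex-+ G _ _)

   Kᵗ-* : ∀ t a f X → Kᵗ t (λ Y → a * f Y) X ≡ a * Kᵗ t f X
   Kᵗ-* zero a f X = refl
   Kᵗ-* (suc t) a f X = trans (Ex-cong G λ c _ → Kᵗ-* t a f (next c X)) (Ex-* G a _)

   Kᵗ-const : Degrees G → ∀ t a X → Kᵗ t (λ _ → a) X ≡ a
   Kᵗ-const h zero a X = refl
   Kᵗ-const h (suc t) a X = trans (Ex-cong G λ c _ → Kᵗ-const h t a (next c X)) (Ex-const G h a)

   Kᵗ-0 : ∀ t X → Kᵗ t (λ _ → 0ℚ) X ≡ 0ℚ
   Kᵗ-0 t X = trans (Kᵗ-cong t (λ _ → sym (ℚ.*-zeroˡ 0ℚ)) X) (trans (Kᵗ-* t 0ℚ (λ _ → 0ℚ) X) (ℚ.*-zeroˡ (Kᵗ t (λ _ → 0ℚ) X)))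

   Kᵗ-nonNeg : ∀ t {f} → (∀ X → 0ℚ ≤ f X) → ∀ X → 0ℚ ≤ Kᵗ t f X
   Kᵗ-nonNeg t {f} h X = subst (_≤ Kᵗ t f X) (Kᵗ-0 t X) (Kᵗ-mono t h X)

   Kᵗ-∘ : ∀ s t f X → Kᵗ (s ℕ.+ t) f X ≡ Kᵗ s (Kᵗ t f) X
   Kᵗ-∘ zero t f X = refl
   Kᵗ-∘ (suc s) t f X = Ex-cong G λ c _ → Kᵗ-∘ s t f (next c X)

   Kᵗ-suc : ∀ t f X → Kᵗ (suc t) f X ≡ Kᵗ t (K f) X
   Kᵗ-suc zero f X = refl
   Kᵗ-suc (suc t) f X = Ex-cong G λ c _ → Kᵗ-suc t f (next c X)

   Ex-Kᵗ-swap : ∀ {m l} (W : Vec (Subset m) l) t (f : Vec (Fin m) l → Subset n → ℚ) X → Ex W (λ c → Kᵗ t (f c) X) ≡ Kᵗ t (λ Y → Ex W (λ c → f c Y)) X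
   Ex-Kᵗ-swap W zero f X = refl
   Ex-Kᵗ-swap W (suc t) f X = trans (Ex-swap W G _) (Ex-cong G λ b _ → Ex-Kᵗ-swap W t f (next b X))

   Kᵗ-Σ : ∀ {A : Set} t (f : A → Subset n → ℚ) xs X → Kᵗ t (λ Y → Σ (λ a → f a Y) xs) X ≡ Σ (λ a → Kᵗ t (f a) X) xs
   Kᵗ-Σ t f [] X = Kᵗ-0 t X
   Kᵗ-Σ t f (a ∷ xs) X = trans (Kᵗ-+ t (f a) (λ Y → Σ (λ a → f a Y) xs) X) (cong (Kᵗ t (f a) X +_) (Kᵗ-Σ t f xs X))

  -- The latest round heads the history but acts last, so it has to be moved past the others and
  -- peeled off at the far end with `Kᵗ-suc`. Backwards in time the two orders agree, and `EH-back`
  -- is a plain induction.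
  EH-informed : (G : Graph n) → ∀ t v f → EH G t (λ cs → f (informed v cs)) ≡ Kernel.Kᵗ G push t f ⁅ v ⁆
  EH-informed G zero v f = refl
  EH-informed G (suc t) v f = trans (Ex-cong G λ c _ → EH-informed G t v (f ∘ push c))
   (trans (Ex-Kᵗ-swap G t (λ c → f ∘ push c) ⁅ v ⁆) (sym (Kᵗ-suc t f ⁅ v ⁆)))
   where open Kernel G push

  EH-back : (G : Graph n) → ∀ t W f → EH G t (λ cs → f (back cs W)) ≡ Kernel.Kᵗ G pre t f W
  EH-back G zero W f = refl
  EH-back G (suc t) W f = Ex-cong G λ c _ → EH-back G t (pre c W) f

open Processes

-- Degree counts in regular graphs and the change of a set in one round.

module GraphCounting where

 open import Data.Nat.Base using (_+_; _*_; _≤_; _<_; _∸_; z≤n; s≤s)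

 private variable
  n : ℕ

 adj : Graph n → Fin n → Fin n → Bool
 adj G u v = lookup (lookup G u) v

 χ : Subset n → Fin n → ℕ
 χ S x = 𝟙 (lookup S x)

 χᶜ : Subset n → Fin n → ℕ
 χᶜ S x = 𝟙 (not (lookup S x))

 χ+χᶜ : (S : Subset n) → ∀ x → χ S x + χᶜ S x ≡ 1
 χ+χᶜ S x = 𝟙-not (lookup S x)

 χ≤1 : (S : Subset n) → ∀ x → χ S x ≤ 1
 χ≤1 S x = 𝟙≤1 (lookup S x)

 𝟙-true : ∀ {b} → b ≡ true → 𝟙 b ≡ 1
 𝟙-true refl = refl

 𝟙-false : ∀ {b} → b ≡ false → 𝟙 b ≡ 0
 𝟙-false refl = refl

 𝟙-mono : ∀ {a b} → (a ≡ true → b ≡ true) → 𝟙 a ≤ 𝟙 b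
 𝟙-mono {true} h = ℕ.≤-reflexive (sym (𝟙-true (h refl)))
 𝟙-mono {false} h = z≤n

 card-mono : {X Y : Subset n} → (∀ x → lookup X x ≡ true → lookup Y x ≡ true) → ∣ X ∣ ≤ ∣ Y ∣
 card-mono {X = X} {Y} h = subst₂ _≤_ (sym (card≡∑ X)) (sym (card≡∑ Y)) (∑-mono λ x → 𝟙-mono (h x))

 lookup-singleton : (v x : Fin n) → lookup ⁅ v ⁆ x ≡ (v ≡ᵇ x)
 lookup-singleton zero zero = refl
 lookup-singleton zero (suc x) = Vec.lookup-replicate x false
 lookup-singleton (suc v) zero = refl
 lookup-singleton (suc v) (suc x) = trans (lookup-singleton v x) (lemma (v Fin.≟ x))
  where
  lemma : (d : Dec (v ≡ x)) → does d ≡ (suc v ≡ᵇ suc x)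
  lemma (yes refl) = sym (≡ᵇ-refl (suc v))
  lemma (no v≢x) = sym (≢⇒≡ᵇ λ e → v≢x (Fin.suc-injective e))

 card-singleton : (v : Fin n) → ∣ ⁅ v ⁆ ∣ ≡ 1
 card-singleton v = trans (card≡∑ ⁅ v ⁆) (trans (∑-cong λ x → cong 𝟙 (lookup-singleton v x)) (∑-δ₁ v))

 _∪ˢ_ : Subset n → Subset n → Subset n
 X ∪ˢ Y = Vec.tabulate λ x → lookup X x ∨ lookup Y x

 module _ (G : Graph n) where

  a : Fin n → Fin n → ℕ
  a u v = 𝟙 (adj G u v)

  degIn : Subset n → Fin n → ℕ
  degIn S u = ∑ (λ v → χ S v * a u v)

  -- Twice the number of edges inside S.
  e₂ : Subset n → ℕ
  e₂ S = ∑ (λ u → χ S u * degIn S u)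

  boundary : Subset n → ℕ
  boundary S = ∑ (λ u → χᶜ S u * degIn S u)

  -- Such a vertex has only one possible caller, so calls to it never collide and the newly informed
  -- vertices can be counted by calls.
  private? : Subset n → Fin n → Bool
  private? I w = not (lookup I w) ∧ does (degIn I w ℕ.≟ 1)

  privates : Subset n → ℕ
  privates I = ∑ (λ u → χ I u * ∑ (λ x → a u x * 𝟙 (private? I x)))

 module RegularGraph {d : ℕ} (G : Graph n) (reg : Regular d G) where

  adj-sym : ∀ u v → adj G u v ≡ adj G v u
  adj-sym u v = bool-ext (flip u v) (flip v u)
   where
   flip : ∀ u v → adj G u v ≡ true → adj G v u ≡ true
   flip u v h = Vec.[]=⇒lookup (proj₁ reg u v (Vec.lookup⇒[]= v (lookup G u) h))

  adj-irrefl : ∀ u → adj G u u ≡ false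
  adj-irrefl u with bool-cases (adj G u u)
  ... | inj₁ h = contradiction (Vec.lookup⇒[]= u (lookup G u) h) (proj₁ (proj₂ reg) u)
  ... | inj₂ h = h

  degrees : ∀ u → ∣ lookup G u ∣ ≡ d
  degrees = proj₂ (proj₂ reg)

  a-sym : ∀ u v → a G u v ≡ a G v u
  a-sym u v = cong 𝟙 (adj-sym u v)

  ∑a : ∀ u → ∑ (a G u) ≡ d
  ∑a u = trans (sym (card≡∑ (lookup G u))) (degrees u)

  ∑a′ : ∀ v → ∑ (λ u → a G u v) ≡ d
  ∑a′ v = trans (∑-cong λ u → a-sym u v) (∑a v)

  degIn≤d : ∀ S u → degIn G S u ≤ d
  degIn≤d S u = subst (degIn G S u ≤_) (∑a u)
   (∑-mono λ v → subst (χ S v * a G u v ≤_) (ℕ.*-identityˡ (a G u v)) (ℕ.*-monoˡ-≤ (a G u v) (χ≤1 S v)))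

  ∑degIn : ∀ (w : Fin n → ℕ) S → ∑ (λ u → w u * degIn G S u) ≡ ∑ (λ v → χ S v * ∑ (λ u → w u * a G u v))
  ∑degIn w S = trans (∑-cong λ u → *-distribˡ-∑ (w u) (λ v → χ S v * a G u v))
   (trans (∑-swap (λ u v → w u * (χ S v * a G u v)))
    (∑-cong λ v → trans (∑-cong λ u → reorder (w u) (χ S v) (a G u v)) (sym (*-distribˡ-∑ (χ S v) (λ u → w u * a G u v)))))
   where
   reorder : ∀ x y z → x * (y * z) ≡ y * (x * z)
   reorder = ℕ-solve-∀

  ∑degIn≡d∣S∣ : ∀ S → ∑ (degIn G S) ≡ d * ∣ S ∣
  ∑degIn≡d∣S∣ S = trans (∑-cong λ u → sym (ℕ.*-identityˡ (degIn G S u)))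
   (trans (∑degIn (λ _ → 1) S)
    (trans (∑-cong λ v → trans (cong (χ S v *_) (trans (∑-cong λ u → ℕ.*-identityˡ (a G u v)) (∑a′ v))) (ℕ.*-comm (χ S v) d))
     (trans (sym (*-distribˡ-∑ d (χ S))) (cong (d *_) (sym (card≡∑ S))))))

  e₂+boundary : ∀ S → e₂ G S + boundary G S ≡ d * ∣ S ∣
  e₂+boundary S = trans (sym (∑-+ (λ u → χ S u * degIn G S u) (λ u → χᶜ S u * degIn G S u)))
   (trans (∑-cong λ u → trans (sym (ℕ.*-distribʳ-+ (degIn G S u) (χ S u) (χᶜ S u)))
     (trans (cong (_* degIn G S u) (χ+χᶜ S u)) (ℕ.*-identityˡ (degIn G S u))))
    (∑degIn≡d∣S∣ S))

  open ℕ.≤-Reasoning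

  -- Every edge between `X` and the added vertices occurs twice in `e₂`; the edges among the added
  -- vertices are dropped, whence the inequality. Through it, sparsity of an enlarged set limits how
  -- often boundary edges share an endpoint.
  e₂-union : ∀ X (f : Fin n → Bool) → (∀ u → f u ≡ true → lookup X u ≡ false) →
   let S = X ∪ˢ Vec.tabulate f in ∣ S ∣ ≡ ∣ X ∣ + ∑ (λ u → 𝟙 (f u)) × e₂ G X + 2 * ∑ (λ u → 𝟙 (f u) * degIn G X u) ≤ e₂ G S
  e₂-union X f h = trans (card≡∑ S) (trans (∑-cong χS) (trans (∑-+ (χ X) y) (cong (_+ ∑ y) (sym (card≡∑ X))))) , (begin
    e₂ G X + 2 * κ ≡⟨ cong (e₂ G X +_) (trans (cong (κ +_) (ℕ.+-identityʳ κ)) (cong (_+ κ) swapped)) ⟩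
    e₂ G X + (∑ (λ u → χ X u * ky u) + κ) ≡⟨ trans (cong (e₂ G X +_) (sym (∑-+ (λ u → χ X u * ky u) (λ u → y u * k u)))) (sym (∑-+ (λ u → χ X u * k u) (λ u → χ X u * ky u + y u * k u))) ⟩
    ∑ (λ u → χ X u * k u + (χ X u * ky u + y u * k u)) ≤⟨ ∑-mono (λ u → expand (χ X u) (y u) (k u) (ky u)) ⟩
    ∑ (λ u → (χ X u + y u) * (k u + ky u)) ≡⟨ ∑-cong (λ u → cong₂ _*_ (sym (χS u)) (sym (degS u))) ⟩
    e₂ G S ∎)
   where
   S = X ∪ˢ Vec.tabulate f
   y k ky : Fin n → ℕ
   y u = 𝟙 (f u)
   k = degIn G X
   ky u = ∑ (λ v → y v * a G u v)
   κ = ∑ (λ u → y u * k u)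
   χS : ∀ u → χ S u ≡ χ X u + y u
   χS u = trans (cong 𝟙 (trans (Vec.lookup∘tabulate _ u) (cong (lookup X u ∨_) (Vec.lookup∘tabulate f u)))) (or (lookup X u) (f u) (h u))
    where
    or : ∀ a b → (b ≡ true → a ≡ false) → 𝟙 (a ∨ b) ≡ 𝟙 a + 𝟙 b
    or true true h = true≢false refl (h refl)
    or true false h = refl
    or false b h = refl
   degS : ∀ u → degIn G S u ≡ k u + ky u
   degS u = trans (∑-cong λ v → trans (cong (_* a G u v) (χS v)) (ℕ.*-distribʳ-+ (a G u v) (χ X v) (y v))) (∑-+ (λ v → χ X v * a G u v) (λ v → y v * a G u v))
   swapped : κ ≡ ∑ (λ u → χ X u * ky u)
   swapped = trans (∑degIn y X) (∑-cong λ v → cong (χ X v *_) (∑-cong λ u → cong (y u *_) (a-sym u v)))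
   expand : ∀ i y k l → i * k + (i * l + y * k) ≤ (i + y) * (k + l)
   expand i y k l = ℕ.≤-trans (ℕ.m≤m+n _ (y * l)) (ℕ.≤-reflexive (ring i y k l))
    where
    ring : ∀ i y k l → i * k + (i * l + y * k) + y * l ≡ (i + y) * (k + l)
    ring = ℕ-solve-∀

  privates≡ : ∀ I → privates G I ≡ ∑ (λ x → 𝟙 (private? G I x) * degIn G I x)
  privates≡ I = sym (trans (∑degIn (λ x → 𝟙 (private? G I x)) I)
   (∑-cong λ u → cong (χ I u *_) (∑-cong λ x → trans (ℕ.*-comm (𝟙 (private? G I x)) (a G x u)) (cong (_* 𝟙 (private? G I x)) (a-sym x u)))))

  compatible-a : ∀ (c : Round n) → Compatible G c → ∀ u {v} → lookup c u ≡ v → a G u v ≡ 1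
  compatible-a c comp u refl = 𝟙-true (comp u)

  ∣pre∣≤ : ∀ c → Compatible G c → ∀ W → ∣ pre c W ∣ ≤ suc d * ∣ W ∣
  ∣pre∣≤ c comp W = subst₂ _≤_ (sym (card≡∑ (pre c W)))
   (trans (∑-+ (χ W) (degIn G W)) (cong₂ _+_ (sym (card≡∑ W)) (∑degIn≡d∣S∣ W)))
   (∑-mono pt)
   where
   reach : ∀ u → χ W (lookup c u) ≤ degIn G W u
   reach u = ℕ.≤-trans (ℕ.≤-reflexive (sym (trans (cong (χ W (lookup c u) *_) (compatible-a c comp u refl)) (ℕ.*-identityʳ _))))
    (term≤∑ (λ v → χ W v * a G u v) (lookup c u))
   pt : ∀ u → χ (pre c W) u ≤ χ W u + degIn G W u
   pt u = ℕ.≤-trans (ℕ.≤-trans (ℕ.≤-reflexive (cong 𝟙 (pre-lookup c W u))) (or (lookup W u) (lookup W (lookup c u))))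
    (ℕ.+-monoʳ-≤ (χ W u) (reach u))
    where
    or : ∀ x y → 𝟙 (x ∨ y) ≤ 𝟙 x + 𝟙 y
    or true y = s≤s z≤n
    or false y = ℕ.≤-refl

  ∣push∣≤ : ∀ (c : Round n) I → ∣ push c I ∣ ≤ ∣ I ∣ + ∑ (λ u → χ I u * χᶜ I (lookup c u))
  ∣push∣≤ c I = subst₂ _≤_ (sym (card≡∑ (push c I)))
   (trans (∑-+ (χ I) new) (cong₂ _+_ (sym (card≡∑ I)) swap)) (∑-mono pt)
   where
   new : Fin n → ℕ
   new w = ∑ (λ u → χ I u * (𝟙 (lookup c u ≡ᵇ w) * χᶜ I w))
   swap : ∑ new ≡ ∑ (λ u → χ I u * χᶜ I (lookup c u))
   swap = trans (∑-swap (λ w u → χ I u * (𝟙 (lookup c u ≡ᵇ w) * χᶜ I w)))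
    (∑-cong λ u → trans (sym (*-distribˡ-∑ (χ I u) (λ w → 𝟙 (lookup c u ≡ᵇ w) * χᶜ I w)))
     (cong (χ I u *_) (∑-δ (lookup c u) (χᶜ I))))
   pt : ∀ w → χ (push c I) w ≤ χ I w + new w
   pt w with bool-cases (lookup (push c I) w) | bool-cases (lookup I w)
   ... | inj₂ e | _ = subst (_≤ χ I w + new w) (sym (𝟙-false e)) z≤n
   ... | inj₁ e | inj₁ w∈I = ℕ.≤-trans (𝟙≤1 (lookup (push c I) w)) (ℕ.≤-trans (ℕ.≤-reflexive (sym (𝟙-true w∈I))) (ℕ.m≤m+n _ _))
   ... | inj₁ e | inj₂ w∉I with push⁻ c I w e
   ... | inj₁ w∈I = true≢false w∈I w∉I
   ... | inj₂ (u , u∈I , refl) = ℕ.≤-trans (𝟙≤1 (lookup (push c I) w)) (ℕ.≤-trans (ℕ.≤-trans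
     (ℕ.≤-reflexive (sym (cong₂ _*_ (𝟙-true u∈I) (cong₂ _*_ (𝟙-true (≡ᵇ-refl w)) (𝟙-true (cong not w∉I))))))
     (term≤∑ (λ u → χ I u * (𝟙 (lookup c u ≡ᵇ w) * χᶜ I w)) u)) (ℕ.m≤n+m _ (χ I w)))

  ∣push∣≤2 : ∀ (c : Round n) I → ∣ push c I ∣ ≤ ∣ I ∣ + ∣ I ∣
  ∣push∣≤2 c I = ℕ.≤-trans (∣push∣≤ c I) (ℕ.+-monoʳ-≤ ∣ I ∣ (subst (∑ (λ u → χ I u * χᶜ I (lookup c u)) ≤_) (sym (card≡∑ I))
   (∑-mono λ u → subst (χ I u * χᶜ I (lookup c u) ≤_) (ℕ.*-identityʳ (χ I u)) (ℕ.*-monoʳ-≤ (χ I u) (𝟙≤1 _)))))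

  private⁻ : ∀ I w → private? G I w ≡ true → lookup I w ≡ false × degIn G I w ≡ 1
  private⁻ I w h with lookup I w
  ... | false = refl , does-true (degIn G I w ℕ.≟ 1) h

  -- Distinct informed vertices calling private neighbours inform distinct vertices.
  ∣push∣≥ : ∀ c → Compatible G c → ∀ I → ∑ (λ u → χ I u + χ I u * 𝟙 (private? G I (lookup c u))) ≤ ∣ push c I ∣
  ∣push∣≥ c comp I = subst₂ _≤_
   (trans (∑-+ (χ I) new) (trans (cong (∑ (χ I) +_) swap) (sym (∑-+ (χ I) _)))) (sym (card≡∑ (push c I))) (∑-mono pt)
   where
   p : Fin n → ℕ
   p w = 𝟙 (private? G I w)
   hits : Fin n → ℕ
   hits w = ∑ (λ u → χ I u * 𝟙 (lookup c u ≡ᵇ w))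
   new : Fin n → ℕ
   new w = p w * hits w
   swap : ∑ new ≡ ∑ (λ u → χ I u * p (lookup c u))
   swap = trans (∑-cong λ w → *-distribˡ-∑ (p w) (λ u → χ I u * 𝟙 (lookup c u ≡ᵇ w)))
    (trans (∑-swap (λ w u → p w * (χ I u * 𝟙 (lookup c u ≡ᵇ w))))
     (∑-cong λ u → trans (∑-cong λ w → reorder (p w) (χ I u) (𝟙 (lookup c u ≡ᵇ w)))
      (trans (sym (*-distribˡ-∑ (χ I u) (λ w → 𝟙 (lookup c u ≡ᵇ w) * p w))) (cong (χ I u *_) (∑-δ (lookup c u) p)))))
    where
    reorder : ∀ x y z → x * (y * z) ≡ y * (z * x)
    reorder = ℕ-solve-∀
   hits≤ : ∀ w → hits w ≤ degIn G I w
   hits≤ w = ∑-mono λ u → ℕ.*-monoʳ-≤ (χ I u) (𝟙-mono λ e → trans (adj-sym w u)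
    (subst (λ v → adj G u v ≡ true) (≡ᵇ⇒≡ e) (comp u)))
   pt : ∀ w → χ I w + new w ≤ χ (push c I) w
   pt w with bool-cases (private? G I w)
   ... | inj₂ np = subst (_≤ χ (push c I) w) (sym (trans (cong (λ q → χ I w + q * hits w) (𝟙-false np)) (ℕ.+-identityʳ (χ I w))))
    (𝟙-mono (push-old c I))
   ... | inj₁ pr with private⁻ I w pr | bool-cases (lookup (push c I) w)
   ... | w∉I , e | inj₁ h = subst₂ _≤_ (sym (cong₂ _+_ (𝟙-false w∉I) (trans (cong (_* hits w) (𝟙-true pr)) (ℕ.*-identityˡ (hits w)))))
    (sym (𝟙-true h)) (subst (hits w ≤_) e (hits≤ w))
   ... | w∉I , e | inj₂ h = subst (_≤ χ (push c I) w) (sym (cong₂ _+_ (𝟙-false w∉I)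
     (trans (cong (p w *_) (∑-zero (λ u → χ I u * 𝟙 (lookup c u ≡ᵇ w)) none)) (ℕ.*-zeroʳ (p w))))) z≤n
    where
    none : ∀ u → χ I u * 𝟙 (lookup c u ≡ᵇ w) ≡ 0
    none u with lookup I u in u∈I | lookup c u Fin.≟ w
    ... | false | _ = refl
    ... | true | no _ = refl
    ... | true | yes refl = true≢false (push-new c I u∈I) h

 mkRegular : ∀ {d} (G : Graph n) → (∀ u v → adj G u v ≡ true → adj G v u ≡ true) →
  (∀ u → adj G u u ≡ false) → (∀ u → ∣ lookup G u ∣ ≡ d) → Regular d G
 mkRegular G s i r = (λ u v h → Vec.lookup⇒[]= u (lookup G v) (s u v (Vec.[]=⇒lookup h))) ,
  (λ u h → true≢false (Vec.[]=⇒lookup h) (i u)) , r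

open GraphCounting

-- Generating functions for one round and the growth rate in the variable `ω`.

module Growth where

 open Rationals

 private variable
  n k : ℕ

 ^-𝟙 : ∀ z b → z ^ 𝟙 b ≡ 1ℚ + (z - 1ℚ) * ι (𝟙 b)
 ^-𝟙 z true = trans (*-identityʳ z) (trans (solve 1 (λ z → z := con 1ℚ :+ (z :- con 1ℚ) :* con 1ℚ) refl z)
  (cong (λ u → 1ℚ + (z - 1ℚ) * u) (sym ι-1)))
 ^-𝟙 z false = sym (trans (cong (λ u → 1ℚ + (z - 1ℚ) * u) ι-0) (solve 1 (λ z → con 1ℚ :+ (z :- con 1ℚ) :* con 0ℚ := con 1ℚ) refl z))

 module OneRound (d : ℕ) (1≤d : 1 ℕ.≤ d) where

  open Expectation d 1≤d

  -- The probability generating function of a Bernoulli(1/d) variable.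
  pgf : ℚ → ℚ
  pgf z = 1ℚ - (1ℚ - z) * δ

  module _ {z : ℚ} (0≤z : 0ℚ ≤ z) (z≤1 : z ≤ 1ℚ) where

   0≤[1-z]δ : 0ℚ ≤ (1ℚ - z) * δ
   0≤[1-z]δ = *-nonNeg (p≤q⇒0≤q-p z≤1) 0≤δ

   [1-z]δ≤1 : (1ℚ - z) * δ ≤ 1ℚ
   [1-z]δ≤1 = ≤-trans (*-mono (p≤q⇒0≤q-p z≤1)
    (≤-by z 0≤z (solve 1 (λ z → con 1ℚ :- z :+ z := con 1ℚ) refl z)) 0≤δ δ≤1) ≤-refl

   0≤pgf : 0ℚ ≤ pgf z
   0≤pgf = p≤q⇒0≤q-p [1-z]δ≤1

   pgf≤1 : pgf z ≤ 1ℚ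
   pgf≤1 = ≤-by ((1ℚ - z) * δ) 0≤[1-z]δ (solve 1 (λ x → con 1ℚ :- x :+ x := con 1ℚ) refl ((1ℚ - z) * δ))

   E₁-hit≡ : ∀ (S : Subset n) → ∣ S ∣ ≡ d → ∀ (H : Fin n → Bool) →
    E₁ S (λ x → z ^ 𝟙 (H x)) ≡ 1ℚ - ι (∑ (λ x → χ S x ℕ.* 𝟙 (H x))) * ((1ℚ - z) * δ)
   E₁-hit≡ S h H = trans (E₁-cong S λ x _ → ^-𝟙 z (H x))
    (trans (E₁-+ S (λ _ → 1ℚ) (λ x → (z - 1ℚ) * ι (𝟙 (H x))))
     (trans (cong₂ _+_ (E₁-const S h 1ℚ) (trans (E₁-* S (z - 1ℚ) (λ x → ι (𝟙 (H x)))) (cong ((z - 1ℚ) *_) inner)))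
      (solve 3 (λ z d m → con 1ℚ :+ (z :- con 1ℚ) :* (d :* m) := con 1ℚ :- m :* ((con 1ℚ :- z) :* d)) refl z δ (ι m))))
    where
    m = ∑ (λ x → χ S x ℕ.* 𝟙 (H x))
    inner : E₁ S (λ x → ι (𝟙 (H x))) ≡ δ * ι m
    inner = cong (δ *_) (trans (∑ℚ-cong λ x → trans (cong (_* ι (𝟙 (H x))) (indicator≡ι (lookup S x))) (sym (ι-* (χ S x) (𝟙 (H x)))))
     (sym (ι-∑ (λ x → χ S x ℕ.* 𝟙 (H x)))))

   -- A call hits one of `m` targets among `d` neighbours with probability `m/d`. Bernoulli's
   -- inequality replaces this by `m` independent chances of `1/d`, so that products over the
   -- callers depend only on the total number of edges.
   E₁-hit : ∀ (S : Subset n) → ∣ S ∣ ≡ d → ∀ (H : Fin n → Bool) →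
    E₁ S (λ x → z ^ 𝟙 (H x)) ≤ pgf z ^ ∑ (λ x → χ S x ℕ.* 𝟙 (H x))
   E₁-hit S h H = ≤-trans (≤-reflexive (E₁-hit≡ S h H)) (bernoulli⁻ ((1ℚ - z) * δ) 0≤[1-z]δ [1-z]δ≤1 (∑ (λ x → χ S x ℕ.* 𝟙 (H x))))

   Ex-hit : ∀ (W : Vec (Subset n) k) → Degrees W → ∀ (α : Fin k → ℕ) (β : Fin k → Bool) (H : Fin n → Bool) →
    Ex W (λ c → z ^ ∑ (λ u → α u ℕ.+ 𝟙 (β u) ℕ.* 𝟙 (H (lookup c u)))) ≤
    z ^ ∑ α * pgf z ^ ∑ (λ u → 𝟙 (β u) ℕ.* ∑ (λ x → χ (lookup W u) x ℕ.* 𝟙 (H x)))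
   Ex-hit W deg α β H = ≤-trans
    (≤-reflexive (trans (Ex-cong W λ c _ → sym (∏-^ z (λ u → α u ℕ.+ 𝟙 (β u) ℕ.* 𝟙 (H (lookup c u)))))
     (Ex-∏ W (λ u x → z ^ (α u ℕ.+ 𝟙 (β u) ℕ.* 𝟙 (H x))))))
    (≤-trans (∏-mono (λ u → ≤-trans (≤-reflexive (sym (E₁-const (lookup W u) (deg u) 0ℚ)))
       (E₁-mono (lookup W u) λ x _ → ^-nonNeg 0≤z (α u ℕ.+ 𝟙 (β u) ℕ.* 𝟙 (H x)))) bound)
     (≤-reflexive (trans (∏-* (λ u → z ^ α u) (λ u → pgf z ^ (𝟙 (β u) ℕ.* m u)))
      (cong₂ _*_ (∏-^ z α) (∏-^ (pgf z) (λ u → 𝟙 (β u) ℕ.* m u))))))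
    where
    m = λ u → ∑ (λ x → χ (lookup W u) x ℕ.* 𝟙 (H x))
    ∏-* : ∀ {k} (f g : Fin k → ℚ) → ∏ (λ i → f i * g i) ≡ ∏ f * ∏ g
    ∏-* {zero} f g = refl
    ∏-* {suc k} f g = trans (cong (f zero * g zero *_) (∏-* (f ∘ suc) (g ∘ suc)))
     (solve 4 (λ a b c d → a :* b :* (c :* d) := a :* c :* (b :* d)) refl (f zero) (g zero) (∏ (f ∘ suc)) (∏ (g ∘ suc)))
    bound : ∀ u → E₁ (lookup W u) (λ x → z ^ (α u ℕ.+ 𝟙 (β u) ℕ.* 𝟙 (H x))) ≤ z ^ α u * pgf z ^ (𝟙 (β u) ℕ.* m u)
    bound u = ≤-trans (≤-reflexive (trans (E₁-cong (lookup W u) λ x _ → ^-+ z (α u) (𝟙 (β u) ℕ.* 𝟙 (H x)))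
       (E₁-* (lookup W u) (z ^ α u) (λ x → z ^ (𝟙 (β u) ℕ.* 𝟙 (H x))))))
      (*-monoˡ (z ^ α u) (^-nonNeg 0≤z (α u)) (go (β u)))
     where
     go : ∀ b → E₁ (lookup W u) (λ x → z ^ (𝟙 b ℕ.* 𝟙 (H x))) ≤ pgf z ^ (𝟙 b ℕ.* m u)
     go true = ≤-trans (≤-reflexive (E₁-cong (lookup W u) λ x _ → cong (z ^_) (ℕ.+-identityʳ (𝟙 (H x)))))
      (subst (λ e → E₁ (lookup W u) (λ x → z ^ 𝟙 (H x)) ≤ pgf z ^ e) (sym (ℕ.+-identityʳ (m u))) (E₁-hit (lookup W u) (deg u) H))
     go false = ≤-reflexive (E₁-const (lookup W u) (deg u) 1ℚ)

   module _ (G : Graph n) (reg : Regular d G) where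

    open RegularGraph G reg

    Ex-pre : ∀ B → Ex G (λ c → z ^ ∣ pre c B ∣) ≤ z ^ ∣ B ∣ * pgf z ^ boundary G B
    Ex-pre B = ≤-trans (≤-reflexive (Ex-cong G λ c _ → cong (z ^_) (trans (card≡∑ (pre c B)) (∑-cong λ u →
       trans (cong 𝟙 (pre-lookup c B u)) (or (lookup B u) (lookup B (lookup c u)))))))
     (subst₂ (λ s t → Ex G (λ c → z ^ ∑ (λ u → χ B u ℕ.+ 𝟙 (not (lookup B u)) ℕ.* 𝟙 (lookup B (lookup c u)))) ≤ z ^ s * pgf z ^ t)
      (sym (card≡∑ B)) (∑-cong λ u → cong (χᶜ B u ℕ.*_) (∑-cong λ x → ℕ.*-comm (a G u x) (χ B x)))
      (Ex-hit G degrees (χ B) (λ u → not (lookup B u)) (lookup B)))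
     where
     or : ∀ x y → 𝟙 (x ∨ y) ≡ 𝟙 x ℕ.+ 𝟙 (not x) ℕ.* 𝟙 y
     or true y = refl
     or false y = sym (ℕ.+-identityʳ (𝟙 y))

    Ex-push : ∀ I → Ex G (λ c → z ^ ∣ push c I ∣) ≤ z ^ ∣ I ∣ * pgf z ^ privates G I
    Ex-push I = ≤-trans (Ex-mono G λ c comp → ^-anti-exp 0≤z z≤1 (∣push∣≥ c comp I))
     (subst (λ s → Ex G (λ c → z ^ ∑ (λ u → χ I u ℕ.+ χ I u ℕ.* 𝟙 (private? G I (lookup c u)))) ≤ z ^ s * pgf z ^ privates G I)
      (sym (card≡∑ I)) (Ex-hit G degrees (χ I) (lookup I) (private? G I)))

  Ex-coordinate : ∀ (W : Vec (Subset n) k) → Degrees W → ∀ u f → Ex W (λ c → f (lookup c u)) ≡ E₁ (lookup W u) f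
  Ex-coordinate (S ∷ W) deg zero f = E₁-cong S λ x _ → Ex-const W (deg ∘ suc) (f x)
  Ex-coordinate (S ∷ W) deg (suc u) f = trans (E₁-cong S λ x _ → Ex-coordinate W (deg ∘ suc) u f) (E₁-const S (deg zero) _)

  Ex-∑ : ∀ (W : Vec (Subset n) k) → Degrees W → ∀ {m} (f : Fin m → Vec (Fin n) k → ℚ) →
   Ex W (λ c → ∑ℚ (λ i → f i c)) ≡ ∑ℚ (λ i → Ex W (f i))
  Ex-∑ W h {zero} f = Ex-const W h 0ℚ
  Ex-∑ W h {suc m} f = trans (Ex-+ W (f zero) (λ c → ∑ℚ (λ i → f (suc i) c))) (cong (Ex W (f zero) +_) (Ex-∑ W h (f ∘ suc)))

 -- The value of a process at z = 1/(1 + ω) is bounded by its value at ω multiplied by the rate ρ: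
 -- in terms of ω the loss from the 1/M-fraction of missing edges is uniform.
 module Rate (d : ℕ) (3≤d : 3 ℕ.≤ d) (M : ℕ) (1≤M : 1 ℕ.≤ M) where

  1≤d : 1 ℕ.≤ d
  1≤d = ℕ.≤-trans (ℕ.z<s) 3≤d

  open Expectation d 1≤d
  open OneRound d 1≤d

  μ r s ρ : ℚ
  μ = ι (d ℕ.∸ 2) * δ
  r = 1ℚ + μ
  s = recip (ι M)
  ρ = r - (1ℚ + 1ℚ + 1ℚ) * s

  0≤s : 0ℚ ≤ s
  0≤s = <⇒≤ (recip-pos (0<ι 1≤M))

  0≤μ : 0ℚ ≤ μ
  0≤μ = *-nonNeg (0≤ι (d ℕ.∸ 2)) 0≤δ

  μ≤1 : μ ≤ 1ℚ
  μ≤1 = subst (μ ≤_) (trans (*-comm (ι d) δ) δ*d) (*-monoʳ δ 0≤δ (ι-mono (ℕ.m∸n≤m d 2)))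

  ρ≤2 : ρ ≤ 1ℚ + 1ℚ
  ρ≤2 = ≤-trans (≤-by ((1ℚ + 1ℚ + 1ℚ) * s) (*-nonNeg (nonNegative⁻¹ (1ℚ + 1ℚ + 1ℚ)) 0≤s)
    (solve 2 (λ r t → r :- t :+ t := r) refl r ((1ℚ + 1ℚ + 1ℚ) * s)))
   (+-monoʳ-≤ 1ℚ μ≤1)

  module _ {ω : ℚ} (0≤ω : 0ℚ ≤ ω) where

   z : ℚ
   z = recip (1ℚ + ω)

   1≤1+ω : 1ℚ ≤ 1ℚ + ω
   1≤1+ω = p≤p+q 0≤ω

   0<1+ω : 0ℚ < 1ℚ + ω
   0<1+ω = <-≤-trans 0<1 1≤1+ω

   0<z : 0ℚ < z
   0<z = recip-pos 0<1+ω

   0≤z : 0ℚ ≤ z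
   0≤z = <⇒≤ 0<z

   z≤1 : z ≤ 1ℚ
   z≤1 = recip≤1 1≤1+ω

  -- With no edges missing, `(1 + ω)(1 + (d - 2)x) = 1 + rω` because `(1 + ω)x = ωδ`. At most `b/M`
  -- factors `1 + x` are missing; by Bernoulli's inequality they cost at most one factor `1 + xs`
  -- per vertex, which `base` absorbs into `ρ`. The 3 in `ρ` is `1 + 2`, from `xs ≤ ωs` and
  -- `ρωxs ≤ 2ωs`.
  step-star : ∀ {ω} (0≤ω : 0ℚ ≤ ω) → 0ℚ ≤ ρ → ∀ b p → M ℕ.* ((d ℕ.∸ 2) ℕ.* b ℕ.∸ p) ℕ.≤ b →
   (1ℚ + ρ * ω) ^ b ≤ (1ℚ + ω) ^ b * (1ℚ + ω * (δ * z 0≤ω)) ^ p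
  step-star {ω} 0≤ω 0≤ρ b p h = *-cancelʳ ((1ℚ + x * s) ^ b) (0<^ (<-≤-trans 0<1 1≤1+xs) b)
   (≤-trans (≤-reflexive (sym (*-^ (1ℚ + ρ * ω) (1ℚ + x * s) b)))
   (≤-trans (^-mono (*-nonNeg (+-nonNeg 0≤1 (*-nonNeg 0≤ρ 0≤ω)) (1≤⇒0≤ 1≤1+xs)) base b)
   (≤-trans (≤-reflexive (*-^ (1ℚ + ω) (1ℚ + ι (d ℕ.∸ 2) * x) b))
   (≤-trans (*-monoˡ ((1ℚ + ω) ^ b) 0≤yᵇ
    (≤-trans (^-mono (+-nonNeg 0≤1 (*-nonNeg (0≤ι (d ℕ.∸ 2)) 0≤x)) (bernoulli⁺ x 0≤x (d ℕ.∸ 2)) b)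
    (≤-trans (≤-reflexive (sym (^-* (1ℚ + x) (d ℕ.∸ 2) b)))
    (≤-trans (^-mono-exp 1≤1+x (ℕ.m≤n+m∸n ((d ℕ.∸ 2) ℕ.* b) p))
    (≤-trans (≤-reflexive (^-+ (1ℚ + x) p f))
     (*-monoˡ ((1ℚ + x) ^ p) (^-nonNeg (1≤⇒0≤ 1≤1+x) p)
      (≤-trans (^-mono (1≤⇒0≤ 1≤1+x) bern f)
      (≤-trans (≤-reflexive (sym (^-* (1ℚ + x * s) M f))) (^-mono-exp 1≤1+xs h)))))))))
    (≤-reflexive (sym (*-assoc ((1ℚ + ω) ^ b) ((1ℚ + x) ^ p) ((1ℚ + x * s) ^ b))))))))
   where
   x = ω * (δ * z 0≤ω)
   f = (d ℕ.∸ 2) ℕ.* b ℕ.∸ p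
   0≤x : 0ℚ ≤ x
   0≤x = *-nonNeg 0≤ω (*-nonNeg 0≤δ (0≤z 0≤ω))
   1≤1+x : 1ℚ ≤ 1ℚ + x
   1≤1+x = p≤p+q 0≤x
   1≤1+xs : 1ℚ ≤ 1ℚ + x * s
   1≤1+xs = p≤p+q (*-nonNeg 0≤x 0≤s)
   0≤yᵇ : 0ℚ ≤ (1ℚ + ω) ^ b
   0≤yᵇ = ^-nonNeg (+-nonNeg 0≤1 0≤ω) b
   bern : 1ℚ + x ≤ (1ℚ + x * s) ^ M
   bern = ≤-trans (≤-reflexive (cong (1ℚ +_) (sym (trans (solve 3 (λ m x s → m :* (x :* s) := x :* (m :* s)) refl (ι M) x s)
     (trans (cong (x *_) (recip-*ʳ (0<ι 1≤M))) (*-identityʳ x))))))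
    (bernoulli⁺ (x * s) (*-nonNeg 0≤x 0≤s) M)
   x≤ω : x ≤ ω
   x≤ω = p*q≤p 0≤ω (≤-trans (*-mono 0≤δ δ≤1 (0≤z 0≤ω) (z≤1 0≤ω)) ≤-refl)
   ωz≤1 : ω * z 0≤ω ≤ 1ℚ
   ωz≤1 = *recip≤ (0<1+ω 0≤ω) (subst (ω ≤_) (sym (*-identityˡ (1ℚ + ω))) (subst (_≤ 1ℚ + ω) (+-identityˡ ω) (+-monoˡ-≤ ω 0≤1)))
   x≤1 : x ≤ 1ℚ
   x≤1 = subst (_≤ 1ℚ) (solve 3 (λ w d z → d :* (w :* z) := w :* (d :* z)) refl ω δ (z 0≤ω))
    (≤-trans (*-mono 0≤δ δ≤1 (*-nonNeg 0≤ω (0≤z 0≤ω)) ωz≤1) ≤-refl)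
   yx : (1ℚ + ω) * x ≡ ω * δ
   yx = trans (solve 4 (λ y w d z → y :* (w :* (d :* z)) := w :* d :* (y :* z)) refl (1ℚ + ω) ω δ (z 0≤ω))
    (trans (cong (ω * δ *_) (recip-*ʳ (0<1+ω 0≤ω))) (*-identityʳ (ω * δ)))
   base : (1ℚ + ρ * ω) * (1ℚ + x * s) ≤ (1ℚ + ω) * (1ℚ + ι (d ℕ.∸ 2) * x)
   base = ≤-trans (≤-by ((ω - x) * s + (2ℚ * (ω * s) * (1ℚ - x) + (1ℚ + 1ℚ - ρ) * (ω * (x * s))))
     (+-nonNeg (*-nonNeg (p≤q⇒0≤q-p x≤ω) 0≤s)
      (+-nonNeg (*-nonNeg (*-nonNeg (nonNegative⁻¹ 2ℚ) (*-nonNeg 0≤ω 0≤s)) (p≤q⇒0≤q-p x≤1))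
       (*-nonNeg (p≤q⇒0≤q-p ρ≤2) (*-nonNeg 0≤ω (*-nonNeg 0≤x 0≤s)))))
     (solve 4 (λ w x s m → (con 1ℚ :+ (con 1ℚ :+ m :- (con (1ℚ + 1ℚ + 1ℚ)) :* s) :* w) :* (con 1ℚ :+ x :* s)
       :+ ((w :- x) :* s :+ (con 2ℚ :* (w :* s) :* (con 1ℚ :- x) :+ (con 2ℚ :- (con 1ℚ :+ m :- (con (1ℚ + 1ℚ + 1ℚ)) :* s)) :* (w :* (x :* s))))
       := con 1ℚ :+ (con 1ℚ :+ m) :* w) refl ω x s μ))
    (≤-reflexive (trans (solve 3 (λ w k d → con 1ℚ :+ (con 1ℚ :+ k :* d) :* w := (con 1ℚ :+ w) :+ k :* (w :* d)) refl ω (ι (d ℕ.∸ 2)) δ)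
     (trans (cong (λ t → (1ℚ + ω) + ι (d ℕ.∸ 2) * t) (sym yx))
      (solve 3 (λ y k x → y :+ k :* (y :* x) := y :* (con 1ℚ :+ k :* x)) refl (1ℚ + ω) (ι (d ℕ.∸ 2)) x))))

  -- Here `pgf z` is `1 - x` and `(1 - x)(1 + x) ≤ 1`, so each edge contributes a factor at most
  -- `1/(1 + x)` and `step-star` applies to the reciprocals.
  step : ∀ {ω} (0≤ω : 0ℚ ≤ ω) (0≤ρ : 0ℚ ≤ ρ) → ∀ b p → M ℕ.* ((d ℕ.∸ 2) ℕ.* b ℕ.∸ p) ℕ.≤ b →
   z 0≤ω ^ b * pgf (z 0≤ω) ^ p ≤ z (*-nonNeg 0≤ρ 0≤ω) ^ b
  step {ω} 0≤ω 0≤ρ b p h = begin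
    z₀ ^ b * g ^ p ≡⟨ trans (sym (*-identityʳ _)) (cong (z₀ ^ b * g ^ p *_) (sym (trans (sym (*-^ y′ z′ b)) (trans (cong (_^ b) (recip-*ʳ (0<1+ω 0≤ω′))) (1^ b))))) ⟩
    z₀ ^ b * g ^ p * (y′ ^ b * z′ ^ b) ≤⟨ *-monoˡ _ (*-nonNeg (^-nonNeg (0≤z 0≤ω) b) (^-nonNeg (0≤pgf (0≤z 0≤ω) (z≤1 0≤ω)) p))
                                (*-monoʳ (z′ ^ b) (^-nonNeg (0≤z 0≤ω′) b) (step-star 0≤ω 0≤ρ b p h)) ⟩
    z₀ ^ b * g ^ p * ((y ^ b * (1ℚ + x) ^ p) * z′ ^ b) ≡⟨ solve 5 (λ a b c d e → a :* b :* ((c :* d) :* e) := e :* ((c :* a) :* (b :* d))) refl (z₀ ^ b) (g ^ p) (y ^ b) ((1ℚ + x) ^ p) (z′ ^ b) ⟩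
    z′ ^ b * ((y ^ b * z₀ ^ b) * (g ^ p * (1ℚ + x) ^ p)) ≡⟨ cong₂ (λ u v → z′ ^ b * (u * v)) (trans (sym (*-^ y z₀ b)) (trans (cong (_^ b) (recip-*ʳ (0<1+ω 0≤ω))) (1^ b))) (sym (*-^ g (1ℚ + x) p)) ⟩
    z′ ^ b * (1ℚ * (g * (1ℚ + x)) ^ p) ≤⟨ p*q≤p (^-nonNeg (0≤z 0≤ω′) b) (subst (_≤ 1ℚ) (sym (*-identityˡ _)) (^≤1 0≤gx gx≤1 p)) ⟩
    z′ ^ b ∎
   where
   open ≤-Reasoning
   0≤ω′ = *-nonNeg 0≤ρ 0≤ω
   z₀ = z 0≤ω
   z′ = z 0≤ω′
   y = 1ℚ + ω
   y′ = 1ℚ + ρ * ω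
   g = pgf z₀
   x = ω * (δ * z₀)
   g≡ : g ≡ 1ℚ - x
   g≡ = cong (λ t → 1ℚ - t) (trans (cong (λ t → (t - z₀) * δ) (sym (recip-*ʳ (0<1+ω 0≤ω))))
    (solve 3 (λ w z d → ((con 1ℚ :+ w) :* z :- z) :* d := w :* (d :* z)) refl ω z₀ δ))
   0≤x : 0ℚ ≤ x
   0≤x = *-nonNeg 0≤ω (*-nonNeg 0≤δ (0≤z 0≤ω))
   0≤gx : 0ℚ ≤ g * (1ℚ + x)
   0≤gx = *-nonNeg (0≤pgf (0≤z 0≤ω) (z≤1 0≤ω)) (+-nonNeg 0≤1 0≤x)
   gx≤1 : g * (1ℚ + x) ≤ 1ℚ
   gx≤1 = subst (λ t → t * (1ℚ + x) ≤ 1ℚ) (sym g≡) (≤-by (x * x) (Sequence.sq-nonNeg x)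
    (solve 1 (λ x → (con 1ℚ :- x) :* (con 1ℚ :+ x) :+ x :* x := con 1ℚ) refl x))

open Growth

-- Iteration of the one-round bound, and first passage out of the small sets.

module GrowthOfProcesses where

 open Rationals

 private variable
  n k : ℕ

 indicator-≤ : ∀ b {x y} → 0ℚ ≤ y → (b ≡ true → x ≤ y) → indicator b * x ≤ y
 indicator-≤ true {x} {y} 0≤y h = subst (_≤ y) (sym (*-identityˡ x)) (h refl)
 indicator-≤ false {x} {y} 0≤y h = subst (_≤ y) (sym (*-zeroˡ x)) 0≤y

 indicator-*-≤ : ∀ b {x y} → (b ≡ true → x ≤ y) → indicator b * x ≤ indicator b * y
 indicator-*-≤ true h = *-monoˡ 1ℚ 0≤1 (h refl)
 indicator-*-≤ false {x} {y} h = ≤-reflexive (trans (*-zeroˡ x) (sym (*-zeroˡ y)))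

 indicator-mono : ∀ {a b} → (a ≡ true → b ≡ true) → indicator a ≤ indicator b
 indicator-mono {true} {b} h = ≤-reflexive (sym (cong indicator (h refl)))
 indicator-mono {false} {b} h = 0≤indicator b

 atMost : ℕ → Subset n → Bool
 atMost m X = does (∣ X ∣ ℕ.≤? m)

 atMost⁻ : ∀ {m} {X : Subset n} → atMost m X ≡ true → ∣ X ∣ ℕ.≤ m
 atMost⁻ {m = m} {X} = does-true (∣ X ∣ ℕ.≤? m)

 atMost⁺ : ∀ {m} {X : Subset n} → ∣ X ∣ ℕ.≤ m → atMost m X ≡ true
 atMost⁺ {m = m} {X} = true-does (∣ X ∣ ℕ.≤? m)

 module Potential (d : ℕ) (3≤d : 3 ℕ.≤ d) (M : ℕ) (1≤M : 1 ℕ.≤ M) (0≤ρ : 0ℚ ≤ Rate.ρ d 3≤d M 1≤M)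
  (G : Graph n) (reg : Regular d G) (next : Round n → Subset n → Subset n) (m : ℕ) (p : Subset n → ℕ)
  (grow : ∀ c X → ∣ X ∣ ℕ.≤ ∣ next c X ∣) where

  open Rate d 3≤d M 1≤M
  open Expectation d 1≤d
  open OneRound d 1≤d
  open Kernel G next
  open RegularGraph G reg using (degrees)

  -- Truncation at `m` is compatible with the kernel because sets never shrink: a set that is too
  -- large stays too large and keeps potential 0. Hence sparsity is only used for sets of size at
  -- most `m`.
  Ψ : ℚ → Subset n → ℚ
  Ψ ω X = indicator (atMost m X) * recip (1ℚ + ω) ^ ∣ X ∣

  module _ (gen : ∀ {z} → 0ℚ ≤ z → z ≤ 1ℚ → ∀ X → Ex G (λ c → z ^ ∣ next c X ∣) ≤ z ^ ∣ X ∣ * pgf z ^ p X) where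

   KΨ≤ : ∀ {ω} → 0ℚ ≤ ω → ∀ X → K (Ψ ω) X ≤ indicator (atMost m X) * (recip (1ℚ + ω) ^ ∣ X ∣ * pgf (recip (1ℚ + ω)) ^ p X)
   KΨ≤ {ω} 0≤ω X with bool-cases (atMost m X)
   ... | inj₁ h = ≤-trans (Ex-mono G λ c _ → indicator-≤ (atMost m (next c X)) (^-nonNeg (0≤z 0≤ω) ∣ next c X ∣) λ _ → ≤-refl)
    (subst (λ b → Ex G (λ c → z 0≤ω ^ ∣ next c X ∣) ≤ indicator b * (z 0≤ω ^ ∣ X ∣ * pgf (z 0≤ω) ^ p X)) (sym h)
     (subst (Ex G (λ c → z 0≤ω ^ ∣ next c X ∣) ≤_) (sym (*-identityˡ _)) (gen (0≤z 0≤ω) (z≤1 0≤ω) X)))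
   ... | inj₂ h = ≤-reflexive (trans (trans (Ex-cong G λ c _ →
      trans (cong (λ b → indicator b * z 0≤ω ^ ∣ next c X ∣) (false-does (∣ next c X ∣ ℕ.≤? m)
       λ le → does-false (∣ X ∣ ℕ.≤? m) h (ℕ.≤-trans (grow c X) le))) (*-zeroˡ (z 0≤ω ^ ∣ next c X ∣)))
     (Ex-const G degrees 0ℚ))
    (sym (trans (cong (λ b → indicator b * (z 0≤ω ^ ∣ X ∣ * pgf (z 0≤ω) ^ p X)) h) (*-zeroˡ (z 0≤ω ^ ∣ X ∣ * pgf (z 0≤ω) ^ p X)))))

   module _ (sparse : ∀ X → ∣ X ∣ ℕ.≤ m → M ℕ.* ((d ℕ.∸ 2) ℕ.* ∣ X ∣ ℕ.∸ p X) ℕ.≤ ∣ X ∣) where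

    KᵗΨ≤ : ∀ t {ω} → 0ℚ ≤ ω → ∀ X → Kᵗ t (Ψ ω) X ≤ Ψ (ρ ^ t * ω) X
    KᵗΨ≤ zero {ω} 0≤ω X = ≤-reflexive (cong (λ w → Ψ w X) (sym (*-identityˡ ω)))
    KᵗΨ≤ (suc t) {ω} 0≤ω X = ≤-trans (Ex-mono G λ c _ → KᵗΨ≤ t 0≤ω (next c X))
     (subst (λ w → K (Ψ (ρ ^ t * ω)) X ≤ Ψ w X) (sym (*-assoc ρ (ρ ^ t) ω))
      (≤-trans (KΨ≤ 0≤ω′ X)
       (indicator-*-≤ (atMost m X) λ h → step 0≤ω′ 0≤ρ ∣ X ∣ (p X) (sparse X (atMost⁻ {X = X} h)))))
     where
     0≤ω′ : 0ℚ ≤ ρ ^ t * ω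
     0≤ω′ = *-nonNeg (^-nonNeg 0≤ρ t) 0≤ω

    module _ (1≤m : 1 ℕ.≤ m) where

     -- Chosen so that `(1 + ω₀) ^ m ≤ 2`: the potential at `ω₀` is then at least half the indicator
     -- of a small set.
     ω₀ : ℚ
     ω₀ = recip (ι (m ℕ.+ m))

     0≤ω₀ : 0ℚ ≤ ω₀
     0≤ω₀ = <⇒≤ (recip-pos (0<ι (ℕ.≤-trans 1≤m (ℕ.m≤m+n m m))))

     ω₀≤1 : ω₀ ≤ 1ℚ
     ω₀≤1 = recip≤1 (1≤ι (ℕ.≤-trans 1≤m (ℕ.m≤m+n m m)))

     atMost≤2Ψ : ∀ X → indicator (atMost m X) ≤ 2ℚ * Ψ ω₀ X
     atMost≤2Ψ X = subst (_≤ 2ℚ * Ψ ω₀ X) (*-identityʳ _)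
      (≤-trans (indicator-*-≤ (atMost m X) λ h → lower (atMost⁻ {X = X} h))
       (≤-reflexive (solve 2 (λ i z → i :* (con 2ℚ :* z) := con 2ℚ :* (i :* z)) refl (indicator (atMost m X)) (z 0≤ω₀ ^ ∣ X ∣))))
      where
      lower : ∣ X ∣ ℕ.≤ m → 1ℚ ≤ 2ℚ * z 0≤ω₀ ^ ∣ X ∣
      lower le = subst (_≤ 2ℚ * z 0≤ω₀ ^ ∣ X ∣) (trans (sym (*-^ (1ℚ + ω₀) (z 0≤ω₀) ∣ X ∣))
        (trans (cong (_^ ∣ X ∣) (recip-*ʳ (0<1+ω 0≤ω₀))) (1^ ∣ X ∣)))
       (*-monoʳ (z 0≤ω₀ ^ ∣ X ∣) (^-nonNeg (0≤z 0≤ω₀) ∣ X ∣)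
        (≤-trans (^-mono-exp (1≤1+ω 0≤ω₀) le) (^-≤2 ω₀ m 0≤ω₀ ω₀≤1 half)))
       where
       half : ι m * ω₀ ≤ ½
       half = *recip≤ (0<ι (ℕ.≤-trans 1≤m (ℕ.m≤m+n m m))) (≤-reflexive
        (trans (solve 1 (λ m → m := con ½ :* (m :+ m)) refl (ι m)) (cong (½ *_) (sym (ι-+ m m)))))

     small-unlikely : ∀ t X → 1 ℕ.≤ ∣ X ∣ → Kᵗ t (λ Y → indicator (atMost m Y)) X ≤ 2ℚ * recip (1ℚ + ρ ^ t * ω₀)
     small-unlikely t X 1≤X = ≤-trans (Kᵗ-mono t atMost≤2Ψ X)
      (≤-trans (≤-reflexive (Kᵗ-* t 2ℚ (Ψ ω₀) X))
       (*-monoˡ 2ℚ (nonNegative⁻¹ 2ℚ) (≤-trans (KᵗΨ≤ t 0≤ω₀ X)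
        (indicator-≤ (atMost m X) (0≤z 0≤ωₜ) λ _ → subst (z 0≤ωₜ ^ ∣ X ∣ ≤_) (*-identityʳ (z 0≤ωₜ))
         (^-anti-exp (0≤z 0≤ωₜ) (z≤1 0≤ωₜ) 1≤X)))))
      where
      0≤ωₜ : 0ℚ ≤ ρ ^ t * ω₀
      0≤ωₜ = *-nonNeg (^-nonNeg 0≤ρ t) 0≤ω₀

     module _ (full : ∀ X → 1 ℕ.≤ ∣ X ∣ → ∣ X ∣ ℕ.≤ m → d ℕ.≤ p X) where

      -- Instead of changing `ω`, each round gains a factor from the `d` edges that `full`
      -- guarantees even for a single vertex. For large `ω` this factor is close to `(1 - 1/d) ^ d`,
      -- the probability that none of the `d` neighbours of a vertex calls it.
      KᵗΨ-stuck : ∀ s {ω} → 0ℚ ≤ ω → ∀ X → 1 ℕ.≤ ∣ X ∣ → Kᵗ s (Ψ ω) X ≤ (pgf (recip (1ℚ + ω)) ^ d) ^ s * Ψ ω X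
      KᵗΨ-stuck zero {ω} 0≤ω X _ = ≤-reflexive (sym (*-identityˡ (Ψ ω X)))
      KᵗΨ-stuck (suc s) {ω} 0≤ω X 1≤X = ≤-trans
       (Ex-mono G λ c _ → KᵗΨ-stuck s 0≤ω (next c X) (ℕ.≤-trans 1≤X (grow c X)))
       (≤-trans (≤-reflexive (Ex-* G ((g ^ d) ^ s) (λ c → Ψ ω (next c X))))
        (≤-trans (*-monoˡ ((g ^ d) ^ s) (^-nonNeg (^-nonNeg 0≤g d) s)
          (≤-trans (KΨ≤ 0≤ω X) (indicator-*-≤ (atMost m X) λ h →
           *-monoˡ (z 0≤ω ^ ∣ X ∣) (^-nonNeg (0≤z 0≤ω) ∣ X ∣)
            (^-anti-exp 0≤g (pgf≤1 (0≤z 0≤ω) (z≤1 0≤ω)) (full X 1≤X (atMost⁻ {X = X} h))))))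
         (≤-reflexive (solve 4 (λ e i z f → e :* (i :* (z :* f)) := (f :* e) :* (i :* z)) refl
          ((g ^ d) ^ s) (indicator (atMost m X)) (z 0≤ω ^ ∣ X ∣) (g ^ d)))))
       where
       g = pgf (z 0≤ω)
       0≤g : 0ℚ ≤ g
       0≤g = 0≤pgf (0≤z 0≤ω) (z≤1 0≤ω)

      -- A probability of order `1/ω`, as in `small-unlikely`, does not survive a union bound over
      -- `n` targets. The first `s` steps add a factor exponentially small in `s`, and the last `t`
      -- steps provide the large `ω` that makes this factor nearly optimal.
      small-very-unlikely : ∀ s t X → 1 ℕ.≤ ∣ X ∣ →
       Kᵗ (s ℕ.+ t) (λ Y → indicator (atMost m Y)) X ≤ 2ℚ * (pgf (recip (1ℚ + ρ ^ t * ω₀)) ^ d) ^ s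
      small-very-unlikely s t X 1≤X = ≤-trans (Kᵗ-mono (s ℕ.+ t) atMost≤2Ψ X)
       (≤-trans (≤-reflexive (trans (Kᵗ-* (s ℕ.+ t) 2ℚ (Ψ ω₀) X) (cong (2ℚ *_) (Kᵗ-∘ s t (Ψ ω₀) X))))
        (*-monoˡ 2ℚ (nonNegative⁻¹ 2ℚ) (≤-trans (Kᵗ-mono s (KᵗΨ≤ t 0≤ω₀) X)
         (≤-trans (KᵗΨ-stuck s 0≤ωₜ X 1≤X)
          (p*q≤p (^-nonNeg (^-nonNeg (0≤pgf (0≤z 0≤ωₜ) (z≤1 0≤ωₜ)) d) s)
           (indicator-≤ (atMost m X) 0≤1 λ _ → ^≤1 (0≤z 0≤ωₜ) (z≤1 0≤ωₜ) ∣ X ∣))))))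
       where
       0≤ωₜ : 0ℚ ≤ ρ ^ t * ω₀
       0≤ωₜ = *-nonNeg (^-nonNeg 0≤ρ t) 0≤ω₀

 -- Starts at 1: a process that begins inside the small sets has not left them at time 0.
 sumOver : ℕ → (ℕ → ℚ) → ℚ
 sumOver zero f = 0ℚ
 sumOver (suc t) f = sumOver t f + f (suc t)

 sumOver-mono : ∀ t {f g : ℕ → ℚ} → (∀ σ → f σ ≤ g σ) → sumOver t f ≤ sumOver t g
 sumOver-mono zero h = ≤-refl
 sumOver-mono (suc t) h = +-mono-≤ (sumOver-mono t h) (h (suc t))

 sumOver-const : ∀ t c → sumOver t (λ _ → c) ≡ ι t * c
 sumOver-const zero c = sym (trans (cong (_* c) ι-0) (*-zeroˡ c))
 sumOver-const (suc t) c = trans (cong (_+ c) (sumOver-const t c))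
  (trans (solve 2 (λ c t → t :* c :+ c := (con 1ℚ :+ t) :* c) refl c (ι t)) (cong (_* c) (sym (ι-suc t))))

 sumOver-*ˡ : ∀ t c f → c * sumOver t f ≡ sumOver t (λ σ → c * f σ)
 sumOver-*ˡ zero c f = *-zeroʳ c
 sumOver-*ˡ (suc t) c f = trans (*-distribˡ-+ c (sumOver t f) (f (suc t))) (cong (_+ c * f (suc t)) (sumOver-*ˡ t c f))

 sumOver-nonNeg : ∀ t {f : ℕ → ℚ} → (∀ σ → 0ℚ ≤ f σ) → 0ℚ ≤ sumOver t f
 sumOver-nonNeg zero h = ≤-refl
 sumOver-nonNeg (suc t) h = +-nonNeg (sumOver-nonNeg t h) (h (suc t))

 Σ-sumOver : ∀ {A : Set} t (f : A → ℕ → ℚ) xs → Σ (λ x → sumOver t (f x)) xs ≡ sumOver t (λ σ → Σ (λ x → f x σ) xs)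
 Σ-sumOver zero f xs = Σ-0 xs
 Σ-sumOver (suc t) f xs = trans (Σ-+ (λ x → sumOver t (f x)) (λ x → f x (suc t)) xs) (cong (_+ Σ (λ x → f x (suc t)) xs) (Σ-sumOver t f xs))

 module FirstPassage (d : ℕ) (1≤d : 1 ℕ.≤ d) (G : Graph n) (deg : Expectation.Degrees d 1≤d G)
  (next : Round n → Subset n → Subset n) where

  open Expectation d 1≤d
  open Kernel G next

  -- f is large only after the process has left the sets of size at most m, and does not increase from then on,
  -- so it is enough to look at the moment of leaving, when the size is at most m₂.
  firstPassage : ∀ m m₂ (f : Subset n → ℚ) → (∀ X → 0ℚ ≤ f X) → (∀ X → ∣ X ∣ ℕ.≤ m → f X ≡ 0ℚ) →
   (∀ c X → Compatible G c → m ℕ.< ∣ X ∣ → f (next c X) ≤ f X) →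
   (∀ c X → Compatible G c → ∣ X ∣ ℕ.≤ m → ∣ next c X ∣ ℕ.≤ m₂) →
   ∀ t X → ∣ X ∣ ℕ.≤ m →
   Kᵗ t f X ≤ sumOver t (λ σ → Kᵗ σ (λ Y → indicator (atMost m₂ Y) * f Y) X)
  firstPassage m m₂ f 0≤f f-small f-anti jump t X X≤m = subst (Kᵗ t f X ≤_)
    (trans (cong (_+ sumOver t (λ σ → Kᵗ σ h X)) (f-small X X≤m)) (+-identityˡ _)) (go t X)
   where
   h : Subset n → ℚ
   h Y = indicator (atMost m₂ Y) * f Y
   0≤h : ∀ Y → 0ℚ ≤ h Y
   0≤h Y = *-nonNeg (0≤indicator (atMost m₂ Y)) (0≤f Y)
   -- From a large set `f` does not increase. From a small one the round lands below `m₂`, where `h`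
   -- agrees with `f`.
   one : ∀ X → K f X ≤ f X + K h X
   one X with ∣ X ∣ ℕ.≤? m
   ... | yes le = ≤-trans (Ex-mono G λ c comp → ≤-reflexive (sym
      (trans (cong (λ b → indicator b * f (next c X)) (atMost⁺ {m = m₂} {X = next c X} (jump c X comp le))) (*-identityˡ _))))
     (subst (K h X ≤_) (+-comm (K h X) (f X)) (p≤p+q (0≤f X)))
   ... | no gt = ≤-trans (Ex-mono G λ c comp → f-anti c X comp (ℕ.≰⇒> gt))
     (≤-trans (≤-reflexive (Ex-const G deg (f X))) (p≤p+q (Kᵗ-nonNeg 1 0≤h X)))
   go : ∀ t X → Kᵗ t f X ≤ f X + sumOver t (λ σ → Kᵗ σ h X)
   go zero X = ≤-reflexive (sym (+-identityʳ (f X)))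
   go (suc t) X = ≤-trans (≤-trans (≤-reflexive (Kᵗ-suc t f X)) (≤-trans (Kᵗ-mono t one X)
     (≤-reflexive (trans (Kᵗ-+ t f (K h) X) (cong (Kᵗ t f X +_) (sym (Kᵗ-suc t h X)))))))
    (≤-trans (+-monoˡ-≤ (Kᵗ (suc t) h X) (go t X)) (≤-reflexive (ℚ.+-assoc (f X) _ _)))

 _≡ˢ_ : Subset n → Subset n → Bool
 X ≡ˢ Y = does (Vec.≡-dec Bool._≟_ X Y)

 ≡ˢ⇒≡ : {X Y : Subset n} → (X ≡ˢ Y) ≡ true → X ≡ Y
 ≡ˢ⇒≡ {X = X} {Y} = does-true (Vec.≡-dec Bool._≟_ X Y)

 sides : List Bool
 sides = inside ∷ outside ∷ []

 allSubsets : ∀ n → List (Subset n)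
 allSubsets n = product (Vec.replicate n sides)

 allSubsets-unique : ∀ n → Unique (allSubsets n)
 allSubsets-unique n = product-unique (Vec.replicate n sides) λ i → subst Unique (sym (Vec.lookup-replicate i sides)) (((λ ()) All.∷ All.[]) ∷ All.[] ∷ [])

 allSubsets-complete : (X : Subset n) → X ∈ allSubsets n
 allSubsets-complete {n} X = product-complete (Vec.replicate n sides) X λ i → subst (lookup X i ∈_) (sym (Vec.lookup-replicate i sides)) (side (lookup X i))
  where
  side : ∀ b → b ∈ sides
  side true = here refl
  side false = there (here refl)

 Σ-δ : {xs : List (Subset n)} → Unique xs → ∀ (f : Subset n → ℚ) X → X ∈ xs → Σ (λ Y → indicator (X ≡ˢ Y) * f Y) xs ≡ f X
 Σ-δ {xs = Y ∷ xs} (Y∉ ∷ u) f X (here refl) = trans (cong₂ _+_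
   (trans (cong (λ b → indicator b * f X) (true-does (Vec.≡-dec Bool._≟_ X X) refl)) (*-identityˡ (f X)))
   (trans (zeros xs Y∉) refl)) (+-identityʳ (f X))
  where
  zeros : ∀ ys → All.All (X ≢_) ys → Σ (λ Y → indicator (X ≡ˢ Y) * f Y) ys ≡ 0ℚ
  zeros [] All.[] = refl
  zeros (y ∷ ys) (ne All.∷ h) = cong₂ _+_ (trans (cong (λ b → indicator b * f y) (false-does (Vec.≡-dec Bool._≟_ X y) ne)) (*-zeroˡ (f y))) (zeros ys h)
 Σ-δ {xs = Y ∷ xs} (Y∉ ∷ u) f X (there X∈) = trans (cong₂ _+_
   (trans (cong (λ b → indicator b * f Y) (false-does (Vec.≡-dec Bool._≟_ X Y) λ e → All.lookup Y∉ X∈ (sym e))) (*-zeroˡ (f Y)))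
   (Σ-δ u f X X∈)) (+-identityˡ (f X))

 -- The coefficients are the arrival probabilities, the form in which the law of a process can be
 -- compared on a graph and on its switched version.
 Kᵗ-expand : ∀ {d} (1≤d : 1 ℕ.≤ d) (G : Graph n) next → let open Expectation.Kernel d 1≤d G next in
  ∀ t (f : Subset n → ℚ) X → Kᵗ t f X ≡ Σ (λ Y → Kᵗ t (λ Z → indicator (Z ≡ˢ Y)) X * f Y) (allSubsets n)
 Kᵗ-expand {n} {d} 1≤d G next t f X = trans (Kᵗ-cong t (λ Z → sym (Σ-δ (allSubsets-unique n) f Z (allSubsets-complete Z))) X)
  (trans (Kᵗ-Σ t (λ Y Z → indicator (Z ≡ˢ Y) * f Y) (allSubsets n) X)
   (Σ-cong (λ Y → trans (Kᵗ-cong t (λ Z → *-comm (indicator (Z ≡ˢ Y)) (f Y)) X)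
    (trans (Kᵗ-* t (f Y) (λ Z → indicator (Z ≡ˢ Y)) X) (*-comm (f Y) _))) (allSubsets n)))
  where open Expectation.Kernel d 1≤d G next

-- Expansion of small sets in sparse graphs.

module SparseGraphs where

 open import Data.Nat.Base using (_+_; _*_; _≤_; _<_; _∸_; z≤n; s≤s)
 open import Data.Nat.DivMod using (_/_; m/n*n≤m; m<n⇒m/n≡0; /-monoˡ-≤)
 open ℕ.≤-Reasoning

 private variable
  n : ℕ

 -- Sets of at most m vertices span few more edges than a tree.
 Sparse : (M : ℕ) .{{_ : ℕ.NonZero M}} → ℕ → Graph n → Set
 Sparse M m G = ∀ S → ∣ S ∣ ≤ m → e₂ G S ≤ 2 * ∣ S ∣ + 2 * (∣ S ∣ / M)

 module Consequences {d : ℕ} (3≤d : 3 ≤ d) (G : Graph n) (reg : Regular d G)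
  (M m : ℕ) .{{_ : ℕ.NonZero M}} (sparse : Sparse M m G) where

  open RegularGraph G reg

  2+d-2 : ∀ b → (d ∸ 2) * b + 2 * b ≡ d * b
  2+d-2 b = trans (sym (ℕ.*-distribʳ-+ b (d ∸ 2) 2)) (cong (_* b) (ℕ.m∸n+n≡m (ℕ.≤-trans (s≤s (s≤s z≤n)) 3≤d)))

  boundary≥ : ∀ X → ∣ X ∣ ≤ m → (d ∸ 2) * ∣ X ∣ ≤ boundary G X + 2 * (∣ X ∣ / M)
  boundary≥ X le = ℕ.+-cancelʳ-≤ (2 * ∣ X ∣) _ _ (begin
   (d ∸ 2) * ∣ X ∣ + 2 * ∣ X ∣ ≡⟨ trans (2+d-2 ∣ X ∣) (sym (e₂+boundary X)) ⟩
   e₂ G X + boundary G X ≤⟨ ℕ.+-monoˡ-≤ (boundary G X) (sparse X le) ⟩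
   2 * ∣ X ∣ + 2 * (∣ X ∣ / M) + boundary G X ≡⟨ reorder (2 * ∣ X ∣) (2 * (∣ X ∣ / M)) (boundary G X) ⟩
   boundary G X + 2 * (∣ X ∣ / M) + 2 * ∣ X ∣ ∎)
   where
   reorder : ∀ a b c → a + b + c ≡ c + b + a
   reorder = ℕ-solve-∀

  -- Turns the floor in `Sparse` into the relative loss `1/M′` required by the growth rate. The
  -- factor `x` is present because, for private neighbours, sparsity is applied to a set up to
  -- `suc d` times larger than `I`; hence `M` is taken larger than `M′`.
  deficit : ∀ {M′ x b p} → 1 ≤ x → 2 * (x * M′) ≤ M → (d ∸ 2) * b ≤ p + 2 * ((x * b) / M) →
   M′ * ((d ∸ 2) * b ∸ p) ≤ b
  deficit {M′} {x} {b} {p} 1≤x xM h = ℕ.*-cancelˡ-≤ x {{ℕ.>-nonZero 1≤x}} (begin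
   x * (M′ * ((d ∸ 2) * b ∸ p)) ≤⟨ ℕ.*-monoʳ-≤ x (ℕ.*-monoʳ-≤ M′ (ℕ.m≤n+o⇒m∸n≤o ((d ∸ 2) * b) p h)) ⟩
   x * (M′ * (2 * ((x * b) / M))) ≡⟨ reorder x M′ ((x * b) / M) ⟩
   ((x * b) / M) * (2 * (x * M′)) ≤⟨ ℕ.*-monoʳ-≤ ((x * b) / M) xM ⟩
   ((x * b) / M) * M ≤⟨ m/n*n≤m (x * b) M ⟩
   x * b ∎)
   where
   reorder : ∀ a b c → a * (b * (2 * c)) ≡ c * (2 * (a * b))
   reorder = ℕ-solve-∀

  boundary-deficit : ∀ {M′} → 2 * (suc d * M′) ≤ M → ∀ X → ∣ X ∣ ≤ m → M′ * ((d ∸ 2) * ∣ X ∣ ∸ boundary G X) ≤ ∣ X ∣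
  boundary-deficit {M′} h X le = deficit {M′} {suc d} {∣ X ∣} {boundary G X} (s≤s z≤n) h (ℕ.≤-trans (boundary≥ X le)
   (ℕ.+-monoʳ-≤ (boundary G X) (ℕ.*-monoʳ-≤ 2 (/-monoˡ-≤ M (ℕ.m≤m+n ∣ X ∣ (d * ∣ X ∣))))))

  e₂+card : ∀ S → e₂ G S + ∣ S ∣ ≤ ∣ S ∣ * ∣ S ∣
  e₂+card S = begin
   e₂ G S + ∣ S ∣ ≡⟨ cong (e₂ G S +_) (card≡∑ S) ⟩
   ∑ (λ u → χ S u * degIn G S u) + ∑ (χ S) ≡⟨ sym (∑-+ (λ u → χ S u * degIn G S u) (χ S)) ⟩
   ∑ (λ u → χ S u * degIn G S u + χ S u) ≤⟨ ∑-mono pt ⟩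
   ∑ (λ u → χ S u * ∣ S ∣) ≡⟨ sym (*-distribʳ-∑ ∣ S ∣ (χ S)) ⟩
   ∑ (χ S) * ∣ S ∣ ≡⟨ cong (_* ∣ S ∣) (sym (card≡∑ S)) ⟩
   ∣ S ∣ * ∣ S ∣ ∎
   where
   inner : ∀ u v → χ S v * a G u v + 𝟙 (u ≡ᵇ v) * χ S v ≤ χ S v
   inner u v with u Fin.≟ v
   ... | yes refl = ℕ.≤-reflexive (trans (cong₂ _+_ (trans (cong (χ S u *_) (𝟙-false (adj-irrefl u))) (ℕ.*-zeroʳ (χ S u))) (ℕ.+-identityʳ (χ S u))) refl)
   ... | no _ = ℕ.≤-trans (ℕ.≤-reflexive (ℕ.+-identityʳ _)) (ℕ.≤-trans (ℕ.*-monoʳ-≤ (χ S v) (𝟙≤1 _)) (ℕ.≤-reflexive (ℕ.*-identityʳ (χ S v))))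
   deg+ : ∀ u → degIn G S u + χ S u ≤ ∣ S ∣
   deg+ u = begin
    degIn G S u + χ S u ≡⟨ cong (degIn G S u +_) (sym (∑-δ u (χ S))) ⟩
    degIn G S u + ∑ (λ v → 𝟙 (u ≡ᵇ v) * χ S v) ≡⟨ sym (∑-+ (λ v → χ S v * a G u v) (λ v → 𝟙 (u ≡ᵇ v) * χ S v)) ⟩
    ∑ (λ v → χ S v * a G u v + 𝟙 (u ≡ᵇ v) * χ S v) ≤⟨ ∑-mono (inner u) ⟩
    ∑ (χ S) ≡⟨ sym (card≡∑ S) ⟩
    ∣ S ∣ ∎
   pt : ∀ u → χ S u * degIn G S u + χ S u ≤ χ S u * ∣ S ∣
   pt u with lookup S u | deg+ u
   ... | true | h = subst₂ _≤_ (cong (_+ 1) (sym (ℕ.+-identityʳ _))) (sym (ℕ.+-identityʳ _)) h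
   ... | false | _ = z≤n

  -- Sparsity is too weak for one or two vertices, where `e₂` is bounded directly. For `3 ≤ b < M`
  -- the floor vanishes and `3(d - 2) ≥ d`. For `b ≥ M` the boundary is at least `b/2`, hence at
  -- least `d`.
  boundary≥d : 2 * d ≤ M → ∀ X → 1 ≤ ∣ X ∣ → ∣ X ∣ ≤ m → d ≤ boundary G X
  boundary≥d 2d≤M X 1≤X X≤m = go ∣ X ∣ refl 1≤X
   where
   e₂≤ : ∀ k → e₂ G X ≤ k → d * ∣ X ∣ ∸ k ≤ boundary G X
   e₂≤ k h = ℕ.m≤n+o⇒m∸n≤o (d * ∣ X ∣) k (ℕ.≤-trans (ℕ.≤-reflexive (sym (e₂+boundary X))) (ℕ.+-monoˡ-≤ (boundary G X) h))
   go : ∀ b → ∣ X ∣ ≡ b → 1 ≤ b → d ≤ boundary G X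
   go 1 eq _ = ℕ.≤-trans (ℕ.≤-reflexive (sym (trans (cong (d *_) eq) (ℕ.*-identityʳ d)))) (e₂≤ 0
    (ℕ.+-cancelʳ-≤ ∣ X ∣ _ _ (ℕ.≤-trans (e₂+card X) (ℕ.≤-reflexive (trans (cong (_* ∣ X ∣) eq) (ℕ.+-identityʳ ∣ X ∣))))))
   go 2 eq _ = begin
    d ≡⟨ sym (ℕ.m+n∸n≡m d d) ⟩
    d + d ∸ d ≤⟨ ℕ.∸-monoʳ-≤ (d + d) (ℕ.≤-trans (s≤s (s≤s z≤n)) 3≤d) ⟩
    d + d ∸ 2 ≡⟨ cong (_∸ 2) (trans (cong (d +_) (sym (ℕ.+-identityʳ d))) (trans (ℕ.*-comm 2 d) (cong (d *_) (sym eq)))) ⟩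
    d * ∣ X ∣ ∸ 2 ≤⟨ e₂≤ 2 (ℕ.+-cancelʳ-≤ ∣ X ∣ _ _ (ℕ.≤-trans (e₂+card X) (ℕ.≤-reflexive (trans (cong₂ _*_ eq eq) (cong (2 +_) (sym eq)))))) ⟩
    boundary G X ∎
   go b@(suc (suc (suc _))) eq _ with b ℕ.<? M
   ... | yes b<M = begin
    d ≤⟨ d≤ ⟩
    (d ∸ 2) * 3 ≤⟨ ℕ.*-monoʳ-≤ (d ∸ 2) (s≤s (s≤s (s≤s z≤n))) ⟩
    (d ∸ 2) * b ≡⟨ cong ((d ∸ 2) *_) (sym eq) ⟩
    (d ∸ 2) * ∣ X ∣ ≤⟨ boundary≥ X X≤m ⟩
    boundary G X + 2 * (∣ X ∣ / M) ≡⟨ cong (λ t → boundary G X + 2 * t) (m<n⇒m/n≡0 (subst (_< M) (sym eq) b<M)) ⟩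
    boundary G X + 0 ≡⟨ ℕ.+-identityʳ _ ⟩
    boundary G X ∎
    where
    d≤ : d ≤ (d ∸ 2) * 3
    d≤ = ℕ.+-cancelʳ-≤ 6 _ _ (begin
     d + 6 ≤⟨ ℕ.+-monoʳ-≤ d (ℕ.*-monoʳ-≤ 2 3≤d) ⟩
     d + 2 * d ≡⟨ ℕ.*-comm 3 d ⟩
     d * 3 ≡⟨ sym (2+d-2 3) ⟩
     (d ∸ 2) * 3 + 6 ∎)
   ... | no b≮M = ℕ.*-cancelˡ-≤ 2 (ℕ.≤-trans 2d≤M (ℕ.≤-trans (ℕ.≮⇒≥ b≮M) (subst (_≤ 2 * boundary G X) eq (ℕ.+-cancelʳ-≤ ∣ X ∣ _ _ (begin
    ∣ X ∣ + ∣ X ∣ ≡⟨ cong (∣ X ∣ +_) (sym (ℕ.+-identityʳ ∣ X ∣)) ⟩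
    2 * ∣ X ∣ ≤⟨ ℕ.*-monoʳ-≤ 2 (ℕ.≤-trans (ℕ.≤-trans (ℕ.≤-reflexive (sym (ℕ.*-identityˡ ∣ X ∣))) (ℕ.*-monoˡ-≤ ∣ X ∣ 1≤d-2)) (boundary≥ X X≤m)) ⟩
    2 * (boundary G X + 2 * (∣ X ∣ / M)) ≡⟨ reorder (boundary G X) (∣ X ∣ / M) ⟩
    2 * boundary G X + (∣ X ∣ / M) * 4 ≤⟨ ℕ.+-monoʳ-≤ (2 * boundary G X) (ℕ.≤-trans (ℕ.*-monoʳ-≤ (∣ X ∣ / M) 4≤M) (m/n*n≤m ∣ X ∣ M)) ⟩
    2 * boundary G X + ∣ X ∣ ∎)))))
    where
    reorder : ∀ x y → 2 * (x + 2 * y) ≡ 2 * x + y * 4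
    reorder = ℕ-solve-∀
    1≤d-2 : 1 ≤ d ∸ 2
    1≤d-2 = ℕ.∸-monoˡ-≤ 2 3≤d
    4≤M : 4 ≤ M
    4≤M = ℕ.≤-trans (ℕ.*-monoʳ-≤ 2 (ℕ.≤-trans (s≤s (s≤s z≤n)) 3≤d)) 2d≤M

  -- Apply sparsity to I together with the vertices Y outside I that have several neighbours in I.
  privates≥ : ∀ I → suc d * ∣ I ∣ ≤ m → (d ∸ 2) * ∣ I ∣ ≤ privates G I + 2 * ((suc d * ∣ I ∣) / M)
  privates≥ I le = ℕ.+-cancelʳ-≤ (2 * ∣ I ∣) _ _ (begin
    (d ∸ 2) * ∣ I ∣ + 2 * ∣ I ∣ ≡⟨ trans (2+d-2 ∣ I ∣) (sym (e₂+boundary I)) ⟩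
    e₂ G I + boundary G I ≤⟨ ℕ.+-monoʳ-≤ (e₂ G I) boundary≤ ⟩
    e₂ G I + (privates G I + κ) ≡⟨ reorder (e₂ G I) (privates G I) κ ⟩
    privates G I + (e₂ G I + κ) ≤⟨ ℕ.+-monoʳ-≤ (privates G I) main ⟩
    privates G I + (2 * ∣ I ∣ + 2 * t) ≡⟨ reorder (privates G I) (2 * ∣ I ∣) (2 * t) ⟩
    2 * ∣ I ∣ + (privates G I + 2 * t) ≡⟨ ℕ.+-comm (2 * ∣ I ∣) _ ⟩
    privates G I + 2 * t + 2 * ∣ I ∣ ∎)
   where
   reorder : ∀ x y z → x + (y + z) ≡ y + (x + z)
   reorder = ℕ-solve-∀
   k : Fin n → ℕ
   k = degIn G I
   inY : Fin n → Bool
   inY w = not (lookup I w) ∧ does (2 ℕ.≤? k w)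
   y : Fin n → ℕ
   y w = 𝟙 (inY w)
   S : Subset n
   S = I ∪ˢ Vec.tabulate inY
   κ t : ℕ
   κ = ∑ (λ w → y w * k w)
   t = (suc d * ∣ I ∣) / M
   inY-I : ∀ w → inY w ≡ true → lookup I w ≡ false
   inY-I w h with lookup I w
   ... | false = refl
   cardS : ∣ S ∣ ≡ ∣ I ∣ + ∑ y
   cardS = proj₁ (e₂-union I inY inY-I)
   2y≤ : 2 * ∑ y ≤ κ
   2y≤ = ℕ.≤-trans (ℕ.≤-reflexive (*-distribˡ-∑ 2 y)) (∑-mono λ w → pt w (bool-cases (inY w)))
    where
    2≤k : ∀ w → inY w ≡ true → 2 ≤ k w
    2≤k w h with lookup I w
    ... | false = does-true (2 ℕ.≤? k w) h
    pt : ∀ w → inY w ≡ true ⊎ inY w ≡ false → 2 * y w ≤ y w * k w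
    pt w (inj₁ h) = subst (λ e → 2 * e ≤ e * k w) (sym (𝟙-true h)) (ℕ.≤-trans (2≤k w h) (ℕ.≤-reflexive (sym (ℕ.+-identityʳ _))))
    pt w (inj₂ h) = subst (λ e → 2 * e ≤ e * k w) (sym (𝟙-false h)) z≤n
   κ≤ : κ ≤ d * ∣ I ∣
   κ≤ = ℕ.≤-trans (∑-mono λ w → ℕ.≤-trans (ℕ.*-monoˡ-≤ (k w) (𝟙≤1 (inY w))) (ℕ.≤-reflexive (ℕ.*-identityˡ (k w)))) (ℕ.≤-reflexive (∑degIn≡d∣S∣ I))
   S≤ : ∣ S ∣ ≤ suc d * ∣ I ∣
   S≤ = ℕ.≤-trans (ℕ.≤-reflexive cardS) (ℕ.+-monoʳ-≤ ∣ I ∣ (ℕ.≤-trans (ℕ.≤-trans (ℕ.m≤m+n (∑ y) _) 2y≤) κ≤))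
   e₂S : e₂ G I + 2 * κ ≤ e₂ G S
   e₂S = proj₂ (e₂-union I inY inY-I)
   main : e₂ G I + κ ≤ 2 * ∣ I ∣ + 2 * t
   main = ℕ.+-cancelʳ-≤ κ _ _ (begin
    e₂ G I + κ + κ ≡⟨ trans (ℕ.+-assoc (e₂ G I) κ κ) (cong (λ e → e₂ G I + (κ + e)) (sym (ℕ.+-identityʳ κ))) ⟩
    e₂ G I + 2 * κ ≤⟨ e₂S ⟩
    e₂ G S ≤⟨ sparse S (ℕ.≤-trans S≤ le) ⟩
    2 * ∣ S ∣ + 2 * (∣ S ∣ / M) ≤⟨ ℕ.+-monoʳ-≤ (2 * ∣ S ∣) (ℕ.*-monoʳ-≤ 2 (/-monoˡ-≤ M S≤)) ⟩
    2 * ∣ S ∣ + 2 * t ≡⟨ cong (λ e → 2 * e + 2 * t) cardS ⟩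
    2 * (∣ I ∣ + ∑ y) + 2 * t ≡⟨ ring ∣ I ∣ (∑ y) t ⟩
    2 * ∣ I ∣ + 2 * t + 2 * ∑ y ≤⟨ ℕ.+-monoʳ-≤ (2 * ∣ I ∣ + 2 * t) 2y≤ ⟩
    2 * ∣ I ∣ + 2 * t + κ ∎)
    where
    ring : ∀ i y t → 2 * (i + y) + 2 * t ≡ 2 * i + 2 * t + 2 * y
    ring = ℕ-solve-∀
   boundary≤ : boundary G I ≤ privates G I + κ
   boundary≤ = ℕ.≤-trans (∑-mono pt) (ℕ.≤-reflexive (trans (∑-+ (λ w → 𝟙 (private? G I w) * k w) (λ w → y w * k w)) (cong (_+ κ) (sym (privates≡ I)))))
    where
    pt : ∀ w → χᶜ I w * k w ≤ 𝟙 (private? G I w) * k w + y w * k w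
    pt w with lookup I w
    ... | true = z≤n
    ... | false = cases (k w)
     where
     cases : ∀ j → 1 * j ≤ 𝟙 (does (j ℕ.≟ 1)) * j + 𝟙 (does (2 ℕ.≤? j)) * j
     cases 0 = z≤n
     cases 1 = s≤s z≤n
     cases (suc (suc j)) = ℕ.≤-refl

  privates-deficit : ∀ {M′} → 2 * (suc d * M′) ≤ M → ∀ I → suc d * ∣ I ∣ ≤ m → M′ * ((d ∸ 2) * ∣ I ∣ ∸ privates G I) ≤ ∣ I ∣
  privates-deficit {M′} h I le = deficit {M′} {suc d} {∣ I ∣} {privates G I} (s≤s z≤n) h (privates≥ I le)

open GrowthOfProcesses

-- Switchings of pairs of edges and their effect on arrival probabilities.

module Switching where

 open Rationals

 private variable
  n k : ℕ

 tr : Fin n → Fin n → Fin n → Fin n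
 tr i j k = if k ≡ᵇ i then j else if k ≡ᵇ j then i else k

 tr-fst : (i j : Fin n) → tr i j i ≡ j
 tr-fst i j rewrite ≡ᵇ-refl i = refl

 tr-snd : (i j : Fin n) → tr i j j ≡ i
 tr-snd i j with j Fin.≟ i
 ... | yes j≡i = j≡i
 ... | no _ rewrite ≡ᵇ-refl j = refl

 tr-other : {i j k : Fin n} → k ≢ i → k ≢ j → tr i j k ≡ k
 tr-other k≢i k≢j rewrite ≢⇒≡ᵇ k≢i | ≢⇒≡ᵇ k≢j = refl

 tr-involutive : (i j k : Fin n) → tr i j (tr i j k) ≡ k
 tr-involutive i j k with k Fin.≟ i
 ... | yes refl = tr-snd i j
 ... | no k≢i with k Fin.≟ j
 ... | yes refl = tr-fst i j
 ... | no k≢j = tr-other k≢i k≢j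

 involution : (σ : Fin n → Fin n) → (∀ x → σ (σ x) ≡ x) → Permutation n n
 involution σ h = permutation σ σ h h

 ∑ℚ-involution : (σ : Fin n → Fin n) → (∀ x → σ (σ x) ≡ x) → ∀ f → ∑ℚ (λ x → f (σ x)) ≡ ∑ℚ f
 ∑ℚ-involution σ h f = sym (∑ℚ-permute f (involution σ h))

 ∑-involution : (σ : Fin n → Fin n) → (∀ x → σ (σ x) ≡ x) → ∀ f → ∑ (λ x → f (σ x)) ≡ ∑ f
 ∑-involution σ h f = ι-injective (trans (ι-∑ (f ∘ σ)) (trans (∑ℚ-involution σ h (ι ∘ f)) (sym (ι-∑ f))))
  where
  ι-injective : ∀ {i j} → ι i ≡ ι j → i ≡ j
  ι-injective e = ℕ.≤-antisym (ι-cancel-≤ (≤-reflexive e)) (ι-cancel-≤ (≤-reflexive (sym e)))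

 mapChoices : (Fin k → Fin n → Fin n) → Vec (Fin n) k → Vec (Fin n) k
 mapChoices σ [] = []
 mapChoices σ (x ∷ c) = σ zero x ∷ mapChoices (σ ∘ suc) c

 lookup-mapChoices : (σ : Fin k → Fin n → Fin n) → ∀ c u → lookup (mapChoices σ c) u ≡ σ u (lookup c u)
 lookup-mapChoices σ (x ∷ c) zero = refl
 lookup-mapChoices σ (x ∷ c) (suc u) = lookup-mapChoices (σ ∘ suc) c u

 module _ (d : ℕ) (1≤d : 1 ℕ.≤ d) where

  open Expectation d 1≤d

  -- Row by row a change of variables: `mapChoices σ` matches the calls possible on one graph with
  -- those on the other, with equal weights.
  Ex-permute : ∀ (W W′ : Vec (Subset n) k) (σ : Fin k → Fin n → Fin n) → (∀ u x → σ u (σ u x) ≡ x) →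
   (∀ u v → lookup (lookup W′ u) v ≡ lookup (lookup W u) (σ u v)) →
   ∀ f → Ex W′ f ≡ Ex W (λ c → f (mapChoices σ c))
  Ex-permute [] [] σ inv h f = refl
  Ex-permute (S ∷ W) (S′ ∷ W′) σ inv h f = trans
   (E₁-cong S′ λ x _ → Ex-permute W W′ (σ ∘ suc) (inv ∘ suc) (h ∘ suc) (λ c → f (x ∷ c)))
   (cong (δ *_) (trans (∑ℚ-cong λ x → cong₂ _*_ (cong indicator (h zero x)) (cong F (sym (inv zero x))))
    (∑ℚ-involution (σ zero) (inv zero) λ x → indicator (lookup S x) * F (σ zero x))))
   where
   F : _ → ℚ
   F x = Ex W (λ c → f (x ∷ mapChoices (σ ∘ suc) c))

  infix 4 _⊑_
  _⊑_ : Subset n → Subset n → Set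
  X ⊑ Y = ∀ x → lookup X x ≡ true → lookup Y x ≡ true

  -- The probability of arriving at the set X only depends on the calls that can occur on the way to X.
  module _ (G G′ : Graph n) (deg : Degrees G) (deg′ : Degrees G′) (next : Round n → Subset n → Subset n)
   (grow : ∀ c J → J ⊑ next c J) (σ : Fin n → Fin n → Fin n) (inv : ∀ u x → σ u (σ u x) ≡ x)
   (rows : ∀ u v → adj G′ u v ≡ adj G u (σ u v)) (X : Subset n)
   (local : ∀ c J → J ⊑ X → next (mapChoices σ c) J ≡ next c J ⊎ (¬ next (mapChoices σ c) J ⊑ X × ¬ next c J ⊑ X)) where

   private
    module K₀ = Kernel G next
    module K₁ = Kernel G′ next
    f : Subset n → ℚ
    f Z = indicator (Z ≡ˢ X)

   ⊑? : (J Y : Subset n) → Dec (J ⊑ Y)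
   ⊑? J Y = Fin.all? λ x → imp (lookup J x) (lookup Y x)
    where
    imp : ∀ a b → Dec (a ≡ true → b ≡ true)
    imp false b = yes λ ()
    imp true true = yes λ _ → refl
    imp true false = no λ h → true≢false (h refl) refl

   outside-zero : (H : Graph n) → Degrees H → ∀ t J → ¬ J ⊑ X → Kernel.Kᵗ H next t f J ≡ 0ℚ
   outside-zero H dH zero J h = cong indicator (false-does (Vec.≡-dec Bool._≟_ J X) λ { refl → h λ _ e → e })
   outside-zero H dH (suc t) J h = trans (Ex-cong H λ c _ → outside-zero H dH t (next c J) λ le → h λ x e → le x (grow c J x e))
    (Ex-const H dH 0ℚ)

   -- A call rerouted by `σ` is harmless if it leads out of `X` on both graphs: sets only grow, so
   -- neither branch ever arrives at `X`.
   arrival-invariant : ∀ t J → K₁.Kᵗ t f J ≡ K₀.Kᵗ t f J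
   arrival-invariant zero J = refl
   arrival-invariant (suc t) J with ⊑? J X
   ... | no ¬J⊑X = trans (outside-zero G′ deg′ (suc t) J ¬J⊑X) (sym (outside-zero G deg (suc t) J ¬J⊑X))
   ... | yes J⊑X = trans (Ex-cong G′ λ c _ → arrival-invariant t (next c J))
    (trans (Ex-permute G G′ σ inv rows (λ c → K₀.Kᵗ t f (next c J))) (Ex-cong G λ c _ → same c (local c J J⊑X)))
    where
    same : ∀ c → _ → K₀.Kᵗ t f (next (mapChoices σ c) J) ≡ K₀.Kᵗ t f (next c J)
    same c (inj₁ e) = cong (K₀.Kᵗ t f) e
    same c (inj₂ (h , l)) = trans (outside-zero G deg t _ h) (sym (outside-zero G deg t _ l))

 -- Replace the edges xx′, yy′ by xy, x′y′. Every row of the adjacency matrix is permuted by a transposition,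
 -- which also translates calls on one graph into calls on the other.
 module Switch (x x′ y y′ : Fin n) where

  τ : Fin n → Fin n → Fin n
  τ u = if u ≡ᵇ x then tr x′ y else if u ≡ᵇ x′ then tr x y′ else if u ≡ᵇ y then tr y′ x else if u ≡ᵇ y′ then tr y x′ else id

  τ-involutive : ∀ u v → τ u (τ u v) ≡ v
  τ-involutive u v with u ≡ᵇ x | u ≡ᵇ x′ | u ≡ᵇ y | u ≡ᵇ y′
  ... | true | _ | _ | _ = tr-involutive x′ y v
  ... | false | true | _ | _ = tr-involutive x y′ v
  ... | false | false | true | _ = tr-involutive y′ x v
  ... | false | false | false | true = tr-involutive y x′ v
  ... | false | false | false | false = refl

  switch : Graph n → Graph n
  switch G = Vec.tabulate λ u → Vec.tabulate λ v → adj G u (τ u v)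

  adj-switch : ∀ G u v → adj (switch G) u v ≡ adj G u (τ u v)
  adj-switch G u v = trans (cong (λ row → lookup row v) (Vec.lookup∘tabulate _ u)) (Vec.lookup∘tabulate _ v)

  graph-ext : {G H : Graph n} → (∀ u v → adj G u v ≡ adj H u v) → G ≡ H
  graph-ext {G} {H} h = trans (sym (Vec.tabulate∘lookup G))
   (trans (Vec.tabulate-cong λ u → subset-ext (h u)) (Vec.tabulate∘lookup H))

  -- True for arbitrary digraphs, because each row is merely permuted. Validity is needed for
  -- symmetry and the absence of loops, but not for the injectivity on which double counting rests.
  switch-involutive : ∀ G → switch (switch G) ≡ G
  switch-involutive G = graph-ext λ u v → trans (adj-switch (switch G) u v)
   (trans (adj-switch G u (τ u v)) (cong (adj G u) (τ-involutive u v)))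

  switch-injective : ∀ {G H} → switch G ≡ switch H → G ≡ H
  switch-injective {G} {H} e = trans (sym (switch-involutive G)) (trans (cong switch e) (switch-involutive H))

  record Valid (G : Graph n) : Set where
   field
    x≢x′ : x ≢ x′
    x≢y : x ≢ y
    x≢y′ : x ≢ y′
    x′≢y : x′ ≢ y
    x′≢y′ : x′ ≢ y′
    y≢y′ : y ≢ y′
    xx′ : adj G x x′ ≡ true
    yy′ : adj G y y′ ≡ true
    xy : adj G x y ≡ false
    x′y′ : adj G x′ y′ ≡ false

  data Special : Fin n → Fin n → Set where
   sxx′ : Special x x′
   sx′x : Special x′ x
   syy′ : Special y y′
   sy′y : Special y′ y
   sxy : Special x y
   syx : Special y x
   sx′y′ : Special x′ y′
   sy′x′ : Special y′ x′

  classify : ∀ u v → Special u v ⊎ τ u v ≡ v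
  classify u v with u Fin.≟ x
  ... | yes refl with v Fin.≟ x′ | v Fin.≟ y
  ... | yes refl | _ = inj₁ sxx′
  ... | no _ | yes refl = inj₁ sxy
  ... | no _ | no _ = inj₂ refl
  classify u v | no _ with u Fin.≟ x′
  ... | yes refl with v Fin.≟ x | v Fin.≟ y′
  ... | yes refl | _ = inj₁ sx′x
  ... | no _ | yes refl = inj₁ sx′y′
  ... | no _ | no _ = inj₂ refl
  classify u v | no _ | no _ with u Fin.≟ y
  ... | yes refl with v Fin.≟ y′ | v Fin.≟ x
  ... | yes refl | _ = inj₁ syy′
  ... | no _ | yes refl = inj₁ syx
  ... | no _ | no _ = inj₂ refl
  classify u v | no _ | no _ | no _ with u Fin.≟ y′
  ... | yes refl with v Fin.≟ y | v Fin.≟ x′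
  ... | yes refl | _ = inj₁ sy′y
  ... | no _ | yes refl = inj₁ sy′x′
  ... | no _ | no _ = inj₂ refl
  classify u v | no _ | no _ | no _ | no _ = inj₂ refl

  module _ {d : ℕ} (G : Graph n) (reg : Regular d G) (valid : Valid G) where

   open Valid valid
   open RegularGraph G reg

   τx : τ x ≡ tr x′ y
   τx rewrite ≡ᵇ-refl x = refl

   τx′ : τ x′ ≡ tr x y′
   τx′ rewrite ≢⇒≡ᵇ (x≢x′ ∘ sym) | ≡ᵇ-refl x′ = refl

   τy : τ y ≡ tr y′ x
   τy rewrite ≢⇒≡ᵇ (x≢y ∘ sym) | ≢⇒≡ᵇ (x′≢y ∘ sym) | ≡ᵇ-refl y = refl

   τy′ : τ y′ ≡ tr y x′
   τy′ rewrite ≢⇒≡ᵇ (x≢y′ ∘ sym) | ≢⇒≡ᵇ (x′≢y′ ∘ sym) | ≢⇒≡ᵇ (y≢y′ ∘ sym) | ≡ᵇ-refl y′ = refl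

   private
    at : ∀ {u v w b} → τ u v ≡ w → adj G u w ≡ b → adj (switch G) u v ≡ b
    at {u} {v} e h = trans (adj-switch G u v) (trans (cong (adj G u) e) h)

   new-xx′ : adj (switch G) x x′ ≡ false
   new-xx′ = at (trans (cong (λ f → f x′) τx) (tr-fst x′ y)) xy
   new-xy : adj (switch G) x y ≡ true
   new-xy = at (trans (cong (λ f → f y) τx) (tr-snd x′ y)) xx′
   new-x′x : adj (switch G) x′ x ≡ false
   new-x′x = at (trans (cong (λ f → f x) τx′) (tr-fst x y′)) x′y′
   new-x′y′ : adj (switch G) x′ y′ ≡ true
   new-x′y′ = at (trans (cong (λ f → f y′) τx′) (tr-snd x y′)) (trans (adj-sym x′ x) xx′)
   new-yy′ : adj (switch G) y y′ ≡ false
   new-yy′ = at (trans (cong (λ f → f y′) τy) (tr-fst y′ x)) (trans (adj-sym y x) xy)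
   new-yx : adj (switch G) y x ≡ true
   new-yx = at (trans (cong (λ f → f x) τy) (tr-snd y′ x)) yy′
   new-y′y : adj (switch G) y′ y ≡ false
   new-y′y = at (trans (cong (λ f → f y) τy′) (tr-fst y x′)) (trans (adj-sym y′ x′) x′y′)
   new-y′x′ : adj (switch G) y′ x′ ≡ true
   new-y′x′ = at (trans (cong (λ f → f x′) τy′) (tr-snd y x′)) (trans (adj-sym y′ y) yy′)

   unchanged : ∀ {u v} → τ u v ≡ v → adj (switch G) u v ≡ adj G u v
   unchanged e = at e refl

   switch-sym : ∀ u v → adj (switch G) u v ≡ true → adj (switch G) v u ≡ true
   switch-sym u v h with classify u v | classify v u
   ... | inj₂ e | inj₂ e′ = trans (unchanged e′) (trans (adj-sym v u) (trans (sym (unchanged e)) h))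
   ... | inj₁ s | _ = special s h
    where
    special : ∀ {u v} → Special u v → adj (switch G) u v ≡ true → adj (switch G) v u ≡ true
    special sxx′ h = true≢false h new-xx′
    special sx′x h = true≢false h new-x′x
    special syy′ h = true≢false h new-yy′
    special sy′y h = true≢false h new-y′y
    special sxy _ = new-yx
    special syx _ = new-xy
    special sx′y′ _ = new-y′x′
    special sy′x′ _ = new-x′y′
   ... | inj₂ e | inj₁ s = back-special s h
    where
    back-special : ∀ {u v} → Special v u → adj (switch G) u v ≡ true → adj (switch G) v u ≡ true
    back-special sxx′ h = true≢false h new-x′x
    back-special sx′x h = true≢false h new-xx′
    back-special syy′ h = true≢false h new-y′y
    back-special sy′y h = true≢false h new-yy′
    back-special sxy _ = new-xy
    back-special syx _ = new-yx
    back-special sx′y′ _ = new-x′y′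
    back-special sy′x′ _ = new-y′x′

   switch-irrefl : ∀ u → adj (switch G) u u ≡ false
   switch-irrefl u with classify u u
   ... | inj₂ e = trans (unchanged e) (adj-irrefl u)
   ... | inj₁ s = contradiction refl (distinct s)
    where
    distinct : ∀ {u v} → Special u v → u ≢ v
    distinct sxx′ = x≢x′
    distinct sx′x = x≢x′ ∘ sym
    distinct syy′ = y≢y′
    distinct sy′y = y≢y′ ∘ sym
    distinct sxy = x≢y
    distinct syx = x≢y ∘ sym
    distinct sx′y′ = x′≢y′
    distinct sy′x′ = x′≢y′ ∘ sym

   switch-degrees : ∀ u → ∣ lookup (switch G) u ∣ ≡ d
   switch-degrees u = trans (card≡∑ (lookup (switch G) u)) (trans (∑-cong λ v → cong 𝟙 (adj-switch G u v))
    (trans (∑-involution (τ u) (τ-involutive u) (λ v → a G u v)) (∑a u)))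

   switch-regular : Regular d (switch G)
   switch-regular = mkRegular (switch G) switch-sym switch-irrefl switch-degrees

 module _ (n d : ℕ) where

  private
   rows = product (Vec.replicate n sides)
   graphs = Vec.replicate n rows

  regularGraphs-unique : Unique (regularGraphs n d)
  regularGraphs-unique = Unique.filter⁺ (regular? d) (product-unique graphs
   λ i → subst Unique (sym (Vec.lookup-replicate i rows)) (allSubsets-unique n))

  regularGraphs-complete : ∀ {G} → Regular d G → G ∈ regularGraphs n d
  regularGraphs-complete {G} reg = ∈-filter⁺ (regular? d) (product-complete graphs G
   λ i → subst (lookup G i ∈_) (sym (Vec.lookup-replicate i rows)) (allSubsets-complete (lookup G i))) reg

  regularGraphs-sound : ∀ {G} → G ∈ regularGraphs n d → Regular d G
  regularGraphs-sound G∈ = proj₂ (∈-filter⁻ (regular? d) {xs = product graphs} G∈)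

  private
   L = regularGraphs n d

  Σ-∑-mono : ∀ {m} {f g : Graph n → ℚ} {h k : Graph n → Fin m → ℕ} →
   (∀ i → Σ (λ G → f G * ι (h G i)) L ≤ Σ (λ G → g G * ι (k G i)) L) →
   Σ (λ G → f G * ι (∑ (h G))) L ≤ Σ (λ G → g G * ι (∑ (k G))) L
  Σ-∑-mono {f = f} {g} {h} {k} le = subst₂ _≤_ (sym (expand f h)) (sym (expand g k)) (∑ℚ-mono le)
   where
   expand : ∀ (f : Graph n → ℚ) (h : Graph n → Fin _ → ℕ) →
    Σ (λ G → f G * ι (∑ (h G))) L ≡ ∑ℚ (λ i → Σ (λ G → f G * ι (h G i)) L)
   expand f h = trans (Σ-cong (λ G → trans (cong (f G *_) (ι-∑ (h G))) (*-distribˡ-∑ℚ (f G) (λ i → ι (h G i)))) L)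
    (Σ-∑-swap (λ G i → f G * ι (h G i)) L)

  -- For a fixed quadruple the switch is injective on graphs, so weights can be compared one
  -- quadruple at a time. Summed over quadruples this compares the number `V` of ways forward with
  -- the number `W` of ways back.
  double-count : {f g : Graph n → ℚ} {V W : Graph n → Fin n → Fin n → Fin n → Fin n → Bool} →
   (∀ G → 0ℚ ≤ g G) →
   (∀ G x x′ y y′ → Regular d G → V G x x′ y y′ ≡ true → let open Switch x x′ y y′ in
    f G ≤ 0ℚ ⊎ (Regular d (switch G) × W (switch G) x x′ y y′ ≡ true × f G ≤ g (switch G))) →
   Σ (λ G → f G * ι (∑ λ x → ∑ λ x′ → ∑ λ y → ∑ λ y′ → 𝟙 (V G x x′ y y′))) L ≤
   Σ (λ G → g G * ι (∑ λ x → ∑ λ x′ → ∑ λ y → ∑ λ y′ → 𝟙 (W G x x′ y y′))) L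
  double-count {f} {g} {V} {W} 0≤g h =
   Σ-∑-mono {f = f} {g} {h = λ G x → ∑ λ x′ → ∑ λ y → ∑ λ y′ → 𝟙 (V G x x′ y y′)} {k = λ G x → ∑ λ x′ → ∑ λ y → ∑ λ y′ → 𝟙 (W G x x′ y y′)} λ x →
   Σ-∑-mono {f = f} {g} {h = λ G x′ → ∑ λ y → ∑ λ y′ → 𝟙 (V G x x′ y y′)} {k = λ G x′ → ∑ λ y → ∑ λ y′ → 𝟙 (W G x x′ y y′)} λ x′ →
   Σ-∑-mono {f = f} {g} {h = λ G y → ∑ λ y′ → 𝟙 (V G x x′ y y′)} {k = λ G y → ∑ λ y′ → 𝟙 (W G x x′ y y′)} λ y →
   Σ-∑-mono {f = f} {g} {h = λ G y′ → 𝟙 (V G x x′ y y′)} {k = λ G y′ → 𝟙 (W G x x′ y y′)} λ y′ →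
    Σ-injection regularGraphs-unique {f = λ G → f G * ι (𝟙 (V G x x′ y y′))} {g = λ G → g G * ι (𝟙 (W G x x′ y y′))}
     (Switch.switch x x′ y y′) (Switch.switch-injective x x′ y y′)
     (λ G → *-nonNeg (0≤g G) (0≤ι (𝟙 (W G x x′ y y′)))) λ G G∈ → point G (regularGraphs-sound G∈) x x′ y y′
   where
   point : ∀ G → Regular d G → ∀ x x′ y y′ → let open Switch x x′ y y′ in f G * ι (𝟙 (V G x x′ y y′)) ≤ 0ℚ ⊎
    (switch G ∈ L × f G * ι (𝟙 (V G x x′ y y′)) ≤ g (switch G) * ι (𝟙 (W (switch G) x x′ y y′)))
   point G reg x x′ y y′ with V G x x′ y y′ in e
   ... | false = inj₁ (≤-reflexive (trans (cong (f G *_) ι-0) (*-zeroʳ (f G))))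
   ... | true with h G x x′ y y′ reg e
   ... | inj₁ f≤0 = inj₁ (subst (_≤ 0ℚ) (sym (trans (cong (f G *_) ι-1) (*-identityʳ (f G)))) f≤0)
   ... | inj₂ (reg′ , w , le) = inj₂ (regularGraphs-complete reg′ , subst₂ _≤_ (sym (trans (cong (f G *_) ι-1) (*-identityʳ (f G))))
    (sym (trans (cong (λ b → g (Switch.switch x x′ y y′ G) * ι (𝟙 b)) w) (trans (cong (g (Switch.switch x x′ y y′ G) *_) ι-1) (*-identityʳ _)))) le)

open SparseGraphs

open Switching

-- The counting behind sparsity: a union bound over sets, and switchings that take an edge out of a
-- set.

module SparsityIsTypical where

 module Enumeration where

  open import Data.Nat.Base using (_+_; _*_; _^_; _!; _≤_; _<_; _∸_; z≤n; s≤s)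
  open ℕ.≤-Reasoning

  rising : ℕ → ℕ → ℕ
  rising s zero = 1
  rising s (suc i) = (s + suc i) * rising s i

  rising-shift : ∀ s i → rising s (suc i) ≡ suc s * rising (suc s) i
  rising-shift s zero = cong (_* 1) (ℕ.+-comm s 1)
  rising-shift s (suc i) = trans (cong ((s + suc (suc i)) *_) (rising-shift s i))
   (trans (reorder (s + suc (suc i)) (suc s) (rising (suc s) i)) (cong (λ e → suc s * (e * rising (suc s) i)) (ℕ.+-suc s (suc i))))
   where
   reorder : ∀ a b c → a * (b * c) ≡ b * (a * c)
   reorder = ℕ-solve-∀

  -- Pascal's rule for rising s i / i! = (s+i choose i).
  rising≤ : ∀ s i → rising s i ≤ i ! * 2 ^ (s + i)
  rising≤ s zero = ℕ.≤-trans (ℕ.m^n>0 2 (s + 0)) (ℕ.≤-reflexive (sym (ℕ.+-identityʳ _)))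
  rising≤ zero (suc i) = begin
   suc i * rising 0 i ≤⟨ ℕ.*-monoʳ-≤ (suc i) (rising≤ zero i) ⟩
   suc i * (i ! * 2 ^ i) ≡⟨ sym (ℕ.*-assoc (suc i) (i !) (2 ^ i)) ⟩
   suc i ! * 2 ^ i ≤⟨ ℕ.*-monoʳ-≤ (suc i !) (ℕ.m≤m+n (2 ^ i) _) ⟩
   suc i ! * 2 ^ suc i ∎
  rising≤ (suc s) (suc i) = begin
   (suc s + suc i) * rising (suc s) i ≡⟨ ℕ.*-distribʳ-+ (rising (suc s) i) (suc s) (suc i) ⟩
   suc s * rising (suc s) i + suc i * rising (suc s) i ≡⟨ cong (_+ suc i * rising (suc s) i) (sym (rising-shift s i)) ⟩
   rising s (suc i) + suc i * rising (suc s) i ≤⟨ ℕ.+-mono-≤ (rising≤ s (suc i)) (ℕ.*-monoʳ-≤ (suc i) (rising≤ (suc s) i)) ⟩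
   suc i ! * 2 ^ (s + suc i) + suc i * (i ! * 2 ^ (suc s + i))
    ≡⟨ cong₂ (λ e f → suc i ! * 2 ^ e + f) (ℕ.+-suc s i) (sym (ℕ.*-assoc (suc i) (i !) (2 ^ (suc s + i)))) ⟩
   suc i ! * 2 ^ suc (s + i) + suc i ! * 2 ^ suc (s + i) ≡⟨ double (suc i !) (2 ^ suc (s + i)) ⟩
   suc i ! * (2 * 2 ^ suc (s + i)) ≡⟨ cong (λ e → suc i ! * (2 * 2 ^ e)) (sym (ℕ.+-suc s i)) ⟩
   suc i ! * 2 ^ (suc s + suc i) ∎
   where
   double : ∀ a b → a * b + a * b ≡ a * (2 * b)
   double = ℕ-solve-∀

  ^≤rising : ∀ s i → s ^ i ≤ rising s i
  ^≤rising s zero = ℕ.≤-refl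
  ^≤rising s (suc i) = ℕ.*-mono-≤ (ℕ.m≤m+n s (suc i)) (^≤rising s i)

  -- A substitute for Stirling's formula: `s ^ i / i !` is at most the binomial coefficient `s + i`
  -- over `i`.
  ^≤! : ∀ s i → s ^ i ≤ i ! * 2 ^ (s + i)
  ^≤! s i = ℕ.≤-trans (^≤rising s i) (rising≤ s i)

  binomial-two : ∀ n s → suc s * n ^ s + n ^ suc s ≤ suc n ^ suc s
  binomial-two n zero = ℕ.≤-reflexive (solve₁ n)
   where
   solve₁ : ∀ n → 1 + n * 1 ≡ suc n * 1
   solve₁ n = sym refl
  binomial-two n (suc s) = begin
   suc (suc s) * n ^ suc s + n ^ suc (suc s) ≤⟨ ℕ.m≤m+n _ (suc s * n ^ s) ⟩
   suc (suc s) * n ^ suc s + n ^ suc (suc s) + suc s * n ^ s ≡⟨ ring n s (n ^ s) ⟩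
   suc n * (suc s * n ^ s + n ^ suc s) ≤⟨ ℕ.*-monoʳ-≤ (suc n) (binomial-two n s) ⟩
   suc n ^ suc (suc s) ∎
   where
   ring : ∀ n s p → suc (suc s) * (n * p) + n * (n * p) + suc s * p ≡ suc n * (suc s * p + n * p)
   ring = ℕ-solve-∀

  ^-distribʳ-* : ∀ m n k → (m * n) ^ k ≡ m ^ k * n ^ k
  ^-distribʳ-* m n zero = refl
  ^-distribʳ-* m n (suc k) = trans (cong (m * n *_) (^-distribʳ-* m n k)) (reorder m n (m ^ k) (n ^ k))
   where
   reorder : ∀ a b c d → a * b * (c * d) ≡ a * c * (b * d)
   reorder = ℕ-solve-∀

  -- `n ^ s / s !` bounds the number of sets of size `s`, and `(2ds²/n) ^ i / i !` with `i = s + k`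
  -- the probability that one of them spans `i` edges. The factorials, together with the reserve
  -- `2 ^ s` that later makes the sum over `s` converge, cost `(64d) ^ s`, which is at most
  -- `2 ^ (hMk)` because `s ≤ Mk`. Each of the `k` excess edges pays with a factor `4ds/n`.
  union-bound : ∀ d h M n s k → 64 * d ≤ 2 ^ h → 1 ≤ k → s ≤ M * k → 4 * d * s * 2 ^ (2 * (h * M)) ≤ n →
   n ^ s * (2 * d * (s * s)) ^ (s + k) * (2 ^ s * 2 ^ (h * M)) ≤ s ! * ((s + k) ! * n ^ (s + k))
  union-bound d h M n s k hd 1≤k sMk hn = begin
   n ^ s * (2 * d * (s * s)) ^ i * (2 ^ s * H)
    ≡⟨ cong (λ e → n ^ s * e * (2 ^ s * H)) (trans (^-distribʳ-* (2 * d) (s * s) i) (cong₂ _*_ (ℕ.^-distribˡ-+-* (2 * d) s k) (^-distribʳ-* s s i))) ⟩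
   n ^ s * ((2 * d) ^ s * (2 * d) ^ k * (s ^ i * s ^ i)) * (2 ^ s * H)
    ≤⟨ ℕ.*-monoˡ-≤ (2 ^ s * H) (ℕ.*-monoʳ-≤ (n ^ s) (ℕ.*-monoʳ-≤ ((2 * d) ^ s * (2 * d) ^ k) (ℕ.*-mono-≤ (^≤! s i)
       (ℕ.≤-trans (ℕ.≤-reflexive (ℕ.^-distribˡ-+-* s s k)) (ℕ.*-monoˡ-≤ (s ^ k) (^≤! s s)))))) ⟩
   n ^ s * ((2 * d) ^ s * (2 * d) ^ k * (i ! * 2 ^ (s + i) * (s ! * 2 ^ (s + s) * s ^ k))) * (2 ^ s * H)
    ≡⟨ cong₂ (λ e f → n ^ s * ((2 * d) ^ s * (2 * d) ^ k * (i ! * e * (s ! * f * s ^ k))) * (2 ^ s * H)) pow₁ (ℕ.^-distribˡ-+-* 2 s s) ⟩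
   n ^ s * ((2 * d) ^ s * (2 * d) ^ k * (i ! * (2 ^ s * 2 ^ s * 2 ^ k) * (s ! * (2 ^ s * 2 ^ s) * s ^ k))) * (2 ^ s * H)
    ≡⟨ ring (n ^ s) ((2 * d) ^ s) ((2 * d) ^ k) (i !) (2 ^ s) (2 ^ k) (s !) (s ^ k) H ⟩
   s ! * (i ! * n ^ s) * ((2 * d) ^ s * (2 ^ s * 2 ^ s * (2 ^ s * 2 ^ s * 2 ^ s)) * H * ((2 * d) ^ k * 2 ^ k * s ^ k))
    ≡⟨ cong₂ (λ e f → s ! * (i ! * n ^ s) * (e * H * f)) pow₂ pow₃ ⟩
   s ! * (i ! * n ^ s) * ((64 * d) ^ s * H * (4 * d * s) ^ k)
    ≤⟨ ℕ.*-monoʳ-≤ (s ! * (i ! * n ^ s)) (ℕ.*-monoˡ-≤ ((4 * d * s) ^ k) (ℕ.*-mono-≤ left right)) ⟩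
   s ! * (i ! * n ^ s) * (H ^ k * H ^ k * (4 * d * s) ^ k)
    ≡⟨ cong (s ! * (i ! * n ^ s) *_) (trans (cong (_* (4 * d * s) ^ k) (sym (^-distribʳ-* H H k))) (trans (sym (^-distribʳ-* (H * H) (4 * d * s) k)) (cong (_^ k) (trans (ℕ.*-comm (H * H) _) (cong (4 * d * s *_) HH))))) ⟩
   s ! * (i ! * n ^ s) * (4 * d * s * 2 ^ (2 * (h * M))) ^ k
    ≤⟨ ℕ.*-monoʳ-≤ (s ! * (i ! * n ^ s)) (ℕ.^-monoˡ-≤ k hn) ⟩
   s ! * (i ! * n ^ s) * n ^ k
    ≡⟨ trans (assoc (s !) (i !) (n ^ s) (n ^ k)) (cong (λ e → s ! * (i ! * e)) (sym (ℕ.^-distribˡ-+-* n s k))) ⟩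
   s ! * (i ! * n ^ i) ∎
   where
   i = s + k
   H = 2 ^ (h * M)
   pow₁ : 2 ^ (s + i) ≡ 2 ^ s * 2 ^ s * 2 ^ k
   pow₁ = trans (ℕ.^-distribˡ-+-* 2 s i) (trans (cong (2 ^ s *_) (ℕ.^-distribˡ-+-* 2 s k)) (sym (ℕ.*-assoc (2 ^ s) (2 ^ s) (2 ^ k))))
   pow₂ : (2 * d) ^ s * (2 ^ s * 2 ^ s * (2 ^ s * 2 ^ s * 2 ^ s)) ≡ (64 * d) ^ s
   pow₂ = trans (cong ((2 * d) ^ s *_) (sym (trans (^-distribʳ-* 4 8 s) (cong₂ _*_ (^-distribʳ-* 2 2 s) (trans (^-distribʳ-* 4 2 s) (cong (_* 2 ^ s) (^-distribʳ-* 2 2 s)))))))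
    (trans (sym (^-distribʳ-* (2 * d) 32 s)) (cong (_^ s) (num d)))
    where
    num : ∀ d → 2 * d * 32 ≡ 64 * d
    num = ℕ-solve-∀
   pow₃ : (2 * d) ^ k * 2 ^ k * s ^ k ≡ (4 * d * s) ^ k
   pow₃ = trans (cong (_* s ^ k) (sym (^-distribʳ-* (2 * d) 2 k))) (trans (sym (^-distribʳ-* (2 * d * 2) s k)) (cong (_^ k) (num d s)))
    where
    num : ∀ d s → 2 * d * 2 * s ≡ 4 * d * s
    num = ℕ-solve-∀
   HH : H * H ≡ 2 ^ (2 * (h * M))
   HH = trans (sym (ℕ.^-distribˡ-+-* 2 (h * M) (h * M))) (cong (λ e → 2 ^ (h * M + e)) (sym (ℕ.+-identityʳ (h * M))))
   left : (64 * d) ^ s ≤ H ^ k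
   left = begin
    (64 * d) ^ s ≤⟨ ℕ.^-monoˡ-≤ s hd ⟩
    (2 ^ h) ^ s ≡⟨ ℕ.^-*-assoc 2 h s ⟩
    2 ^ (h * s) ≤⟨ ℕ.^-monoʳ-≤ 2 (ℕ.*-monoʳ-≤ h sMk) ⟩
    2 ^ (h * (M * k)) ≡⟨ trans (cong (2 ^_) (sym (ℕ.*-assoc h M k))) (sym (ℕ.^-*-assoc 2 (h * M) k)) ⟩
    H ^ k ∎
   right : H ≤ H ^ k
   right = ℕ.≤-trans (ℕ.≤-reflexive (sym (ℕ.^-identityʳ H))) (ℕ.^-monoʳ-≤ H {{ℕ.>-nonZero (ℕ.m^n>0 2 (h * M))}} 1≤k)
   ring : ∀ N A B F T U S P H → N * (A * B * (F * (T * T * U) * (S * (T * T) * P))) * (T * H)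
    ≡ S * (F * N) * (A * (T * T * (T * T * T)) * H * (B * U * P))
   ring = ℕ-solve-∀
   assoc : ∀ a b c e → a * (b * c) * e ≡ a * (b * (c * e))
   assoc = ℕ-solve-∀

 module EdgeCounts {n d : ℕ} (S : Subset n) where

  open import Data.Nat.Base using (_+_; _*_; _≤_; _<_; _∸_; z≤n; s≤s)
  open ℕ.≤-Reasoning

  s : ℕ
  s = ∣ S ∣

  -- `V` describes the switchings that destroy an edge `xx′` inside `S`. Of the result `W` records
  -- only the new edges at `x` and `x′`, which suffices to bound the number of ways back.
  V W : Graph n → Fin n → Fin n → Fin n → Fin n → Bool
  V G x x′ y y′ = (lookup S x ∧ (lookup S x′ ∧ adj G x x′)) ∧
   ((not (lookup S y) ∧ (not (lookup S y′) ∧ adj G y y′)) ∧ (not (adj G x y) ∧ not (adj G x′ y′)))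
  W G x x′ y y′ = (lookup S x ∧ adj G x y) ∧ (lookup S x′ ∧ adj G x′ y′)

  decode : ∀ a b c d e f g h → (a ∧ (b ∧ c)) ∧ ((not d ∧ (not e ∧ f)) ∧ (not g ∧ not h)) ≡ true →
   a ≡ true × b ≡ true × c ≡ true × d ≡ false × e ≡ false × f ≡ true × g ≡ false × h ≡ false
  decode true true true false false true false false refl = refl , refl , refl , refl , refl , refl , refl , refl

  ∑∑-* : ∀ {k l} (f : Fin k → ℕ) (g : Fin l → ℕ) → ∑ (λ i → ∑ (λ j → f i * g j)) ≡ ∑ f * ∑ g
  ∑∑-* f g = trans (∑-cong λ i → sym (*-distribˡ-∑ (f i) g)) (sym (*-distribʳ-∑ (∑ g) f))

  module _ (G : Graph n) (reg : Regular d G) where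

   open RegularGraph G reg

   inner : Fin n → Fin n → ℕ
   inner x x′ = ∑ λ y → ∑ λ y′ → 𝟙 ((not (lookup S y) ∧ (not (lookup S y′) ∧ adj G y y′)) ∧ (not (adj G x y) ∧ not (adj G x′ y′)))

   ∑χdeg : ∑ (λ y → χ S y * ∑ (a G y)) ≡ d * s
   ∑χdeg = trans (∑-cong λ y → trans (cong (χ S y *_) (∑a y)) (ℕ.*-comm (χ S y) d))
    (trans (sym (*-distribˡ-∑ d (χ S))) (cong (d *_) (sym (card≡∑ S))))

   ∑adeg : ∀ x → ∑ (λ y → a G x y * ∑ (a G y)) ≡ d * d
   ∑adeg x = trans (∑-cong λ y → trans (cong (a G x y *_) (∑a y)) (ℕ.*-comm (a G x y) d))
    (trans (sym (*-distribˡ-∑ d (a G x))) (cong (d *_) (∑a x)))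

   inner≥ : ∀ x x′ → d * n ≤ inner x x′ + (d * s + d * s + (d * d + d * d))
   inner≥ x x′ = begin
    d * n
     ≡⟨ trans (ℕ.*-comm d n) (sym (trans (∑-cong ∑a) (∑-const n d))) ⟩
    ∑ (λ y → ∑ (λ y′ → a G y y′))
     ≤⟨ ∑-mono (λ y → ∑-mono λ y′ → bool (lookup S y) (lookup S y′) (adj G y y′) (adj G x y) (adj G x′ y′)) ⟩
    ∑ (λ y → ∑ (λ y′ → i y y′ + ((χ S y * a G y y′ + χ S y′ * a G y y′) + (a G x y * a G y y′ + a G x′ y′ * a G y y′))))
     ≡⟨ ∑-cong (λ y → trans (∑-+ (i y) _) (cong (∑ (i y) +_) (trans (∑-+ (λ y′ → χ S y * a G y y′ + χ S y′ * a G y y′) _)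
        (cong₂ _+_ (∑-+ (λ y′ → χ S y * a G y y′) (λ y′ → χ S y′ * a G y y′)) (∑-+ (λ y′ → a G x y * a G y y′) (λ y′ → a G x′ y′ * a G y y′)))))) ⟩
    ∑ (λ y → ∑ (i y) + ((∑ (λ y′ → χ S y * a G y y′) + ∑ (λ y′ → χ S y′ * a G y y′)) + (∑ (λ y′ → a G x y * a G y y′) + ∑ (λ y′ → a G x′ y′ * a G y y′))))
     ≡⟨ trans (∑-+ (λ y → ∑ (i y)) _) (cong (inner x x′ +_) (trans (∑-+ (λ y → ∑ (λ y′ → χ S y * a G y y′) + ∑ (λ y′ → χ S y′ * a G y y′)) _)
        (cong₂ _+_ (∑-+ (λ y → ∑ (λ y′ → χ S y * a G y y′)) _) (∑-+ (λ y → ∑ (λ y′ → a G x y * a G y y′)) _)))) ⟩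
    inner x x′ + ((∑ (λ y → ∑ (λ y′ → χ S y * a G y y′)) + ∑ (λ y → ∑ (λ y′ → χ S y′ * a G y y′))) +
     (∑ (λ y → ∑ (λ y′ → a G x y * a G y y′)) + ∑ (λ y → ∑ (λ y′ → a G x′ y′ * a G y y′))))
     ≡⟨ cong (inner x x′ +_) (cong₂ _+_ (cong₂ _+_ (fst (χ S) ∑χdeg) (snd (χ S) ∑χdeg)) (cong₂ _+_ (fst (a G x) (∑adeg x)) (snd (a G x′) (∑adeg x′)))) ⟩
    inner x x′ + (d * s + d * s + (d * d + d * d)) ∎
    where
    i : Fin n → Fin n → ℕ
    i y y′ = 𝟙 ((not (lookup S y) ∧ (not (lookup S y′) ∧ adj G y y′)) ∧ (not (adj G x y) ∧ not (adj G x′ y′)))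
    bool : ∀ s t b e f → 𝟙 b ≤ 𝟙 ((not s ∧ (not t ∧ b)) ∧ (not e ∧ not f)) + ((𝟙 s * 𝟙 b + 𝟙 t * 𝟙 b) + (𝟙 e * 𝟙 b + 𝟙 f * 𝟙 b))
    bool s t false e f = z≤n
    bool true t true e f = ℕ.≤-trans (s≤s z≤n) (ℕ.m≤n+m _ 0)
    bool false true true e f = s≤s z≤n
    bool false false true true f = s≤s z≤n
    bool false false true false true = s≤s z≤n
    bool false false true false false = s≤s z≤n
    fst : ∀ (w : Fin n → ℕ) {k} → ∑ (λ y → w y * ∑ (a G y)) ≡ k → ∑ (λ y → ∑ (λ y′ → w y * a G y y′)) ≡ k
    fst w e = trans (∑-cong λ y → sym (*-distribˡ-∑ (w y) (a G y))) e
    snd : ∀ (w : Fin n → ℕ) {k} → ∑ (λ y → w y * ∑ (a G y)) ≡ k → ∑ (λ y → ∑ (λ y′ → w y′ * a G y y′)) ≡ k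
    snd w e = trans (∑-swap (λ y y′ → w y′ * a G y y′)) (trans (∑-cong λ y′ → ∑-cong λ y → cong (w y′ *_) (a-sym y y′)) (fst w e))

   -- Of the `dn` ordered edges `yy′`, at most `2ds` touch `S` and at most `2d²` start at a
   -- neighbour of `x` or end at a neighbour of `x′`. By `small` at least half of them remain.
   V-count : 4 * s + 4 * d ≤ n → e₂ G S * (d * n) ≤ 2 * ∑ (λ x → ∑ λ x′ → ∑ λ y → ∑ λ y′ → 𝟙 (V G x x′ y y′))
   V-count small = begin
    e₂ G S * (d * n)
     ≡⟨ cong (_* (d * n)) (∑-cong λ x → trans (*-distribˡ-∑ (χ S x) (λ v → χ S v * a G x v)) (∑-cong λ x′ → sym (p x x′))) ⟩
    ∑ (λ x → ∑ (λ x′ → P x x′)) * (d * n)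
     ≡⟨ trans (*-distribʳ-∑ (d * n) (λ x → ∑ (P x))) (∑-cong λ x → *-distribʳ-∑ (d * n) (P x)) ⟩
    ∑ (λ x → ∑ (λ x′ → P x x′ * (d * n)))
     ≤⟨ ∑-mono (λ x → ∑-mono λ x′ → ℕ.≤-trans (ℕ.*-monoʳ-≤ (P x x′) (half x x′)) (ℕ.≤-reflexive (reorder (P x x′) (inner x x′)))) ⟩
    ∑ (λ x → ∑ (λ x′ → 2 * (P x x′ * inner x x′)))
     ≡⟨ trans (∑-cong λ x → sym (*-distribˡ-∑ 2 (λ x′ → P x x′ * inner x x′))) (sym (*-distribˡ-∑ 2 (λ x → ∑ (λ x′ → P x x′ * inner x x′)))) ⟩
    2 * ∑ (λ x → ∑ (λ x′ → P x x′ * inner x x′))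
     ≡⟨ cong (2 *_) (∑-cong λ x → ∑-cong λ x′ → trans (*-distribˡ-∑ (P x x′) (λ y → ∑ (Q x x′ y))) (∑-cong λ y → trans (*-distribˡ-∑ (P x x′) (Q x x′ y))
        (∑-cong λ y′ → sym (𝟙-∧ (lookup S x ∧ (lookup S x′ ∧ adj G x x′)) ((not (lookup S y) ∧ (not (lookup S y′) ∧ adj G y y′)) ∧ (not (adj G x y) ∧ not (adj G x′ y′))))))) ⟩
    2 * ∑ (λ x → ∑ λ x′ → ∑ λ y → ∑ λ y′ → 𝟙 (V G x x′ y y′)) ∎
    where
    P : Fin n → Fin n → ℕ
    P x x′ = 𝟙 (lookup S x ∧ (lookup S x′ ∧ adj G x x′))
    Q : Fin n → Fin n → Fin n → Fin n → ℕ
    Q x x′ y y′ = 𝟙 ((not (lookup S y) ∧ (not (lookup S y′) ∧ adj G y y′)) ∧ (not (adj G x y) ∧ not (adj G x′ y′)))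
    p : ∀ x x′ → P x x′ ≡ χ S x * (χ S x′ * a G x x′)
    p x x′ = trans (𝟙-∧ (lookup S x) (lookup S x′ ∧ adj G x x′)) (cong (χ S x *_) (𝟙-∧ (lookup S x′) (adj G x x′)))
    reorder : ∀ a b → a * (2 * b) ≡ 2 * (a * b)
    reorder = ℕ-solve-∀
    half : ∀ x x′ → d * n ≤ 2 * inner x x′
    half x x′ = ℕ.+-cancelʳ-≤ (d * n) _ _ (begin
     d * n + d * n ≤⟨ ℕ.+-mono-≤ (inner≥ x x′) (inner≥ x x′) ⟩
     (inner x x′ + (d * s + d * s + (d * d + d * d))) + (inner x x′ + (d * s + d * s + (d * d + d * d)))
                                        ≡⟨ ring (inner x x′) d s ⟩
     2 * inner x x′ + d * (4 * s + 4 * d) ≤⟨ ℕ.+-monoʳ-≤ (2 * inner x x′) (ℕ.*-monoʳ-≤ d small) ⟩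
     2 * inner x x′ + d * n ∎)
     where
     ring : ∀ i d s → (i + (d * s + d * s + (d * d + d * d))) + (i + (d * s + d * s + (d * d + d * d))) ≡ 2 * i + d * (4 * s + 4 * d)
     ring = ℕ-solve-∀

   W-count : ∑ (λ x → ∑ λ x′ → ∑ λ y → ∑ λ y′ → 𝟙 (W G x x′ y y′)) ≡ d * s * (d * s)
   W-count = begin-equality
    ∑ (λ x → ∑ λ x′ → ∑ λ y → ∑ λ y′ → 𝟙 (W G x x′ y y′))
     ≡⟨ ∑-cong (λ x → ∑-cong λ x′ → trans (∑-cong λ y → ∑-cong λ y′ → trans (𝟙-∧ (lookup S x ∧ adj G x y) (lookup S x′ ∧ adj G x′ y′)) (cong₂ _*_ (𝟙-∧ (lookup S x) (adj G x y)) (𝟙-∧ (lookup S x′) (adj G x′ y′))))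
        (∑∑-* (λ y → χ S x * a G x y) (λ y′ → χ S x′ * a G x′ y′))) ⟩
    ∑ (λ x → ∑ λ x′ → ∑ (λ y → χ S x * a G x y) * ∑ (λ y′ → χ S x′ * a G x′ y′))
     ≡⟨ ∑∑-* (λ x → ∑ (λ y → χ S x * a G x y)) (λ x′ → ∑ (λ y′ → χ S x′ * a G x′ y′)) ⟩
    ∑ (λ x → ∑ (λ y → χ S x * a G x y)) * ∑ (λ x → ∑ (λ y → χ S x * a G x y))
     ≡⟨ cong₂ _*_ ds ds ⟩
    d * s * (d * s) ∎
    where
    ds : ∑ (λ x → ∑ (λ y → χ S x * a G x y)) ≡ d * s
    ds = trans (∑-cong λ x → sym (*-distribˡ-∑ (χ S x) (a G x))) ∑χdeg

   module _ (x x′ y y′ : Fin n) (v : V G x x′ y y′ ≡ true) where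

    open Switch x x′ y y′

    private
     facts = decode (lookup S x) (lookup S x′) (adj G x x′) (lookup S y) (lookup S y′) (adj G y y′) (adj G x y) (adj G x′ y′) v

    x∈ : lookup S x ≡ true
    x∈ = proj₁ facts
    x′∈ : lookup S x′ ≡ true
    x′∈ = proj₁ (proj₂ facts)
    e-xx′ : adj G x x′ ≡ true
    e-xx′ = proj₁ (proj₂ (proj₂ facts))
    y∉ : lookup S y ≡ false
    y∉ = proj₁ (proj₂ (proj₂ (proj₂ facts)))
    y′∉ : lookup S y′ ≡ false
    y′∉ = proj₁ (proj₂ (proj₂ (proj₂ (proj₂ facts))))
    e-yy′ : adj G y y′ ≡ true
    e-yy′ = proj₁ (proj₂ (proj₂ (proj₂ (proj₂ (proj₂ facts)))))

    differ : ∀ {u w} → lookup S u ≡ true → lookup S w ≡ false → u ≢ w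
    differ h h′ refl = true≢false h h′

    valid : Valid G
    valid = record
     { x≢x′ = λ { refl → true≢false e-xx′ (adj-irrefl x) }
     ; x≢y = differ x∈ y∉ ; x≢y′ = differ x∈ y′∉ ; x′≢y = differ x′∈ y∉ ; x′≢y′ = differ x′∈ y′∉
     ; y≢y′ = λ { refl → true≢false e-yy′ (adj-irrefl y) }
     ; xx′ = e-xx′ ; yy′ = e-yy′
     ; xy = proj₁ (proj₂ (proj₂ (proj₂ (proj₂ (proj₂ (proj₂ facts)))))) ; x′y′ = proj₂ (proj₂ (proj₂ (proj₂ (proj₂ (proj₂ (proj₂ facts)))))) }

    W-switch : W (switch G) x x′ y y′ ≡ true
    W-switch rewrite x∈ | x′∈ | new-xy G reg valid | new-x′y′ G reg valid = refl

    -- Only `xx′` and `x′x` can be lost: every other pair that changes has an endpoint `y` or `y′`,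
    -- outside `S`.
    e₂-switch : e₂ G S ≤ e₂ (switch G) S + 2
    e₂-switch = begin
     e₂ G S
      ≡⟨ ∑-cong (λ u → *-distribˡ-∑ (χ S u) (λ w → χ S w * a G u w)) ⟩
     ∑ (λ u → ∑ (λ w → χ S u * (χ S w * a G u w)))
      ≤⟨ ∑-mono (λ u → ∑-mono λ w → pt u w) ⟩
     ∑ (λ u → ∑ (λ w → χ S u * (χ S w * a (switch G) u w) + (𝟙 (x ≡ᵇ u) * 𝟙 (x′ ≡ᵇ w) + 𝟙 (x′ ≡ᵇ u) * 𝟙 (x ≡ᵇ w))))
      ≡⟨ ∑-cong (λ u → trans (∑-+ (λ w → χ S u * (χ S w * a (switch G) u w)) _) (cong₂ _+_ (sym (*-distribˡ-∑ (χ S u) (λ w → χ S w * a (switch G) u w))) (∑-+ (λ w → 𝟙 (x ≡ᵇ u) * 𝟙 (x′ ≡ᵇ w)) (λ w → 𝟙 (x′ ≡ᵇ u) * 𝟙 (x ≡ᵇ w))))) ⟩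
     ∑ (λ u → χ S u * degIn (switch G) S u + (∑ (λ w → 𝟙 (x ≡ᵇ u) * 𝟙 (x′ ≡ᵇ w)) + ∑ (λ w → 𝟙 (x′ ≡ᵇ u) * 𝟙 (x ≡ᵇ w))))
      ≡⟨ trans (∑-+ (λ u → χ S u * degIn (switch G) S u) _) (cong (e₂ (switch G) S +_) (∑-+ (λ u → ∑ (λ w → 𝟙 (x ≡ᵇ u) * 𝟙 (x′ ≡ᵇ w))) (λ u → ∑ (λ w → 𝟙 (x′ ≡ᵇ u) * 𝟙 (x ≡ᵇ w))))) ⟩
     e₂ (switch G) S + (∑ (λ u → ∑ (λ w → 𝟙 (x ≡ᵇ u) * 𝟙 (x′ ≡ᵇ w))) + ∑ (λ u → ∑ (λ w → 𝟙 (x′ ≡ᵇ u) * 𝟙 (x ≡ᵇ w))))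
      ≡⟨ cong (e₂ (switch G) S +_) (cong₂ _+_ (one x x′) (one x′ x)) ⟩
     e₂ (switch G) S + 2 ∎
     where
     one : ∀ p q → ∑ (λ u → ∑ (λ w → 𝟙 (p ≡ᵇ u) * 𝟙 (q ≡ᵇ w))) ≡ 1
     one p q = trans (∑∑-* (λ u → 𝟙 (p ≡ᵇ u)) (λ w → 𝟙 (q ≡ᵇ w))) (cong₂ _*_ (∑-δ₁ p) (∑-δ₁ q))
     zero-left : ∀ {u w b} → lookup S u ≡ false ⊎ lookup S w ≡ false → χ S u * (χ S w * b) ≡ 0
     zero-left {u} {w} {b} (inj₁ h) = cong (_* (χ S w * b)) (𝟙-false h)
     zero-left {u} {w} {b} (inj₂ h) = trans (cong (λ e → χ S u * (e * b)) (𝟙-false h)) (ℕ.*-zeroʳ (χ S u))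
     ≤1 : ∀ u w b → χ S u * (χ S w * 𝟙 b) ≤ 1
     ≤1 u w b = ℕ.*-mono-≤ (χ≤1 S u) (ℕ.*-mono-≤ (χ≤1 S w) (𝟙≤1 b))
     pt : ∀ u w → χ S u * (χ S w * a G u w) ≤ χ S u * (χ S w * a (switch G) u w) + (𝟙 (x ≡ᵇ u) * 𝟙 (x′ ≡ᵇ w) + 𝟙 (x′ ≡ᵇ u) * 𝟙 (x ≡ᵇ w))
     pt u w with classify u w
     ... | inj₂ e = ℕ.≤-trans (ℕ.≤-reflexive (cong (λ b → χ S u * (χ S w * 𝟙 b)) (sym (unchanged G reg valid e)))) (ℕ.m≤m+n _ _)
     ... | inj₁ sxx′ = ℕ.≤-trans (≤1 x x′ (adj G x x′)) (ℕ.≤-trans (ℕ.≤-trans (ℕ.≤-reflexive (sym (cong₂ _*_ (𝟙-true (≡ᵇ-refl x)) (𝟙-true (≡ᵇ-refl x′))))) (ℕ.m≤m+n _ _)) (ℕ.m≤n+m _ (χ S x * (χ S x′ * a (switch G) x x′))))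
     ... | inj₁ sx′x = ℕ.≤-trans (≤1 x′ x (adj G x′ x)) (ℕ.≤-trans (ℕ.≤-trans (ℕ.≤-reflexive (sym (cong₂ _*_ (𝟙-true (≡ᵇ-refl x′)) (𝟙-true (≡ᵇ-refl x))))) (ℕ.m≤n+m _ (𝟙 (x ≡ᵇ x′) * 𝟙 (x′ ≡ᵇ x)))) (ℕ.m≤n+m _ (χ S x′ * (χ S x * a (switch G) x′ x))))
     ... | inj₁ syy′ = ℕ.≤-trans (ℕ.≤-reflexive (zero-left (inj₁ y∉))) z≤n
     ... | inj₁ sy′y = ℕ.≤-trans (ℕ.≤-reflexive (zero-left (inj₁ y′∉))) z≤n
     ... | inj₁ sxy = ℕ.≤-trans (ℕ.≤-reflexive (zero-left {x} (inj₂ y∉))) z≤n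
     ... | inj₁ syx = ℕ.≤-trans (ℕ.≤-reflexive (zero-left (inj₁ y∉))) z≤n
     ... | inj₁ sx′y′ = ℕ.≤-trans (ℕ.≤-reflexive (zero-left {x′} (inj₂ y′∉))) z≤n
     ... | inj₁ sy′x′ = ℕ.≤-trans (ℕ.≤-reflexive (zero-left (inj₁ y′∉))) z≤n

-- Almost every regular graph is sparse.

module SparsityBound where

 open SparsityIsTypical

 open Rationals
 open import Data.Nat.Base using (_!)
 open import Data.Nat.DivMod using (_/_; m≡m%n+[m/n]*n; m%n<n)
 open import Data.Fin.Base using (toℕ; fromℕ<)
 open Enumeration

 cnt : ∀ n → ℕ → ℚ
 cnt n s = Σ (λ S → indicator (does (∣ S ∣ ℕ.≟ s))) (allSubsets n)

 Σ-allSubsets : ∀ n (f : Subset (suc n) → ℚ) → Σ f (allSubsets (suc n)) ≡ Σ (λ S → f (true ∷ S)) (allSubsets n) + Σ (λ S → f (false ∷ S)) (allSubsets n)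
 Σ-allSubsets n f = trans (Σ-cartesian f _∷_ sides (allSubsets n)) (cong (Σ (λ S → f (true ∷ S)) (allSubsets n) +_) (+-identityʳ _))

 -- Pascal's rule on the left is matched on the right by the first two terms of the binomial
 -- expansion of `(n + 1) ^ (s + 1)`.
 cnt≤ : ∀ n s → ι (s !) * cnt n s ≤ ι (n ℕ.^ s)
 cnt≤ zero zero = ≤-reflexive (trans (cong (_* (1ℚ + 0ℚ)) ι-1) (trans (*-identityˡ (1ℚ + 0ℚ)) (sym ι-1)))
 cnt≤ zero (suc s) = ≤-trans (≤-reflexive (*-zeroʳ (ι (suc s !)))) (0≤ι 0)
 cnt≤ (suc n) zero = ≤-trans (*-monoˡ (ι 1) (0≤ι 1) (≤-reflexive (trans (Σ-allSubsets n (λ S → indicator (does (∣ S ∣ ℕ.≟ 0))))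
   (trans (cong (_+ cnt n 0) (Σ-0 (allSubsets n))) (+-identityˡ (cnt n 0)))))) (cnt≤ n zero)
 cnt≤ (suc n) (suc s) = begin
   ι (suc s !) * cnt (suc n) (suc s) ≡⟨ cong (ι (suc s !) *_) pascal ⟩
   ι (suc s !) * (cnt n s + cnt n (suc s)) ≡⟨ *-distribˡ-+ (ι (suc s !)) (cnt n s) (cnt n (suc s)) ⟩
   ι (suc s !) * cnt n s + ι (suc s !) * cnt n (suc s) ≤⟨ +-mono-≤ first (cnt≤ n (suc s)) ⟩
   ι (suc s) * ι (n ℕ.^ s) + ι (n ℕ.^ suc s) ≡⟨ cong (_+ ι (n ℕ.^ suc s)) (sym (ι-* (suc s) (n ℕ.^ s))) ⟩
   ι (suc s ℕ.* n ℕ.^ s) + ι (n ℕ.^ suc s) ≡⟨ sym (ι-+ (suc s ℕ.* n ℕ.^ s) (n ℕ.^ suc s)) ⟩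
   ι (suc s ℕ.* n ℕ.^ s ℕ.+ n ℕ.^ suc s) ≤⟨ ι-mono (binomial-two n s) ⟩
   ι (suc n ℕ.^ suc s) ∎
  where
  open ≤-Reasoning
  pascal : cnt (suc n) (suc s) ≡ cnt n s + cnt n (suc s)
  pascal = trans (Σ-allSubsets n (λ S → indicator (does (∣ S ∣ ℕ.≟ suc s)))) refl
  first : ι (suc s !) * cnt n s ≤ ι (suc s) * ι (n ℕ.^ s)
  first = ≤-trans (≤-reflexive (trans (cong (_* cnt n s) (ι-* (suc s) (s !))) (*-assoc (ι (suc s)) (ι (s !)) (cnt n s))))
   (*-monoˡ (ι (suc s)) (0≤ι (suc s)) (cnt≤ n s))

 card≤ : ∀ {n} (S : Subset n) → ∣ S ∣ ℕ.≤ n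
 card≤ {n} S = ℕ.≤-trans (ℕ.≤-reflexive (card≡∑ S)) (ℕ.≤-trans (∑-mono (χ≤1 S)) (ℕ.≤-reflexive (trans (∑-const n 1) (ℕ.*-identityʳ n))))

 Σ-by-size : ∀ n (g : ℕ → ℚ) → (∀ s → 0ℚ ≤ g s) → Σ (λ S → g ∣ S ∣) (allSubsets n) ≤ ∑ℚ {suc n} (λ s → cnt n (toℕ s) * g (toℕ s))
 Σ-by-size n g 0≤g = ≤-trans (Σ-mono (allSubsets n) λ S _ → term S)
  (≤-reflexive (trans (Σ-∑-swap (λ S (s : Fin (suc n)) → indicator (does (∣ S ∣ ℕ.≟ toℕ s)) * g (toℕ s)) (allSubsets n))
   (∑ℚ-cong {suc n} λ s → Σ-*ʳ (g (toℕ s)) (λ S → indicator (does (∣ S ∣ ℕ.≟ toℕ s))) (allSubsets n))))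
  where
  term : ∀ S → g ∣ S ∣ ≤ ∑ℚ {suc n} (λ s → indicator (does (∣ S ∣ ℕ.≟ toℕ s)) * g (toℕ s))
  term S = subst (_≤ ∑ℚ {suc n} F) eq (term≤∑ℚ F (λ s → *-nonNeg (0≤indicator (does (∣ S ∣ ℕ.≟ toℕ s))) (0≤g (toℕ s))) (fromℕ< lt))
   where
   F : Fin (suc n) → ℚ
   F s = indicator (does (∣ S ∣ ℕ.≟ toℕ s)) * g (toℕ s)
   lt : ∣ S ∣ ℕ.< suc n
   lt = ℕ.s≤s (card≤ S)
   eq : F (fromℕ< lt) ≡ g ∣ S ∣
   eq = trans (cong (λ e → indicator (does (∣ S ∣ ℕ.≟ e)) * g e) (Fin.toℕ-fromℕ< lt))
    (trans (cong (λ b → indicator b * g ∣ S ∣) (true-does (∣ S ∣ ℕ.≟ ∣ S ∣) refl)) (*-identityˡ _))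

 geometric : ∀ n → ∑ℚ {n} (λ i → ½ ^ toℕ i) ≤ 1ℚ + 1ℚ
 geometric zero = nonNegative⁻¹ 2ℚ
 geometric (suc n) = +-monoʳ-≤ 1ℚ (≤-trans (≤-reflexive (sym (*-distribˡ-∑ℚ {n} ½ (λ i → ½ ^ toℕ i))))
  (*-monoˡ ½ (nonNegative⁻¹ ½) (geometric n)))

 module _ (n d : ℕ) (1≤d : 1 ℕ.≤ d) where

  L : List (Graph n)
  L = regularGraphs n d

  tot : ℚ
  tot = ι (length L)

  -- The `suc` replaces a parity argument: if the test fails then `e₂ G S ≤ 2i - 2`, as evenness of
  -- `e₂` would give, and for `i = index ∣ S ∣` this is exactly the bound in `Sparse`.
  dense : ℕ → Subset n → Graph n → Bool
  dense i S G = does (2 ℕ.* i ℕ.≤? suc (e₂ G S))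

  N : ℕ → Subset n → ℚ
  N i S = Σ (λ G → indicator (dense i S G)) L

  -- A graph counted on the left admits at least `(i + 1)dn/2` switchings, each of which lowers `e₂`
  -- by at most 2, and a graph counted on the right arises from at most `(ds)²` of them. Iteration
  -- gives the probability of order `(2ds²/n) ^ i / i !`.
  dense-step : ∀ S i → 4 ℕ.* ∣ S ∣ ℕ.+ 4 ℕ.* d ℕ.≤ n →
   ι (suc i ℕ.* n) * N (suc i) S ≤ ι (2 ℕ.* d ℕ.* (∣ S ∣ ℕ.* ∣ S ∣)) * N i S
  dense-step S i small = *-cancelˡ (ι d) (0<ι 1≤d) (begin
    ι d * (ι (suc i ℕ.* n) * N (suc i) S) ≡⟨ trans (sym (*-assoc (ι d) (ι (suc i ℕ.* n)) _)) (cong (_* N (suc i) S) (sym (ι-* d (suc i ℕ.* n)))) ⟩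
    ι (d ℕ.* (suc i ℕ.* n)) * N (suc i) S ≡⟨ trans (*-comm (ι (d ℕ.* (suc i ℕ.* n))) _) (sym (Σ-*ʳ (ι (d ℕ.* (suc i ℕ.* n))) (λ G → indicator (dense (suc i) S G)) L)) ⟩
    Σ (λ G → indicator (dense (suc i) S G) * ι (d ℕ.* (suc i ℕ.* n))) L
     ≤⟨ Σ-mono L (λ G G∈ → indicator-*-≤ (dense (suc i) S G) λ h → lower G (regularGraphs-sound n d G∈) h) ⟩
    Σ (λ G → indicator (dense (suc i) S G) * (ι 2 * ι (Vc G))) L
     ≡⟨ trans (Σ-cong (λ G → solve 3 (λ f t v → f :* (t :* v) := t :* (f :* v)) refl (indicator (dense (suc i) S G)) (ι 2) (ι (Vc G))) L) (Σ-*ˡ (ι 2) (λ G → indicator (dense (suc i) S G) * ι (Vc G)) L) ⟩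
    ι 2 * Σ (λ G → indicator (dense (suc i) S G) * ι (Vc G)) L
     ≤⟨ *-monoˡ (ι 2) (0≤ι 2) (double-count n d {f = λ G → indicator (dense (suc i) S G)} {g = λ G → indicator (dense i S G)} {V = V} {W = W} (λ G → 0≤indicator (dense i S G)) move) ⟩
    ι 2 * Σ (λ G → indicator (dense i S G) * ι (∑ λ x → ∑ λ x′ → ∑ λ y → ∑ λ y′ → 𝟙 (W G x x′ y y′))) L
     ≤⟨ *-monoˡ (ι 2) (0≤ι 2) (Σ-mono L λ G G∈ → ≤-reflexive (cong (λ e → indicator (dense i S G) * ι e) (W-count G (regularGraphs-sound n d G∈)))) ⟩
    ι 2 * Σ (λ G → indicator (dense i S G) * ι (d ℕ.* s ℕ.* (d ℕ.* s))) L
     ≡⟨ cong (ι 2 *_) (Σ-*ʳ (ι (d ℕ.* s ℕ.* (d ℕ.* s))) (λ G → indicator (dense i S G)) L) ⟩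
    ι 2 * (N i S * ι (d ℕ.* s ℕ.* (d ℕ.* s)))
     ≡⟨ trans (solve 3 (λ t x y → t :* (x :* y) := (t :* y) :* x) refl (ι 2) (N i S) (ι (d ℕ.* s ℕ.* (d ℕ.* s)))) (cong (_* N i S) (trans (sym (ι-* 2 _)) (trans (cong ι (ring d s)) (ι-* d _)))) ⟩
    ι d * ι (2 ℕ.* d ℕ.* (s ℕ.* s)) * N i S
     ≡⟨ *-assoc (ι d) (ι (2 ℕ.* d ℕ.* (s ℕ.* s))) (N i S) ⟩
    ι d * (ι (2 ℕ.* d ℕ.* (s ℕ.* s)) * N i S) ∎)
   where
   open ≤-Reasoning
   open EdgeCounts {n} {d} S
   Vc : Graph n → ℕ
   Vc G = ∑ λ x → ∑ λ x′ → ∑ λ y → ∑ λ y′ → 𝟙 (V G x x′ y y′)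
   ring : ∀ d s → 2 ℕ.* (d ℕ.* s ℕ.* (d ℕ.* s)) ≡ d ℕ.* (2 ℕ.* d ℕ.* (s ℕ.* s))
   ring = ℕ-solve-∀
   lower : ∀ G → Regular d G → dense (suc i) S G ≡ true → ι (d ℕ.* (suc i ℕ.* n)) ≤ ι 2 * ι (Vc G)
   lower G reg h = subst (ι (d ℕ.* (suc i ℕ.* n)) ≤_) (ι-* 2 (Vc G)) (ι-mono (ℕ.≤-trans
    (ℕ.≤-trans (ℕ.≤-reflexive (swap d (suc i) n)) (ℕ.*-monoˡ-≤ (d ℕ.* n) si≤)) (V-count G reg small)))
    where
    swap : ∀ a b c → a ℕ.* (b ℕ.* c) ≡ b ℕ.* (a ℕ.* c)
    swap = ℕ-solve-∀
    si≤ : suc i ℕ.≤ e₂ G S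
    si≤ = ℕ.≤-trans (ℕ.≤-trans (ℕ.m≤n+m (suc i) i) (ℕ.≤-reflexive (cong (i ℕ.+_) (sym (ℕ.+-identityʳ (suc i))))))
     (ℕ.s≤s⁻¹ (does-true (2 ℕ.* suc i ℕ.≤? suc (e₂ G S)) h))
   move : ∀ G x x′ y y′ → Regular d G → V G x x′ y y′ ≡ true → let open Switch x x′ y y′ in
    indicator (dense (suc i) S G) ≤ 0ℚ ⊎ (Regular d (switch G) × W (switch G) x x′ y y′ ≡ true × indicator (dense (suc i) S G) ≤ indicator (dense i S (switch G)))
   move G x x′ y y′ reg v = inj₂ (Switch.switch-regular x x′ y y′ G reg (valid G reg x x′ y y′ v) , W-switch G reg x x′ y y′ v ,
    indicator-mono λ h → true-does (2 ℕ.* i ℕ.≤? suc (e₂ (Switch.switch x x′ y y′ G) S)) (ℕ.+-cancelʳ-≤ 2 _ _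
     (ℕ.≤-trans (ℕ.≤-reflexive (two i)) (ℕ.≤-trans (does-true (2 ℕ.* suc i ℕ.≤? suc (e₂ G S)) h) (ℕ.s≤s (e₂-switch G reg x x′ y y′ v))))))
    where
    two : ∀ i → 2 ℕ.* i ℕ.+ 2 ≡ 2 ℕ.* suc i
    two = ℕ-solve-∀

  dense-bound : ∀ S → 4 ℕ.* ∣ S ∣ ℕ.+ 4 ℕ.* d ℕ.≤ n → ∀ i →
   ι (i ! ℕ.* n ℕ.^ i) * N i S ≤ ι ((2 ℕ.* d ℕ.* (∣ S ∣ ℕ.* ∣ S ∣)) ℕ.^ i) * tot
  dense-bound S small zero = *-monoˡ (ι 1) (0≤ι 1) (≤-trans (Σ-mono L λ G _ → indicator≤1 (dense 0 S G)) (≤-reflexive (trans (Σ-const 1ℚ L) (*-identityʳ tot))))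
  dense-bound S small (suc i) = begin
    ι (suc i ! ℕ.* n ℕ.^ suc i) * N (suc i) S ≡⟨ trans (cong (λ e → ι e * N (suc i) S) (ring (suc i) (i !) n (n ℕ.^ i))) (trans (cong (_* N (suc i) S) (ι-* (i ! ℕ.* n ℕ.^ i) (suc i ℕ.* n))) (*-assoc (ι (i ! ℕ.* n ℕ.^ i)) (ι (suc i ℕ.* n)) (N (suc i) S))) ⟩
    ι (i ! ℕ.* n ℕ.^ i) * (ι (suc i ℕ.* n) * N (suc i) S) ≤⟨ *-monoˡ (ι (i ! ℕ.* n ℕ.^ i)) (0≤ι _) (dense-step S i small) ⟩
    ι (i ! ℕ.* n ℕ.^ i) * (ι c * N i S) ≡⟨ solve 3 (λ x y z → x :* (y :* z) := y :* (x :* z)) refl (ι (i ! ℕ.* n ℕ.^ i)) (ι c) (N i S) ⟩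
    ι c * (ι (i ! ℕ.* n ℕ.^ i) * N i S) ≤⟨ *-monoˡ (ι c) (0≤ι c) (dense-bound S small i) ⟩
    ι c * (ι (c ℕ.^ i) * tot) ≡⟨ trans (sym (*-assoc (ι c) (ι (c ℕ.^ i)) tot)) (cong (_* tot) (sym (ι-* c (c ℕ.^ i)))) ⟩
    ι (c ℕ.^ suc i) * tot ∎
   where
   open ≤-Reasoning
   c = 2 ℕ.* d ℕ.* (∣ S ∣ ℕ.* ∣ S ∣)
   ring : ∀ j f n p → j ℕ.* f ℕ.* (n ℕ.* p) ≡ f ℕ.* p ℕ.* (j ℕ.* n)
   ring = ℕ-solve-∀

  module _ (M : ℕ) .{{_ : ℕ.NonZero M}} (m h : ℕ) (hd : 64 ℕ.* d ℕ.≤ 2 ℕ.^ h)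
   (small : 4 ℕ.* m ℕ.+ 4 ℕ.* d ℕ.≤ n) (very-small : 4 ℕ.* d ℕ.* m ℕ.* 2 ℕ.^ (2 ℕ.* (h ℕ.* M)) ℕ.≤ n) (1≤n : 1 ℕ.≤ n) where

   index : ℕ → ℕ
   index s = s ℕ.+ suc (s / M)

   violations : Graph n → ℚ
   violations G = Σ (λ S → indicator (atMost m S) * indicator (dense (index ∣ S ∣) S G)) (allSubsets n)

   sparse-or-violated : ∀ G → Sparse M m G ⊎ 1ℚ ≤ violations G
   sparse-or-violated G = conclude (search (allSubsets n))
    where
    F : Subset n → ℚ
    F S = indicator (atMost m S) * indicator (dense (index ∣ S ∣) S G)
    0≤F : ∀ S → 0ℚ ≤ F S
    0≤F S = *-nonNeg (0≤indicator (atMost m S)) (0≤indicator (dense (index ∣ S ∣) S G))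
    Fine : Subset n → Set
    Fine S = ∣ S ∣ ℕ.≤ m → e₂ G S ℕ.≤ 2 ℕ.* ∣ S ∣ ℕ.+ 2 ℕ.* (∣ S ∣ / M)
    check : ∀ S → Fine S ⊎ F S ≡ 1ℚ
    check S with ∣ S ∣ ℕ.≤? m | 2 ℕ.* index ∣ S ∣ ℕ.≤? suc (e₂ G S)
    ... | no gt | _ = inj₁ λ le → contradiction le gt
    ... | yes le | no ¬p = inj₁ λ _ → ℕ.s≤s⁻¹ (ℕ.s≤s⁻¹ (ℕ.≤-trans (ℕ.≰⇒> ¬p) (ℕ.≤-reflexive (ring ∣ S ∣ (∣ S ∣ / M)))))
     where
     ring : ∀ a b → 2 ℕ.* (a ℕ.+ suc b) ≡ suc (suc (2 ℕ.* a ℕ.+ 2 ℕ.* b))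
     ring = ℕ-solve-∀
    ... | yes le | yes p = inj₂ (cong₂ (λ a b → indicator a * indicator b) (true-does (∣ S ∣ ℕ.≤? m) le) (true-does (2 ℕ.* index ∣ S ∣ ℕ.≤? suc (e₂ G S)) p))
    search : ∀ xs → All.All Fine xs ⊎ 1ℚ ≤ Σ F xs
    search [] = inj₁ All.[]
    search (S ∷ xs) with check S | search xs
    ... | inj₂ e | _ = inj₂ (subst (_≤ F S + Σ F xs) e (p≤p+q (Σ-nonNeg 0≤F xs)))
    ... | inj₁ _ | inj₂ le = inj₂ (≤-trans le (subst (_≤ F S + Σ F xs) (+-identityˡ (Σ F xs)) (+-monoˡ-≤ (Σ F xs) (0≤F S))))
    ... | inj₁ f | inj₁ fs = inj₁ (f All.∷ fs)
    conclude : All.All Fine (allSubsets n) ⊎ 1ℚ ≤ Σ F (allSubsets n) → Sparse M m G ⊎ 1ℚ ≤ violations G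
    conclude (inj₂ le) = inj₂ le
    conclude (inj₁ fs) = inj₁ λ S → All.lookup fs (allSubsets-complete S)

   Y : ℕ → ℚ
   Y s = ι ((2 ℕ.* d ℕ.* (s ℕ.* s)) ℕ.^ index s) * recip (ι (index s ! ℕ.* n ℕ.^ index s))

   0<denominator : ∀ i → 0ℚ < ι (i ! ℕ.* n ℕ.^ i)
   0<denominator i = 0<ι (ℕ.*-mono-≤ (ℕ.1≤n! i) (ℕ.m^n>0 n {{ℕ.>-nonZero 1≤n}} i))

   0≤Y : ∀ s → 0ℚ ≤ Y s
   0≤Y s = *-nonNeg (0≤ι _) (<⇒≤ (recip-pos (0<denominator (index s))))

   size-term : ∀ s → s ℕ.≤ m → cnt n s * Y s ≤ ½ ^ s * ½ ^ (h ℕ.* M)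
   size-term s s≤m = subst (_≤ ε) (*-assoc (cnt n s) (ι X) (recip (ι F))) (*recip≤ (0<denominator i)
     (*-cancelˡ (ι (s !)) (0<ι (ℕ.1≤n! s)) (begin
      ι (s !) * (cnt n s * ι X) ≡⟨ sym (*-assoc (ι (s !)) (cnt n s) (ι X)) ⟩
      ι (s !) * cnt n s * ι X ≤⟨ *-monoʳ (ι X) (0≤ι X) (cnt≤ n s) ⟩
      ι (n ℕ.^ s) * ι X ≡⟨ trans (sym (ι-* (n ℕ.^ s) X)) (trans (sym (*-identityˡ _)) (cong (_* ι (n ℕ.^ s ℕ.* X)) (sym ε-inv))) ⟩
      ε * ι (2 ℕ.^ s ℕ.* 2 ℕ.^ (h ℕ.* M)) * ι (n ℕ.^ s ℕ.* X) ≡⟨ trans (*-assoc ε _ _) (cong (ε *_) (trans (*-comm (ι (2 ℕ.^ s ℕ.* 2 ℕ.^ (h ℕ.* M))) (ι (n ℕ.^ s ℕ.* X))) (sym (ι-* (n ℕ.^ s ℕ.* X) _)))) ⟩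
      ε * ι (n ℕ.^ s ℕ.* X ℕ.* (2 ℕ.^ s ℕ.* 2 ℕ.^ (h ℕ.* M))) ≤⟨ *-monoˡ ε 0≤ε (ι-mono (union-bound d h M n s (suc (s / M)) hd (ℕ.z<s) s≤Mk ds≤n)) ⟩
      ε * ι (s ! ℕ.* F) ≡⟨ trans (cong (ε *_) (ι-* (s !) F)) (solve 3 (λ x y z → x :* (y :* z) := y :* (x :* z)) refl ε (ι (s !)) (ι F)) ⟩
      ι (s !) * (ε * ι F) ∎)))
    where
    open ≤-Reasoning
    i = index s
    X = (2 ℕ.* d ℕ.* (s ℕ.* s)) ℕ.^ i
    F = i ! ℕ.* n ℕ.^ i
    ε = ½ ^ s * ½ ^ (h ℕ.* M)
    0≤ε : 0ℚ ≤ ε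
    0≤ε = *-nonNeg (^-nonNeg (nonNegative⁻¹ ½) s) (^-nonNeg (nonNegative⁻¹ ½) (h ℕ.* M))
    half : ∀ k → ½ ^ k * ι (2 ℕ.^ k) ≡ 1ℚ
    half k = trans (cong (½ ^ k *_) (ι-^ 2 k)) (trans (sym (*-^ ½ (ι 2) k)) (trans (cong (λ e → (½ * e) ^ k) (ι≡fromℕ 2)) (1^ k)))
    ε-inv : ε * ι (2 ℕ.^ s ℕ.* 2 ℕ.^ (h ℕ.* M)) ≡ 1ℚ
    ε-inv = trans (cong (ε *_) (ι-* (2 ℕ.^ s) (2 ℕ.^ (h ℕ.* M)))) (trans (solve 4 (λ a b c e → a :* b :* (c :* e) := (a :* c) :* (b :* e)) refl (½ ^ s) (½ ^ (h ℕ.* M)) (ι (2 ℕ.^ s)) (ι (2 ℕ.^ (h ℕ.* M))))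
     (cong₂ _*_ (half s) (half (h ℕ.* M))))
    s≤Mk : s ℕ.≤ M ℕ.* suc (s / M)
    s≤Mk = ℕ.≤-trans (ℕ.≤-reflexive (m≡m%n+[m/n]*n s M)) (ℕ.≤-trans (ℕ.+-monoˡ-≤ (s / M ℕ.* M) (ℕ.<⇒≤ (m%n<n s M))) (ℕ.≤-reflexive (ℕ.*-comm (suc (s / M)) M)))
    ds≤n : 4 ℕ.* d ℕ.* s ℕ.* 2 ℕ.^ (2 ℕ.* (h ℕ.* M)) ℕ.≤ n
    ds≤n = ℕ.≤-trans (ℕ.*-monoˡ-≤ (2 ℕ.^ (2 ℕ.* (h ℕ.* M))) (ℕ.*-monoʳ-≤ (4 ℕ.* d) s≤m)) very-small

   violations-bound : Σ violations L ≤ 2ℚ * ½ ^ (h ℕ.* M) * tot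
   violations-bound = begin
     Σ violations L
      ≡⟨ Σ-swap (λ G S → indicator (atMost m S) * indicator (dense (index ∣ S ∣) S G)) L (allSubsets n) ⟩
     Σ (λ S → Σ (λ G → indicator (atMost m S) * indicator (dense (index ∣ S ∣) S G)) L) (allSubsets n)
      ≡⟨ Σ-cong (λ S → Σ-*ˡ (indicator (atMost m S)) (λ G → indicator (dense (index ∣ S ∣) S G)) L) (allSubsets n) ⟩
     Σ (λ S → indicator (atMost m S) * N (index ∣ S ∣) S) (allSubsets n)
      ≤⟨ Σ-mono (allSubsets n) (λ S _ → ≤-trans (indicator-*-≤ (atMost m S) λ h → per-set S (atMost⁻ {X = S} h))
         (≤-reflexive (sym (*-assoc (indicator (atMost m S)) (Y ∣ S ∣) tot)))) ⟩
     Σ (λ S → g ∣ S ∣ * tot) (allSubsets n)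
      ≤⟨ ≤-reflexive (Σ-*ʳ tot (λ S → g ∣ S ∣) (allSubsets n)) ⟩
     Σ (λ S → g ∣ S ∣) (allSubsets n) * tot
      ≤⟨ *-monoʳ tot (0≤ι _) (≤-trans (Σ-by-size n g 0≤g) (≤-trans (∑ℚ-mono {suc n} λ s → size (toℕ s))
         (≤-trans (≤-reflexive (sym (*-distribʳ-∑ℚ {suc n} (½ ^ (h ℕ.* M)) (λ s → ½ ^ toℕ s)))) (*-monoʳ (½ ^ (h ℕ.* M)) 0≤½^ (geometric (suc n)))))) ⟩
     2ℚ * ½ ^ (h ℕ.* M) * tot ∎
    where
    open ≤-Reasoning
    0≤½^ : 0ℚ ≤ ½ ^ (h ℕ.* M)
    0≤½^ = ^-nonNeg (nonNegative⁻¹ ½) (h ℕ.* M)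
    g : ℕ → ℚ
    g s = indicator (does (s ℕ.≤? m)) * Y s
    0≤g : ∀ s → 0ℚ ≤ g s
    0≤g s = *-nonNeg (0≤indicator (does (s ℕ.≤? m))) (0≤Y s)
    per-set : ∀ S → ∣ S ∣ ℕ.≤ m → N (index ∣ S ∣) S ≤ Y ∣ S ∣ * tot
    per-set S le = subst (N (index ∣ S ∣) S ≤_) (solve 3 (λ x t r → x :* t :* r := x :* r :* t) refl (ι X) tot (recip (ι F)))
     (≤*recip (0<denominator (index ∣ S ∣)) (subst (_≤ ι X * tot) (*-comm (ι F) _)
      (dense-bound S (ℕ.≤-trans (ℕ.+-monoˡ-≤ (4 ℕ.* d) (ℕ.*-monoʳ-≤ 4 le)) small) (index ∣ S ∣))))
     where
     X = (2 ℕ.* d ℕ.* (∣ S ∣ ℕ.* ∣ S ∣)) ℕ.^ index ∣ S ∣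
     F = index ∣ S ∣ ! ℕ.* n ℕ.^ index ∣ S ∣
    size : ∀ s → cnt n s * g s ≤ ½ ^ s * ½ ^ (h ℕ.* M)
    size s = ≤-trans (≤-reflexive (solve 3 (λ c i y → c :* (i :* y) := i :* (c :* y)) refl (cnt n s) (indicator (does (s ℕ.≤? m))) (Y s)))
     (indicator-≤ (does (s ℕ.≤? m)) (*-nonNeg (^-nonNeg (nonNegative⁻¹ ½) s) 0≤½^) λ e → size-term s (does-true (s ℕ.≤? m) e))

-- Switchings that create a path of length two between `I` and `B`.

module Joining {n d : ℕ} (1≤d : 1 ℕ.≤ d) (I B : Subset n) (I∩B : Disjoint I B) where

 open import Data.Nat.Base using (_+_; _*_; _≤_; _<_; _∸_; z≤n; s≤s)

 inD : Graph n → Fin n → Bool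
 inD G y = not (lookup B y) ∧ does (1 ℕ.≤? degIn G B y)

 reached : Graph n → Fin n → Bool
 reached G y = lookup I y ∨ does (1 ℕ.≤? degIn G I y)

 -- The possible relay stations: through such a vertex information can pass from `I` to `B` within
 -- two rounds.
 good : Graph n → Fin n → Bool
 good G y = inD G y ∧ reached G y

 #good : Graph n → ℕ
 #good G = ∑ (λ y → 𝟙 (good G y))

 -- Edges that leave `I` and avoid `B` and its neighbours. Moving one of them changes no adjacency
 -- to `B`, and the endpoint `x′` that loses its neighbour in `I` was not good.
 outPair : Graph n → Fin n → Fin n → Bool
 outPair G x x′ = (lookup I x ∧ adj G x x′) ∧ (not (lookup I x′) ∧ (not (lookup B x′) ∧ not (inD G x′)))

 out : Graph n → ℕ
 out G = ∑ (λ x → ∑ (λ x′ → 𝟙 (outPair G x x′)))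

 Dsum : Graph n → ℕ
 Dsum G = ∑ (λ y → 𝟙 (inD G y) * (d ∸ degIn G B y))

 badPair : Graph n → Fin n → Fin n → Bool
 badPair G y y′ = (inD G y ∧ not (reached G y)) ∧ (adj G y y′ ∧ not (lookup B y′))

 -- The switch gives the unreached neighbour `y` of `B` a neighbour `x` in `I`. The last two
 -- conditions of `V` ensure that the new edge `x′y′` is neither a loop nor a repeated edge.
 V W : Graph n → Fin n → Fin n → Fin n → Fin n → Bool
 V G x x′ y y′ = outPair G x x′ ∧ (badPair G y y′ ∧ (not (x′ ≡ᵇ y′) ∧ not (adj G x′ y′)))
 W G x x′ y y′ = (good G y ∧ adj G y x) ∧ adj G x′ y′

 private
  decode : ∀ a b c e f → a ∧ (b ∧ (not c ∧ not e)) ≡ f → f ≡ true → a ≡ true × b ≡ true × c ≡ false × e ≡ false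
  decode true true false false true _ _ = refl , refl , refl , refl
  decode-out : ∀ a b c e f → (a ∧ b) ∧ (not c ∧ (not e ∧ not f)) ≡ true → a ≡ true × b ≡ true × c ≡ false × e ≡ false × f ≡ false
  decode-out true true false false false _ = refl , refl , refl , refl , refl
  decode-bad : ∀ a b c e → (a ∧ not b) ∧ (c ∧ not e) ≡ true → a ≡ true × b ≡ false × c ≡ true × e ≡ false
  decode-bad true false true false _ = refl , refl , refl , refl
  ∨-false : ∀ a b → a ∨ b ≡ false → a ≡ false × b ≡ false
  ∨-false false false _ = refl , refl

 degIn≥1 : ∀ (G : Graph n) X u {w} → lookup X w ≡ true → adj G u w ≡ true → 1 ≤ degIn G X u
 degIn≥1 G X u {w} h h′ = ℕ.≤-trans (ℕ.≤-reflexive (sym (cong₂ _*_ (𝟙-true h) (𝟙-true h′)))) (term≤∑ (λ v → χ X v * a G u v) w)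

 unreached : ∀ (G : Graph n) y {w} → reached G y ≡ false → lookup I w ≡ true → adj G y w ≡ false
 unreached G y {w} h w∈I with bool-cases (adj G y w)
 ... | inj₂ e = e
 ... | inj₁ e = contradiction (degIn≥1 G I y w∈I e) (does-false (1 ℕ.≤? degIn G I y) (proj₂ (∨-false (lookup I y) _ h)))

 degIn-cong : ∀ (G H : Graph n) X u → (∀ v → lookup X v ≡ true → adj H u v ≡ adj G u v) → degIn H X u ≡ degIn G X u
 degIn-cong G H X u h = ∑-cong pt
  where
  pt : ∀ v → χ X v * a H u v ≡ χ X v * a G u v
  pt v with lookup X v | h v
  ... | false | _ = refl
  ... | true | e = cong (λ b → 1 * 𝟙 b) (e refl)

 module Move (G : Graph n) (reg : Regular d G) (x x′ y y′ : Fin n) (v : V G x x′ y y′ ≡ true) where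

  open RegularGraph G reg
  open Switch x x′ y y′

  private
   f₀ = decode (outPair G x x′) (badPair G y y′) (x′ ≡ᵇ y′) (adj G x′ y′) _ refl v
   f₁ = decode-out (lookup I x) (adj G x x′) (lookup I x′) (lookup B x′) (inD G x′) (proj₁ f₀)
   f₂ = decode-bad (inD G y) (reached G y) (adj G y y′) (lookup B y′) (proj₁ (proj₂ f₀))

  x∈I : lookup I x ≡ true
  x∈I = proj₁ f₁
  e-xx′ : adj G x x′ ≡ true
  e-xx′ = proj₁ (proj₂ f₁)
  x′∉I : lookup I x′ ≡ false
  x′∉I = proj₁ (proj₂ (proj₂ f₁))
  x′∉B : lookup B x′ ≡ false
  x′∉B = proj₁ (proj₂ (proj₂ (proj₂ f₁)))
  x′∉D : inD G x′ ≡ false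
  x′∉D = proj₂ (proj₂ (proj₂ (proj₂ f₁)))
  y∈D : inD G y ≡ true
  y∈D = proj₁ f₂
  y-unreached : reached G y ≡ false
  y-unreached = proj₁ (proj₂ f₂)
  e-yy′ : adj G y y′ ≡ true
  e-yy′ = proj₁ (proj₂ (proj₂ f₂))
  y′∉B : lookup B y′ ≡ false
  y′∉B = proj₂ (proj₂ (proj₂ f₂))
  y∉I : lookup I y ≡ false
  y∉I = proj₁ (∨-false (lookup I y) _ y-unreached)
  y∉B : lookup B y ≡ false
  y∉B with lookup B y | y∈D
  ... | false | _ = refl
  x∉B : lookup B x ≡ false
  x∉B = I∩B x x∈I
  y′∉I : lookup I y′ ≡ false
  y′∉I with bool-cases (lookup I y′)
  ... | inj₂ e = e
  ... | inj₁ e = true≢false e-yy′ (unreached G y y-unreached e)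

  differ : ∀ {X : Subset n} {u w} → lookup X u ≡ true → lookup X w ≡ false → u ≢ w
  differ h h′ refl = true≢false h h′

  valid : Valid G
  valid = record
   { x≢x′ = λ { refl → true≢false e-xx′ (adj-irrefl x) }
   ; x≢y = differ {I} x∈I y∉I ; x≢y′ = differ {I} x∈I y′∉I
   ; x′≢y = λ { refl → true≢false y∈D x′∉D }
   ; x′≢y′ = λ { refl → true≢false (≡ᵇ-refl x′) (proj₁ (proj₂ (proj₂ f₀))) }
   ; y≢y′ = λ { refl → true≢false e-yy′ (adj-irrefl y) }
   ; xx′ = e-xx′ ; yy′ = e-yy′
   ; xy = trans (adj-sym x y) (unreached G y y-unreached x∈I) ; x′y′ = proj₂ (proj₂ (proj₂ f₀)) }

  G′ : Graph n
  G′ = switch G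

  reg′ : Regular d G′
  reg′ = switch-regular G reg valid

  same : ∀ {u w} → τ u w ≡ w → adj G′ u w ≡ adj G u w
  same = unchanged G reg valid

  adj′-B : ∀ u w → lookup B w ≡ true → adj G′ u w ≡ adj G u w
  adj′-B u w w∈B with classify u w
  ... | inj₂ e = same e
  ... | inj₁ sxx′ = true≢false w∈B x′∉B
  ... | inj₁ sx′x = true≢false w∈B x∉B
  ... | inj₁ syy′ = true≢false w∈B y′∉B
  ... | inj₁ sy′y = true≢false w∈B y∉B
  ... | inj₁ sxy = true≢false w∈B y∉B
  ... | inj₁ syx = true≢false w∈B x∉B
  ... | inj₁ sx′y′ = true≢false w∈B y′∉B
  ... | inj₁ sy′x′ = true≢false w∈B x′∉B

  adj′-I : ∀ u w → u ≢ x′ → u ≢ y → lookup I w ≡ true → adj G′ u w ≡ adj G u w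
  adj′-I u w u≢x′ u≢y w∈I with classify u w
  ... | inj₂ e = same e
  ... | inj₁ sxx′ = true≢false w∈I x′∉I
  ... | inj₁ sx′x = contradiction refl u≢x′
  ... | inj₁ syy′ = true≢false w∈I y′∉I
  ... | inj₁ sy′y = true≢false w∈I y∉I
  ... | inj₁ sxy = true≢false w∈I y∉I
  ... | inj₁ syx = contradiction refl u≢y
  ... | inj₁ sx′y′ = true≢false w∈I y′∉I
  ... | inj₁ sy′x′ = true≢false w∈I x′∉I

  degB : ∀ u → degIn G′ B u ≡ degIn G B u
  degB u = degIn-cong G G′ B u (adj′-B u)

  inD′ : ∀ u → inD G′ u ≡ inD G u
  inD′ u = cong (λ k → not (lookup B u) ∧ does (1 ℕ.≤? k)) (degB u)

  y-good′ : good G′ y ≡ true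
  y-good′ = cong₂ _∧_ (trans (inD′ y) y∈D) (∨-trueʳ {lookup I y} (true-does (1 ℕ.≤? degIn G′ I y) (degIn≥1 G′ I y x∈I (new-yx G reg valid))))

  y-not-good : good G y ≡ false
  y-not-good = trans (cong (_∧ reached G y) y∈D) y-unreached

  good′ : ∀ u → u ≢ y → good G′ u ≡ good G u
  good′ u u≢y with u Fin.≟ x′
  ... | yes refl = trans (cong (_∧ reached G′ x′) (trans (inD′ x′) x′∉D)) (sym (cong (_∧ reached G x′) x′∉D))
  ... | no u≢x′ = cong₂ _∧_ (inD′ u) (cong (λ k → lookup I u ∨ does (1 ℕ.≤? k)) (degIn-cong G G′ I u λ w → adj′-I u w u≢x′ u≢y))

  -- Only `x′` and `y` see their adjacency to `I` change, and `x′` is not a neighbour of `B` before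
  -- or after; so `y` is the one vertex whose status changes.
  #good′ : #good G′ ≡ suc (#good G)
  #good′ = trans (∑-cong pt) (trans (∑-+ (λ u → 𝟙 (y ≡ᵇ u)) (λ u → 𝟙 (good G u))) (cong (_+ #good G) (∑-δ₁ y)))
   where
   pt : ∀ u → 𝟙 (good G′ u) ≡ 𝟙 (y ≡ᵇ u) + 𝟙 (good G u)
   pt u with y Fin.≟ u
   ... | yes refl = trans (𝟙-true y-good′) (cong suc (sym (𝟙-false y-not-good)))
   ... | no y≢u = cong 𝟙 (good′ u (y≢u ∘ sym))

  W-switch : W G′ x x′ y y′ ≡ true
  W-switch = cong₂ _∧_ (cong₂ _∧_ y-good′ (new-yx G reg valid)) (new-x′y′ G reg valid)

  Dsum′ : Dsum G′ ≡ Dsum G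
  Dsum′ = ∑-cong λ u → cong₂ (λ b k → 𝟙 b * (d ∸ k)) (inD′ u) (degB u)

  -- The one lost pair is `xx′`. Together with `#good′` this keeps `out + #good` from decreasing,
  -- which is why richness is later measured by that sum.
  out′ : out G ≤ suc (out G′)
  out′ = ℕ.≤-trans (∑-mono λ u → ∑-mono λ w → pt u w) (ℕ.≤-reflexive (trans
    (∑-cong λ u → ∑-+ (λ w → 𝟙 (x ≡ᵇ u) * 𝟙 (x′ ≡ᵇ w)) (λ w → 𝟙 (outPair G′ u w)))
    (trans (∑-+ (λ u → ∑ (λ w → 𝟙 (x ≡ᵇ u) * 𝟙 (x′ ≡ᵇ w))) (λ u → ∑ (λ w → 𝟙 (outPair G′ u w)))) (cong (_+ out G′) one))))
   where
   one : ∑ (λ u → ∑ (λ w → 𝟙 (x ≡ᵇ u) * 𝟙 (x′ ≡ᵇ w))) ≡ 1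
   one = trans (∑-cong λ u → trans (sym (*-distribˡ-∑ (𝟙 (x ≡ᵇ u)) (λ w → 𝟙 (x′ ≡ᵇ w)))) (trans (cong (𝟙 (x ≡ᵇ u) *_) (∑-δ₁ x′)) (ℕ.*-identityʳ _))) (∑-δ₁ x)
   keep : ∀ u w → outPair G u w ≡ true → τ u w ≡ w → outPair G′ u w ≡ true
   keep u w h e = trans (cong₂ (λ b c → (lookup I u ∧ b) ∧ (not (lookup I w) ∧ (not (lookup B w) ∧ not c))) (same e) (inD′ w)) h
   pt : ∀ u w → 𝟙 (outPair G u w) ≤ 𝟙 (x ≡ᵇ u) * 𝟙 (x′ ≡ᵇ w) + 𝟙 (outPair G′ u w)
   pt u w with bool-cases (outPair G u w)
   ... | inj₂ h = ℕ.≤-trans (ℕ.≤-reflexive (𝟙-false h)) z≤n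
   ... | inj₁ h with decode-out (lookup I u) (adj G u w) (lookup I w) (lookup B w) (inD G w) h | classify u w
   ... | _ | inj₂ e = ℕ.≤-trans (ℕ.≤-trans (𝟙≤1 (outPair G u w)) (ℕ.≤-reflexive (sym (𝟙-true (keep u w h e))))) (ℕ.m≤n+m _ (𝟙 (x ≡ᵇ u) * 𝟙 (x′ ≡ᵇ w)))
   ... | _ | inj₁ sxx′ = ℕ.≤-trans (𝟙≤1 (outPair G x x′)) (ℕ.≤-trans (ℕ.≤-reflexive (sym (cong₂ _*_ (𝟙-true (≡ᵇ-refl x)) (𝟙-true (≡ᵇ-refl x′))))) (ℕ.m≤m+n _ _))
   ... | i , _ | inj₁ sx′x = true≢false i x′∉I
   ... | i , _ | inj₁ syy′ = true≢false i y∉I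
   ... | i , _ | inj₁ sy′y = true≢false i y′∉I
   ... | _ , _ , _ , _ , nd | inj₁ sxy = true≢false y∈D nd
   ... | i , _ | inj₁ syx = true≢false i y∉I
   ... | i , _ | inj₁ sx′y′ = true≢false i x′∉I
   ... | i , _ | inj₁ sy′x′ = true≢false i y′∉I

  -- All four vertices lie outside `B`, and among them only `x` is in `I`. A rerouted call therefore
  -- ends outside `B` on both graphs, and outside `I` on both if its caller is in `I`: it cannot be
  -- part of an arrival at exactly `I` or `B` on one graph only.
  special-ends : ∀ u w → Special u w → lookup B w ≡ false × lookup B (τ u w) ≡ false ×
   (lookup I u ≡ true → lookup I w ≡ false × lookup I (τ u w) ≡ false)
  special-ends _ _ sxx′ rewrite τx G reg valid | tr-fst x′ y = x′∉B , y∉B , λ _ → x′∉I , y∉I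
  special-ends _ _ sxy rewrite τx G reg valid | tr-snd x′ y = y∉B , x′∉B , λ _ → y∉I , x′∉I
  special-ends _ _ sx′x rewrite τx′ G reg valid | tr-fst x y′ = x∉B , y′∉B , λ i → true≢false i x′∉I
  special-ends _ _ sx′y′ rewrite τx′ G reg valid | tr-snd x y′ = y′∉B , x∉B , λ i → true≢false i x′∉I
  special-ends _ _ syy′ rewrite τy G reg valid | tr-fst y′ x = y′∉B , x∉B , λ i → true≢false i y∉I
  special-ends _ _ syx rewrite τy G reg valid | tr-snd y′ x = x∉B , y′∉B , λ i → true≢false i y∉I
  special-ends _ _ sy′y rewrite τy′ G reg valid | tr-fst y x′ = y∉B , x′∉B , λ i → true≢false i y′∉I
  special-ends _ _ sy′x′ rewrite τy′ G reg valid | tr-snd y x′ = x′∉B , y∉B , λ i → true≢false i y′∉I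

  open Expectation d 1≤d

  private
   σc : Round n → Round n
   σc = mapChoices τ
   σu : ∀ c u → lookup (σc c) u ≡ τ u (lookup c u)
   σu c u = lookup-mapChoices τ c u

  arrival-push : ∀ t J → Kernel.Kᵗ G′ push t (λ Z → indicator (Z ≡ˢ I)) J ≡ Kernel.Kᵗ G push t (λ Z → indicator (Z ≡ˢ I)) J
  arrival-push = arrival-invariant d 1≤d G G′ degrees (RegularGraph.degrees G′ reg′) push (λ c J w → push-old c J)
   τ τ-involutive (adj-switch G) I local
   where
   local : ∀ c J → _⊑_ d 1≤d J I → push (σc c) J ≡ push c J ⊎ (¬ _⊑_ d 1≤d (push (σc c) J) I × ¬ _⊑_ d 1≤d (push c J) I)
   local c J J⊑I with Fin.any? (λ u → (lookup J u Bool.≟ true) ×-dec ¬? (τ u (lookup c u) Fin.≟ lookup c u))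
   ... | no none = inj₁ (subset-ext λ w → bool-ext (to w) (from w))
    where
    agree : ∀ u → lookup J u ≡ true → τ u (lookup c u) ≡ lookup c u
    agree u u∈J with τ u (lookup c u) Fin.≟ lookup c u
    ... | yes e = e
    ... | no ≢ = contradiction (u , u∈J , ≢) none
    to : ∀ w → lookup (push (σc c) J) w ≡ true → lookup (push c J) w ≡ true
    to w h with push⁻ (σc c) J w h
    ... | inj₁ e = push-old c J e
    ... | inj₂ (u , u∈J , e) = push⁺ c J w (inj₂ (u , u∈J , trans (sym (agree u u∈J)) (trans (sym (σu c u)) e)))
    from : ∀ w → lookup (push c J) w ≡ true → lookup (push (σc c) J) w ≡ true
    from w h with push⁻ c J w h
    ... | inj₁ e = push-old (σc c) J e
    ... | inj₂ (u , u∈J , e) = push⁺ (σc c) J w (inj₂ (u , u∈J , trans (σu c u) (trans (agree u u∈J) e)))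
   ... | yes (u , u∈J , ≢) with classify u (lookup c u)
   ... | inj₂ e = contradiction e ≢
   ... | inj₁ s = let _ , _ , h = special-ends u (lookup c u) s ; i , j = h (J⊑I u u∈J) in
    inj₂ ((λ le → true≢false (le (lookup (σc c) u) (push-new (σc c) J u∈J)) (trans (cong (lookup I) (σu c u)) j)) ,
       (λ le → true≢false (le (lookup c u) (push-new c J u∈J)) i))

  arrival-pre : ∀ t J → Kernel.Kᵗ G′ pre t (λ Z → indicator (Z ≡ˢ B)) J ≡ Kernel.Kᵗ G pre t (λ Z → indicator (Z ≡ˢ B)) J
  arrival-pre = arrival-invariant d 1≤d G G′ degrees (RegularGraph.degrees G′ reg′) pre (λ c J w → pre-old c J)
   τ τ-involutive (adj-switch G) B λ c J J⊑B → inj₁ (subset-ext λ u →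
    trans (pre-lookup (σc c) J u) (trans (cong (lookup J u ∨_) (trans (cong (lookup J) (σu c u)) (call c J J⊑B u))) (sym (pre-lookup c J u))))
   where
   notin : ∀ {J : Subset n} → _⊑_ d 1≤d J B → ∀ {w} → lookup B w ≡ false → lookup J w ≡ false
   notin {J} le {w} h with bool-cases (lookup J w)
   ... | inj₂ e = e
   ... | inj₁ e = true≢false (le w e) h
   call : ∀ c J → _⊑_ d 1≤d J B → ∀ u → lookup J (τ u (lookup c u)) ≡ lookup J (lookup c u)
   call c J le u with classify u (lookup c u)
   ... | inj₂ e = cong (lookup J) e
   ... | inj₁ s = let p , q , _ = special-ends u (lookup c u) s in trans (notin {J} le q) (sym (notin {J} le p))

 module Counts (G : Graph n) (reg : Regular d G) where

  open RegularGraph G reg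
  open ℕ.≤-Reasoning

  W-count : ∑ (λ x → ∑ λ x′ → ∑ λ y → ∑ λ y′ → 𝟙 (W G x x′ y y′)) ≡ #good G * (d * (d * n))
  W-count = begin-equality
   ∑ (λ x → ∑ λ x′ → ∑ λ y → ∑ λ y′ → 𝟙 (W G x x′ y y′))
    ≡⟨ ∑-cong (λ x → ∑-cong λ x′ → ∑-cong λ y → trans (∑-cong λ y′ → 𝟙-∧ (good G y ∧ adj G y x) (adj G x′ y′))
       (trans (sym (*-distribˡ-∑ (𝟙 (good G y ∧ adj G y x)) (a G x′))) (cong₂ _*_ (𝟙-∧ (good G y) (adj G y x)) (∑a x′)))) ⟩
   ∑ (λ x → ∑ λ (x′ : Fin n) → ∑ λ y → 𝟙 (good G y) * a G y x * d)
    ≡⟨ ∑-cong (λ x → ∑-const n (∑ λ y → 𝟙 (good G y) * a G y x * d)) ⟩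
   ∑ (λ x → n * ∑ λ y → 𝟙 (good G y) * a G y x * d)
    ≡⟨ sym (*-distribˡ-∑ n (λ x → ∑ λ y → 𝟙 (good G y) * a G y x * d)) ⟩
   n * ∑ (λ x → ∑ λ y → 𝟙 (good G y) * a G y x * d)
    ≡⟨ cong (n *_) (∑-swap (λ x y → 𝟙 (good G y) * a G y x * d)) ⟩
   n * ∑ (λ y → ∑ λ x → 𝟙 (good G y) * a G y x * d)
    ≡⟨ cong (n *_) (∑-cong λ y → trans (sym (*-distribʳ-∑ d (λ x → 𝟙 (good G y) * a G y x))) (cong (_* d) (trans (sym (*-distribˡ-∑ (𝟙 (good G y)) (a G y))) (cong (𝟙 (good G y) *_) (∑a y))))) ⟩
   n * ∑ (λ y → 𝟙 (good G y) * d * d)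
    ≡⟨ cong (n *_) (trans (∑-cong λ y → ℕ.*-assoc (𝟙 (good G y)) d d) (sym (*-distribʳ-∑ (d * d) (λ y → 𝟙 (good G y))))) ⟩
   n * (#good G * (d * d))
    ≡⟨ reorder n (#good G) d ⟩
   #good G * (d * (d * n)) ∎
   where
   reorder : ∀ a b c → a * (b * (c * c)) ≡ b * (c * (c * a))
   reorder = ℕ-solve-∀

  pairs : ℕ
  pairs = ∑ (λ y → ∑ (λ y′ → 𝟙 (badPair G y y′)))

  notB : ∀ y → ∑ (λ y′ → a G y y′ * χᶜ B y′) + degIn G B y ≡ d
  notB y = trans (sym (∑-+ (λ y′ → a G y y′ * χᶜ B y′) (λ y′ → χ B y′ * a G y y′)))
   (trans (∑-cong λ y′ → trans (cong (a G y y′ * χᶜ B y′ +_) (ℕ.*-comm (χ B y′) (a G y y′)))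
     (trans (sym (ℕ.*-distribˡ-+ (a G y y′) (χᶜ B y′) (χ B y′))) (trans (cong (a G y y′ *_) (trans (ℕ.+-comm (χᶜ B y′) (χ B y′)) (χ+χᶜ B y′))) (ℕ.*-identityʳ _))))
    (∑a y))

  pairs≥ : Dsum G ≤ pairs + d * #good G
  pairs≥ = begin
   Dsum G ≤⟨ ∑-mono pt ⟩
   ∑ (λ y → ∑ (λ y′ → 𝟙 (badPair G y y′)) + d * 𝟙 (good G y)) ≡⟨ ∑-+ (λ y → ∑ (λ y′ → 𝟙 (badPair G y y′))) (λ y → d * 𝟙 (good G y)) ⟩
   pairs + ∑ (λ y → d * 𝟙 (good G y)) ≡⟨ cong (pairs +_) (sym (*-distribˡ-∑ d (λ y → 𝟙 (good G y)))) ⟩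
   pairs + d * #good G ∎
   where
   pt : ∀ y → 𝟙 (inD G y) * (d ∸ degIn G B y) ≤ ∑ (λ y′ → 𝟙 (badPair G y y′)) + d * 𝟙 (good G y)
   pt y = ℕ.≤-trans (cases (inD G y) (reached G y)) (ℕ.≤-reflexive (cong (_+ d * 𝟙 (good G y)) (sym row)))
    where
    r = ∑ (λ y′ → a G y y′ * χᶜ B y′)
    row : ∑ (λ y′ → 𝟙 (badPair G y y′)) ≡ 𝟙 (inD G y ∧ not (reached G y)) * r
    row = trans (∑-cong λ y′ → trans (𝟙-∧ (inD G y ∧ not (reached G y)) (adj G y y′ ∧ not (lookup B y′))) (cong (𝟙 (inD G y ∧ not (reached G y)) *_) (𝟙-∧ (adj G y y′) (not (lookup B y′)))))
     (sym (*-distribˡ-∑ (𝟙 (inD G y ∧ not (reached G y))) (λ y′ → a G y y′ * χᶜ B y′)))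
    r≥ : d ∸ degIn G B y ≤ r
    r≥ = ℕ.m≤n+o⇒m∸n≤o d (degIn G B y) (ℕ.≤-reflexive (trans (sym (notB y)) (ℕ.+-comm r (degIn G B y))))
    cases : ∀ p q → 𝟙 p * (d ∸ degIn G B y) ≤ 𝟙 (p ∧ not q) * r + d * 𝟙 (p ∧ q)
    cases false q = z≤n
    cases true true = ℕ.≤-trans (ℕ.≤-reflexive (ℕ.+-identityʳ _)) (ℕ.≤-trans (ℕ.m∸n≤m d (degIn G B y)) (ℕ.≤-reflexive (sym (ℕ.*-identityʳ d))))
    cases true false = ℕ.≤-trans (ℕ.≤-trans (ℕ.≤-reflexive (ℕ.+-identityʳ _)) (ℕ.≤-trans r≥ (ℕ.≤-reflexive (sym (ℕ.+-identityʳ r))))) (ℕ.m≤m+n _ _)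

  -- By `pairs≥`, the good vertices cost at most `d` candidate pairs each. Excluding `y′ = x′` and
  -- the neighbours `y′` of `x′` costs another `d + d²`, uniformly in `x′`.
  V-count : out G * (Dsum G ∸ (d * #good G + (d + d * d))) ≤ ∑ (λ x → ∑ λ x′ → ∑ λ y → ∑ λ y′ → 𝟙 (V G x x′ y y′))
  V-count = begin
   out G * k
    ≡⟨ trans (*-distribʳ-∑ k (λ x → ∑ (O x))) (∑-cong λ x → *-distribʳ-∑ k (O x)) ⟩
   ∑ (λ x → ∑ (λ x′ → O x x′ * k))
    ≤⟨ ∑-mono (λ x → ∑-mono λ x′ → ℕ.*-monoʳ-≤ (O x x′) (inner≥ x′)) ⟩
   ∑ (λ x → ∑ (λ x′ → O x x′ * ∑ (λ y → ∑ (Q x′ y))))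
    ≡⟨ ∑-cong (λ x → ∑-cong λ x′ → trans (*-distribˡ-∑ (O x x′) (λ y → ∑ (Q x′ y))) (∑-cong λ y → trans (*-distribˡ-∑ (O x x′) (Q x′ y))
       (∑-cong λ y′ → sym (𝟙-∧ (outPair G x x′) (badPair G y y′ ∧ (not (x′ ≡ᵇ y′) ∧ not (adj G x′ y′))))))) ⟩
   ∑ (λ x → ∑ λ x′ → ∑ λ y → ∑ λ y′ → 𝟙 (V G x x′ y y′)) ∎
   where
   k = Dsum G ∸ (d * #good G + (d + d * d))
   O : Fin n → Fin n → ℕ
   O x x′ = 𝟙 (outPair G x x′)
   Q : Fin n → Fin n → Fin n → ℕ
   Q x′ y y′ = 𝟙 (badPair G y y′ ∧ (not (x′ ≡ᵇ y′) ∧ not (adj G x′ y′)))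
   R : Fin n → Fin n → Fin n → ℕ
   R x′ y y′ = 𝟙 (x′ ≡ᵇ y′) * a G y y′ + a G x′ y′ * a G y y′
   pairs≤ : ∀ x′ → pairs ≤ ∑ (λ y → ∑ (Q x′ y)) + (d + d * d)
   pairs≤ x′ = begin
    pairs ≤⟨ ∑-mono (λ y → ∑-mono λ y′ → bool (inD G y ∧ not (reached G y)) (adj G y y′) (not (lookup B y′)) (x′ ≡ᵇ y′) (adj G x′ y′)) ⟩
    ∑ (λ y → ∑ (λ y′ → Q x′ y y′ + R x′ y y′)) ≡⟨ trans (∑-cong λ y → ∑-+ (Q x′ y) (R x′ y)) (∑-+ (λ y → ∑ (Q x′ y)) (λ y → ∑ (R x′ y))) ⟩
    ∑ (λ y → ∑ (Q x′ y)) + ∑ (λ y → ∑ (R x′ y)) ≡⟨ cong (∑ (λ y → ∑ (Q x′ y)) +_) rsum ⟩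
    ∑ (λ y → ∑ (Q x′ y)) + (d + d * d) ∎
    where
    bool : ∀ p e b f g → 𝟙 (p ∧ (e ∧ b)) ≤ 𝟙 ((p ∧ (e ∧ b)) ∧ (not f ∧ not g)) + (𝟙 f * 𝟙 e + 𝟙 g * 𝟙 e)
    bool false e b f g = z≤n
    bool true false b f g = z≤n
    bool true true false f g = z≤n
    bool true true true true g = s≤s z≤n
    bool true true true false true = s≤s z≤n
    bool true true true false false = s≤s z≤n
    rsum : ∑ (λ y → ∑ (R x′ y)) ≡ d + d * d
    rsum = trans (∑-swap (R x′)) (trans (∑-cong λ y′ → trans (∑-+ (λ y → 𝟙 (x′ ≡ᵇ y′) * a G y y′) (λ y → a G x′ y′ * a G y y′))
      (cong₂ _+_ (trans (sym (*-distribˡ-∑ (𝟙 (x′ ≡ᵇ y′)) (λ y → a G y y′))) (cong (𝟙 (x′ ≡ᵇ y′) *_) (∑a′ y′)))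
       (trans (sym (*-distribˡ-∑ (a G x′ y′) (λ y → a G y y′))) (cong (a G x′ y′ *_) (∑a′ y′)))))
     (trans (∑-+ (λ y′ → 𝟙 (x′ ≡ᵇ y′) * d) (λ y′ → a G x′ y′ * d))
      (cong₂ _+_ (trans (sym (*-distribʳ-∑ d (λ y′ → 𝟙 (x′ ≡ᵇ y′)))) (trans (cong (_* d) (∑-δ₁ x′)) (ℕ.+-identityʳ d)))
       (trans (sym (*-distribʳ-∑ d (a G x′))) (cong (_* d) (∑a x′))))))
   inner≥ : ∀ x′ → k ≤ ∑ (λ y → ∑ (Q x′ y))
   inner≥ x′ = ℕ.m≤n+o⇒m∸n≤o (Dsum G) (d * #good G + (d + d * d)) (begin
    Dsum G ≤⟨ pairs≥ ⟩
    pairs + d * #good G ≤⟨ ℕ.+-monoˡ-≤ (d * #good G) (pairs≤ x′) ⟩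
    ∑ (λ y → ∑ (Q x′ y)) + (d + d * d) + d * #good G ≡⟨ reorder (∑ (λ y → ∑ (Q x′ y))) (d + d * d) (d * #good G) ⟩
    d * #good G + (d + d * d) + ∑ (λ y → ∑ (Q x′ y)) ∎)
    where
    reorder : ∀ a b c → a + b + c ≡ c + b + a
    reorder = ℕ-solve-∀

-- Large sets are typically joined within two rounds.

module JoiningIsTypical {n d : ℕ} (1≤d : 1 ℕ.≤ d) (I B : Subset n) (I∩B : Disjoint I B) where

 open Joining 1≤d I B I∩B

 module SparseJoin (3≤d : 3 ℕ.≤ d) (G : Graph n) (reg : Regular d G) (M m : ℕ) .{{_ : ℕ.NonZero M}} (sparse : Sparse M m G) where

  open import Data.Nat.Base using (_+_; _*_; _≤_; _<_; _∸_; z≤n; s≤s)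
  open import Data.Nat.DivMod using (_/_; m/n*n≤m; /-monoˡ-≤)
  open ℕ.≤-Reasoning
  open RegularGraph G reg
  open Consequences 3≤d G reg M m sparse using (2+d-2)

  D : Subset n
  D = Vec.tabulate (inD G)

  D∉B : ∀ u → inD G u ≡ true → lookup B u ≡ false
  D∉B u h with lookup B u
  ... | false = refl

  b i #D : ℕ
  b = ∣ B ∣
  i = ∣ I ∣
  #D = ∑ (λ u → 𝟙 (inD G u))

  boundary-D : ∑ (λ u → 𝟙 (inD G u) * degIn G B u) ≡ boundary G B
  boundary-D = ∑-cong λ u → pt (lookup B u) (degIn G B u)
   where
   pt : ∀ p k → 𝟙 (not p ∧ does (1 ℕ.≤? k)) * k ≡ 𝟙 (not p) * k
   pt true k = refl
   pt false zero = refl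
   pt false (suc k) = refl

  #D≤ : #D ≤ d * b
  #D≤ = ℕ.≤-trans (∑-mono λ u → pt (lookup B u) (degIn G B u)) (ℕ.≤-reflexive (∑degIn≡d∣S∣ B))
   where
   pt : ∀ p k → 𝟙 (not p ∧ does (1 ℕ.≤? k)) ≤ k
   pt true k = z≤n
   pt false zero = z≤n
   pt false (suc k) = s≤s z≤n

  Dsum+ : Dsum G + boundary G B ≡ d * #D
  Dsum+ = trans (cong (Dsum G +_) (sym boundary-D)) (trans (sym (∑-+ (λ u → 𝟙 (inD G u) * (d ∸ degIn G B u)) (λ u → 𝟙 (inD G u) * degIn G B u)))
   (trans (∑-cong λ u → trans (sym (ℕ.*-distribˡ-+ (𝟙 (inD G u)) (d ∸ degIn G B u) (degIn G B u))) (trans (cong (𝟙 (inD G u) *_) (ℕ.m∸n+n≡m (degIn≤d B u))) (ℕ.*-comm (𝟙 (inD G u)) d)))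
    (sym (*-distribˡ-∑ d (λ u → 𝟙 (inD G u))))))

  -- Sparsity of `B` together with its neighbours `D` keeps the boundary edges of `B` from sharing
  -- endpoints too often, so `D` is large and its vertices have many edges that do not lead back to
  -- `B`.
  Dsum≥ : suc d * b ≤ m → d * suc d ≤ M → b ≤ 2 * Dsum G
  Dsum≥ small hM = ℕ.+-cancelʳ-≤ (2 * b) _ _ (ℕ.+-cancelʳ-≤ (2 * bd) _ _ (begin
    b + 2 * b + 2 * bd ≤⟨ ℕ.+-monoˡ-≤ (2 * bd) 3b≤ ⟩
    d * (d ∸ 2) * b + 2 * bd ≤⟨ big ⟩
    2 * Dsum G + 2 * (d * t) + 2 * bd ≤⟨ ℕ.+-monoˡ-≤ (2 * bd) (ℕ.+-monoʳ-≤ (2 * Dsum G) (ℕ.*-monoʳ-≤ 2 dt≤b)) ⟩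
    2 * Dsum G + 2 * b + 2 * bd ∎))
   where
   S = B ∪ˢ D
   union = e₂-union B (inD G) D∉B
   bd = boundary G B
   t = (suc d * b) / M
   S≤ : ∣ S ∣ ≤ suc d * b
   S≤ = ℕ.≤-trans (ℕ.≤-reflexive (proj₁ union)) (ℕ.+-monoʳ-≤ b #D≤)
   main : e₂ G B + 2 * bd ≤ 2 * (b + #D) + 2 * t
   main = begin
    e₂ G B + 2 * bd ≡⟨ cong (λ e → e₂ G B + 2 * e) (sym boundary-D) ⟩
    _ ≤⟨ proj₂ union ⟩
    e₂ G S ≤⟨ sparse S (ℕ.≤-trans S≤ small) ⟩
    2 * ∣ S ∣ + 2 * (∣ S ∣ / M) ≤⟨ ℕ.+-mono-≤ (ℕ.≤-reflexive (cong (2 *_) (proj₁ union))) (ℕ.*-monoʳ-≤ 2 (/-monoˡ-≤ M S≤)) ⟩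
    2 * (b + #D) + 2 * t ∎
   dt≤b : d * t ≤ b
   dt≤b = ℕ.*-cancelˡ-≤ (suc d) (begin
    suc d * (d * t) ≡⟨ reorder (suc d) d t ⟩
    t * (d * suc d) ≤⟨ ℕ.*-monoʳ-≤ t hM ⟩
    t * M ≤⟨ m/n*n≤m (suc d * b) M ⟩
    suc d * b ∎)
    where
    reorder : ∀ a b c → a * (b * c) ≡ c * (b * a)
    reorder = ℕ-solve-∀
   3b≤ : b + 2 * b ≤ d * (d ∸ 2) * b
   3b≤ = ℕ.*-monoˡ-≤ b (ℕ.*-mono-≤ 3≤d (ℕ.∸-monoˡ-≤ 2 3≤d))
   -- d times `main`, after substituting bd + e₂ = db and Dsum = d #D - bd.
   big : d * (d ∸ 2) * b + 2 * bd ≤ 2 * Dsum G + 2 * (d * t) + 2 * bd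
   big = ℕ.+-cancelʳ-≤ (2 * d * b) _ _ (begin
    d * (d ∸ 2) * b + 2 * bd + 2 * d * b ≡⟨ ring₁ d (d ∸ 2) b bd ⟩
    d * ((d ∸ 2) * b + 2 * b) + 2 * bd ≡⟨ cong (λ e → d * e + 2 * bd) (trans (2+d-2 b) (sym (e₂+boundary B))) ⟩
    d * (e₂ G B + bd) + 2 * bd ≤⟨ ℕ.+-monoʳ-≤ (d * (e₂ G B + bd)) (ℕ.*-monoˡ-≤ bd (ℕ.≤-trans (s≤s (s≤s z≤n)) 3≤d)) ⟩
    d * (e₂ G B + bd) + d * bd ≡⟨ ring₂ d (e₂ G B) bd ⟩
    d * (e₂ G B + 2 * bd) ≤⟨ ℕ.*-monoʳ-≤ d main ⟩
    d * (2 * (b + #D) + 2 * t) ≡⟨ ring₃ d b #D t ⟩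
    2 * (d * #D) + 2 * (d * t) + 2 * d * b ≡⟨ cong (λ e → 2 * e + 2 * (d * t) + 2 * d * b) (sym Dsum+) ⟩
    2 * (Dsum G + bd) + 2 * (d * t) + 2 * d * b ≡⟨ ring₄ (Dsum G) bd (d * t) (2 * d * b) ⟩
    2 * Dsum G + 2 * (d * t) + 2 * bd + 2 * d * b ∎)
    where
    ring₁ : ∀ d e b c → d * e * b + 2 * c + 2 * d * b ≡ d * (e * b + 2 * b) + 2 * c
    ring₁ = ℕ-solve-∀
    ring₂ : ∀ d e c → d * (e + c) + d * c ≡ d * (e + 2 * c)
    ring₂ = ℕ-solve-∀
    ring₃ : ∀ d b x t → d * (2 * (b + x) + 2 * t) ≡ 2 * (d * x) + 2 * (d * t) + 2 * d * b
    ring₃ = ℕ-solve-∀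
    ring₄ : ∀ s c x y → 2 * (s + c) + 2 * x + y ≡ 2 * s + 2 * x + 2 * c + y
    ring₄ = ℕ-solve-∀

  -- Sparsity is applied to `I` enlarged by `B` and its neighbours. The addition is at most an
  -- eighth of `∣ I ∣`, so the enlarged set absorbs little more than `2 ∣ I ∣` of the `d ∣ I ∣` edge
  -- ends at `I`.
  out≥ : 8 * (suc d * b) ≤ i → 2 * i ≤ m → 16 ≤ M → i ≤ 2 * out G
  out≥ hb small hM = ℕ.*-cancelˡ-≤ 2 (ℕ.+-cancelʳ-≤ (2 * i) _ _ (begin
    2 * i + 2 * i ≡⟨ ring₁ i ⟩
    4 * i ≤⟨ ℕ.*-monoʳ-≤ 4 main ⟩
    4 * (out G + (2 * (suc d * b) + 2 * t)) ≡⟨ ring₂ (out G) (suc d * b) t ⟩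
    2 * (2 * out G) + (8 * (suc d * b) + 8 * t) ≤⟨ ℕ.+-monoʳ-≤ (2 * (2 * out G)) (ℕ.+-mono-≤ hb 8t≤i) ⟩
    2 * (2 * out G) + (i + i) ≡⟨ cong (λ e → 2 * (2 * out G) + (i + e)) (sym (ℕ.+-identityʳ i)) ⟩
    2 * (2 * out G) + 2 * i ∎))
   where
   ring₁ : ∀ i → 2 * i + 2 * i ≡ 4 * i
   ring₁ = ℕ-solve-∀
   ring₂ : ∀ o c t → 4 * (o + (2 * c + 2 * t)) ≡ 2 * (2 * o) + (8 * c + 8 * t)
   ring₂ = ℕ-solve-∀
   f : Fin n → Bool
   f u = not (lookup I u) ∧ (lookup B u ∨ inD G u)
   f-I : ∀ u → f u ≡ true → lookup I u ≡ false
   f-I u h with lookup I u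
   ... | false = refl
   S = I ∪ˢ Vec.tabulate f
   union = e₂-union I f f-I
   t = (2 * i) / M
   κ = ∑ (λ u → 𝟙 (f u) * degIn G I u)
   #f = ∑ (λ u → 𝟙 (f u))
   #f≤ : #f ≤ suc d * b
   #f≤ = ℕ.≤-trans (∑-mono λ u → or (lookup I u) (lookup B u) (inD G u))
    (ℕ.≤-trans (ℕ.≤-reflexive (trans (∑-+ (χ B) (λ u → 𝟙 (inD G u))) (cong (_+ #D) (sym (card≡∑ B))))) (ℕ.+-monoʳ-≤ b #D≤))
    where
    or : ∀ p q r → 𝟙 (not p ∧ (q ∨ r)) ≤ 𝟙 q + 𝟙 r
    or true q r = z≤n
    or false true r = s≤s z≤n
    or false false r = ℕ.≤-refl
   cb≤i : suc d * b ≤ i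
   cb≤i = ℕ.≤-trans (ℕ.m≤m+n (suc d * b) _) hb
   S≤ : ∣ S ∣ ≤ 2 * i
   S≤ = ℕ.≤-trans (ℕ.≤-reflexive (proj₁ union)) (ℕ.+-monoʳ-≤ i (ℕ.≤-trans #f≤ (ℕ.≤-trans cb≤i (ℕ.≤-reflexive (sym (ℕ.+-identityʳ i))))))
   8t≤i : 8 * t ≤ i
   8t≤i = ℕ.*-cancelˡ-≤ 2 (begin
    2 * (8 * t) ≡⟨ reorder t ⟩
    t * 16 ≤⟨ ℕ.*-monoʳ-≤ t hM ⟩
    t * M ≤⟨ m/n*n≤m (2 * i) M ⟩
    2 * i ∎)
    where
    reorder : ∀ t → 2 * (8 * t) ≡ t * 16
    reorder = ℕ-solve-∀
   leaving : d * i ≤ e₂ G I + κ + out G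
   leaving = begin
    d * i ≡⟨ sym (∑degIn≡d∣S∣ I) ⟩
    ∑ (degIn G I) ≡⟨ ∑-cong (λ v → ∑-cong λ u → cong (χ I u *_) (a-sym v u)) ⟩
    ∑ (λ v → ∑ (λ u → χ I u * a G u v)) ≤⟨ ∑-mono (λ v → ∑-mono λ u → bool (lookup I u) (adj G u v) (lookup I v) (lookup B v) (inD G v)) ⟩
    ∑ (λ v → ∑ (λ u → (χ I v * (χ I u * a G u v) + 𝟙 (f v) * (χ I u * a G u v)) + 𝟙 (outPair G u v)))
     ≡⟨ ∑-cong (λ v → trans (∑-+ (λ u → χ I v * (χ I u * a G u v) + 𝟙 (f v) * (χ I u * a G u v)) (λ u → 𝟙 (outPair G u v)))
        (cong (_+ ∑ (λ u → 𝟙 (outPair G u v))) (trans (∑-+ (λ u → χ I v * (χ I u * a G u v)) (λ u → 𝟙 (f v) * (χ I u * a G u v)))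
         (cong₂ _+_ (collect v (χ I v)) (collect v (𝟙 (f v))))))) ⟩
    ∑ (λ v → (χ I v * degIn G I v + 𝟙 (f v) * degIn G I v) + ∑ (λ u → 𝟙 (outPair G u v)))
     ≡⟨ trans (∑-+ (λ v → χ I v * degIn G I v + 𝟙 (f v) * degIn G I v) (λ v → ∑ (λ u → 𝟙 (outPair G u v))))
        (cong₂ _+_ (∑-+ (λ v → χ I v * degIn G I v) (λ v → 𝟙 (f v) * degIn G I v)) (∑-swap (λ v u → 𝟙 (outPair G u v)))) ⟩
    e₂ G I + κ + out G ∎
    where
    collect : ∀ v c → ∑ (λ u → c * (χ I u * a G u v)) ≡ c * degIn G I v
    collect v c = trans (sym (*-distribˡ-∑ c (λ u → χ I u * a G u v))) (cong (c *_) (∑-cong λ u → cong (χ I u *_) (a-sym u v)))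
    bool : ∀ p e i b q → 𝟙 p * 𝟙 e ≤ (𝟙 i * (𝟙 p * 𝟙 e) + 𝟙 (not i ∧ (b ∨ q)) * (𝟙 p * 𝟙 e)) + 𝟙 ((p ∧ e) ∧ (not i ∧ (not b ∧ not q)))
    bool false e i b q = z≤n
    bool true false i b q = z≤n
    bool true true true b q = s≤s z≤n
    bool true true false true q = s≤s z≤n
    bool true true false false true = s≤s z≤n
    bool true true false false false = s≤s z≤n
   main : i ≤ out G + (2 * (suc d * b) + 2 * t)
   main = ℕ.+-cancelʳ-≤ (2 * i) _ _ (begin
    i + 2 * i ≤⟨ ℕ.*-monoˡ-≤ i 3≤d ⟩
    d * i ≤⟨ leaving ⟩
    e₂ G I + κ + out G ≤⟨ ℕ.+-monoˡ-≤ (out G) (ℕ.+-monoʳ-≤ (e₂ G I) (ℕ.m≤m+n κ (κ + 0))) ⟩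
    e₂ G I + 2 * κ + out G ≤⟨ ℕ.+-monoˡ-≤ (out G) (ℕ.≤-trans (proj₂ union) (sparse S (ℕ.≤-trans S≤ small))) ⟩
    2 * ∣ S ∣ + 2 * (∣ S ∣ / M) + out G ≤⟨ ℕ.+-monoˡ-≤ (out G) (ℕ.+-mono-≤ (ℕ.≤-trans (ℕ.≤-reflexive (cong (2 *_) (proj₁ union))) (ℕ.*-monoʳ-≤ 2 (ℕ.+-monoʳ-≤ i #f≤))) (ℕ.*-monoʳ-≤ 2 (/-monoˡ-≤ M S≤))) ⟩
    2 * (i + suc d * b) + 2 * t + out G ≡⟨ ring i (suc d * b) t (out G) ⟩
    out G + (2 * (suc d * b) + 2 * t) + 2 * i ∎)
    where
    ring : ∀ i c t o → 2 * (i + c) + 2 * t + o ≡ o + (2 * c + 2 * t) + 2 * i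
    ring = ℕ-solve-∀

 open Rationals
 open Expectation d 1≤d
 open OneRound d 1≤d

 missed : Graph n → Subset n → Subset n → ℚ
 missed G J C = EH G 2 (λ bs → indicator (disj (back bs C) J))

 -- These are `1 - 1/d` and `1 - 1/d²`: the probability that a given call is not made, and that a
 -- given path of two calls is not followed.
 q θ : ℚ
 q = pgf 0ℚ
 θ = pgf q

 0≤q : 0ℚ ≤ q
 0≤q = 0≤pgf ℚ.≤-refl 0≤1

 q≤1 : q ≤ 1ℚ
 q≤1 = pgf≤1 ℚ.≤-refl 0≤1

 -- Two rounds fail to join B to I only if for each good vertex y, y does not call B in the second round
 -- or nobody in I calls y in the first one.
 missed≤ : ∀ G → Regular d G → missed G I B ≤ θ ^ #good G
 missed≤ G reg = ℚ.≤-trans (Ex-mono G λ c₂ _ → first (pre c₂ B))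
   (ℚ.≤-trans (ℚ.≤-reflexive (Ex-cong G λ c₂ _ → cong (q ^_) (∑-cong λ u → second c₂ u)))
    (ℚ.≤-trans (Ex-hit 0≤q q≤1 G degrees (λ _ → 0) (good G) (lookup B))
     (ℚ.≤-trans (ℚ.≤-reflexive (drop q (θ ^ ∑ (λ u → 𝟙 (good G u) ℕ.* ∑ (λ x → χ (lookup G u) x ℕ.* 𝟙 (lookup B x))))))
      (^-anti-exp (0≤pgf 0≤q q≤1) (pgf≤1 0≤q q≤1) (∑-mono third)))))
  where
  open RegularGraph G reg
  drop : ∀ z y → z ^ ∑ {n} (λ _ → 0) * y ≡ y
  drop z y = trans (cong (λ e → z ^ e * y) (∑-zero {n} (λ _ → 0) λ _ → refl)) (ℚ.*-identityˡ y)
  second : ∀ c₂ u → χ (pre c₂ B) u ℕ.* 𝟙 (good G u) ≡ 0 ℕ.+ 𝟙 (good G u) ℕ.* 𝟙 (lookup B (lookup c₂ u))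
  second c₂ u rewrite pre-lookup c₂ B u with lookup B u
  ... | true = refl
  ... | false = ℕ.*-comm (χ B (lookup c₂ u)) _
  third : ∀ u → 𝟙 (good G u) ℕ.≤ 𝟙 (good G u) ℕ.* ∑ (λ x → χ (lookup G u) x ℕ.* 𝟙 (lookup B x))
  third u with bool-cases (good G u)
  ... | inj₂ e = ℕ.≤-trans (ℕ.≤-reflexive (𝟙-false e)) ℕ.z≤n
  ... | inj₁ e = ℕ.≤-trans (ℕ.≤-reflexive (sym (ℕ.*-identityʳ (𝟙 (good G u))))) (ℕ.*-monoʳ-≤ (𝟙 (good G u)) (subst (1 ℕ.≤_) (∑-cong λ x → ℕ.*-comm (χ B x) (a G u x)) (1≤deg (lookup B u) (reached G u) e)))
   where
   1≤deg : ∀ p r → (not p ∧ does (1 ℕ.≤? degIn G B u)) ∧ r ≡ true → 1 ℕ.≤ degIn G B u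
   1≤deg false r h = does-true (1 ℕ.≤? degIn G B u) (and (does (1 ℕ.≤? degIn G B u)) r h)
    where
    and : ∀ a b → a ∧ b ≡ true → a ≡ true
    and true b _ = refl
  first : ∀ C → Ex G (λ c₁ → indicator (disj (pre c₁ C) I)) ≤ q ^ ∑ (λ u → χ C u ℕ.* 𝟙 (good G u))
  first C with disjoint? C I
  ... | no meets = ℚ.≤-trans (ℚ.≤-reflexive (trans (Ex-cong G λ c₁ _ → cong indicator (false-does (disjoint? (pre c₁ C) I) λ h → meets λ x e → h x (pre-old c₁ C e))) (Ex-const G degrees 0ℚ)))
    (^-nonNeg 0≤q (∑ (λ u → χ C u ℕ.* 𝟙 (good G u))))
  -- Generating functions are used at `z = 0`, where `0ℚ ^ k` is the indicator of `k = 0`: no call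
  -- from `I` enters `C`.
  ... | yes C∩I = ℚ.≤-trans (Ex-mono G λ c₁ _ → untouched c₁)
    (ℚ.≤-trans (Ex-hit ℚ.≤-refl 0≤1 G degrees (λ _ → 0) (lookup I) (lookup C))
     (ℚ.≤-trans (ℚ.≤-reflexive (drop 0ℚ (q ^ ∑ (λ u → χ I u ℕ.* ∑ (λ x → χ (lookup G u) x ℕ.* 𝟙 (lookup C x))))))
      (^-anti-exp 0≤q q≤1 (ℕ.≤-trans (∑-mono touch) (ℕ.≤-reflexive exchange)))))
   where
   untouched : ∀ c₁ → indicator (disj (pre c₁ C) I) ≤ 0ℚ ^ ∑ (λ u → 0 ℕ.+ χ I u ℕ.* χ C (lookup c₁ u))
   untouched c₁ with bool-cases (disj (pre c₁ C) I)
   ... | inj₂ e = subst (_≤ 0ℚ ^ ∑ (λ u → χ I u ℕ.* χ C (lookup c₁ u))) (sym (cong indicator e)) (^-nonNeg ℚ.≤-refl (∑ (λ u → χ I u ℕ.* χ C (lookup c₁ u))))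
   ... | inj₁ e = ℚ.≤-reflexive (trans (cong indicator e) (sym (cong (0ℚ ^_) (∑-zero (λ u → χ I u ℕ.* χ C (lookup c₁ u)) none))))
    where
    none : ∀ u → χ I u ℕ.* χ C (lookup c₁ u) ≡ 0
    none u with bool-cases (lookup C (lookup c₁ u))
    ... | inj₂ e′ = trans (cong (χ I u ℕ.*_) (𝟙-false e′)) (ℕ.*-zeroʳ (χ I u))
    ... | inj₁ e′ = cong (ℕ._* χ C (lookup c₁ u)) (𝟙-false (does-true (disjoint? (pre c₁ C) I) e u (trans (pre-lookup c₁ C u) (∨-trueʳ {lookup C u} e′))))
   touch : ∀ u → χ C u ℕ.* 𝟙 (good G u) ℕ.≤ χ C u ℕ.* degIn G I u
   touch u with bool-cases (lookup C u)
   ... | inj₂ e = ℕ.≤-reflexive (trans (cong (ℕ._* 𝟙 (good G u)) (𝟙-false e)) (sym (cong (ℕ._* degIn G I u) (𝟙-false e))))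
   ... | inj₁ e = ℕ.*-monoʳ-≤ (χ C u) (le (inD G u) (lookup I u) (degIn G I u) (C∩I u e))
    where
    le : ∀ p r k → r ≡ false → 𝟙 (p ∧ (r ∨ does (1 ℕ.≤? k))) ℕ.≤ k
    le false _ k refl = ℕ.z≤n
    le true _ zero refl = ℕ.z≤n
    le true _ (suc k) refl = ℕ.z<s
   exchange : ∑ (λ u → χ C u ℕ.* degIn G I u) ≡ ∑ (λ u → χ I u ℕ.* ∑ (λ x → χ (lookup G u) x ℕ.* χ C x))
   exchange = trans (∑degIn (χ C) I) (∑-cong λ v → cong (χ I v ℕ.*_) (∑-cong λ u → trans (ℕ.*-comm (χ C u) (a G u v)) (cong (ℕ._* χ C u) (a-sym u v))))

 module Typical (w : Graph n → ℚ) (0≤w : ∀ G → 0ℚ ≤ w G)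
  (invariant : ∀ G → Regular d G → ∀ x x′ y y′ → V G x x′ y y′ ≡ true → w (Switch.switch x x′ y y′ G) ≡ w G)
  (R₀ R₁ k : ℕ) (enough : 2 ℕ.* ((k ℕ.+ k) ℕ.* (d ℕ.* (d ℕ.* n))) ℕ.≤ (R₀ ℕ.∸ (k ℕ.+ k)) ℕ.* (R₁ ℕ.∸ (d ℕ.* (k ℕ.+ k) ℕ.+ (d ℕ.+ d ℕ.* d)))) (1≤n : 1 ℕ.≤ n) (1≤k : 1 ℕ.≤ k) where

  L : List (Graph n)
  L = regularGraphs n d

  rich : Graph n → Bool
  rich G = does (R₀ ℕ.≤? out G ℕ.+ #good G) ∧ does (R₁ ℕ.≤? Dsum G)

  class : ℕ → Graph n → Bool
  class j G = does (#good G ℕ.<? j) ∧ rich G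

  U : ℕ → ℚ
  U j = Σ (λ G → indicator (class j G) * w G) L

  private
   split : ∀ a b c → a ∧ (b ∧ c) ≡ true → a ≡ true × b ≡ true × c ≡ true
   split true true true _ = refl , refl , refl

  -- A graph with fewer than `j ≤ 2k` good vertices admits at least `E` switchings by `enough`, and
  -- one with at most `j` good vertices is reached by at most `E/2`. As `w` is invariant, allowing
  -- one more good vertex at least doubles the weight; going from `k` to `2k` gives the factor
  -- `½ ^ k`.
  U-step : ∀ j → j ℕ.≤ k ℕ.+ k → 1 ℕ.≤ j → U j ≤ ½ * U (suc j)
  U-step j j≤2k 1≤j = *-cancelʳ (ι E) (0<ι 1≤E) (begin
    U j * ι E ≡⟨ sym (Σ-*ʳ (ι E) (λ G → indicator (class j G) * w G) L) ⟩
    Σ (λ G → indicator (class j G) * w G * ι E) L ≤⟨ Σ-mono L (λ G G∈ → left G (regularGraphs-sound n d G∈)) ⟩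
    Σ (λ G → indicator (class j G) * w G * ι (∑ λ x → ∑ λ x′ → ∑ λ y → ∑ λ y′ → 𝟙 (V G x x′ y y′))) L
     ≤⟨ double-count n d {f = λ G → indicator (class j G) * w G} {g = λ G → indicator (class (suc j) G) * w G} {V = V} {W = W} (λ G → *-nonNeg (0≤indicator (class (suc j) G)) (0≤w G)) move ⟩
    Σ (λ G → indicator (class (suc j) G) * w G * ι (∑ λ x → ∑ λ x′ → ∑ λ y → ∑ λ y′ → 𝟙 (W G x x′ y y′))) L
     ≤⟨ Σ-mono L (λ G G∈ → right G (regularGraphs-sound n d G∈)) ⟩
    Σ (λ G → indicator (class (suc j) G) * w G * (½ * ι E)) L
     ≡⟨ trans (Σ-*ʳ (½ * ι E) (λ G → indicator (class (suc j) G) * w G) L) (solve 3 (λ u h e → u :* (h :* e) := h :* u :* e) refl (U (suc j)) ½ (ι E)) ⟩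
    ½ * U (suc j) * ι E ∎)
   where
   open ℚ.≤-Reasoning
   F E : ℕ
   F = (k ℕ.+ k) ℕ.* (d ℕ.* (d ℕ.* n))
   E = 2 ℕ.* F
   1≤E : 1 ℕ.≤ E
   1≤E = ℕ.*-mono-≤ {1} {2} (ℕ.z<s) (ℕ.*-mono-≤ (ℕ.≤-trans 1≤k (ℕ.m≤m+n k k)) (ℕ.*-mono-≤ 1≤d (ℕ.*-mono-≤ 1≤d 1≤n)))
   left : ∀ G → Regular d G → indicator (class j G) * w G * ι E ≤ indicator (class j G) * w G * ι (∑ λ x → ∑ λ x′ → ∑ λ y → ∑ λ y′ → 𝟙 (V G x x′ y y′))
   left G reg = subst₂ _≤_ (sym (ℚ.*-assoc (indicator (class j G)) (w G) (ι E))) (sym (ℚ.*-assoc (indicator (class j G)) (w G) _))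
    (indicator-*-≤ (class j G) λ h → *-monoˡ (w G) (0≤w G) (ι-mono (bound h)))
    where
    open Counts G reg
    bound : class j G ≡ true → E ℕ.≤ ∑ λ x → ∑ λ x′ → ∑ λ y → ∑ λ y′ → 𝟙 (V G x x′ y y′)
    bound h with split (does (#good G ℕ.<? j)) (does (R₀ ℕ.≤? out G ℕ.+ #good G)) (does (R₁ ℕ.≤? Dsum G)) h
    ... | h₁ , h₂ , h₃ = ℕ.≤-trans enough (ℕ.≤-trans (ℕ.*-mono-≤ o D≤) V-count)
     where
     g≤ : #good G ℕ.≤ k ℕ.+ k
     g≤ = ℕ.≤-trans (ℕ.<⇒≤ (does-true (#good G ℕ.<? j) h₁)) j≤2k
     o : R₀ ℕ.∸ (k ℕ.+ k) ℕ.≤ out G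
     o = ℕ.m≤n+o⇒m∸n≤o R₀ (k ℕ.+ k) (ℕ.≤-trans (does-true (R₀ ℕ.≤? out G ℕ.+ #good G) h₂) (ℕ.≤-trans (ℕ.+-monoʳ-≤ (out G) g≤) (ℕ.≤-reflexive (ℕ.+-comm (out G) (k ℕ.+ k)))))
     D≤ : R₁ ℕ.∸ (d ℕ.* (k ℕ.+ k) ℕ.+ (d ℕ.+ d ℕ.* d)) ℕ.≤ Dsum G ℕ.∸ (d ℕ.* #good G ℕ.+ (d ℕ.+ d ℕ.* d))
     D≤ = ℕ.∸-mono (does-true (R₁ ℕ.≤? Dsum G) h₃) (ℕ.+-monoˡ-≤ (d ℕ.+ d ℕ.* d) (ℕ.*-monoʳ-≤ d g≤))
   right : ∀ G → Regular d G → indicator (class (suc j) G) * w G * ι (∑ λ x → ∑ λ x′ → ∑ λ y → ∑ λ y′ → 𝟙 (W G x x′ y y′)) ≤ indicator (class (suc j) G) * w G * (½ * ι E)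
   right G reg = subst₂ _≤_ (sym (ℚ.*-assoc (indicator (class (suc j) G)) (w G) _)) (sym (ℚ.*-assoc (indicator (class (suc j) G)) (w G) (½ * ι E)))
    (indicator-*-≤ (class (suc j) G) λ h → *-monoˡ (w G) (0≤w G) (bound h))
    where
    open Counts G reg
    bound : class (suc j) G ≡ true → ι (∑ λ x → ∑ λ x′ → ∑ λ y → ∑ λ y′ → 𝟙 (W G x x′ y y′)) ≤ ½ * ι E
    bound h with split (does (#good G ℕ.<? suc j)) (does (R₀ ℕ.≤? out G ℕ.+ #good G)) (does (R₁ ℕ.≤? Dsum G)) h
    ... | h₁ , _ = ℚ.≤-trans (ι-mono (ℕ.≤-trans (ℕ.≤-reflexive W-count) (ℕ.*-monoˡ-≤ (d ℕ.* (d ℕ.* n)) (ℕ.≤-trans (ℕ.s≤s⁻¹ (does-true (#good G ℕ.<? suc j) h₁)) j≤2k))))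
     (ℚ.≤-reflexive (sym (trans (cong (½ *_) (ι-* 2 F)) (trans (sym (ℚ.*-assoc ½ (ι 2) (ι F))) (trans (cong (λ e → ½ * e * ι F) (ι≡fromℕ 2)) (ℚ.*-identityˡ (ι F)))))))
   move : ∀ G x x′ y y′ → Regular d G → V G x x′ y y′ ≡ true → let open Switch x x′ y y′ in
    indicator (class j G) * w G ≤ 0ℚ ⊎ (Regular d (switch G) × W (switch G) x x′ y y′ ≡ true × indicator (class j G) * w G ≤ indicator (class (suc j) (switch G)) * w (switch G))
   move G x x′ y y′ reg v = inj₂ (reg′ , W-switch , subst (λ e → indicator (class j G) * w G ≤ indicator (class (suc j) G′) * e) (sym (invariant G reg x x′ y y′ v))
     (*-monoʳ (w G) (0≤w G) (indicator-mono up)))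
    where
    open Move G reg x x′ y y′ v
    up : class j G ≡ true → class (suc j) G′ ≡ true
    up h with split (does (#good G ℕ.<? j)) (does (R₀ ℕ.≤? out G ℕ.+ #good G)) (does (R₁ ℕ.≤? Dsum G)) h
    ... | h₁ , h₂ , h₃ = cong₂ _∧_ (true-does (#good G′ ℕ.<? suc j) (subst (ℕ._< suc j) (sym #good′) (ℕ.s≤s (does-true (#good G ℕ.<? j) h₁))))
     (cong₂ _∧_ (true-does (R₀ ℕ.≤? out G′ ℕ.+ #good G′) (ℕ.≤-trans (does-true (R₀ ℕ.≤? out G ℕ.+ #good G) h₂)
       (ℕ.≤-trans (ℕ.+-monoˡ-≤ (#good G) out′) (ℕ.≤-reflexive (trans (sym (ℕ.+-suc (out G′) (#good G))) (cong (out G′ ℕ.+_) (sym #good′)))))))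
      (true-does (R₁ ℕ.≤? Dsum G′) (subst (R₁ ℕ.≤_) (sym Dsum′) (does-true (R₁ ℕ.≤? Dsum G) h₃))))

  total : ℚ
  total = Σ w L

  U≤ : ∀ e → e ℕ.≤ k → U k ≤ ½ ^ e * U (k ℕ.+ e)
  U≤ zero _ = ℚ.≤-reflexive (trans (cong U (sym (ℕ.+-identityʳ k))) (sym (ℚ.*-identityˡ (U (k ℕ.+ 0)))))
  U≤ (suc e) h = ℚ.≤-trans (U≤ e (ℕ.<⇒≤ h)) (ℚ.≤-trans (*-monoˡ (½ ^ e) (^-nonNeg (ℚ.nonNegative⁻¹ ½) e)
    (U-step (k ℕ.+ e) (ℕ.+-monoʳ-≤ k (ℕ.<⇒≤ h)) (ℕ.≤-trans 1≤k (ℕ.m≤m+n k e))))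
   (ℚ.≤-reflexive (trans (sym (ℚ.*-assoc (½ ^ e) ½ (U (suc (k ℕ.+ e))))) (cong₂ _*_ (ℚ.*-comm (½ ^ e) ½) (cong U (sym (ℕ.+-suc k e)))))))

  few-good-unlikely : U k ≤ ½ ^ k * total
  few-good-unlikely = ℚ.≤-trans (U≤ k ℕ.≤-refl) (*-monoˡ (½ ^ k) (^-nonNeg (ℚ.nonNegative⁻¹ ½) k)
   (Σ-mono L λ G _ → indicator-≤ (class (k ℕ.+ k) G) (0≤w G) λ _ → ℚ.≤-refl))

  missed-unlikely : Σ (λ G → indicator (rich G) * (w G * missed G I B)) L ≤ (½ ^ k + θ ^ k) * total
  missed-unlikely = begin
    Σ (λ G → indicator (rich G) * (w G * missed G I B)) L ≤⟨ Σ-mono L (λ G G∈ → pt G (regularGraphs-sound n d G∈)) ⟩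
    Σ (λ G → indicator (class k G) * w G + θ ^ k * w G) L ≡⟨ trans (Σ-+ (λ G → indicator (class k G) * w G) (λ G → θ ^ k * w G) L) (cong (U k +_) (Σ-*ˡ (θ ^ k) w L)) ⟩
    U k + θ ^ k * total ≤⟨ ℚ.+-monoˡ-≤ (θ ^ k * total) few-good-unlikely ⟩
    ½ ^ k * total + θ ^ k * total ≡⟨ sym (ℚ.*-distribʳ-+ total (½ ^ k) (θ ^ k)) ⟩
    (½ ^ k + θ ^ k) * total ∎
   where
   open ℚ.≤-Reasoning
   0≤θ = 0≤pgf 0≤q q≤1
   θ≤1 = pgf≤1 0≤q q≤1
   pt : ∀ G → Regular d G → indicator (rich G) * (w G * missed G I B) ≤ indicator (class k G) * w G + θ ^ k * w G
   pt G reg with bool-cases (does (#good G ℕ.<? k))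
   ... | inj₁ few = ℚ.≤-trans (subst (λ e → indicator (rich G) * (w G * missed G I B) ≤ indicator e * w G) (sym (cong (_∧ rich G) few))
     (indicator-*-≤ (rich G) λ _ → p*q≤p (0≤w G) (ℚ.≤-trans (missed≤ G reg) (^≤1 0≤θ θ≤1 (#good G))))) (p≤p+q (*-nonNeg (^-nonNeg 0≤θ k) (0≤w G)))
   ... | inj₂ many = ℚ.≤-trans (indicator-≤ (rich G) (*-nonNeg (^-nonNeg 0≤θ k) (0≤w G)) λ _ → ℚ.≤-trans (*-monoˡ (w G) (0≤w G)
      (ℚ.≤-trans (missed≤ G reg) (^-anti-exp 0≤θ θ≤1 (ℕ.≮⇒≥ (does-false (#good G ℕ.<? k) many))))) (ℚ.≤-reflexive (ℚ.*-comm (w G) (θ ^ k))))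
     (subst (_≤ indicator (class k G) * w G + θ ^ k * w G) (ℚ.+-identityˡ (θ ^ k * w G)) (ℚ.+-monoˡ-≤ (θ ^ k * w G) (*-nonNeg (0≤indicator (class k G)) (0≤w G))))

-- The lower bound: growth at rate at most `r`, and vertices that nobody calls.

module SlowSpread {n d : ℕ} (3≤d : 3 ℕ.≤ d) (G : Graph n) (reg : Regular d G) where

 open Rationals
 open Rate d 3≤d 1 ℕ.≤-refl using (1≤d; μ; r; 0≤μ)
 open Expectation d 1≤d
 open OneRound d 1≤d
 open RegularGraph G reg
 open Kernel G push

 3ℚ : ℚ
 3ℚ = 1ℚ + 1ℚ + 1ℚ

 -- At least `∣ X ∣ - 1` edges, as in a connected graph. Unlike sparsity this is available in every
 -- regular graph, because each newly informed vertex is adjacent to its caller.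
 TreeLike : Subset n → Set
 TreeLike X = 2 ℕ.* ∣ X ∣ ℕ.≤ e₂ G X ℕ.+ 2

 push-treeLike : ∀ c → Compatible G c → ∀ X → TreeLike X → TreeLike (push c X)
 push-treeLike c comp X h = subst (λ S → 2 ℕ.* ∣ S ∣ ℕ.≤ e₂ G S ℕ.+ 2) (sym S≡) (ℕ.≤-trans
   (ℕ.≤-reflexive (trans (cong (2 ℕ.*_) (proj₁ union)) (ℕ.*-distribˡ-+ 2 ∣ X ∣ (∑ (λ u → 𝟙 (f u))))))
   (ℕ.≤-trans (ℕ.+-mono-≤ h (ℕ.*-monoʳ-≤ 2 (∑-mono called)))
    (ℕ.≤-trans (ℕ.≤-reflexive (reorder (e₂ G X) (2 ℕ.* ∑ (λ u → 𝟙 (f u) ℕ.* degIn G X u)))) (ℕ.+-monoˡ-≤ 2 (proj₂ union)))))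
  where
  f : Fin n → Bool
  f w = not (lookup X w) ∧ lookup (push c X) w
  f-X : ∀ w → f w ≡ true → lookup X w ≡ false
  f-X w e with lookup X w
  ... | false = refl
  union = e₂-union X f f-X
  reorder : ∀ a b → a ℕ.+ 2 ℕ.+ b ≡ a ℕ.+ b ℕ.+ 2
  reorder = ℕ-solve-∀
  S≡ : push c X ≡ X ∪ˢ Vec.tabulate f
  S≡ = subset-ext λ w → sym (trans (Vec.lookup∘tabulate _ w) (trans (cong (lookup X w ∨_) (Vec.lookup∘tabulate f w)) (or (lookup X w) _ (push-old c X {w}))))
   where
   or : ∀ a b → (a ≡ true → b ≡ true) → a ∨ (not a ∧ b) ≡ b
   or true b h = sym (h refl)
   or false b h = refl
  called : ∀ w → 𝟙 (f w) ℕ.≤ 𝟙 (f w) ℕ.* degIn G X w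
  called w with bool-cases (f w)
  ... | inj₂ e = ℕ.≤-trans (ℕ.≤-reflexive (𝟙-false e)) ℕ.z≤n
  ... | inj₁ e = ℕ.≤-trans (ℕ.≤-reflexive (sym (ℕ.*-identityʳ (𝟙 (f w))))) (ℕ.*-monoʳ-≤ (𝟙 (f w)) (caller (push⁻ c X w pushed)))
   where
   pushed : lookup (push c X) w ≡ true
   pushed = and (lookup X w) (lookup (push c X) w) e
    where
    and : ∀ a b → not a ∧ b ≡ true → b ≡ true
    and false b h = h
   caller : lookup X w ≡ true ⊎ ∃[ u ] (lookup X u ≡ true × lookup c u ≡ w) → 1 ℕ.≤ degIn G X w
   caller (inj₁ w∈X) = true≢false w∈X (f-X w e)
   caller (inj₂ (u , u∈X , refl)) = ℕ.≤-trans (ℕ.≤-reflexive (sym (cong₂ ℕ._*_ (𝟙-true u∈X) (𝟙-true (trans (adj-sym w u) (comp u))))))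
    (term≤∑ (λ v → χ X v ℕ.* a G w v) u)

 outgoing : Subset n → ℕ
 outgoing X = ∑ (λ u → χ X u ℕ.* ∑ (λ x → a G u x ℕ.* χᶜ X x))

 e₂+outgoing : ∀ X → e₂ G X ℕ.+ outgoing X ≡ d ℕ.* ∣ X ∣
 e₂+outgoing X = trans (sym (∑-+ (λ u → χ X u ℕ.* degIn G X u) (λ u → χ X u ℕ.* ∑ (λ x → a G u x ℕ.* χᶜ X x))))
  (trans (∑-cong λ u → trans (sym (ℕ.*-distribˡ-+ (χ X u) (degIn G X u) _)) (trans (cong (χ X u ℕ.*_) (row u)) (ℕ.*-comm (χ X u) d)))
   (trans (sym (*-distribˡ-∑ d (χ X))) (cong (d ℕ.*_) (sym (card≡∑ X)))))
  where
  row : ∀ u → degIn G X u ℕ.+ ∑ (λ x → a G u x ℕ.* χᶜ X x) ≡ d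
  row u = trans (sym (∑-+ (λ x → χ X x ℕ.* a G u x) (λ x → a G u x ℕ.* χᶜ X x))) (trans (∑-cong λ x → trans (cong (ℕ._+ a G u x ℕ.* χᶜ X x) (ℕ.*-comm (χ X x) (a G u x)))
   (trans (sym (ℕ.*-distribˡ-+ (a G u x) (χ X x) (χᶜ X x))) (trans (cong (a G u x ℕ.*_) (χ+χᶜ X x)) (ℕ.*-identityʳ _)))) (∑a u))

 E-push≤ : ∀ X → Ex G (λ c → ι ∣ push c X ∣) ≤ ι ∣ X ∣ + δ * ι (outgoing X)
 E-push≤ X = begin
   Ex G (λ c → ι ∣ push c X ∣) ≤⟨ Ex-mono G (λ c _ → ≤-trans (ι-mono (∣push∣≤ c X)) (≤-reflexive (trans (ι-+ ∣ X ∣ _) (cong (ι ∣ X ∣ +_) (ι-∑ (λ u → χ X u ℕ.* χᶜ X (lookup c u))))))) ⟩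
   Ex G (λ c → ι ∣ X ∣ + ∑ℚ (λ u → ι (χ X u ℕ.* χᶜ X (lookup c u)))) ≡⟨ trans (Ex-+ G (λ _ → ι ∣ X ∣) (λ c → ∑ℚ (λ u → ι (χ X u ℕ.* χᶜ X (lookup c u))))) (cong₂ _+_ (Ex-const G degrees (ι ∣ X ∣)) (Ex-∑ G degrees (λ u c → ι (χ X u ℕ.* χᶜ X (lookup c u))))) ⟩
   ι ∣ X ∣ + ∑ℚ (λ u → Ex G (λ c → ι (χ X u ℕ.* χᶜ X (lookup c u)))) ≡⟨ cong (ι ∣ X ∣ +_) (∑ℚ-cong λ u → trans (Ex-coordinate G degrees u (λ x → ι (χ X u ℕ.* χᶜ X x))) (one u)) ⟩
   ι ∣ X ∣ + ∑ℚ (λ u → δ * ι (χ X u ℕ.* ∑ (λ x → a G u x ℕ.* χᶜ X x))) ≡⟨ cong (ι ∣ X ∣ +_) (trans (sym (*-distribˡ-∑ℚ δ (λ u → ι (χ X u ℕ.* ∑ (λ x → a G u x ℕ.* χᶜ X x))))) (cong (δ *_) (sym (ι-∑ (λ u → χ X u ℕ.* ∑ (λ x → a G u x ℕ.* χᶜ X x)))))) ⟩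
   ι ∣ X ∣ + δ * ι (outgoing X) ∎
  where
  open ≤-Reasoning
  one : ∀ u → E₁ (lookup G u) (λ x → ι (χ X u ℕ.* χᶜ X x)) ≡ δ * ι (χ X u ℕ.* ∑ (λ x → a G u x ℕ.* χᶜ X x))
  one u = cong (δ *_) (trans (∑ℚ-cong λ x → trans (cong (_* ι (χ X u ℕ.* χᶜ X x)) (indicator≡ι (adj G u x))) (trans (sym (ι-* (a G u x) (χ X u ℕ.* χᶜ X x))) (cong ι (reorder (a G u x) (χ X u) (χᶜ X x)))))
   (trans (sym (ι-∑ (λ x → χ X u ℕ.* (a G u x ℕ.* χᶜ X x)))) (cong ι (sym (*-distribˡ-∑ (χ X u) (λ x → a G u x ℕ.* χᶜ X x))))))
   where
   reorder : ∀ a b c → a ℕ.* (b ℕ.* c) ≡ b ℕ.* (a ℕ.* c)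
   reorder = ℕ-solve-∀

 8δ≤3 : ι 8 * δ ≤ 3ℚ
 8δ≤3 = *recip≤ (0<ι 1≤d) (≤-trans (ι-mono {8} {9} (ℕ.n≤1+n 8)) (subst (_≤ 3ℚ * ι d) (sym (ι≡fromℕ 9)) (subst (λ e → 3ℚ * e ≤ 3ℚ * ι d) (ι≡fromℕ 3) (*-monoˡ 3ℚ (nonNegative⁻¹ 3ℚ) (ι-mono 3≤d)))))

 μ≡ : μ ≡ 1ℚ - ι 2 * δ
 μ≡ = trans (solve 3 (λ x t d → x :* d := (x :+ t) :* d :- t :* d) refl (ι (d ℕ.∸ 2)) (ι 2) δ)
  (cong (_- ι 2 * δ) (trans (cong (_* δ) (trans (sym (ι-+ (d ℕ.∸ 2) 2)) (cong ι (ℕ.m∸n+n≡m (ℕ.≤-trans (ℕ.n≤1+n 2) 3≤d))))) (trans (*-comm (ι d) δ) δ*d)))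

 -- At most `(d - 2) ∣ X ∣ + 2` edges leave `X`. The shift by 3 absorbs the additive `2/d`: this
 -- needs `2/d ≤ 3μ = 3(1 - 2/d)`, that is `8/d ≤ 3`.
 size-step : ∀ X → TreeLike X → Ex G (λ c → ι ∣ push c X ∣ + 3ℚ) ≤ r * (ι ∣ X ∣ + 3ℚ)
 size-step X h = begin
   Ex G (λ c → ι ∣ push c X ∣ + 3ℚ) ≡⟨ trans (Ex-+ G (λ c → ι ∣ push c X ∣) (λ _ → 3ℚ)) (cong (Ex G (λ c → ι ∣ push c X ∣) +_) (Ex-const G degrees 3ℚ)) ⟩
   Ex G (λ c → ι ∣ push c X ∣) + 3ℚ ≤⟨ +-monoˡ-≤ 3ℚ (≤-trans (E-push≤ X) (+-monoʳ-≤ (ι ∣ X ∣) (*-monoˡ δ 0≤δ (ι-mono out≤)))) ⟩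
   ι ∣ X ∣ + δ * ι ((d ℕ.∸ 2) ℕ.* ∣ X ∣ ℕ.+ 2) + 3ℚ ≡⟨ cong (λ e → ι ∣ X ∣ + δ * e + 3ℚ) (trans (ι-+ ((d ℕ.∸ 2) ℕ.* ∣ X ∣) 2) (cong (_+ ι 2) (ι-* (d ℕ.∸ 2) ∣ X ∣))) ⟩
   ι ∣ X ∣ + δ * (ι (d ℕ.∸ 2) * ι ∣ X ∣ + ι 2) + 3ℚ ≡⟨ solve 4 (λ x d k t → x :+ d :* (k :* x :+ t) :+ con 3ℚ := (x :+ k :* d :* x :+ con 3ℚ) :+ t :* d) refl (ι ∣ X ∣) δ (ι (d ℕ.∸ 2)) (ι 2) ⟩
   (ι ∣ X ∣ + μ * ι ∣ X ∣ + 3ℚ) + ι 2 * δ ≤⟨ +-monoʳ-≤ (ι ∣ X ∣ + μ * ι ∣ X ∣ + 3ℚ) 2δ≤ ⟩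
   (ι ∣ X ∣ + μ * ι ∣ X ∣ + 3ℚ) + μ * 3ℚ ≡⟨ solve 2 (λ x m → (x :+ m :* x :+ con 3ℚ) :+ m :* con 3ℚ := (con 1ℚ :+ m) :* (x :+ con 3ℚ)) refl (ι ∣ X ∣) μ ⟩
   r * (ι ∣ X ∣ + 3ℚ) ∎
  where
  open ≤-Reasoning
  out≤ : outgoing X ℕ.≤ (d ℕ.∸ 2) ℕ.* ∣ X ∣ ℕ.+ 2
  out≤ = ℕ.+-cancelʳ-≤ (2 ℕ.* ∣ X ∣) _ _ (ℕ.≤-trans (ℕ.+-monoʳ-≤ (outgoing X) h) (ℕ.≤-reflexive (trans (ring (outgoing X) (e₂ G X)) (trans (cong (ℕ._+ 2) (trans (e₂+outgoing X)
   (sym (trans (sym (ℕ.*-distribʳ-+ ∣ X ∣ (d ℕ.∸ 2) 2)) (cong (ℕ._* ∣ X ∣) (ℕ.m∸n+n≡m (ℕ.≤-trans (ℕ.n≤1+n 2) 3≤d))))))) (ring′ ((d ℕ.∸ 2) ℕ.* ∣ X ∣) (2 ℕ.* ∣ X ∣))))))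
   where
   ring : ∀ o e → o ℕ.+ (e ℕ.+ 2) ≡ e ℕ.+ o ℕ.+ 2
   ring = ℕ-solve-∀
   ring′ : ∀ a b → a ℕ.+ b ℕ.+ 2 ≡ a ℕ.+ 2 ℕ.+ b
   ring′ = ℕ-solve-∀
  2δ≤ : ι 2 * δ ≤ μ * 3ℚ
  2δ≤ = subst (λ e → ι 2 * δ ≤ e * 3ℚ) (sym μ≡) (≤-by (3ℚ - ι 8 * δ) (p≤q⇒0≤q-p 8δ≤3)
   (trans (cong₂ (λ e f → e * δ + (3ℚ - f * δ)) (ι≡fromℕ 2) (ι≡fromℕ 8))
    (trans (solve 1 (λ d → con (ℤ.+ 2 ℚ./ 1) :* d :+ (con 3ℚ :- con (ℤ.+ 8 ℚ./ 1) :* d) := (con 1ℚ :- con (ℤ.+ 2 ℚ./ 1) :* d) :* con 3ℚ) refl δ)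
     (cong (λ e → (1ℚ - e * δ) * 3ℚ) (sym (ι≡fromℕ 2))))))

 0≤r : 0ℚ ≤ r
 0≤r = +-nonNeg 0≤1 0≤μ

 size-bound : ∀ t X → TreeLike X → Kᵗ t (λ Y → ι ∣ Y ∣ + 3ℚ) X ≤ r ^ t * (ι ∣ X ∣ + 3ℚ)
 size-bound zero X h = ≤-reflexive (sym (*-identityˡ (ι ∣ X ∣ + 3ℚ)))
 size-bound (suc t) X h = ≤-trans (Ex-mono G λ c comp → size-bound t (push c X) (push-treeLike c comp X h))
  (≤-trans (≤-reflexive (Ex-* G (r ^ t) (λ c → ι ∣ push c X ∣ + 3ℚ))) (≤-trans (*-monoˡ (r ^ t) (^-nonNeg 0≤r t) (size-step X h))
   (≤-reflexive (solve 3 (λ p r x → p :* (r :* x) := r :* p :* x) refl (r ^ t) r (ι ∣ X ∣ + 3ℚ)))))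

 -- Markov's inequality for the number of informed vertices.
 large-unlikely : ∀ t v m → 1 ℕ.≤ m → Kᵗ t (λ Y → indicator (not (atMost m Y))) ⁅ v ⁆ ≤ r ^ t * (1ℚ + 3ℚ) * recip (ι m)
 large-unlikely t v m 1≤m = ≤*recip (0<ι 1≤m) (≤-trans (≤-reflexive (trans (*-comm _ (ι m)) (sym (Kᵗ-* t (ι m) (λ Y → indicator (not (atMost m Y))) ⁅ v ⁆))))
   (≤-trans (Kᵗ-mono t markov ⁅ v ⁆) (≤-trans (size-bound t ⁅ v ⁆ tree) (≤-reflexive (cong (λ e → r ^ t * (e + 3ℚ)) (trans (cong ι (card-singleton v)) ι-1))))))
  where
  tree : TreeLike ⁅ v ⁆
  tree = ℕ.≤-trans (ℕ.≤-reflexive (cong (2 ℕ.*_) (card-singleton v))) (ℕ.m≤n+m 2 (e₂ G ⁅ v ⁆))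
  markov : ∀ Y → ι m * indicator (not (atMost m Y)) ≤ ι ∣ Y ∣ + 3ℚ
  markov Y with bool-cases (atMost m Y)
  ... | inj₁ e = ≤-trans (≤-reflexive (trans (cong (λ b → ι m * indicator (not b)) e) (*-zeroʳ (ι m)))) (+-nonNeg (0≤ι ∣ Y ∣) (nonNegative⁻¹ 3ℚ))
  ... | inj₂ e = ≤-trans (≤-reflexive (trans (cong (λ b → ι m * indicator (not b)) e) (*-identityʳ (ι m))))
    (≤-trans (ι-mono (ℕ.<⇒≤ (ℕ.≰⇒> (does-false (∣ Y ∣ ℕ.≤? m) e)))) (p≤p+q (nonNegative⁻¹ 3ℚ)))

 q Q : ℚ
 q = pgf 0ℚ
 Q = q ^ d

 0≤q : 0ℚ ≤ q
 0≤q = 0≤pgf ≤-refl 0≤1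

 0≤Q : 0ℚ ≤ Q
 0≤Q = ^-nonNeg 0≤q d

 -- Calls by uninformed vertices count as well, so the value does not depend on who is informed and
 -- the rounds are independent. Written as a power of `0ℚ`, it is a generating function at `z = 0`.
 spare₁ : Fin n → Round n → ℚ
 spare₁ w c = 0ℚ ^ ∑ (λ u → 𝟙 (lookup c u ≡ᵇ w))

 spare : ∀ {t} → Fin n → History n t → ℚ
 spare w [] = 1ℚ
 spare w (c ∷ cs) = spare₁ w c * spare w cs

 0^ : ∀ {k} → 1 ℕ.≤ k → 0ℚ ^ k ≡ 0ℚ
 0^ {suc k} _ = *-zeroˡ (0ℚ ^ k)

 E-spare₁ : ∀ w → Ex G (spare₁ w) ≡ Q
 E-spare₁ w = trans (Ex-cong G λ c _ → sym (∏-^ 0ℚ (λ u → 𝟙 (lookup c u ≡ᵇ w))))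
  (trans (Ex-∏ G (λ u x → 0ℚ ^ 𝟙 (x ≡ᵇ w)))
   (trans (∏-cong λ u → trans (E₁-hit≡ ≤-refl 0≤1 (lookup G u) (degrees u) (_≡ᵇ w)) (trans (cong (λ k → 1ℚ - ι k * ((1ℚ - 0ℚ) * δ)) (only u)) (single (adj G u w))))
    (trans (∏-^ q (λ u → a G u w)) (cong (q ^_) (∑a′ w)))))
  where
  ≡ᵇ-sym : ∀ (x y : Fin n) → (x ≡ᵇ y) ≡ (y ≡ᵇ x)
  ≡ᵇ-sym x y = bool-ext (λ h → subst (λ e → (y ≡ᵇ e) ≡ true) (sym (≡ᵇ⇒≡ {x = x} h)) (≡ᵇ-refl y)) (λ h → subst (λ e → (x ≡ᵇ e) ≡ true) (sym (≡ᵇ⇒≡ {x = y} h)) (≡ᵇ-refl x))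
  only : ∀ u → ∑ (λ x → χ (lookup G u) x ℕ.* 𝟙 (x ≡ᵇ w)) ≡ a G u w
  only u = trans (∑-cong λ x → trans (ℕ.*-comm (a G u x) _) (cong (λ b → 𝟙 b ℕ.* a G u x) (≡ᵇ-sym x w))) (∑-δ w (a G u))
  single : ∀ b → 1ℚ - ι (𝟙 b) * ((1ℚ - 0ℚ) * δ) ≡ q ^ 𝟙 b
  single true = trans (cong (λ k → 1ℚ - k * ((1ℚ - 0ℚ) * δ)) ι-1) (trans (cong (λ k → 1ℚ - k) (*-identityˡ ((1ℚ - 0ℚ) * δ))) (sym (*-identityʳ q)))
  single false = trans (cong (λ k → 1ℚ - k * ((1ℚ - 0ℚ) * δ)) ι-0) (cong (λ k → 1ℚ - k) (*-zeroˡ ((1ℚ - 0ℚ) * δ)))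

 -- This is the negative correlation: calls to `w` or `w′` are counted together, and `E₁-hit` treats
 -- the `2d` edges as independent chances even where one caller is adjacent to both.
 E-spare₁-pair : ∀ {w w′} → w ≢ w′ → Ex G (λ c → spare₁ w c * spare₁ w′ c) ≤ Q * Q
 E-spare₁-pair {w} {w′} w≢w′ = ≤-trans (≤-reflexive (Ex-cong G λ c _ → trans (sym (^-+ 0ℚ (∑ (λ u → 𝟙 (lookup c u ≡ᵇ w))) (∑ (λ u → 𝟙 (lookup c u ≡ᵇ w′))))) (cong (0ℚ ^_) (trans (sym (∑-+ (λ u → 𝟙 (lookup c u ≡ᵇ w)) (λ u → 𝟙 (lookup c u ≡ᵇ w′))))
    (∑-cong λ u → trans (sym (either (lookup c u))) (sym (ℕ.+-identityʳ _)))))))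
   (≤-trans (Ex-hit ≤-refl 0≤1 G degrees (λ _ → 0) (λ _ → true) (λ x → (x ≡ᵇ w) ∨ (x ≡ᵇ w′)))
    (≤-reflexive (trans (cong₂ (λ e f → 0ℚ ^ e * q ^ f) (∑-zero {n} (λ _ → 0) λ _ → refl) count) (trans (*-identityˡ _) (^-+ q d d)))))
  where
  either : ∀ x → 𝟙 ((x ≡ᵇ w) ∨ (x ≡ᵇ w′)) ≡ 𝟙 (x ≡ᵇ w) ℕ.+ 𝟙 (x ≡ᵇ w′)
  either x with x Fin.≟ w
  ... | no _ = refl
  ... | yes refl = cong suc (sym (𝟙-false (≢⇒≡ᵇ w≢w′)))
  ≡ᵇ-sym : ∀ (x y : Fin n) → (x ≡ᵇ y) ≡ (y ≡ᵇ x)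
  ≡ᵇ-sym x y = bool-ext (λ h → subst (λ e → (y ≡ᵇ e) ≡ true) (sym (≡ᵇ⇒≡ {x = x} h)) (≡ᵇ-refl y)) (λ h → subst (λ e → (x ≡ᵇ e) ≡ true) (sym (≡ᵇ⇒≡ {x = y} h)) (≡ᵇ-refl x))
  only : ∀ z u → ∑ (λ x → a G u x ℕ.* 𝟙 (x ≡ᵇ z)) ≡ a G u z
  only z u = trans (∑-cong λ x → trans (ℕ.*-comm (a G u x) _) (cong (λ b → 𝟙 b ℕ.* a G u x) (≡ᵇ-sym x z))) (∑-δ z (a G u))
  count : ∑ (λ u → 1 ℕ.* ∑ (λ x → a G u x ℕ.* 𝟙 ((x ≡ᵇ w) ∨ (x ≡ᵇ w′)))) ≡ d ℕ.+ d
  count = trans (∑-cong λ u → trans (ℕ.*-identityˡ _) (trans (∑-cong λ x → trans (cong (a G u x ℕ.*_) (either x)) (ℕ.*-distribˡ-+ (a G u x) _ _))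
    (trans (∑-+ (λ x → a G u x ℕ.* 𝟙 (x ≡ᵇ w)) (λ x → a G u x ℕ.* 𝟙 (x ≡ᵇ w′))) (cong₂ ℕ._+_ (only w u) (only w′ u)))))
   (trans (∑-+ (λ u → a G u w) (λ u → a G u w′)) (cong₂ ℕ._+_ (∑a′ w) (∑a′ w′)))

 E-spare : ∀ t w → EH G t (spare w) ≡ Q ^ t
 E-spare zero w = refl
 E-spare (suc t) w = trans (Ex-cong G λ c _ → trans (EH-* G t (spare₁ w c) (spare w)) (trans (cong (spare₁ w c *_) (E-spare t w)) (*-comm (spare₁ w c) (Q ^ t))))
  (trans (Ex-* G (Q ^ t) (spare₁ w)) (trans (cong (Q ^ t *_) (E-spare₁ w)) (*-comm (Q ^ t) Q)))

 0≤spare₁ : ∀ w c → 0ℚ ≤ spare₁ w c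
 0≤spare₁ w c = ^-nonNeg ≤-refl (∑ (λ u → 𝟙 (lookup c u ≡ᵇ w)))

 0≤spare : ∀ {t} w (cs : History n t) → 0ℚ ≤ spare w cs
 0≤spare w [] = 0≤1
 0≤spare w (c ∷ cs) = *-nonNeg (0≤spare₁ w c) (0≤spare w cs)

 spare≤1 : ∀ {t} w (cs : History n t) → spare w cs ≤ 1ℚ
 spare≤1 w [] = ≤-refl
 spare≤1 w (c ∷ cs) = ≤-trans (p*q≤p (0≤spare₁ w c) (spare≤1 w cs)) (^≤1 ≤-refl 0≤1 (∑ (λ u → 𝟙 (lookup c u ≡ᵇ w))))

 E-spare-pair : ∀ t {w w′} → w ≢ w′ → EH G t (λ cs → spare w cs * spare w′ cs) ≤ Q ^ t * Q ^ t
 E-spare-pair zero ne = ≤-refl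
 E-spare-pair (suc t) {w} {w′} ne = ≤-trans (Ex-mono G λ c _ → ≤-trans
   (≤-reflexive (trans (EH-cong G t λ cs → solve 4 (λ a b c e → a :* b :* (c :* e) := a :* c :* (b :* e)) refl (spare₁ w c) (spare w cs) (spare₁ w′ c) (spare w′ cs)) (EH-* G t (spare₁ w c * spare₁ w′ c) (λ cs → spare w cs * spare w′ cs))))
   (*-monoˡ (spare₁ w c * spare₁ w′ c) (*-nonNeg (0≤spare₁ w c) (0≤spare₁ w′ c)) (E-spare-pair t ne)))
  (≤-trans (≤-reflexive (trans (Ex-cong G λ c _ → *-comm (spare₁ w c * spare₁ w′ c) (Q ^ t * Q ^ t)) (Ex-* G (Q ^ t * Q ^ t) (λ c → spare₁ w c * spare₁ w′ c))))
   (≤-trans (*-monoˡ (Q ^ t * Q ^ t) (*-nonNeg (^-nonNeg 0≤Q t) (^-nonNeg 0≤Q t)) (E-spare₁-pair ne))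
    (≤-reflexive (solve 2 (λ p q → p :* p :* (q :* q) := q :* p :* (q :* p)) refl (Q ^ t) Q))))

 spared-stays : ∀ {s t} v (as : History n s) (bs : History n t) w → lookup (informed v bs) w ≡ false →
  lookup (informed v (as Vec.++ bs)) w ≡ true → spare w as ≡ 0ℚ
 spared-stays v [] bs w out now = true≢false now out
 spared-stays v (c ∷ as) bs w out now with push⁻ c (informed v (as Vec.++ bs)) w now
 ... | inj₁ before = trans (cong (spare₁ w c *_) (spared-stays v as bs w out before)) (*-zeroʳ (spare₁ w c))
 ... | inj₂ (u , _ , refl) = trans (cong (_* spare w as) (0^ (ℕ.≤-trans (ℕ.≤-reflexive (sym (𝟙-true (≡ᵇ-refl w)))) (term≤∑ (λ u → 𝟙 (lookup c u ≡ᵇ w)) u)))) (*-zeroˡ (spare w as))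

 all? : Subset n → Bool
 all? X = X ≡ˢ ⊤

 lookup-⊤ : ∀ w → lookup (⊤ {n}) w ≡ true
 lookup-⊤ w = Vec.lookup-replicate w true

 -- Chebyshev's inequality for the number of spared vertices.
 completion-unlikely : ∀ s {t} v (bs : History n t) → let u = ∑ (χᶜ (informed v bs)) in
  EH G s (λ as → indicator (all? (informed v (as Vec.++ bs)))) * (ι u * Q ^ s) ≤ 1ℚ ⊎ ι u * Q ^ s ≤ 0ℚ
 completion-unlikely s v bs with ι (∑ (χᶜ (informed v bs))) * Q ^ s ℚ.≤? 0ℚ
 ... | yes le = inj₂ le
 ... | no gt = inj₁ (*-cancelʳ m 0<m (begin
   EH G s f * m * m ≡⟨ trans (*-assoc (EH G s f) m m) (trans (*-comm (EH G s f) (m * m)) (sym (EH-* G s (m * m) f))) ⟩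
   EH G s (λ as → m * m * f as) ≤⟨ EH-mono G s pointwise ⟩
   EH G s (λ as → Z as * Z as + (- (m + m)) * Z as + m * m) ≡⟨ trans (EH-+ G s (λ as → Z as * Z as + (- (m + m)) * Z as) (λ _ → m * m)) (cong₂ _+_ (trans (EH-+ G s (λ as → Z as * Z as) (λ as → (- (m + m)) * Z as)) (cong (EH G s (λ as → Z as * Z as) +_) (trans (EH-* G s (- (m + m)) Z) (cong ((- (m + m)) *_) EZ)))) (EH-const G degrees s (m * m))) ⟩
   EH G s (λ as → Z as * Z as) + (- (m + m)) * m + m * m ≤⟨ +-monoˡ-≤ (m * m) (+-monoˡ-≤ ((- (m + m)) * m) EZ²) ⟩
   m + m * m + (- (m + m)) * m + m * m ≡⟨ solve 1 (λ m → m :+ m :* m :+ (:- (m :+ m)) :* m :+ m :* m := con 1ℚ :* m) refl m ⟩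
   1ℚ * m ∎))
  where
  open ≤-Reasoning
  U : Fin n → ℚ
  U w = ι (χᶜ (informed v bs) w)
  u = ∑ (χᶜ (informed v bs))
  m = ι u * Q ^ s
  0<m : 0ℚ < m
  0<m = ℚ.≰⇒> gt
  f : History n s → ℚ
  f as = indicator (all? (informed v (as Vec.++ bs)))
  Z : History n s → ℚ
  Z as = ∑ℚ (λ w → U w * spare w as)
  EZ : EH G s Z ≡ m
  EZ = trans (EH-∑ G degrees s (λ w as → U w * spare w as)) (trans (∑ℚ-cong λ w → trans (EH-* G s (U w) (spare w)) (cong (U w *_) (E-spare s w)))
   (trans (sym (*-distribʳ-∑ℚ (Q ^ s) U)) (cong (_* Q ^ s) (sym (ι-∑ (χᶜ (informed v bs)))))))
  pair : ∀ w w′ → EH G s (λ as → spare w as * spare w′ as) ≤ ι (𝟙 (w ≡ᵇ w′)) * Q ^ s + Q ^ s * Q ^ s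
  pair w w′ with w Fin.≟ w′
  ... | yes refl = ≤-trans (≤-trans (EH-mono G s λ as → p*q≤p (0≤spare w as) (spare≤1 w as)) (≤-reflexive (trans (E-spare s w) (trans (sym (*-identityˡ (Q ^ s))) (cong (_* Q ^ s) (sym ι-1))))))
    (p≤p+q (*-nonNeg (^-nonNeg 0≤Q s) (^-nonNeg 0≤Q s)))
  ... | no ne = ≤-trans (E-spare-pair s ne) (≤-reflexive (sym (trans (cong (λ e → e * Q ^ s + Q ^ s * Q ^ s) ι-0) (trans (cong (_+ Q ^ s * Q ^ s) (*-zeroˡ (Q ^ s))) (+-identityˡ _)))))
  EZ² : EH G s (λ as → Z as * Z as) ≤ m + m * m
  EZ² = begin
   EH G s (λ as → Z as * Z as)
    ≡⟨ trans (EH-cong G s λ as → trans (*-distribʳ-∑ℚ (Z as) (λ w → U w * spare w as)) (∑ℚ-cong λ w → trans (*-distribˡ-∑ℚ (U w * spare w as) (λ w′ → U w′ * spare w′ as))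
       (∑ℚ-cong λ w′ → solve 4 (λ a b c e → a :* b :* (c :* e) := a :* c :* (b :* e)) refl (U w) (spare w as) (U w′) (spare w′ as))))
      (trans (EH-∑ G degrees s (λ w as → ∑ℚ (λ w′ → U w * U w′ * (spare w as * spare w′ as)))) (∑ℚ-cong λ w → trans (EH-∑ G degrees s (λ w′ as → U w * U w′ * (spare w as * spare w′ as)))
       (∑ℚ-cong λ w′ → EH-* G s (U w * U w′) (λ as → spare w as * spare w′ as)))) ⟩
   ∑ℚ (λ w → ∑ℚ (λ w′ → U w * U w′ * EH G s (λ as → spare w as * spare w′ as)))
    ≤⟨ ∑ℚ-mono (λ w → ∑ℚ-mono λ w′ → ≤-trans (*-monoˡ (U w * U w′) (*-nonNeg (0≤ι _) (0≤ι _)) (pair w w′)) (diag w w′)) ⟩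
   ∑ℚ (λ w → ∑ℚ (λ w′ → ι (𝟙 (w ≡ᵇ w′) ℕ.* χᶜ (informed v bs) w′) * Q ^ s + U w * Q ^ s * (U w′ * Q ^ s)))
    ≡⟨ trans (∑ℚ-cong λ w → trans (∑ℚ-+ (λ w′ → ι (𝟙 (w ≡ᵇ w′) ℕ.* χᶜ (informed v bs) w′) * Q ^ s) (λ w′ → U w * Q ^ s * (U w′ * Q ^ s)))
       (cong₂ _+_ (trans (sym (*-distribʳ-∑ℚ (Q ^ s) (λ w′ → ι (𝟙 (w ≡ᵇ w′) ℕ.* χᶜ (informed v bs) w′)))) (cong (_* Q ^ s) (trans (sym (ι-∑ (λ w′ → 𝟙 (w ≡ᵇ w′) ℕ.* χᶜ (informed v bs) w′))) (cong ι (∑-δ w (χᶜ (informed v bs)))))))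
        (trans (sym (*-distribˡ-∑ℚ (U w * Q ^ s) (λ w′ → U w′ * Q ^ s))) (cong (U w * Q ^ s *_) UQ))))
      (trans (∑ℚ-+ (λ w → U w * Q ^ s) (λ w → U w * Q ^ s * m)) (cong₂ _+_ UQ (trans (sym (*-distribʳ-∑ℚ m (λ w → U w * Q ^ s))) (cong (_* m) UQ)))) ⟩
   m + m * m ∎
   where
   UQ : ∑ℚ (λ w → U w * Q ^ s) ≡ m
   UQ = trans (sym (*-distribʳ-∑ℚ (Q ^ s) U)) (cong (_* Q ^ s) (sym (ι-∑ (χᶜ (informed v bs)))))
   diag : ∀ w w′ → U w * U w′ * (ι (𝟙 (w ≡ᵇ w′)) * Q ^ s + Q ^ s * Q ^ s) ≤ ι (𝟙 (w ≡ᵇ w′) ℕ.* χᶜ (informed v bs) w′) * Q ^ s + U w * Q ^ s * (U w′ * Q ^ s)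
   diag w w′ = ≤-trans (≤-reflexive (solve 4 (λ a b i p → a :* b :* (i :* p :+ p :* p) := (i :* b :* p) :* a :+ a :* p :* (b :* p)) refl (U w) (U w′) (ι (𝟙 (w ≡ᵇ w′))) (Q ^ s)))
    (+-monoˡ-≤ (U w * Q ^ s * (U w′ * Q ^ s)) (≤-trans (p*q≤p (*-nonNeg (*-nonNeg (0≤ι _) (0≤ι _)) (^-nonNeg 0≤Q s)) (subst (U w ≤_) ι-1 (ι-mono (𝟙≤1 _))))
     (≤-reflexive (cong (_* Q ^ s) (sym (ι-* (𝟙 (w ≡ᵇ w′)) (χᶜ (informed v bs) w′)))))))
  -- The right-hand side is `(Z - m)²`. It is never negative, and it equals `m²` once everybody is
  -- informed, since no vertex uninformed at the outset can then have been spared.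
  pointwise : ∀ as → m * m * f as ≤ Z as * Z as + (- (m + m)) * Z as + m * m
  pointwise as with bool-cases (all? (informed v (as Vec.++ bs)))
  ... | inj₂ e = ≤-trans (≤-reflexive (trans (cong (λ b → m * m * indicator b) e) (*-zeroʳ (m * m))))
    (≤-trans (sq-nonNeg (Z as - m)) (≤-reflexive (solve 2 (λ z m → (z :- m) :* (z :- m) := z :* z :+ (:- (m :+ m)) :* z :+ m :* m) refl (Z as) m)))
  ... | inj₁ e = ≤-reflexive (trans (cong (λ b → m * m * indicator b) e) (trans (solve 1 (λ m → m :* m :* con 1ℚ := con 0ℚ :* con 0ℚ :+ (:- (m :+ m)) :* con 0ℚ :+ m :* m) refl m)
    (cong (λ z → z * z + (- (m + m)) * z + m * m) (sym Z≡0))))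
   where
   everyone : ∀ w → lookup (informed v (as Vec.++ bs)) w ≡ true
   everyone w = trans (cong (λ X → lookup X w) (≡ˢ⇒≡ {X = informed v (as Vec.++ bs)} e)) (lookup-⊤ w)
   Z≡0 : Z as ≡ 0ℚ
   Z≡0 = ∑ℚ-zero (λ w → U w * spare w as) λ w → each w (bool-cases (lookup (informed v bs) w))
    where
    each : ∀ w → lookup (informed v bs) w ≡ true ⊎ lookup (informed v bs) w ≡ false → U w * spare w as ≡ 0ℚ
    each w (inj₁ h) = trans (cong (λ k → ι k * spare w as) (𝟙-false (cong not h))) (trans (cong (_* spare w as) ι-0) (*-zeroˡ (spare w as)))
    each w (inj₂ h) = trans (cong (U w *_) (spared-stays v as bs w h (everyone w))) (*-zeroʳ (U w))

 -- In `s ℕ.+ t` the later block comes first. `EH-swap` makes it possible to fix the first `t`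
 -- rounds, and with them the uninformed vertices, before averaging over the last `s`.
 early-completion : ∀ s t v m → 1 ℕ.≤ m → m ℕ.< n → 0ℚ < Q →
  EH G (s ℕ.+ t) (λ cs → indicator (all? (informed v cs))) ≤ r ^ t * (1ℚ + 3ℚ) * recip (ι m) + recip (ι (n ℕ.∸ m) * Q ^ s)
 early-completion s t v m 1≤m m<n 0<Q = begin
   EH G (s ℕ.+ t) (λ cs → indicator (all? (informed v cs))) ≡⟨ trans (EH-++ G s t _) (EH-swap G s t (λ as bs → indicator (all? (informed v (as Vec.++ bs))))) ⟩
   EH G t (λ bs → EH G s (λ as → indicator (all? (informed v (as Vec.++ bs))))) ≤⟨ EH-mono G t cases ⟩
   EH G t (λ bs → indicator (not (atMost m (informed v bs))) + c) ≡⟨ trans (EH-+ G t (λ bs → indicator (not (atMost m (informed v bs)))) (λ _ → c)) (cong₂ _+_ (EH-informed G t v (λ Y → indicator (not (atMost m Y)))) (EH-const G degrees t c)) ⟩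
   Kᵗ t (λ Y → indicator (not (atMost m Y))) ⁅ v ⁆ + c ≤⟨ +-monoˡ-≤ c (large-unlikely t v m 1≤m) ⟩
   r ^ t * (1ℚ + 3ℚ) * recip (ι m) + c ∎
  where
  open ≤-Reasoning
  D = ι (n ℕ.∸ m) * Q ^ s
  0<D : 0ℚ < D
  0<D = *-pos (0<ι (ℕ.m<n⇒0<n∸m m<n)) (0<^ 0<Q s)
  c = recip D
  0≤c : 0ℚ ≤ c
  0≤c = <⇒≤ (recip-pos 0<D)
  cases : ∀ bs → EH G s (λ as → indicator (all? (informed v (as Vec.++ bs)))) ≤ indicator (not (atMost m (informed v bs))) + c
  cases bs with bool-cases (atMost m (informed v bs))
  ... | inj₂ e = ≤-trans (≤-trans (EH-mono G s λ as → indicator≤1 (all? (informed v (as Vec.++ bs)))) (≤-reflexive (trans (EH-const G degrees s 1ℚ) (cong (λ b → indicator (not b)) (sym e))))) (p≤p+q 0≤c)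
  ... | inj₁ e = ≤-trans small (subst (_≤ indicator (not (atMost m (informed v bs))) + c) (+-identityˡ c) (+-monoˡ-≤ c (0≤indicator (not (atMost m (informed v bs))))))
   where
   u = ∑ (χᶜ (informed v bs))
   X = EH G s (λ as → indicator (all? (informed v (as Vec.++ bs))))
   u≥ : n ℕ.∸ m ℕ.≤ u
   u≥ = ℕ.m≤n+o⇒m∸n≤o n m (ℕ.≤-trans (ℕ.≤-reflexive (sym (trans (cong (ℕ._+ u) (card≡∑ (informed v bs))) (trans (sym (∑-+ (χ (informed v bs)) (χᶜ (informed v bs)))) (trans (∑-cong (χ+χᶜ (informed v bs))) (trans (∑-const n 1) (ℕ.*-identityʳ n)))))))
    (ℕ.+-monoˡ-≤ u (atMost⁻ {X = informed v bs} e)))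
   D≤ : D ≤ ι u * Q ^ s
   D≤ = *-monoʳ (Q ^ s) (^-nonNeg 0≤Q s) (ι-mono u≥)
   0≤X : 0ℚ ≤ X
   0≤X = ≤-trans (≤-reflexive (sym (EH-const G degrees s 0ℚ))) (EH-mono G s λ as → 0≤indicator (all? (informed v (as Vec.++ bs))))
   small : X ≤ c
   small with completion-unlikely s v bs
   ... | inj₂ le = contradiction (≤-trans D≤ le) (<⇒≱ 0<D)
   ... | inj₁ le = subst (X ≤_) (*-identityˡ c) (≤*recip {X} {1ℚ} {D} 0<D (≤-trans (*-monoˡ X 0≤X D≤) le))

-- The circulant graph in which i and j are adjacent iff D ∣i - j∣, where D k = D (n - k).
module Circulant where

 open import Data.Nat.Base using (_+_; _*_; _≤_; _<_; _∸_; z≤n; s≤s; ∣_-_∣)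
 open import Data.Nat.Divisibility using (_∣_; divides; ∣m+n∣m⇒∣n; m∣m*n)
 open import Data.Nat.DivMod using (_/_; _%_; m≡m%n+[m/n]*n; m%n<n)
 open import Data.Fin.Base using (toℕ)

 module _ (n h mid : ℕ) (2h<n : h + h < n) (middle : mid + mid ≡ n ⊎ mid ≡ 0) where

  D : ℕ → Bool
  D k = does (1 ℕ.≤? k) ∧ (does (k ℕ.≤? h) ∨ (does (n ℕ.≤? k + h) ∨ does (k ℕ.≟ mid)))

  g : ℕ → ℕ
  g k = 𝟙 (D k)

  S : ℕ → ℕ
  S zero = 0
  S (suc N) = S N + g (suc N)

  D-sym : ∀ k k′ → suc k + suc k′ ≡ n → D (suc k) ≡ true → D (suc k′) ≡ true
  D-sym k k′ e h₁ with ∨-true⁻ {does (suc k ℕ.≤? h)} h₁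
  ... | inj₁ p = ∨-trueʳ {does (suc k′ ℕ.≤? h)} (∨-trueˡ (true-does (n ℕ.≤? suc k′ + h)
    (ℕ.≤-trans (ℕ.≤-reflexive (trans (sym e) (ℕ.+-comm (suc k) (suc k′)))) (ℕ.+-monoʳ-≤ (suc k′) (does-true (suc k ℕ.≤? h) p)))))
  ... | inj₂ p with ∨-true⁻ {does (n ℕ.≤? suc k + h)} p
  ... | inj₁ p′ = ∨-trueˡ (true-does (suc k′ ℕ.≤? h) (ℕ.+-cancelˡ-≤ (suc k) (suc k′) h (ℕ.≤-trans (ℕ.≤-reflexive e) (does-true (n ℕ.≤? suc k + h) p′))))
  ... | inj₂ p′ = central middle
   where
   central : mid + mid ≡ n ⊎ mid ≡ 0 → D (suc k′) ≡ true
   central (inj₂ mid≡0) = contradiction (trans (does-true (suc k ℕ.≟ mid) p′) mid≡0) λ ()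
   central (inj₁ 2mid≡n) = ∨-trueʳ {does (suc k′ ℕ.≤? h)} (∨-trueʳ {does (n ℕ.≤? suc k′ + h)} (true-does (suc k′ ℕ.≟ mid)
    (ℕ.+-cancelˡ-≡ mid (suc k′) mid (trans (cong (_+ suc k′) (sym (does-true (suc k ℕ.≟ mid) p′))) (trans e (sym 2mid≡n))))))

  g-sym : ∀ k k′ → suc k + suc k′ ≡ n → g (suc k) ≡ g (suc k′)
  g-sym k k′ e = cong 𝟙 (bool-ext (D-sym k k′ e) (D-sym k′ k (trans (ℕ.+-comm (suc k′) (suc k)) e)))

  -- By the symmetry `g k = g (n - k)` a step can be moved from one arc to the other. Hence the row
  -- sums do not depend on the vertex and can be evaluated at position `h`.
  S-split : ∀ i j → suc (i + j) ≡ n → S i + S j ≡ S (i + j)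
  S-split zero j e = refl
  S-split (suc i) j e = trans (ℕ.+-assoc (S i) (g (suc i)) (S j))
   (trans (cong (S i +_) (trans (ℕ.+-comm (g (suc i)) (S j)) (cong (S j +_) (g-sym i j (trans (cong suc (ℕ.+-suc i j)) e)))))
    (trans (S-split i (suc j) (trans (cong suc (ℕ.+-suc i j)) e)) (cong S (ℕ.+-suc i j))))

  S-low : ∀ N → N ≤ h → S N ≡ N
  S-low zero _ = refl
  S-low (suc N) l = trans (cong₂ _+_ (S-low N (ℕ.<⇒≤ l)) (𝟙-true (∨-trueˡ {does (suc N ℕ.≤? h)} (true-does (suc N ℕ.≤? h) l)))) (ℕ.+-comm N 1)

  m? : ℕ → ℕ
  m? N = 𝟙 (does (1 ℕ.≤? mid) ∧ does (mid ℕ.≤? N))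

  mid-far : ∀ {N} → N ≤ h → m? N ≡ 0
  mid-far {N} l = far middle (bool-cases (does (1 ℕ.≤? mid)))
   where
   far : mid + mid ≡ n ⊎ mid ≡ 0 → _ → m? N ≡ 0
   far _ (inj₂ f) = cong (λ b → 𝟙 (b ∧ does (mid ℕ.≤? N))) f
   far (inj₂ e) (inj₁ t) = contradiction (subst (1 ≤_) e (does-true (1 ℕ.≤? mid) t)) λ ()
   far (inj₁ e) (inj₁ t) = 𝟙-false (trans (cong (_∧ does (mid ℕ.≤? N)) t)
    (false-does (mid ℕ.≤? N) λ le → ℕ.<-irrefl e (ℕ.≤-<-trans (ℕ.+-mono-≤ (ℕ.≤-trans le l) (ℕ.≤-trans le l)) 2h<n)))

  S-mid : ∀ e → h + e + h < n → S (h + e) ≡ h + m? (h + e)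
  S-mid zero _ = trans (S-low (h + 0) (ℕ.≤-reflexive (ℕ.+-identityʳ h))) (trans (ℕ.+-identityʳ h) (sym (trans (cong (h +_) (mid-far (ℕ.≤-reflexive (ℕ.+-identityʳ h)))) (ℕ.+-identityʳ h))))
  S-mid (suc e) l = trans (cong S (ℕ.+-suc h e)) (trans (cong₂ _+_ (S-mid e (ℕ.≤-trans (s≤s (ℕ.+-monoˡ-≤ h (ℕ.+-monoʳ-≤ h (ℕ.n≤1+n e)))) l)) gN)
    (trans (ℕ.+-assoc h (m? N) _) (cong (h +_) (trans (step (1 ℕ.≤? mid)) (cong m? (sym (ℕ.+-suc h e)))))))
   where
   N = h + e
   gN : g (suc N) ≡ 𝟙 (does (suc N ℕ.≟ mid))
   gN = cong 𝟙 (trans (cong (_∨ (does (n ℕ.≤? suc N + h) ∨ does (suc N ℕ.≟ mid))) (false-does (suc N ℕ.≤? h) λ le → ℕ.<-irrefl refl (ℕ.≤-trans (s≤s (ℕ.m≤m+n h e)) le)))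
    (cong (_∨ does (suc N ℕ.≟ mid)) (false-does (n ℕ.≤? suc N + h) λ le → ℕ.<-irrefl refl (ℕ.≤-trans (subst (λ k → k + h < n) (ℕ.+-suc h e) l) le))))
   step : Dec (1 ≤ mid) → m? N + 𝟙 (does (suc N ℕ.≟ mid)) ≡ m? (suc N)
   step (no ¬p) = trans (cong₂ _+_ (cong (λ b → 𝟙 (b ∧ does (mid ℕ.≤? N))) f) (𝟙-false (false-does (suc N ℕ.≟ mid) λ e → ¬p (subst (1 ≤_) e (s≤s z≤n)))))
     (sym (cong (λ b → 𝟙 (b ∧ does (mid ℕ.≤? suc N))) f))
    where
    f = false-does (1 ℕ.≤? mid) ¬p
   step (yes p) = trans (cong (λ b → 𝟙 (b ∧ does (mid ℕ.≤? N)) + 𝟙 (does (suc N ℕ.≟ mid))) p′) (trans (cases (ℕ.<-cmp (suc N) mid)) (cong (λ b → 𝟙 (b ∧ does (mid ℕ.≤? suc N))) (sym p′)))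
    where
    open import Relation.Binary.Definitions using (Tri; tri<; tri≈; tri>)
    p′ = true-does (1 ℕ.≤? mid) p
    cases : Tri (suc N < mid) (suc N ≡ mid) (mid < suc N) → 𝟙 (does (mid ℕ.≤? N)) + 𝟙 (does (suc N ℕ.≟ mid)) ≡ 𝟙 (does (mid ℕ.≤? suc N))
    cases (tri< a ¬b ¬c) = trans (cong₂ _+_ (𝟙-false (false-does (mid ℕ.≤? N) λ le → ¬c (s≤s le))) (𝟙-false (false-does (suc N ℕ.≟ mid) ¬b))) (sym (𝟙-false (false-does (mid ℕ.≤? suc N) (ℕ.<⇒≱ a))))
    cases (tri≈ ¬a b ¬c) = trans (cong₂ _+_ (𝟙-false (false-does (mid ℕ.≤? N) λ le → ¬c (s≤s le))) (𝟙-true (true-does (suc N ℕ.≟ mid) b))) (sym (𝟙-true (true-does (mid ℕ.≤? suc N) (ℕ.≤-reflexive (sym b)))))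
    cases (tri> ¬a ¬b c) = trans (cong₂ _+_ (𝟙-true (true-does (mid ℕ.≤? N) (ℕ.s≤s⁻¹ c))) (𝟙-false (false-does (suc N ℕ.≟ mid) ¬b))) (sym (𝟙-true (true-does (mid ℕ.≤? suc N) (ℕ.<⇒≤ c))))

  snoc : ∀ k (f : ℕ → ℕ) → ∑ {suc k} (f ∘ toℕ) ≡ ∑ {k} (f ∘ toℕ) + f k
  snoc zero f = ℕ.+-identityʳ (f 0)
  snoc (suc k) f = trans (cong (f 0 +_) (snoc k (f ∘ suc))) (sym (ℕ.+-assoc (f 0) _ (f (suc k))))

  ∑g≡S : ∀ k → ∑ {k} (λ j → g (suc (toℕ j))) ≡ S k
  ∑g≡S zero = refl
  ∑g≡S (suc k) = trans (snoc k (g ∘ suc)) (cong (_+ g (suc k)) (∑g≡S k))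

  row : ∀ k (i : Fin (suc k)) → ∑ {suc k} (λ j → g ∣ toℕ i - toℕ j ∣) ≡ S (toℕ i) + S (k ∸ toℕ i)
  row k zero = ∑g≡S k
  row (suc k) (suc i) = trans (cong (g (suc (toℕ i)) +_) (row k i)) (trans (sym (ℕ.+-assoc (g (suc (toℕ i))) (S (toℕ i)) _)) (cong (_+ S (k ∸ toℕ i)) (ℕ.+-comm (g (suc (toℕ i))) (S (toℕ i)))))

  circulant : Graph n
  circulant = Vec.tabulate λ i → Vec.tabulate λ j → D ∣ toℕ i - toℕ j ∣

  adj-circulant : ∀ i j → adj circulant i j ≡ D ∣ toℕ i - toℕ j ∣
  adj-circulant i j = trans (cong (λ r → lookup r j) (Vec.lookup∘tabulate _ i)) (Vec.lookup∘tabulate _ j)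

  row-sum : ∀ i → ∣ lookup circulant i ∣ ≡ S h + S (n ∸ suc h)
  row-sum i = trans (card≡∑ (lookup circulant i)) (trans (∑-cong λ j → cong 𝟙 (adj-circulant i j)) (total n i refl))
   where
   total : ∀ m (i : Fin m) → m ≡ n → ∑ {m} (λ j → g ∣ toℕ i - toℕ j ∣) ≡ S h + S (n ∸ suc h)
   total (suc k) i e = trans (row k i) (trans (S-split (toℕ i) (k ∸ toℕ i) (trans (cong suc (ℕ.m+[n∸m]≡n (ℕ.s≤s⁻¹ (Fin.toℕ<n i)))) e))
    (trans (cong S (trans (ℕ.m+[n∸m]≡n (ℕ.s≤s⁻¹ (Fin.toℕ<n i))) (sym (ℕ.m+[n∸m]≡n h≤k)))) (trans (sym (S-split h (k ∸ h) (trans (cong suc (ℕ.m+[n∸m]≡n h≤k)) e))) (cong (λ x → S h + S x) (cong (_∸ suc h) e)))))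
    where
    h≤k : h ≤ k
    h≤k = ℕ.s≤s⁻¹ (subst (h <_) (sym e) (ℕ.≤-<-trans (ℕ.m≤m+n h h) 2h<n))

  circulant-regular : ∀ d → h + h + m? (n ∸ suc h) ≡ d → Regular d circulant
  circulant-regular d e = mkRegular circulant
   (λ i j t → trans (adj-circulant j i) (trans (cong D (ℕ.∣-∣-comm (toℕ j) (toℕ i))) (trans (sym (adj-circulant i j)) t)))
   (λ i → trans (adj-circulant i i) (cong D (ℕ.∣n-n∣≡0 (toℕ i))))
   (λ i → trans (row-sum i) (trans (cong₂ _+_ (S-low h ℕ.≤-refl) upper) (trans (sym (ℕ.+-assoc h h _)) e)))
   where
   h≤ : h ≤ n ∸ suc h
   h≤ = ℕ.m+n≤o⇒m≤o∸n h (ℕ.≤-trans (ℕ.≤-reflexive (ℕ.+-suc h h)) 2h<n)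
   h<n : suc h ≤ n
   h<n = ℕ.≤-trans (s≤s (ℕ.m≤m+n h h)) 2h<n
   split : h + (n ∸ suc h ∸ h) ≡ n ∸ suc h
   split = ℕ.m+[n∸m]≡n h≤
   upper : S (n ∸ suc h) ≡ h + m? (n ∸ suc h)
   upper = trans (cong S (sym split)) (trans (S-mid (n ∸ suc h ∸ h) (ℕ.≤-reflexive (trans (cong (λ x → suc (x + h)) split) (trans (sym (ℕ.+-suc (n ∸ suc h) h)) (ℕ.m∸n+n≡m h<n))))) (cong (λ x → h + m? x) split))

 -- The average over an empty list is 0, so the probability bound needs some regular graph. If `d`
 -- is odd then `n` is even, and the antipode at distance `n/2` supplies the unpaired neighbour.
 regular-exists : ∀ n d → d < n → 2 ∣ d * n → ∃[ G ] Regular {n} d G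
 regular-exists n d d<n 2∣dn with d % 2 in e | m≡m%n+[m/n]*n d 2 | m%n<n d 2
 ... | zero | d≡ | _ = circulant n h 0 2h<n (inj₂ refl) , circulant-regular n h 0 2h<n (inj₂ refl) d (trans (ℕ.+-identityʳ (h + h)) hh≡d)
  where
  h = d / 2
  hh≡d : h + h ≡ d
  hh≡d = trans (two h) (sym d≡)
   where
   two : ∀ h → h + h ≡ h * 2
   two = ℕ-solve-∀
  2h<n : h + h < n
  2h<n = subst (_< n) (sym hh≡d) d<n
 ... | suc zero | d≡ | _ = odd (∣m+n∣m⇒∣n (subst (2 ∣_) (trans (cong (_* n) d≡) (expand (d / 2) n)) 2∣dn) (divides (d / 2 * n) (ℕ.*-comm 2 (d / 2 * n))))
  where
  h = d / 2
  expand : ∀ h n → (1 + h * 2) * n ≡ 2 * (h * n) + n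
  expand = ℕ-solve-∀
  odd : 2 ∣ n → ∃[ G ] Regular {n} d G
  odd (divides m n≡) = circulant n h m 2h<n (inj₁ mm) , circulant-regular n h m 2h<n (inj₁ mm) d
    (trans (cong (λ b → h + h + 𝟙 b) (cong₂ _∧_ (true-does (1 ℕ.≤? m) 1≤m) (true-does (m ℕ.≤? n ∸ suc h) m≤)))
     (trans (cong (_+ 1) (two h)) (trans (ℕ.+-comm (h * 2) 1) (sym d≡))))
   where
   two : ∀ h → h + h ≡ h * 2
   two = ℕ-solve-∀
   mm : m + m ≡ n
   mm = trans (two m) (sym n≡)
   2h<n : h + h < n
   2h<n = ℕ.≤-trans (ℕ.≤-trans (s≤s (ℕ.≤-reflexive (two h))) (ℕ.≤-reflexive (sym d≡))) (ℕ.<⇒≤ d<n)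
   1≤m : 1 ≤ m
   1≤m = ℕ.n≢0⇒n>0 λ { refl → contradiction (subst (d <_) n≡ d<n) λ () }
   h<m : suc h ≤ m
   h<m = ℕ.*-cancelʳ-< 2 h m (ℕ.≤-trans (ℕ.≤-reflexive (sym d≡)) (ℕ.≤-trans (ℕ.<⇒≤ d<n) (ℕ.≤-reflexive n≡)))
   m≤ : m ≤ n ∸ suc h
   m≤ = ℕ.m+n≤o⇒m≤o∸n m (ℕ.≤-trans (ℕ.+-monoʳ-≤ m h<m) (ℕ.≤-reflexive mm))
 ... | suc (suc _) | _ | s≤s (s≤s ())

-- Approximate additivity of the truncated logarithm.

module Logarithms where

 open Rationals
 open Sequence hiding (fromℕ; bernoulli)

 geo : ℕ → ℚ → ℚ
 geo zero u = 0ℚ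
 geo (suc n) u = geo n u + u ^ n

 geo-sum : ∀ n u → geo n u * (1ℚ - u) ≡ 1ℚ - u ^ n
 geo-sum zero u = solve 1 (λ u → con 0ℚ :* (con 1ℚ :- u) := con 1ℚ :- con 1ℚ) refl u
 geo-sum (suc n) u = trans (ℚ.*-distribʳ-+ (1ℚ - u) (geo n u) (u ^ n)) (trans (cong (_+ u ^ n * (1ℚ - u)) (geo-sum n u))
  (solve 2 (λ p u → (con 1ℚ :- p) :+ p :* (con 1ℚ :- u) := con 1ℚ :- u :* p) refl (u ^ n) u))

 power-diff : ∀ {z w} → 0ℚ ≤ z → z ≤ w → ∀ m →
  ι (suc m) * (z ^ m * (w - z)) ≤ w ^ suc m - z ^ suc m × w ^ suc m - z ^ suc m ≤ ι (suc m) * (w ^ m * (w - z))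
 power-diff {z} {w} 0≤z z≤w zero = ≤-reflexive eq , ≤-reflexive (sym eq)
  where
  eq : ι 1 * (1ℚ * (w - z)) ≡ w * 1ℚ - z * 1ℚ
  eq = trans (cong (_* (1ℚ * (w - z))) ι-1) (solve 2 (λ w z → con 1ℚ :* (con 1ℚ :* (w :- z)) := w :* con 1ℚ :- z :* con 1ℚ) refl w z)
 power-diff {z} {w} 0≤z z≤w (suc m) = lower , upper
  where
  IH = power-diff 0≤z z≤w m
  0≤w = ≤-trans 0≤z z≤w
  0≤w-z = p≤q⇒0≤q-p z≤w
  split : w * (w ^ suc m - z ^ suc m) + z ^ suc m * (w - z) ≡ w ^ suc (suc m) - z ^ suc (suc m)
  split = solve 4 (λ w z p q → w :* (p :- q) :+ q :* (w :- z) := w :* p :- z :* q) refl w z (w ^ suc m) (z ^ suc m)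
  lower : ι (suc (suc m)) * (z ^ suc m * (w - z)) ≤ w ^ suc (suc m) - z ^ suc (suc m)
  lower = subst₂ _≤_ (trans (solve 4 (λ k z p d → z :* (k :* (p :* d)) :+ z :* p :* d := (con 1ℚ :+ k) :* (z :* p :* d)) refl (ι (suc m)) z (z ^ m) (w - z)) (cong (_* (z ^ suc m * (w - z))) (sym (ι-suc (suc m))))) split
   (+-monoˡ-≤ (z ^ suc m * (w - z)) (*-mono 0≤z z≤w (*-nonNeg (0≤ι (suc m)) (*-nonNeg (^-nonNeg 0≤z m) 0≤w-z)) (proj₁ IH)))
  upper : w ^ suc (suc m) - z ^ suc (suc m) ≤ ι (suc (suc m)) * (w ^ suc m * (w - z))
  upper = subst₂ _≤_ split (trans (solve 4 (λ k w p d → w :* (k :* (p :* d)) :+ w :* p :* d := (con 1ℚ :+ k) :* (w :* p :* d)) refl (ι (suc m)) w (w ^ m) (w - z)) (cong (_* (w ^ suc m * (w - z))) (sym (ι-suc (suc m)))))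
   (+-mono-≤ (*-monoˡ w 0≤w (proj₂ IH)) (*-monoʳ (w - z) 0≤w-z (^-mono 0≤z z≤w (suc m))))

 even-power : ∀ w k → (w * w) ^ k ≡ w ^ (2 ℕ.* k)
 even-power w k = trans (*-^ w w k) (trans (sym (^-+ w k k)) (cong (λ e → w ^ (k ℕ.+ e)) (sym (ℕ.+-identityʳ k))))

 term-diff : ∀ {z w} → 0ℚ ≤ z → z ≤ w → ∀ k → let t = λ v → v * (coeff k * (v * v) ^ k) in
  (w - z) * (z * z) ^ k ≤ t w - t z × t w - t z ≤ (w - z) * (w * w) ^ k
 term-diff {z} {w} 0≤z z≤w k = subst₂ _≤_ (left z) right (*-monoˡ (coeff k) (coeff-nonNeg k) (proj₁ PD)) ,
   subst₂ _≤_ right (left w) (*-monoˡ (coeff k) (coeff-nonNeg k) (proj₂ PD))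
  where
  PD = power-diff 0≤z z≤w (2 ℕ.* k)
  inv : coeff k * ι (suc (2 ℕ.* k)) ≡ 1ℚ
  inv = trans (cong (_* ι (suc (2 ℕ.* k))) (1/suc≡recip (2 ℕ.* k))) (recip-*ˡ (0<ι (ℕ.z<s)))
  left : ∀ v → coeff k * (ι (suc (2 ℕ.* k)) * (v ^ (2 ℕ.* k) * (w - z))) ≡ (w - z) * (v * v) ^ k
  left v = trans (sym (*-assoc (coeff k) (ι (suc (2 ℕ.* k))) _)) (trans (cong (_* (v ^ (2 ℕ.* k) * (w - z))) inv)
   (trans (*-identityˡ _) (trans (*-comm (v ^ (2 ℕ.* k)) (w - z)) (cong ((w - z) *_) (sym (even-power v k))))))
  right : coeff k * (w ^ suc (2 ℕ.* k) - z ^ suc (2 ℕ.* k)) ≡ w * (coeff k * (w * w) ^ k) - z * (coeff k * (z * z) ^ k)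
  right = trans (solve 5 (λ c w z p q → c :* (w :* p :- z :* q) := w :* (c :* p) :- z :* (c :* q)) refl (coeff k) w z (w ^ (2 ℕ.* k)) (z ^ (2 ℕ.* k)))
   (cong₂ (λ p q → w * (coeff k * p) - z * (coeff k * q)) (sym (even-power w k)) (sym (even-power z k)))

 -- A mean value theorem for artanh, with derivative `1/(1 - v²)`, proved term by term: each
 -- increment lies between truncated geometric sums at the two endpoints.
 series-diff : ∀ {z w} → 0ℚ ≤ z → z ≤ w → ∀ n → let s = λ v → v * series n (v * v) in
  (w - z) * geo n (z * z) ≤ s w - s z × s w - s z ≤ (w - z) * geo n (w * w)
 series-diff {z} {w} 0≤z z≤w zero = ≤-reflexive (e z) , ≤-reflexive (sym (e w))
  where
  e : ∀ v → (w - z) * 0ℚ ≡ w * 0ℚ - z * 0ℚ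
  e _ = solve 2 (λ w z → (w :- z) :* con 0ℚ := w :* con 0ℚ :- z :* con 0ℚ) refl w z
 series-diff {z} {w} 0≤z z≤w (suc n) =
   subst₂ _≤_ (sym (*-distribˡ-+ (w - z) (geo n (z * z)) ((z * z) ^ n))) join (+-mono-≤ (proj₁ IH) (proj₁ TD)) ,
   subst₂ _≤_ join (sym (*-distribˡ-+ (w - z) (geo n (w * w)) ((w * w) ^ n))) (+-mono-≤ (proj₂ IH) (proj₂ TD))
  where
  IH = series-diff 0≤z z≤w n
  TD = term-diff 0≤z z≤w n
  join : (w * series n (w * w) - z * series n (z * z)) + (w * (coeff n * (w * w) ^ n) - z * (coeff n * (z * z) ^ n))
   ≡ w * (series n (w * w) + coeff n * (w * w) ^ n) - z * (series n (z * z) + coeff n * (z * z) ^ n)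
  join = solve 6 (λ w z a b c d → (w :* a :- z :* b) :+ (w :* c :- z :* d) := w :* (a :+ c) :- z :* (b :+ d)) refl
   w z (series n (w * w)) (series n (z * z)) (coeff n * (w * w) ^ n) (coeff n * (z * z) ^ n)

 module _ {x y : ℚ} (1≤x : 1ℚ ≤ x) (x≤y : x ≤ y) where

  private
   1≤y = ≤-trans 1≤x x≤y
   0<x = <-≤-trans 0<1 1≤x
   0<y = <-≤-trans 0<1 1≤y
   0<x+1 = +-pos 0<x 0<1
   0<y+1 = +-pos 0<y 0<1
   i j z w : ℚ
   i = recip (x + 1ℚ)
   j = recip (y + 1ℚ)
   z = möbius x
   w = möbius y
   0<i = recip-pos 0<x+1
   0<j = recip-pos 0<y+1
   ei : (x + 1ℚ) * i ≡ 1ℚ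
   ei = recip-*ʳ 0<x+1
   ej : (y + 1ℚ) * j ≡ 1ℚ
   ej = recip-*ʳ 0<y+1

  0≤möbius : 0ℚ ≤ z
  0≤möbius = *-nonNeg (p≤q⇒0≤q-p 1≤x) (<⇒≤ 0<i)

  möbius-diff : w - z ≡ 2ℚ * ((y - x) * (i * j))
  möbius-diff = trans (cong₂ _-_ (trans (sym (*-identityʳ w)) (cong (w *_) (sym ei))) (trans (sym (*-identityʳ z)) (cong (z *_) (sym ej)))) cross
   where
   cross : (y - 1ℚ) * j * ((x + 1ℚ) * i) - (x - 1ℚ) * i * ((y + 1ℚ) * j) ≡ 2ℚ * ((y - x) * (i * j))
   cross = solve 4 (λ x y i j → (y :- con 1ℚ) :* j :* ((x :+ con 1ℚ) :* i) :- (x :- con 1ℚ) :* i :* ((y :+ con 1ℚ) :* j) := con 2ℚ :* ((y :- x) :* (i :* j))) refl x y i j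

  möbius-mono : z ≤ w
  möbius-mono = 0≤q-p⇒p≤q (subst (0ℚ ≤_) (sym möbius-diff) (*-nonNeg (nonNegative⁻¹ 2ℚ) (*-nonNeg (p≤q⇒0≤q-p x≤y) (*-nonNeg (<⇒≤ 0<i) (<⇒≤ 0<j)))))

  private
   4ℚ : ℚ
   4ℚ = 1ℚ + 1ℚ + 2ℚ
   1-sq : ∀ t k → (t + 1ℚ) * k ≡ 1ℚ → 1ℚ - (t - 1ℚ) * k * ((t - 1ℚ) * k) ≡ 4ℚ * (t * (k * k))
   1-sq t k e = trans (cong (λ u → u * u - (t - 1ℚ) * k * ((t - 1ℚ) * k)) (sym e))
    (solve 2 (λ t k → (t :+ con 1ℚ) :* k :* ((t :+ con 1ℚ) :* k) :- (t :- con 1ℚ) :* k :* ((t :- con 1ℚ) :* k) := con 4ℚ :* (t :* (k :* k))) refl t k)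
   2L : ∀ n → lnApprox n y - lnApprox n x ≡ 2ℚ * (w * series n (w * w) - z * series n (z * z))
   2L n = solve 2 (λ a b → con 2ℚ :* a :- con 2ℚ :* b := con 2ℚ :* (a :- b)) refl (w * series n (w * w)) (z * series n (z * z))
   xy≤ : x * (y + 1ℚ) ≤ y * (x + 1ℚ)
   xy≤ = ≤-by (y - x) (p≤q⇒0≤q-p x≤y) (solve 2 (λ x y → x :* (y :+ con 1ℚ) :+ (y :- x) := y :* (x :+ con 1ℚ)) refl x y)

  möbius²≤1 : w * w ≤ 1ℚ
  möbius²≤1 = 0≤q-p⇒p≤q (subst (0ℚ ≤_) (sym (1-sq y j ej)) (*-nonNeg (nonNegative⁻¹ 4ℚ) (*-nonNeg (<⇒≤ 0<y) (*-nonNeg (<⇒≤ 0<j) (<⇒≤ 0<j)))))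

  -- From `series-diff`, `geo-sum` and `1 - w² = 4y/(y + 1)²`. Cutting off the geometric sum only
  -- helps, so `ln y - ln x ≤ (y - x)/x` holds for every truncation.
  ln-upper : ∀ n → (lnApprox n y - lnApprox n x) * x ≤ y - x
  ln-upper n = *-cancelʳ (y * (x + 1ℚ)) (*-pos 0<y 0<x+1) (begin
    Ld * x * (y * (x + 1ℚ)) ≡⟨ solve 3 (λ l x y → l :* x :* (y :* (x :+ con 1ℚ)) := (l :* y :* (x :+ con 1ℚ)) :* x) refl Ld x y ⟩
    (Ld * y * (x + 1ℚ)) * x ≤⟨ *-monoʳ x (<⇒≤ 0<x) main ⟩
    (y - x) * (y + 1ℚ) * x ≡⟨ solve 2 (λ x y → (y :- x) :* (y :+ con 1ℚ) :* x := (y :- x) :* (x :* (y :+ con 1ℚ))) refl x y ⟩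
    (y - x) * (x * (y + 1ℚ)) ≤⟨ *-monoˡ (y - x) (p≤q⇒0≤q-p x≤y) xy≤ ⟩
    (y - x) * (y * (x + 1ℚ)) ∎)
   where
   open ≤-Reasoning
   Ld = lnApprox n y - lnApprox n x
   sd = w * series n (w * w) - z * series n (z * z)
   0≤w² : 0ℚ ≤ w * w
   0≤w² = sq-nonNeg w
   stepA : sd * (1ℚ - w * w) ≤ w - z
   stepA = ≤-trans (*-monoʳ (1ℚ - w * w) (p≤q⇒0≤q-p möbius²≤1) (proj₂ (series-diff 0≤möbius möbius-mono n)))
    (subst (_≤ w - z) (sym (trans (*-assoc (w - z) (geo n (w * w)) (1ℚ - w * w)) (cong ((w - z) *_) (geo-sum n (w * w)))))
     (p*q≤p (p≤q⇒0≤q-p möbius-mono) (≤-by ((w * w) ^ n) (^-nonNeg 0≤w² n) (solve 1 (λ a → con 1ℚ :- a :+ a := con 1ℚ) refl ((w * w) ^ n)))))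
   main : Ld * y * (x + 1ℚ) ≤ (y - x) * (y + 1ℚ)
   main = *-cancelʳ (2ℚ * (i * (j * j))) (*-pos (positive⁻¹ 2ℚ) (*-pos 0<i (*-pos 0<j 0<j))) (begin
    Ld * y * (x + 1ℚ) * (2ℚ * (i * (j * j))) ≡⟨ trans (cong (λ l → l * y * (x + 1ℚ) * (2ℚ * (i * (j * j)))) (2L n)) (solve 5 (λ s y x i j → con 2ℚ :* s :* y :* (x :+ con 1ℚ) :* (con 2ℚ :* (i :* (j :* j))) := s :* (con 4ℚ :* (y :* (j :* j))) :* ((x :+ con 1ℚ) :* i)) refl sd y x i j) ⟩
    sd * (4ℚ * (y * (j * j))) * ((x + 1ℚ) * i) ≡⟨ cong₂ (λ a b → sd * a * b) (sym (1-sq y j ej)) ei ⟩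
    sd * (1ℚ - w * w) * 1ℚ ≤⟨ *-monoʳ 1ℚ 0≤1 stepA ⟩
    (w - z) * 1ℚ ≡⟨ cong₂ _*_ möbius-diff (sym ej) ⟩
    2ℚ * ((y - x) * (i * j)) * ((y + 1ℚ) * j) ≡⟨ solve 4 (λ x y i j → con 2ℚ :* ((y :- x) :* (i :* j)) :* ((y :+ con 1ℚ) :* j) := (y :- x) :* (y :+ con 1ℚ) :* (con 2ℚ :* (i :* (j :* j)))) refl x y i j ⟩
    (y - x) * (y + 1ℚ) * (2ℚ * (i * (j * j))) ∎)

  -- In this direction truncation hurts: the factor `1 - (z * z) ^ n` is the part of the geometric
  -- series that has been kept.
  ln-lower : ∀ n → (y - x) * (1ℚ - (z * z) ^ n) ≤ (lnApprox n y - lnApprox n x) * y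
  ln-lower n = *-cancelʳ (x * (y + 1ℚ)) (*-pos 0<x 0<y+1) (begin
    (y - x) * ζ * (x * (y + 1ℚ)) ≤⟨ *-monoˡ ((y - x) * ζ) (*-nonNeg (p≤q⇒0≤q-p x≤y) 0≤ζ) xy≤ ⟩
    (y - x) * ζ * (y * (x + 1ℚ)) ≡⟨ solve 3 (λ x y c → (y :- x) :* c :* (y :* (x :+ con 1ℚ)) := ((y :- x) :* (x :+ con 1ℚ) :* c) :* y) refl x y ζ ⟩
    ((y - x) * (x + 1ℚ) * ζ) * y ≤⟨ *-monoʳ y (<⇒≤ 0<y) main ⟩
    (Ld * x * (y + 1ℚ)) * y ≡⟨ solve 3 (λ l x y → (l :* x :* (y :+ con 1ℚ)) :* y := l :* y :* (x :* (y :+ con 1ℚ))) refl Ld x y ⟩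
    Ld * y * (x * (y + 1ℚ)) ∎)
   where
   open ≤-Reasoning
   Ld = lnApprox n y - lnApprox n x
   sd = w * series n (w * w) - z * series n (z * z)
   ζ = 1ℚ - (z * z) ^ n
   z²≤1 : z * z ≤ 1ℚ
   z²≤1 = ≤-trans (*-mono 0≤möbius möbius-mono 0≤möbius möbius-mono) möbius²≤1
   0≤ζ : 0ℚ ≤ ζ
   0≤ζ = p≤q⇒0≤q-p (^≤1 (sq-nonNeg z) z²≤1 n)
   stepA : (w - z) * ζ ≤ sd * (1ℚ - z * z)
   stepA = subst (_≤ sd * (1ℚ - z * z)) (trans (*-assoc (w - z) (geo n (z * z)) (1ℚ - z * z)) (cong ((w - z) *_) (geo-sum n (z * z))))
    (*-monoʳ (1ℚ - z * z) (p≤q⇒0≤q-p z²≤1) (proj₁ (series-diff 0≤möbius möbius-mono n)))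
   main : (y - x) * (x + 1ℚ) * ζ ≤ Ld * x * (y + 1ℚ)
   main = *-cancelʳ (2ℚ * (i * (i * j))) (*-pos (positive⁻¹ 2ℚ) (*-pos 0<i (*-pos 0<i 0<j))) (begin
    (y - x) * (x + 1ℚ) * ζ * (2ℚ * (i * (i * j))) ≡⟨ solve 5 (λ x y i j c → (y :- x) :* (x :+ con 1ℚ) :* c :* (con 2ℚ :* (i :* (i :* j))) := con 2ℚ :* ((y :- x) :* (i :* j)) :* c :* ((x :+ con 1ℚ) :* i)) refl x y i j ζ ⟩
    2ℚ * ((y - x) * (i * j)) * ζ * ((x + 1ℚ) * i) ≡⟨ cong₂ (λ a b → a * ζ * b) (sym möbius-diff) ei ⟩
    (w - z) * ζ * 1ℚ ≤⟨ *-monoʳ 1ℚ 0≤1 stepA ⟩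
    sd * (1ℚ - z * z) * 1ℚ ≡⟨ cong₂ (λ a b → sd * a * b) (1-sq x i ei) (sym ej) ⟩
    sd * (4ℚ * (x * (i * i))) * ((y + 1ℚ) * j) ≡⟨ trans (solve 5 (λ s y x i j → s :* (con 4ℚ :* (x :* (i :* i))) :* ((y :+ con 1ℚ) :* j) := con 2ℚ :* s :* x :* (y :+ con 1ℚ) :* (con 2ℚ :* (i :* (i :* j)))) refl sd y x i j) (cong (λ l → l * x * (y + 1ℚ) * (2ℚ * (i * (i * j)))) (sym (2L n))) ⟩
    Ld * x * (y + 1ℚ) * (2ℚ * (i * (i * j))) ∎)

  ln-mono : ∀ n → lnApprox n x ≤ lnApprox n y
  ln-mono n = 0≤q-p⇒p≤q (*-cancelʳ y 0<y (≤-trans (≤-reflexive (*-zeroˡ y)) (≤-trans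
   (*-nonNeg (p≤q⇒0≤q-p x≤y) (p≤q⇒0≤q-p (^≤1 (sq-nonNeg z) (≤-trans (*-mono 0≤möbius möbius-mono 0≤möbius möbius-mono) möbius²≤1) n))) (ln-lower n))))

 ln-1 : ∀ n → lnApprox n 1ℚ ≡ 0ℚ
 ln-1 n = trans (cong (λ z → 2ℚ * (z * series n (z * z))) (*-zeroˡ (recip 2ℚ)))
  (trans (cong (2ℚ *_) (*-zeroˡ (series n (0ℚ * 0ℚ)))) (*-zeroʳ 2ℚ))

 2möbius≤ln : ∀ {x} → 1ℚ ≤ x → ∀ n → 1 ℕ.≤ n → 2ℚ * möbius x ≤ lnApprox n x
 2möbius≤ln {x} 1≤x (suc n) _ = *-monoˡ 2ℚ (nonNegative⁻¹ 2ℚ)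
  (subst (_≤ möbius x * series (suc n) (möbius x * möbius x)) (*-identityʳ (möbius x))
   (*-monoˡ (möbius x) (0≤möbius 1≤x (≤-refl {x})) (1≤series (sq-nonNeg (möbius x)) n)))

 ln≤x-1 : ∀ {x} → 1ℚ ≤ x → ∀ n → lnApprox n x ≤ x - 1ℚ
 ln≤x-1 {x} 1≤x n = subst (_≤ x - 1ℚ) (trans (*-identityʳ _) (trans (cong (λ t → lnApprox n x - t) (ln-1 n)) (+-identityʳ (lnApprox n x)))) (ln-upper ≤-refl 1≤x n)

 Small : (ℕ → ℚ) → Set
 Small f = ∀ ε → 0ℚ < ε → Eventually (λ n → f n ≤ ε × - f n ≤ ε)

 -- Telescoping over the grid x_k = 1 + kh: the increments of ln along (a x_k) and along (x_k) both lie
 -- between h/x_{k+1} (up to the truncation error ζ) and h/x_k.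
 module _ {a x : ℚ} (1≤a : 1ℚ ≤ a) (1≤x : 1ℚ ≤ x) where

  defect : ℕ → ℚ → ℚ
  defect n t = lnApprox n (a * t) - lnApprox n a - lnApprox n t

  ζ : ℕ → ℚ
  ζ n = (möbius (a * x) * möbius (a * x)) ^ n

  private
   module _ (n : ℕ) (h : ℚ) (0≤h : 0ℚ ≤ h) where
    X : ℕ → ℚ
    X k = 1ℚ + ι k * h
    1≤X : ∀ k → 1ℚ ≤ X k
    1≤X k = p≤p+q (*-nonNeg (0≤ι k) 0≤h)
    0<X : ∀ k → 0ℚ < X k
    0<X k = <-≤-trans 0<1 (1≤X k)
    X-suc : ∀ k → X (suc k) - X k ≡ h
    X-suc k = trans (cong (λ e → (1ℚ + e * h) - X k) (ι-suc k)) (solve 2 (λ k h → (con 1ℚ :+ (con 1ℚ :+ k) :* h) :- (con 1ℚ :+ k :* h) := h) refl (ι k) h)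
    X-mono : ∀ k → X k ≤ X (suc k)
    X-mono k = 0≤q-p⇒p≤q (subst (0ℚ ≤_) (sym (X-suc k)) 0≤h)
    increment : ∀ c → 1ℚ ≤ c → c ≤ a → ∀ k → X (suc k) ≤ x →
     lnApprox n (c * X (suc k)) - lnApprox n (c * X k) ≤ h * recip (X k) ×
     h * (1ℚ - ζ n) * recip (X (suc k)) ≤ lnApprox n (c * X (suc k)) - lnApprox n (c * X k)
    increment c 1≤c c≤a k le = ≤*recip {Ld} {h} (0<X k) (*-cancelʳ {Ld * X k} {h} c 0<c up) ,
      *recip≤ {h * (1ℚ - ζ n)} {Ld} (0<X (suc k)) (*-cancelʳ {h * (1ℚ - ζ n)} {Ld * X (suc k)} c 0<c low)
     where
     0<c = <-≤-trans 0<1 1≤c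
     0≤c = <⇒≤ 0<c
     1≤cX = 1≤* 1≤c (1≤X k)
     cX≤ = *-monoˡ c 0≤c (X-mono k)
     Ld = lnApprox n (c * X (suc k)) - lnApprox n (c * X k)
     diff : c * X (suc k) - c * X k ≡ h * c
     diff = trans (solve 3 (λ c p q → c :* p :- c :* q := (p :- q) :* c) refl c (X (suc k)) (X k)) (cong (_* c) (X-suc k))
     up : Ld * X k * c ≤ h * c
     up = subst₂ _≤_ (solve 3 (λ l c p → l :* (c :* p) := l :* p :* c) refl Ld c (X k)) diff (ln-upper 1≤cX cX≤ n)
     zc = möbius (c * X k)
     zc≤ : zc ≤ möbius (a * x)
     zc≤ = möbius-mono 1≤cX (*-mono 0≤c c≤a (<⇒≤ (0<X k)) (≤-trans (X-mono k) le))
     0≤zc = 0≤möbius 1≤cX (≤-refl {c * X k})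
     low : h * (1ℚ - ζ n) * c ≤ Ld * X (suc k) * c
     low = ≤-trans (≤-by (h * c * (ζ n - (zc * zc) ^ n)) (*-nonNeg (*-nonNeg 0≤h 0≤c) (p≤q⇒0≤q-p (^-mono (sq-nonNeg zc) (*-mono 0≤zc zc≤ 0≤zc zc≤) n)))
       (solve 4 (λ h c e f → h :* (con 1ℚ :- e) :* c :+ h :* c :* (e :- f) := h :* c :* (con 1ℚ :- f)) refl h c (ζ n) ((zc * zc) ^ n)))
      (subst₂ _≤_ (cong (_* (1ℚ - (zc * zc) ^ n)) diff) (solve 3 (λ l c p → l :* (c :* p) := l :* p :* c) refl Ld c (X (suc k))) (ln-lower 1≤cX cX≤ n))
    -- The differences `h / X j - h / X (j + 1)` telescope to `h (1 - 1 / X k)`, and the truncation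
    -- adds at most `ζ n * h` per step.
    bound : ∀ k → X k ≤ x → let B = h * (1ℚ - recip (X k)) + ζ n * (ι k * h) in defect n (X k) ≤ B × - defect n (X k) ≤ B
    bound zero _ = ≤-reflexive (trans d0 (sym B0)) , ≤-reflexive (trans (cong -_ d0) (sym B0))
     where
     X0 : X 0 ≡ 1ℚ
     X0 = trans (cong (λ e → 1ℚ + e * h) ι-0) (solve 1 (λ h → con 1ℚ :+ con 0ℚ :* h := con 1ℚ) refl h)
     d0 : defect n (X 0) ≡ 0ℚ
     d0 = trans (cong (defect n) X0) (trans (cong₂ (λ p q → lnApprox n p - lnApprox n a - q) (*-identityʳ a) (ln-1 n)) (solve 1 (λ l → l :- l :- con 0ℚ := con 0ℚ) refl (lnApprox n a)))
     B0 : h * (1ℚ - recip (X 0)) + ζ n * (ι 0 * h) ≡ 0ℚ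
     B0 = trans (cong₂ (λ p q → h * (1ℚ - recip p) + ζ n * (q * h)) X0 ι-0) (solve 2 (λ h z → h :* con 0ℚ :+ z :* (con 0ℚ :* h) := con 0ℚ) refl h (ζ n))
    bound (suc k) le = widen excess (subst₂ _≤_ dsum Bsum (+-mono-≤ (proj₁ IH) (+-mono-≤ (proj₁ IA) (neg-antimono-≤ (proj₂ IB)))) ,
      subst₂ _≤_ dsum′ Bsum (+-mono-≤ (proj₂ IH) (≤-trans (≤-reflexive (+-comm (- A) Bc)) (+-mono-≤ (proj₁ IB) (neg-antimono-≤ (proj₂ IA))))))
     where
     IH = bound k (≤-trans (X-mono k) le)
     IA = increment a 1≤a ≤-refl k le
     IB′ = increment 1ℚ ≤-refl 1≤a k le
     A = lnApprox n (a * X (suc k)) - lnApprox n (a * X k)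
     Bc = lnApprox n (X (suc k)) - lnApprox n (X k)
     IB : Bc ≤ h * recip (X k) × h * (1ℚ - ζ n) * recip (X (suc k)) ≤ Bc
     IB = subst₂ (λ p q → lnApprox n p - lnApprox n q ≤ h * recip (X k) × h * (1ℚ - ζ n) * recip (X (suc k)) ≤ lnApprox n p - lnApprox n q)
      (*-identityˡ (X (suc k))) (*-identityˡ (X k)) IB′
     u l z′ : ℚ
     u = recip (X k)
     l = recip (X (suc k))
     z′ = ζ n
     B′ : ℚ
     B′ = h * (1ℚ - u) + z′ * (ι k * h) + (h * u + - (h * (1ℚ - z′) * l))
     dsum : defect n (X k) + (A + - Bc) ≡ defect n (X (suc k))
     dsum = solve 5 (λ p q r s t → (p :- r :- s) :+ ((q :- p) :+ :- (t :- s)) := q :- r :- t) refl (lnApprox n (a * X k)) (lnApprox n (a * X (suc k))) (lnApprox n a) (lnApprox n (X k)) (lnApprox n (X (suc k)))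
     dsum′ : - defect n (X k) + (- A + Bc) ≡ - defect n (X (suc k))
     dsum′ = solve 5 (λ p q r s t → :- (p :- r :- s) :+ (:- (q :- p) :+ (t :- s)) := :- (q :- r :- t)) refl (lnApprox n (a * X k)) (lnApprox n (a * X (suc k))) (lnApprox n a) (lnApprox n (X k)) (lnApprox n (X (suc k)))
     Bsum : h * (1ℚ - u) + z′ * (ι k * h) + (h * u + - (h * (1ℚ - z′) * l)) ≡ B′
     Bsum = refl
     excess : B′ ≤ h * (1ℚ - l) + z′ * (ι (suc k) * h)
     excess = ≤-by (z′ * h * (1ℚ - l)) (*-nonNeg (*-nonNeg (^-nonNeg (sq-nonNeg (möbius (a * x))) n) 0≤h) (p≤q⇒0≤q-p (recip≤1 (1≤X (suc k)))))
      (trans (solve 5 (λ h u l z k → h :* (con 1ℚ :- u) :+ z :* (k :* h) :+ (h :* u :+ :- (h :* (con 1ℚ :- z) :* l)) :+ z :* h :* (con 1ℚ :- l) := h :* (con 1ℚ :- l) :+ z :* ((con 1ℚ :+ k) :* h)) refl h u l z′ (ι k))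
       (cong (λ e → h * (1ℚ - l) + z′ * (e * h)) (sym (ι-suc k))))
     widen : ∀ {p q B C} → B ≤ C → p ≤ B × q ≤ B → p ≤ C × q ≤ C
     widen e (f , g) = ≤-trans f e , ≤-trans g e

  additive : Small (λ n → defect n x)
  additive ε 0<ε = N₀ , λ n N₀≤n → close n (hN n N₀≤n)
   where
   y = x - 1ℚ
   0≤y : 0ℚ ≤ y
   0≤y = p≤q⇒0≤q-p 1≤x
   half = ½ * ε
   0<half = *-pos (positive⁻¹ ½) 0<ε
   -- The mesh is fixed first, so that the telescoped term is at most `ε/2`; only then is `n` taken
   -- large enough for the accumulated truncation error to be at most `ε/2`.
   NN = ι-archimedes (y * recip half)
   N = suc (proj₁ NN)
   h = y * recip (ι N)
   0<N = 0<ι {N} (ℕ.z<s)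
   0≤h : 0ℚ ≤ h
   0≤h = *-nonNeg 0≤y (<⇒≤ (recip-pos 0<N))
   h≤half : h ≤ half
   h≤half = *recip≤ 0<N (subst (_≤ half * ι N) (trans (solve 3 (λ e y i → e :* (y :* i) := y :* (e :* i)) refl half y (recip half)) (trans (cong (y *_) (recip-*ʳ 0<half)) (*-identityʳ y)))
    (*-monoˡ half (<⇒≤ 0<half) (≤-trans (proj₂ NN) (ι-mono (ℕ.n≤1+n (proj₁ NN))))))
   Nh : ι N * h ≡ y
   Nh = trans (solve 3 (λ n y i → n :* (y :* i) := y :* (n :* i)) refl (ι N) y (recip (ι N))) (trans (cong (y *_) (recip-*ʳ 0<N)) (*-identityʳ y))
   XN : 1ℚ + ι N * h ≡ x
   XN = trans (cong (1ℚ +_) Nh) (solve 1 (λ x → con 1ℚ :+ (x :- con 1ℚ) := x) refl x)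
   1≤ax = 1≤* 1≤a 1≤x
   0<ax = <-≤-trans 0<1 1≤ax
   i = recip (a * x + 1ℚ)
   0<i = recip-pos (+-pos 0<ax 0<1)
   σ = (1ℚ + 1ℚ + 2ℚ) * (a * x * (i * i))
   0<σ : 0ℚ < σ
   0<σ = *-pos (positive⁻¹ (1ℚ + 1ℚ + 2ℚ)) (*-pos 0<ax (*-pos 0<i 0<i))
   σ≡ : 1ℚ - σ ≡ möbius (a * x) * möbius (a * x)
   σ≡ = trans (cong (λ u → u * u - σ) (sym (recip-*ʳ (+-pos 0<ax 0<1))))
    (solve 2 (λ t k → (t :+ con 1ℚ) :* k :* ((t :+ con 1ℚ) :* k) :- con (1ℚ + 1ℚ + 2ℚ) :* (t :* (k :* k)) := (t :- con 1ℚ) :* k :* ((t :- con 1ℚ) :* k)) refl (a * x) i)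
   η = half * recip x
   0<x = <-≤-trans 0<1 1≤x
   0<η = *-pos 0<half (recip-pos 0<x)
   D = decay σ 0<σ (subst (0ℚ ≤_) (sym σ≡) (sq-nonNeg (möbius (a * x)))) η 0<η
   N₀ = proj₁ D
   hN : ∀ n → N₀ ℕ.≤ n → ζ n ≤ η
   hN n le = subst (λ u → u ^ n ≤ η) σ≡ (proj₂ D n le)
   close : ∀ n → ζ n ≤ η → defect n x ≤ ε × - defect n x ≤ ε
   close n small = subst (λ t → defect n t ≤ ε × - defect n t ≤ ε) XN (≤-trans (proj₁ b) B≤ , ≤-trans (proj₂ b) B≤)
    where
    b = bound n h 0≤h N (≤-reflexive XN)
    B≤ : h * (1ℚ - recip (1ℚ + ι N * h)) + ζ n * (ι N * h) ≤ ε
    B≤ = ≤-trans (+-mono-≤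
      (≤-trans (p*q≤p 0≤h (≤-by (recip (1ℚ + ι N * h)) (<⇒≤ (recip-pos (subst (0ℚ <_) (sym XN) 0<x))) (solve 1 (λ a → con 1ℚ :- a :+ a := con 1ℚ) refl (recip (1ℚ + ι N * h))))) h≤half)
      (≤-trans (≤-reflexive (cong (ζ n *_) Nh)) (≤-trans (*-mono (^-nonNeg (sq-nonNeg (möbius (a * x))) n) small 0≤y (≤-by 1ℚ 0≤1 (solve 1 (λ x → x :- con 1ℚ :+ con 1ℚ := x) refl x)))
       (≤-reflexive (trans (*-assoc half (recip x) x) (trans (cong (half *_) (recip-*ˡ 0<x)) (*-identityʳ half)))))))
     (≤-reflexive (solve 1 (λ e → con ½ :* e :+ con ½ :* e := e) refl ε))

 Small-0 : Small (λ _ → 0ℚ)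
 Small-0 ε 0<ε = 0 , λ _ _ → <⇒≤ 0<ε , <⇒≤ 0<ε

 Small-cong : ∀ {f g} → (∀ n → f n ≡ g n) → Small f → Small g
 Small-cong e sf ε 0<ε = let N , h = sf ε 0<ε in N , λ n le → subst (λ t → t ≤ ε × - t ≤ ε) (e n) (h n le)

 Small-+ : ∀ {f g} → Small f → Small g → Small (λ n → f n + g n)
 Small-+ {f} {g} sf sg ε 0<ε =
  let
    0<h = *-pos (positive⁻¹ ½) 0<ε
    N₁ , h₁ = sf (½ * ε) 0<h
    N₂ , h₂ = sg (½ * ε) 0<h
  in N₁ ℕ.⊔ N₂ , λ n le →
   let
     p₁ , m₁ = h₁ n (ℕ.≤-trans (ℕ.m≤m⊔n N₁ N₂) le)
     p₂ , m₂ = h₂ n (ℕ.≤-trans (ℕ.m≤n⊔m N₁ N₂) le)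
     total = solve 1 (λ e → con ½ :* e :+ con ½ :* e := e) refl ε
   in subst (f n + g n ≤_) total (+-mono-≤ p₁ p₂) ,
     subst₂ _≤_ (sym (ℚ.neg-distrib-+ (f n) (g n))) total (+-mono-≤ m₁ m₂)

 ln-* : ∀ {x y} → 1ℚ ≤ x → 1ℚ ≤ y → Small (λ n → lnApprox n (x * y) - (lnApprox n x + lnApprox n y))
 ln-* {x} {y} 1≤x 1≤y = Small-cong (λ n → solve 3 (λ p q r → p :- q :- r := p :- (q :+ r)) refl (lnApprox n (x * y)) (lnApprox n x) (lnApprox n y)) (additive 1≤x 1≤y)

 ln-^ : ∀ {x} → 1ℚ ≤ x → ∀ k → Small (λ n → lnApprox n (x ^ k) - ι k * lnApprox n x)
 ln-^ {x} 1≤x zero = Small-cong (λ n → sym (trans (cong₂ (λ p q → p - q * lnApprox n x) (ln-1 n) ι-0) (solve 1 (λ l → con 0ℚ :- con 0ℚ :* l := con 0ℚ) refl (lnApprox n x)))) Small-0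
 ln-^ {x} 1≤x (suc k) = Small-cong (λ n → trans (solve 4 (λ p q r i → (p :- (q :+ r)) :+ (r :- i :* q) := p :- (con 1ℚ :+ i) :* q) refl (lnApprox n (x ^ suc k)) (lnApprox n x) (lnApprox n (x ^ k)) (ι k))
   (cong (λ i → lnApprox n (x ^ suc k) - i * lnApprox n x) (sym (ι-suc k))))
  (Small-+ (ln-* 1≤x (1≤^ 1≤x k)) (ln-^ 1≤x k))

-- From inequalities between powers to the inequality between reals.

module RealBound where

 open Logarithms

 open Rationals
 open Sequence hiding (fromℕ; bernoulli)

 möbius-recip : ∀ {q} → 0ℚ < q → möbius (recip q) ≡ - möbius q
 möbius-recip {q} 0<q = begin
   (x - 1ℚ) * j ≡⟨ trans (sym (*-identityʳ _)) (cong ((x - 1ℚ) * j *_) (sym ei)) ⟩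
   (x - 1ℚ) * j * ((q + 1ℚ) * i) ≡⟨ solve 4 (λ x q i j → (x :- con 1ℚ) :* j :* ((q :+ con 1ℚ) :* i) := (q :* x :+ x :- q :- con 1ℚ) :* (i :* j)) refl x q i j ⟩
   (q * x + x - q - 1ℚ) * (i * j) ≡⟨ cong (λ t → (t + x - q - 1ℚ) * (i * j)) qx ⟩
   (1ℚ + x - q - 1ℚ) * (i * j) ≡⟨ solve 4 (λ x q i j → (con 1ℚ :+ x :- q :- con 1ℚ) :* (i :* j) := (:- (con 1ℚ :+ q :- x :- con 1ℚ)) :* (i :* j)) refl x q i j ⟩
   (- (1ℚ + q - x - 1ℚ)) * (i * j) ≡⟨ cong (λ t → (- (t + q - x - 1ℚ)) * (i * j)) (sym qx) ⟩
   (- (q * x + q - x - 1ℚ)) * (i * j) ≡⟨ solve 4 (λ x q i j → (:- (q :* x :+ q :- x :- con 1ℚ)) :* (i :* j) := (:- ((q :- con 1ℚ) :* i)) :* ((x :+ con 1ℚ) :* j)) refl x q i j ⟩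
   (- ((q - 1ℚ) * i)) * ((x + 1ℚ) * j) ≡⟨ trans (cong ((- ((q - 1ℚ) * i)) *_) ej) (*-identityʳ _) ⟩
   - ((q - 1ℚ) * i) ∎
  where
  open ≡-Reasoning
  x = recip q
  0<x = recip-pos 0<q
  i = recip (q + 1ℚ)
  j = recip (x + 1ℚ)
  ei = recip-*ʳ (+-pos 0<q 0<1)
  ej = recip-*ʳ (+-pos 0<x 0<1)
  qx : q * x ≡ 1ℚ
  qx = recip-*ʳ 0<q

 -- Exact for each truncation, since the partial sums are odd in `möbius q`. It reduces the negative
 -- `ln (1 - 1/d)` to an argument above 1, where the estimates apply.
 ln-recip : ∀ {q} → 0ℚ < q → ∀ m → lnApprox m q ≡ - lnApprox m (recip q)
 ln-recip {q} 0<q m = sym (trans (cong (λ z → - (2ℚ * (z * series m (z * z)))) (möbius-recip 0<q))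
  (trans (cong (λ u → - (2ℚ * (- z * series m u))) (solve 1 (λ z → :- z :* :- z := z :* z) refl z))
   (solve 2 (λ z s → :- (con 2ℚ :* (:- z :* s)) := con 2ℚ :* (z :* s)) refl z (series m (z * z)))))
  where z = möbius q

 recip-neg : ∀ {p} → 0ℚ < p → recip (- p) ≡ - recip p
 recip-neg {p} 0<p = inverse-unique { - p} (*-recip (- p) -p≢0) (trans (solve 2 (λ p i → :- p :* :- i := p :* i) refl p (recip p)) (recip-*ʳ 0<p))
  where
  -p≢0 : - p ≢ 0ℚ
  -p≢0 e = 0<⇒≢0 0<p (trans (solve 1 (λ p → p := :- (:- p)) refl p) (cong -_ e))

 Eventually-∩ : ∀ {P Q : ℕ → Set} → Eventually P → Eventually Q → Eventually (λ n → P n × Q n)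
 Eventually-∩ (N₁ , h₁) (N₂ , h₂) = N₁ ℕ.⊔ N₂ , λ n le → h₁ n (ℕ.≤-trans (ℕ.m≤m⊔n N₁ N₂) le) , h₂ n (ℕ.≤-trans (ℕ.m≤n⊔m N₁ N₂) le)

 Eventually-map : ∀ {P Q : ℕ → Set} → (∀ n → P n → Q n) → Eventually P → Eventually Q
 Eventually-map f (N , h) = N , λ n le → f n (h n le)

 Small⇒≤ : ∀ {f g : ℕ → ℚ} → Small (λ n → f n - g n) → ∀ ε → 0ℚ < ε → Eventually (λ n → f n ≤ g n + ε × g n ≤ f n + ε)
 Small⇒≤ {f} {g} sm ε 0<ε = Eventually-map (λ n (p , q) →
  subst₂ _≤_ (solve 2 (λ a b → (a :- b) :+ b := a) refl (f n) (g n)) (+-comm ε (g n)) (+-monoˡ-≤ (g n) p) ,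
  subst₂ _≤_ (solve 2 (λ a b → (:- (a :- b)) :+ a := b) refl (f n) (g n)) (+-comm ε (f n)) (+-monoˡ-≤ (f n) q)) (sm ε 0<ε)

 abs-≤ : ∀ {p b} → p ≤ b → - p ≤ b → ℚ.∣ p ∣ ≤ b
 abs-≤ {p} {b} h h′ with ℚ.∣p∣≡p∨∣p∣≡-p p
 ... | inj₁ e = subst (_≤ b) (sym e) h
 ... | inj₂ e = subst (_≤ b) (sym e) h′

 ¼ : ℚ
 ¼ = ½ * ½

 0<¼ : 0ℚ < ¼
 0<¼ = positive⁻¹ ¼

 module _ {x y z : ℚ} (1≤x : 1ℚ ≤ x) (1≤y : 1ℚ ≤ y) (1≤z : 1ℚ ≤ z) (e p : ℕ) where

  private
   L = lnApprox
   facts : Eventually (λ m → (L m (x ^ e) ≤ ι e * L m x + ¼ × ι e * L m x ≤ L m (x ^ e) + ¼) ×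
    ((L m (z ^ p) ≤ ι p * L m z + ¼ × ι p * L m z ≤ L m (z ^ p) + ¼)))
   facts = Eventually-∩ (Small⇒≤ (ln-^ 1≤x e) ¼ 0<¼) (Small⇒≤ (ln-^ 1≤z p) ¼ 0<¼)
   collect : ∀ a b → a + (b + ¼) + ¼ + ¼ ≤ a + (b + 1ℚ)
   collect a b = ≤-by ¼ (<⇒≤ 0<¼) (solve 2 (λ a b → a :+ (b :+ con ¼) :+ con ¼ :+ con ¼ :+ con ¼ := a :+ (b :+ con 1ℚ)) refl a b)

  -- Three approximations, for two powers and a product, cost a quarter each; 1 is a convenient
  -- bound for the sum.
  ln-^-≤ : x ^ e ≤ y * z ^ p → Eventually (λ m → ι e * lnApprox m x ≤ lnApprox m y + (ι p * lnApprox m z + 1ℚ))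
  ln-^-≤ h = Eventually-map (λ m (((_ , f₁) , (f₂ , _)) , (f₃ , _)) →
   ≤-trans f₁ (≤-trans (+-monoˡ-≤ ¼ (≤-trans (ln-mono (1≤^ 1≤x e) h m) (≤-trans f₃ (+-monoˡ-≤ ¼ (+-monoʳ-≤ (L m y) f₂)))))
    (collect (L m y) (ι p * L m z))))
   (Eventually-∩ facts (Small⇒≤ (ln-* 1≤y (1≤^ 1≤z p)) ¼ 0<¼))

  ≤-ln-^ : y ≤ x ^ e * z ^ p → Eventually (λ m → lnApprox m y ≤ ι e * lnApprox m x + (ι p * lnApprox m z + 1ℚ))
  ≤-ln-^ h = Eventually-map (λ m (((f₁ , _) , (f₂ , _)) , (f₃ , _)) →
   ≤-trans (ln-mono 1≤y h m) (≤-trans f₃ (≤-trans (+-monoˡ-≤ ¼ (+-mono-≤ f₁ f₂))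
    (≤-trans (≤-reflexive (solve 2 (λ a b → (a :+ con ¼) :+ (b :+ con ¼) :+ con ¼ := a :+ (b :+ con ¼) :+ con ¼ :+ con ¼) refl (ι e * L m x) (ι p * L m z))) (collect (ι e * L m x) (ι p * L m z))))))
   (Eventually-∩ facts (Small⇒≤ (ln-* (1≤^ 1≤x e) (1≤^ 1≤z p)) ¼ 0<¼))

 module _ (d : ℕ) (3≤d : 3 ℕ.≤ d) where

  open Defs.Ratio d 3≤d

  r̂ q̂ x̂ : ℚ
  r̂ = 2[1-1/d]
  q̂ = 1-1/d
  x̂ = recip q̂

  q̂≤1 : q̂ ≤ 1ℚ
  q̂≤1 = ≤-by (ℤ.+ 1 ℚ./ d) (<⇒≤ 0<1/d) (solve 1 (λ t → con 1ℚ :- t :+ t := con 1ℚ) refl (ℤ.+ 1 ℚ./ d))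

  1≤x̂ : 1ℚ ≤ x̂
  1≤x̂ = recip-anti 0<1-1/d q̂≤1

  1<x̂ : 1ℚ < x̂
  1<x̂ = ℚ.≰⇒> λ x̂≤1 → 1-1/d≢1 (ℚ.≤-antisym q̂≤1 (subst (_≤ q̂) (recip-*ʳ 0<1-1/d) (p*q≤p (<⇒≤ 0<1-1/d) x̂≤1)))

  1≤r̂ : 1ℚ ≤ r̂
  1≤r̂ = <⇒≤ 1<2[1-1/d]

  r₀ x₀ : ℚ
  r₀ = möbius r̂
  x₀ = möbius x̂

  0<r₀ : 0ℚ < r₀
  0<r₀ = proj₁ (lnApprox-pos 1<2[1-1/d])

  0<x₀ : 0ℚ < x₀
  0<x₀ = proj₁ (lnApprox-pos 1<x̂)

  -- `1/r₀` and `1/x₀` bound the reciprocals of `ln r̂` and `d ln x̂`. The factor `3p + 1` comes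
  -- from `p ln Λ + 1 ≤ (3p + 1) ln ln n`, and `c` counts stray rounds.
  constant : ℕ → ℕ → ℚ
  constant p c = ι (3 ℕ.* p ℕ.+ 1) * (recip r₀ + recip x₀) + ι c

  module _ (p c n Λ T e₁ e₂ f₁ f₂ : ℕ) (2≤n : 2 ℕ.≤ n) (8≤Λ : 8 ℕ.≤ Λ) (2^Λ≤n : 2 ℕ.^ Λ ℕ.≤ n)
   (T≤ : T ℕ.≤ e₁ ℕ.+ e₂ ℕ.+ c) (h₁ : r̂ ^ e₁ ≤ ι n * ι Λ ^ p) (h₂ : x̂ ^ (d ℕ.* e₂) ≤ ι n * ι Λ ^ p)
   (T≥ : f₁ ℕ.+ f₂ ℕ.≤ T ℕ.+ c) (h₃ : ι n ≤ r̂ ^ f₁ * ι Λ ^ p) (h₄ : ι n ≤ x̂ ^ (d ℕ.* f₂) * ι Λ ^ p) where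

   private
    L = lnApprox
    1≤n : 1ℚ ≤ ι n
    1≤n = 1≤ι (ℕ.≤-trans (ℕ.n≤1+n 1) 2≤n)
    1≤Λ : 1ℚ ≤ ι Λ
    1≤Λ = 1≤ι (ℕ.≤-trans (ℕ.z<s) 8≤Λ)
    ι2 : ι 2 ≡ 2ℚ
    ι2 = ι≡fromℕ 2
    1≤2 : 1ℚ ≤ 2ℚ
    1≤2 = p≤p+q 0≤1
    half : ℚ
    half = ½ * ι Λ
    4ℚ : ℚ
    4ℚ = 2ℚ + 2ℚ
    4≤half : 4ℚ ≤ half
    4≤half = subst (_≤ half) (cong (½ *_) (ι≡fromℕ 8)) (*-monoˡ ½ (nonNegative⁻¹ ½) (ι-mono 8≤Λ))
    1≤4 : 1ℚ ≤ 4ℚ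
    1≤4 = ≤-trans 1≤2 (p≤p+q (nonNegative⁻¹ 2ℚ))
    1≤half = ≤-trans 1≤4 4≤half

    -- `2 ^ Λ ≤ n` gives `Λ ln 2 ≤ ln n + 1`, and `ln 2 ≥ 2/3` with `Λ ≥ 8` improves this to
    -- `Λ/2 ≤ ln n`. The first claim then follows from `Λ/2 ≥ 4` and `ln 4 ≥ 6/5`, the second by
    -- comparing `ln Λ` with `ln (Λ/2)`.
    loglog : Eventually (λ m → 1ℚ ≤ L m (L m (ι n)) × L m (ι Λ) ≤ L m (L m (ι n)) + 2ℚ)
    loglog = Eventually-map body (Eventually-∩ (Eventually-∩ (1 , λ m le → le) (ln-^-≤ 1≤2 1≤n 1≤2 Λ 0 pow)) (Small⇒≤ (ln-* 1≤2 1≤half) 1ℚ 0<1))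
     where
     pow : 2ℚ ^ Λ ≤ ι n * 2ℚ ^ 0
     pow = subst₂ _≤_ (trans (ι-^ 2 Λ) (cong (_^ Λ) ι2)) (sym (*-identityʳ (ι n))) (ι-mono 2^Λ≤n)
     body : ∀ m → (1 ℕ.≤ m × ι Λ * L m 2ℚ ≤ L m (ι n) + (ι 0 * L m 2ℚ + 1ℚ)) × (L m (2ℚ * half) ≤ L m 2ℚ + L m half + 1ℚ × L m 2ℚ + L m half ≤ L m (2ℚ * half) + 1ℚ) →
      1ℚ ≤ L m (L m (ι n)) × L m (ι Λ) ≤ L m (L m (ι n)) + 2ℚ
     body m ((1≤m , g) , (f , _)) = ≤-trans (≤-trans 1≤L4 (ln-mono 1≤4 4≤half m)) half≤ ,
       ≤-trans (≤-reflexive (cong (L m) (sym 2half))) (≤-trans f (≤-trans (+-monoˡ-≤ 1ℚ (+-mono-≤ (ln≤x-1 1≤2 m) half≤))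
        (≤-reflexive (solve 1 (λ l → (con 2ℚ :- con 1ℚ) :+ l :+ con 1ℚ := l :+ con 2ℚ) refl (L m (L m (ι n)))))))
      where
      2half : 2ℚ * half ≡ ι Λ
      2half = solve 1 (λ l → con 2ℚ :* (con ½ :* l) := l) refl (ι Λ)
      ⅔ : ℚ
      ⅔ = 2ℚ * möbius 2ℚ
      1≤L4 : 1ℚ ≤ L m 4ℚ
      1≤L4 = ≤-trans (ℚ.*≤* (ℤ.+≤+ (ℕ.s≤s (ℕ.s≤s (ℕ.s≤s (ℕ.s≤s (ℕ.z<s))))))) (2möbius≤ln 1≤4 m 1≤m)
      half≤D : half ≤ L m (ι n)
      half≤D = 0≤q-p⇒p≤q (≤-trans (p≤q⇒0≤q-p (≤-trans (*-monoˡ (ι Λ) (1≤⇒0≤ 1≤Λ) (2möbius≤ln 1≤2 m 1≤m)) g))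
       (≤-trans (≤-reflexive (cong (λ e → L m (ι n) + (e * L m 2ℚ + 1ℚ) - ι Λ * ⅔) ι-0)) (≤-by (ι Λ * ⅙ - 1ℚ) (p≤q⇒0≤q-p sixth)
        (solve 3 (λ l d t → d :+ (con 0ℚ :* t :+ con 1ℚ) :- l :* con ⅔ :+ (l :* con ⅙ :- con 1ℚ) := d :- con ½ :* l) refl (ι Λ) (L m (ι n)) (L m 2ℚ)))))
       where
       ⅙ : ℚ
       ⅙ = ℤ.+ 1 ℚ./ 6
       sixth : 1ℚ ≤ ι Λ * ⅙
       sixth = ≤-trans (subst (λ e → 1ℚ ≤ e * ⅙) (sym (ι≡fromℕ 6)) ≤-refl) (*-monoʳ ⅙ (nonNegative⁻¹ ⅙) (ι-mono (ℕ.≤-trans (ℕ.m≤n+m 6 2) 8≤Λ)))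
      half≤ : L m half ≤ L m (L m (ι n))
      half≤ = ln-mono 1≤half half≤D m

   -- The exponents `e₁` and `f₁` account for the spreading, `e₂` and `f₂` for the wait at a single
   -- vertex. Logarithms divided by `ln r̂` and `d ln x̂` compare the sums with `C ln n`; the powers
   -- `Λ ^ p` become the error.
   bound : Defs.abs (Defs.fromℕ T Defs.- Defs.C d 3≤d Defs.* Defs.lnℕ n 2≤n) Defs.≤ Defs.fromℚ (constant p c) Defs.* (Defs.lnlnℕ n 2≤n Defs.* Defs.lnlnℕ n 2≤n)
   bound ε 0<ε = Eventually-map body (Eventually-∩ loglog (Eventually-∩ (1 , λ m le → le) (Eventually-∩
     (Eventually-∩ (ln-^-≤ 1≤r̂ 1≤n 1≤Λ e₁ p h₁) (ln-^-≤ 1≤x̂ 1≤n 1≤Λ (d ℕ.* e₂) p h₂))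
     (Eventually-∩ (≤-ln-^ 1≤r̂ 1≤n 1≤Λ f₁ p h₃) (≤-ln-^ 1≤x̂ 1≤n 1≤Λ (d ℕ.* f₂) p h₄)))))
    where
    body : ∀ m → (1ℚ ≤ L m (L m (ι n)) × L m (ι Λ) ≤ L m (L m (ι n)) + 2ℚ) × (1 ℕ.≤ m ×
     ((ι e₁ * L m r̂ ≤ L m (ι n) + (ι p * L m (ι Λ) + 1ℚ) × ι (d ℕ.* e₂) * L m x̂ ≤ L m (ι n) + (ι p * L m (ι Λ) + 1ℚ)) ×
      (L m (ι n) ≤ ι f₁ * L m r̂ + (ι p * L m (ι Λ) + 1ℚ) × L m (ι n) ≤ ι (d ℕ.* f₂) * L m x̂ + (ι p * L m (ι Λ) + 1ℚ)))) →
     ℚ.∣ (ℤ.+ T ℚ./ 1) - (recip (L m r̂) + - recip ((ℤ.+ d ℚ./ 1) * L m q̂)) * L m (ℤ.+ n ℚ./ 1) ∣ ≤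
     constant p c * (L m (L m (ℤ.+ n ℚ./ 1)) * L m (L m (ℤ.+ n ℚ./ 1))) + ε
    body m ((1≤LL , LΛ≤) , (1≤m , ((g₁ , g₂) , (g₃ , g₄)))) = ≤-trans (abs-≤ upper lower) (p≤p+q (<⇒≤ 0<ε))
     where
     D LL R X B s₀ s₁ : ℚ
     D = L m (ℤ.+ n ℚ./ 1)
     LL = L m D
     R = L m r̂
     X = L m x̂
     B = ι p * L m (ι Λ) + 1ℚ
     s₀ = recip r₀
     s₁ = recip x₀
     ιn : ι n ≡ ℤ.+ n ℚ./ 1
     ιn = ι≡fromℕ n
     d̂ : ℚ
     d̂ = ι d * X
     double : ∀ {t} → 0ℚ ≤ t → t ≤ 2ℚ * t
     double {t} 0≤t = p≤q*p 0≤t 1≤2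
     r₀≤R : r₀ ≤ R
     r₀≤R = ≤-trans (double (<⇒≤ 0<r₀)) (2möbius≤ln 1≤r̂ m 1≤m)
     x₀≤X : x₀ ≤ X
     x₀≤X = ≤-trans (double (<⇒≤ 0<x₀)) (2möbius≤ln 1≤x̂ m 1≤m)
     x₀≤d̂ : x₀ ≤ d̂
     x₀≤d̂ = ≤-trans x₀≤X (p≤q*p (≤-trans (<⇒≤ 0<x₀) x₀≤X) (1≤ι (ℕ.≤-trans (ℕ.z<s) 3≤d)))
     0<R = <-≤-trans 0<r₀ r₀≤R
     0<d̂ = <-≤-trans 0<x₀ x₀≤d̂
     Cm : ℚ
     Cm = recip R + - recip ((ℤ.+ d ℚ./ 1) * L m q̂)
     Cm≡ : Cm ≡ recip R + recip d̂
     Cm≡ = cong (recip R +_) (trans (cong (λ t → - recip t) (trans (cong₂ _*_ (sym (ι≡fromℕ d)) (ln-recip 0<1-1/d m)) (solve 2 (λ d x → d :* :- x := :- (d :* x)) refl (ι d) X)))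
      (trans (cong -_ (recip-neg 0<d̂)) (solve 1 (λ a → :- (:- a) := a) refl (recip d̂))))
     LL≡ : L m (L m (ι n)) ≡ LL
     LL≡ = cong (λ t → L m (L m t)) ιn
     1≤LL′ : 1ℚ ≤ LL
     1≤LL′ = subst (1ℚ ≤_) LL≡ 1≤LL
     0≤LL = 1≤⇒0≤ 1≤LL′
     LΛ≤3 : L m (ι Λ) ≤ (1ℚ + 2ℚ) * LL
     LΛ≤3 = ≤-trans (subst (λ t → L m (ι Λ) ≤ t + 2ℚ) LL≡ LΛ≤) (≤-by (2ℚ * (LL - 1ℚ)) (*-nonNeg (nonNegative⁻¹ 2ℚ) (p≤q⇒0≤q-p 1≤LL′))
      (solve 1 (λ l → l :+ con 2ℚ :+ con 2ℚ :* (l :- con 1ℚ) := con (1ℚ + 2ℚ) :* l) refl LL))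
     B≤ : B ≤ ι (3 ℕ.* p ℕ.+ 1) * LL
     B≤ = ≤-trans (+-mono-≤ (*-monoˡ (ι p) (0≤ι p) LΛ≤3) 1≤LL′) (≤-reflexive (trans (solve 2 (λ p l → p :* (con (1ℚ + 2ℚ) :* l) :+ l := (con (1ℚ + 2ℚ) :* p :+ con 1ℚ) :* l) refl (ι p) LL)
      (cong (_* LL) (sym (trans (ι-+ (3 ℕ.* p) 1) (cong₂ _+_ (trans (ι-* 3 p) (cong (_* ι p) (ι≡fromℕ 3))) ι-1))))))
     0≤B : 0ℚ ≤ B
     0≤B = +-nonNeg (*-nonNeg (0≤ι p) (≤-trans (≤-reflexive (sym (ln-1 m))) (ln-mono ≤-refl 1≤Λ m))) 0≤1
     i₀ i₁ : ℚ
     i₀ = recip R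
     i₁ = recip d̂
     Bi₀ : B * i₀ ≤ B * s₀
     Bi₀ = *-monoˡ B 0≤B (recip-anti 0<r₀ r₀≤R)
     Bi₁ : B * i₁ ≤ B * s₁
     Bi₁ = *-monoˡ B 0≤B (recip-anti 0<x₀ x₀≤d̂)
     over : ∀ {e P i s} → 0ℚ < P → i ≡ recip P → B * i ≤ B * s → e * P ≤ D + B → e ≤ D * i + B * s
     over {e} {P} {i} {s} 0<P refl Bi h = ≤-trans (≤*recip 0<P h) (≤-trans (≤-reflexive (ℚ.*-distribʳ-+ i D B)) (+-monoʳ-≤ (D * i) Bi))
     under : ∀ {f P i s} → 0ℚ < P → i ≡ recip P → B * i ≤ B * s → D ≤ f * P + B → D * i ≤ f + B * s
     under {f} {P} {i} {s} 0<P refl Bi h = ≤-trans (*-monoʳ i (<⇒≤ (recip-pos 0<P)) h)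
      (≤-trans (≤-reflexive (trans (ℚ.*-distribʳ-+ i (f * P) B) (cong (_+ B * i) (trans (*-assoc f P i) (trans (cong (f *_) (recip-*ʳ 0<P)) (*-identityʳ f)))))) (+-monoʳ-≤ f Bi))
     split : ∀ e → ι (d ℕ.* e) * X ≡ ι e * d̂
     split e = trans (cong (_* X) (ι-* d e)) (solve 3 (λ d e x → d :* e :* x := e :* (d :* x)) refl (ι d) (ι e) X)
     D≡ : L m (ι n) ≡ D
     D≡ = cong (L m) ιn
     E₁ : ι e₁ ≤ D * i₀ + B * s₀
     E₁ = over 0<R refl Bi₀ (subst (λ t → ι e₁ * R ≤ t + B) D≡ g₁)
     E₂ : ι e₂ ≤ D * i₁ + B * s₁
     E₂ = over 0<d̂ refl Bi₁ (subst₂ (λ s t → s ≤ t + B) (split e₂) D≡ g₂)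
     F₁ : D * i₀ ≤ ι f₁ + B * s₀
     F₁ = under {f = ι f₁} 0<R refl Bi₀ (subst (λ t → t ≤ ι f₁ * R + B) D≡ g₃)
     F₂ : D * i₁ ≤ ι f₂ + B * s₁
     F₂ = under {f = ι f₂} 0<d̂ refl Bi₁ (subst₂ (λ s t → t ≤ s + B) (split f₂) D≡ g₄)
     K : ℚ
     K = constant p c
     -- The error is linear in `LL`; `1 ≤ LL` turns it into the square.
     final : B * s₀ + B * s₁ + ι c ≤ K * (LL * LL)
     final = ≤-trans (+-mono-≤ (≤-trans (≤-reflexive (sym (*-distribˡ-+ B s₀ s₁))) (*-monoʳ (s₀ + s₁) (+-nonNeg (<⇒≤ (recip-pos 0<r₀)) (<⇒≤ (recip-pos 0<x₀))) B≤))
       (≤-trans (≤-reflexive (sym (*-identityʳ (ι c)))) (*-monoˡ (ι c) (0≤ι c) 1≤LL′)))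
      (≤-trans (≤-reflexive (solve 4 (λ a l s c → a :* l :* s :+ c :* l := (a :* s :+ c) :* l) refl (ι (3 ℕ.* p ℕ.+ 1)) LL (s₀ + s₁) (ι c)))
       (*-monoˡ K 0≤K (p≤q*p 0≤LL 1≤LL′)))
      where
      0≤K : 0ℚ ≤ K
      0≤K = +-nonNeg (*-nonNeg (0≤ι (3 ℕ.* p ℕ.+ 1)) (+-nonNeg (<⇒≤ (recip-pos 0<r₀)) (<⇒≤ (recip-pos 0<x₀)))) (0≤ι c)
     CD : Cm * D ≡ D * i₀ + D * i₁
     CD = trans (cong (_* D) Cm≡) (solve 3 (λ a b d → (a :+ b) :* d := d :* a :+ d :* b) refl i₀ i₁ D)
     T̂ : ℤ.+ T ℚ./ 1 ≡ ι T
     T̂ = sym (ι≡fromℕ T)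
     upper : (ℤ.+ T ℚ./ 1) - Cm * D ≤ K * (LL * LL)
     upper = ≤-trans (subst₂ (λ s t → s - t ≤ B * s₀ + B * s₁ + ι c) (sym T̂) (sym CD)
      (0≤q-p⇒p≤q (≤-trans (p≤q⇒0≤q-p (≤-trans (ι-mono T≤) (≤-trans (≤-reflexive (trans (ι-+ (e₁ ℕ.+ e₂) c) (cong (_+ ι c) (ι-+ e₁ e₂)))) (+-monoˡ-≤ (ι c) (+-mono-≤ E₁ E₂)))))
       (≤-reflexive (solve 6 (λ t a b u v c → (a :+ u) :+ (b :+ v) :+ c :- t := u :+ v :+ c :- (t :- (a :+ b))) refl (ι T) (D * i₀) (D * i₁) (B * s₀) (B * s₁) (ι c)))))) final
     lower : - ((ℤ.+ T ℚ./ 1) - Cm * D) ≤ K * (LL * LL)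
     lower = ≤-trans (subst₂ (λ s t → - (s - t) ≤ B * s₀ + B * s₁ + ι c) (sym T̂) (sym CD)
      (0≤q-p⇒p≤q (≤-trans (p≤q⇒0≤q-p (≤-trans (+-mono-≤ F₁ F₂) (≤-trans (≤-reflexive (solve 4 (λ f g u v → (f :+ u) :+ (g :+ v) := (f :+ g) :+ (u :+ v)) refl (ι f₁) (ι f₂) (B * s₀) (B * s₁)))
        (+-monoˡ-≤ (B * s₀ + B * s₁) (≤-trans (≤-reflexive (sym (ι-+ f₁ f₂))) (≤-trans (ι-mono T≥) (≤-reflexive (ι-+ T c))))))))
       (≤-reflexive (solve 6 (λ t a b u v c → (t :+ c) :+ (u :+ v) :- (a :+ b) := u :+ v :+ c :- :- (t :- (a :+ b))) refl (ι T) (D * i₀) (D * i₁) (B * s₀) (B * s₁) (ι c)))))) final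

-- The upper bound: growth forwards and backwards, joining, and the average over graphs.

module FastSpread (n d : ℕ) (3≤d : 3 ℕ.≤ d) (1≤n : 1 ℕ.≤ n) (v : Fin n)
 (M M′ m₁ h mᴮ mᴵ R₀ R₁ k : ℕ) .{{_ : ℕ.NonZero M}}
 (1≤M′ : 1 ℕ.≤ M′) (0≤ρ : 0ℚ ℚ.≤ Growth.Rate.ρ d 3≤d M′ 1≤M′)
 (M-rate : 2 ℕ.* (suc d ℕ.* M′) ℕ.≤ M) (M≥2d : 2 ℕ.* d ℕ.≤ M) (M≥dd : d ℕ.* suc d ℕ.≤ M) (M≥16 : 16 ℕ.≤ M)
 (hd : 64 ℕ.* d ℕ.≤ 2 ℕ.^ h) (small : 4 ℕ.* m₁ ℕ.+ 4 ℕ.* d ℕ.≤ n) (very-small : 4 ℕ.* d ℕ.* m₁ ℕ.* 2 ℕ.^ (2 ℕ.* (h ℕ.* M)) ℕ.≤ n)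
 (1≤mᴮ : 1 ℕ.≤ mᴮ) (mᴮ≪mᴵ : 8 ℕ.* (suc d ℕ.* (suc d ℕ.* mᴮ)) ℕ.≤ mᴵ) (mᴵ≪m₁ : suc d ℕ.* mᴵ ℕ.≤ m₁)
 (R₀≤ : 2 ℕ.* R₀ ℕ.≤ mᴵ) (R₁≤ : 2 ℕ.* R₁ ℕ.≤ mᴮ) (1≤k : 1 ℕ.≤ k)
 (enough : 2 ℕ.* ((k ℕ.+ k) ℕ.* (d ℕ.* (d ℕ.* n))) ℕ.≤ (R₀ ℕ.∸ (k ℕ.+ k)) ℕ.* (R₁ ℕ.∸ (d ℕ.* (k ℕ.+ k) ℕ.+ (d ℕ.+ d ℕ.* d)))) where

 open SparsityBound

 open Rationals
 open Rate d 3≤d M′ 1≤M′ using (1≤d; ρ)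
 open Expectation d 1≤d
 open OneRound d 1≤d

 ℒ : List (Graph n)
 ℒ = L n d 1≤d

 mᴮ≤mᴵ : suc d ℕ.* mᴮ ℕ.≤ mᴵ
 mᴮ≤mᴵ = ℕ.≤-trans (ℕ.≤-trans (ℕ.m≤n*m (suc d ℕ.* mᴮ) (suc d)) (ℕ.m≤n*m (suc d ℕ.* (suc d ℕ.* mᴮ)) 8)) mᴮ≪mᴵ

 1≤mᴵ : 1 ℕ.≤ mᴵ
 1≤mᴵ = ℕ.≤-trans (ℕ.≤-trans 1≤mᴮ (ℕ.m≤n*m mᴮ (suc d))) mᴮ≤mᴵ

 over : ℕ → ℕ → Subset n → Bool
 over m m₂ X = not (atMost m X) ∧ atMost m₂ X

 sizeI sizeB : Subset n → Bool
 sizeI = over mᴵ (mᴵ ℕ.+ mᴵ)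
 sizeB = over mᴮ (suc d ℕ.* mᴮ)

 missed : Graph n → Subset n → Subset n → ℚ
 missed G I B = EH G 2 (λ bs → indicator (disj (back bs B) I))

 0≤missed : ∀ G I B → 0ℚ ≤ missed G I B
 0≤missed G I B = subst (_≤ missed G I B) (trans (EH-* G 2 0ℚ (λ _ → 0ℚ)) (*-zeroˡ (EH G 2 (λ _ → 0ℚ))))
  (EH-mono G 2 {f = λ _ → 0ℚ * 0ℚ} λ bs → 0≤indicator (disj (back bs B) I))

 back-grow : ∀ {t} (bs : History n t) {X Y : Subset n} → (∀ x → lookup X x ≡ true → lookup Y x ≡ true) → ∀ x → lookup (back bs X) x ≡ true → lookup (back bs Y) x ≡ true
 back-grow [] le = le
 back-grow (c ∷ bs) {X} {Y} le = back-grow bs λ u e → trans (pre-lookup c Y u) (or (∨-true⁻ (trans (sym (pre-lookup c X u)) e)))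
  where
  or : ∀ {u} → lookup X u ≡ true ⊎ lookup X (lookup c u) ≡ true → lookup Y u ∨ lookup Y (lookup c u) ≡ true
  or (inj₁ e) = ∨-trueˡ (le _ e)
  or {u} (inj₂ e) = ∨-trueʳ {lookup Y u} (le _ e)

 -- Makes the probability of not joining admissible in `firstPassage`: once `I` or `B` is large, its
 -- further growth can only help.
 missed-anti : ∀ G {I J B C} → (∀ x → lookup I x ≡ true → lookup J x ≡ true) → (∀ x → lookup B x ≡ true → lookup C x ≡ true) → missed G J C ≤ missed G I B
 missed-anti G {I} {J} {B} {C} I⊑J B⊑C = EH-mono G 2 λ bs → indicator-mono λ e → true-does (disjoint? (back bs B) I) λ x x∈ →
  false-of (does-true (disjoint? (back bs C) J) e x (back-grow bs B⊑C x x∈)) (I⊑J x)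
  where
  false-of : ∀ {a b} → b ≡ false → (a ≡ true → b ≡ true) → a ≡ false
  false-of {false} _ _ = refl
  false-of {true} f g = true≢false (g refl) f

 meets-missed : ∀ G → Degrees G → ∀ I B → ¬ Disjoint I B → missed G I B ≡ 0ℚ
 meets-missed G deg I B meets = trans (EH-cong G 2 λ bs → cong indicator (false-does (disjoint? (back bs B) I) λ h → meets λ x x∈I → flip x x∈I bs (h x))) (EH-const G deg 2 0ℚ)
  where
  stays : ∀ {t} (bs : History n t) (X : Subset n) x → lookup X x ≡ true → lookup (back bs X) x ≡ true
  stays [] X x e = e
  stays (c ∷ bs) X x e = stays bs (pre c X) x (pre-old c X e)
  flip : ∀ x → lookup I x ≡ true → ∀ (bs : History n 2) → (lookup (back bs B) x ≡ true → lookup I x ≡ false) → lookup B x ≡ false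
  flip x x∈I bs h with bool-cases (lookup B x)
  ... | inj₂ e = e
  ... | inj₁ e = true≢false x∈I (h (stays bs B x e))

 module Pair (I B : Subset n) (I∩B : Disjoint I B) where
  open Joining 1≤d I B I∩B public using (out; #good; Dsum; V; module Move)
  rich : Graph n → Bool
  rich G = does (R₀ ℕ.≤? out G ℕ.+ #good G) ∧ does (R₁ ℕ.≤? Dsum G)

 -- The case distinction supplies the disjointness under which the switchings are defined. Sets that
 -- already meet contribute nothing, in accordance with `meets-missed`.
 term′ : (I B : Subset n) → Dec (Disjoint I B) → Graph n → ℚ
 term′ I B (no _) G = 0ℚ
 term′ I B (yes I∩B) G = indicator (Pair.rich I B I∩B G) * missed G I B

 term : Subset n → Subset n → Graph n → ℚ
 term I B G = indicator (sizeI I ∧ sizeB B) * term′ I B (disjoint? I B) G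

 φ ψ : Graph n → ℕ → Fin n → Subset n → ℚ
 φ G τ u I = Kernel.Kᵗ G push τ (λ Z → indicator (Z ≡ˢ I)) ⁅ u ⁆
 ψ G σ w B = Kernel.Kᵗ G pre σ (λ Z → indicator (Z ≡ˢ B)) ⁅ w ⁆

 0≤φ : ∀ G τ u I → 0ℚ ≤ φ G τ u I
 0≤φ G τ u I = Kernel.Kᵗ-nonNeg G push τ (λ Z → 0≤indicator (Z ≡ˢ I)) ⁅ u ⁆

 0≤ψ : ∀ G σ w B → 0ℚ ≤ ψ G σ w B
 0≤ψ G σ w B = Kernel.Kᵗ-nonNeg G pre σ (λ Z → 0≤indicator (Z ≡ˢ B)) ⁅ w ⁆

 γ : ℚ
 γ = ½ ^ k + pgf (pgf 0ℚ) ^ k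

 0≤γ : 0ℚ ≤ γ
 0≤γ = +-nonNeg (^-nonNeg (nonNegative⁻¹ ½) k) (^-nonNeg (0≤pgf (0≤pgf ≤-refl 0≤1) (pgf≤1 ≤-refl 0≤1)) k)

 -- For fixed `I` and `B` the product of the two arrival probabilities is a switching-invariant
 -- weight on graphs, which is the sense in which the two sets may be conditioned on.
 pair-bound : ∀ τ σ w I B → Σ (λ G → φ G τ v I * ψ G σ w B * term I B G) ℒ ≤ γ * Σ (λ G → φ G τ v I * ψ G σ w B) ℒ
 pair-bound τ σ w I B = go (disjoint? I B)
  where
  W : Graph n → ℚ
  W G = φ G τ v I * ψ G σ w B
  0≤W : ∀ G → 0ℚ ≤ W G
  0≤W G = *-nonNeg (0≤φ G τ v I) (0≤ψ G σ w B)
  go : (dec : Dec (Disjoint I B)) → Σ (λ G → W G * (indicator (sizeI I ∧ sizeB B) * term′ I B dec G)) ℒ ≤ γ * Σ W ℒ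
  go (no _) = ≤-trans (≤-reflexive (trans (Σ-cong (λ G → trans (cong (W G *_) (*-zeroʳ (indicator (sizeI I ∧ sizeB B)))) (*-zeroʳ (W G))) ℒ) (Σ-0 ℒ))) (*-nonNeg 0≤γ (Σ-nonNeg 0≤W ℒ))
  go (yes I∩B) = ≤-trans (Σ-mono ℒ λ G _ → ≤-trans (*-monoˡ (W G) (0≤W G) (indicator-≤ (sizeI I ∧ sizeB B) (*-nonNeg (0≤indicator (Pair.rich I B I∩B G)) (0≤missed G I B)) λ _ → ≤-refl))
    (≤-reflexive (solve 3 (λ w r m → w :* (r :* m) := r :* (w :* m)) refl (W G) (indicator (Pair.rich I B I∩B G)) (missed G I B))))
   (JoiningIsTypical.Typical.missed-unlikely 1≤d I B I∩B W 0≤W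
    (λ G reg x x′ y y′ e → cong₂ _*_ (Pair.Move.arrival-push I B I∩B G reg x x′ y y′ e τ ⁅ v ⁆) (Pair.Move.arrival-pre I B I∩B G reg x x′ y y′ e σ ⁅ w ⁆))
    R₀ R₁ k enough 1≤n 1≤k)

 -- A union over all leaving times of the two processes and over all sets at which they may arrive
 -- then.
 Z : ℕ → ℕ → Fin n → Graph n → ℚ
 Z S t w G = sumOver S λ σ → sumOver t λ τ → Σ (λ B → Σ (λ I → φ G τ v I * ψ G σ w B * term I B G) (allSubsets n)) (allSubsets n)

 total-mass : ∀ G → Degrees G → ∀ next τ u → Σ (λ Y → Kernel.Kᵗ G next τ (λ Q → indicator (Q ≡ˢ Y)) u) (allSubsets n) ≡ 1ℚ
 total-mass G deg next τ u = trans (Σ-cong (λ Y → sym (*-identityʳ _)) (allSubsets n)) (trans (sym (Kᵗ-expand 1≤d G next τ (λ _ → 1ℚ) u)) (Kernel.Kᵗ-const G next deg τ 1ℚ u))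

 -- At fixed times the arrival probabilities sum to 1 over all sets, so only the number of pairs of
 -- times is lost.
 Z-bound : ∀ S t w → Σ (Z S t w) ℒ ≤ ι S * (ι t * (γ * tot n d 1≤d))
 Z-bound S t w = ≤-trans (≤-reflexive (trans (Σ-sumOver S (λ G σ → sumOver t λ τ → inner G σ τ) ℒ) refl))
   (≤-trans (sumOver-mono S λ σ → ≤-trans (≤-reflexive (Σ-sumOver t (λ G τ → inner G σ τ) ℒ)) (≤-trans (sumOver-mono t λ τ → one σ τ) (≤-reflexive (sumOver-const t (γ * tot n d 1≤d)))))
    (≤-reflexive (sumOver-const S (ι t * (γ * tot n d 1≤d)))))
  where
  A = allSubsets n
  inner : Graph n → ℕ → ℕ → ℚ
  inner G σ τ = Σ (λ B → Σ (λ I → φ G τ v I * ψ G σ w B * term I B G) A) A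
  one : ∀ σ τ → Σ (λ G → inner G σ τ) ℒ ≤ γ * tot n d 1≤d
  one σ τ = begin
   Σ (λ G → Σ (λ B → Σ (λ I → φ G τ v I * ψ G σ w B * term I B G) A) A) ℒ ≡⟨ trans (Σ-swap (λ G B → Σ (λ I → φ G τ v I * ψ G σ w B * term I B G) A) ℒ A) (Σ-cong (λ B → Σ-swap (λ G I → φ G τ v I * ψ G σ w B * term I B G) ℒ A) A) ⟩
   Σ (λ B → Σ (λ I → Σ (λ G → φ G τ v I * ψ G σ w B * term I B G) ℒ) A) A ≤⟨ Σ-mono A (λ B _ → Σ-mono A λ I _ → pair-bound τ σ w I B) ⟩
   Σ (λ B → Σ (λ I → γ * Σ (λ G → φ G τ v I * ψ G σ w B) ℒ) A) A ≡⟨ trans (Σ-cong (λ B → Σ-*ˡ γ (λ I → Σ (λ G → φ G τ v I * ψ G σ w B) ℒ) A) A) (Σ-*ˡ γ (λ B → Σ (λ I → Σ (λ G → φ G τ v I * ψ G σ w B) ℒ) A) A) ⟩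
   γ * Σ (λ B → Σ (λ I → Σ (λ G → φ G τ v I * ψ G σ w B) ℒ) A) A ≡⟨ cong (γ *_) (trans (Σ-cong (λ B → sym (Σ-swap (λ G I → φ G τ v I * ψ G σ w B) ℒ A)) A) (sym (Σ-swap (λ G B → Σ (λ I → φ G τ v I * ψ G σ w B) A) ℒ A))) ⟩
   γ * Σ (λ G → Σ (λ B → Σ (λ I → φ G τ v I * ψ G σ w B) A) A) ℒ ≤⟨ *-monoˡ γ 0≤γ (Σ-mono ℒ λ G G∈ → ≤-reflexive (mass G (RegularGraph.degrees G (regularGraphs-sound n d G∈)))) ⟩
   γ * Σ (λ _ → 1ℚ) ℒ ≡⟨ cong (γ *_) (trans (Σ-const 1ℚ ℒ) (*-identityʳ _)) ⟩
   γ * tot n d 1≤d ∎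
   where
   open ≤-Reasoning
   mass : ∀ G → Degrees G → Σ (λ B → Σ (λ I → φ G τ v I * ψ G σ w B) A) A ≡ 1ℚ
   mass G deg = trans (Σ-cong (λ B → trans (Σ-*ʳ (ψ G σ w B) (φ G τ v) A) (trans (cong (_* ψ G σ w B) (total-mass G deg push τ ⁅ v ⁆)) (*-identityˡ _))) A) (total-mass G deg pre σ ⁅ w ⁆)

 0≤term : ∀ I B G → 0ℚ ≤ term I B G
 0≤term I B G = *-nonNeg (0≤indicator (sizeI I ∧ sizeB B)) (go (disjoint? I B))
  where
  go : ∀ dec → 0ℚ ≤ term′ I B dec G
  go (no _) = ≤-refl
  go (yes e) = *-nonNeg (0≤indicator (Pair.rich I B e G)) (0≤missed G I B)

 0≤Z : ∀ S t w G → 0ℚ ≤ Z S t w G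
 0≤Z S t w G = sumOver-nonNeg S λ σ → sumOver-nonNeg t λ τ → Σ-nonNeg (λ B → Σ-nonNeg (λ I → *-nonNeg (*-nonNeg (0≤φ G τ v I) (0≤ψ G σ w B)) (0≤term I B G)) (allSubsets n)) (allSubsets n)

 module SparseCase (G : Graph n) (reg : Regular d G) (sparse : Sparse M m₁ G) where

  open RegularGraph G reg
  open Consequences 3≤d G reg M m₁ sparse
  private
   module Kp = Kernel G push
   module Kb = Kernel G pre

  split-over : ∀ m m₂ X → over m m₂ X ≡ true → m ℕ.< ∣ X ∣ × ∣ X ∣ ℕ.≤ m₂
  split-over m m₂ X e = go (atMost m X) (atMost m₂ X) refl refl e
   where
   go : ∀ a b → a ≡ atMost m X → b ≡ atMost m₂ X → not a ∧ b ≡ true → m ℕ.< ∣ X ∣ × ∣ X ∣ ℕ.≤ m₂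
   go false true ea eb _ = ℕ.≰⇒> (does-false (∣ X ∣ ℕ.≤? m) (sym ea)) , atMost⁻ {X = X} (sym eb)

  -- On a sparse graph, disjoint sets of the sizes found on leaving are rich. The upper bounds on
  -- the sizes matter too: sparsity is known only up to `m₁`, and `B` must be much smaller than `I`.
  covered : ∀ I B → indicator (sizeI I ∧ sizeB B) * missed G I B ≤ term I B G
  covered I B = indicator-*-≤ (sizeI I ∧ sizeB B) λ e → go (disjoint? I B) (and (sizeI I) (sizeB B) e)
   where
   and : ∀ a b → a ∧ b ≡ true → a ≡ true × b ≡ true
   and true true _ = refl , refl
   go : (dec : Dec (Disjoint I B)) → sizeI I ≡ true × sizeB B ≡ true → missed G I B ≤ term′ I B dec G
   go (no meets) _ = ≤-reflexive (meets-missed G degrees I B meets)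
   go (yes I∩B) (eI , eB) = ≤-reflexive (sym (trans (cong (λ b → indicator b * missed G I B) isRich) (*-identityˡ (missed G I B))))
    where
    open JoiningIsTypical.SparseJoin 1≤d I B I∩B 3≤d G reg M m₁ sparse using (out≥; Dsum≥)
    open Pair I B I∩B
    szI = split-over mᴵ (mᴵ ℕ.+ mᴵ) I eI
    szB = split-over mᴮ (suc d ℕ.* mᴮ) B eB
    b≤ : suc d ℕ.* ∣ B ∣ ℕ.≤ suc d ℕ.* (suc d ℕ.* mᴮ)
    b≤ = ℕ.*-monoʳ-≤ (suc d) (proj₂ szB)
    2i≤ : 2 ℕ.* ∣ I ∣ ℕ.≤ m₁
    2i≤ = ℕ.≤-trans (ℕ.*-monoʳ-≤ 2 (proj₂ szI)) (ℕ.≤-trans (ℕ.≤-trans (ℕ.≤-reflexive (ring mᴵ)) (ℕ.*-monoˡ-≤ mᴵ (ℕ.≤-trans (ℕ.s≤s 3≤d) ℕ.≤-refl))) mᴵ≪m₁)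
     where
     ring : ∀ m → 2 ℕ.* (m ℕ.+ m) ≡ 4 ℕ.* m
     ring = ℕ-solve-∀
    o : ∣ I ∣ ℕ.≤ 2 ℕ.* out G
    o = out≥ (ℕ.≤-trans (ℕ.*-monoʳ-≤ 8 b≤) (ℕ.≤-trans mᴮ≪mᴵ (ℕ.<⇒≤ (proj₁ szI)))) 2i≤ M≥16
    D : ∣ B ∣ ℕ.≤ 2 ℕ.* Dsum G
    D = Dsum≥ (ℕ.≤-trans b≤ (ℕ.≤-trans (ℕ.m≤n*m (suc d ℕ.* (suc d ℕ.* mᴮ)) 8) (ℕ.≤-trans mᴮ≪mᴵ (ℕ.≤-trans (ℕ.m≤n*m mᴵ (suc d)) mᴵ≪m₁)))) M≥dd
    isRich : rich G ≡ true
    isRich = cong₂ _∧_ (true-does (R₀ ℕ.≤? out G ℕ.+ #good G) (ℕ.≤-trans (ℕ.*-cancelˡ-≤ 2 (ℕ.≤-trans R₀≤ (ℕ.≤-trans (ℕ.<⇒≤ (proj₁ szI)) o))) (ℕ.m≤m+n (out G) (#good G))))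
     (true-does (R₁ ℕ.≤? Dsum G) (ℕ.*-cancelˡ-≤ 2 (ℕ.≤-trans R₁≤ (ℕ.≤-trans (ℕ.<⇒≤ (proj₁ szB)) D))))

  fᴵ : Subset n → Subset n → ℚ
  fᴵ B I = indicator (not (atMost mᴵ I)) * missed G I B

  H : ℕ → Subset n → ℚ
  H t B = Kp.Kᵗ t (fᴵ B) ⁅ v ⁆

  0≤fᴵ : ∀ B I → 0ℚ ≤ fᴵ B I
  0≤fᴵ B I = *-nonNeg (0≤indicator (not (atMost mᴵ I))) (0≤missed G I B)

  fᴮ : ℕ → Subset n → ℚ
  fᴮ t B = indicator (not (atMost mᴮ B)) * H t B

  0≤H : ∀ t B → 0ℚ ≤ H t B
  0≤H t B = Kp.Kᵗ-nonNeg t (0≤fᴵ B) ⁅ v ⁆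

  not-small : ∀ m (X : Subset n) → ∣ X ∣ ℕ.≤ m → ∀ y → indicator (not (atMost m X)) * y ≡ 0ℚ
  not-small m X le y = trans (cong (λ b → indicator (not b) * y) (atMost⁺ {X = X} le)) (*-zeroˡ y)

  big : ∀ m (X : Subset n) → m ℕ.< ∣ X ∣ → not (atMost m X) ≡ true
  big m X lt = cong not (false-does (∣ X ∣ ℕ.≤? m) (ℕ.<⇒≱ lt))

  anti : ∀ m (X Y : Subset n) → m ℕ.< ∣ X ∣ → ∀ {p q} → 0ℚ ≤ p → p ≤ q → indicator (not (atMost m Y)) * p ≤ indicator (not (atMost m X)) * q
  anti m X Y lt {p} {q} 0≤p p≤q = ≤-trans (indicator-≤ (not (atMost m Y)) (≤-trans 0≤p p≤q) λ _ → p≤q) (≤-reflexive (sym (trans (cong (λ b → indicator b * q) (big m X lt)) (*-identityˡ q))))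

  H≤ : ∀ t B → H t B ≤ sumOver t λ τ → Kp.Kᵗ τ (λ I → indicator (atMost (mᴵ ℕ.+ mᴵ) I) * fᴵ B I) ⁅ v ⁆
  H≤ t B = FirstPassage.firstPassage d 1≤d G degrees push mᴵ (mᴵ ℕ.+ mᴵ) (fᴵ B) (0≤fᴵ B) (λ X le → not-small mᴵ X le (missed G X B))
   (λ c X _ lt → anti mᴵ X (push c X) lt (0≤missed G (push c X) B) (missed-anti G {X} {push c X} {B} {B} (λ x → push-old c X) (λ _ e → e)))
   (λ c X _ le → ℕ.≤-trans (∣push∣≤2 c X) (ℕ.+-mono-≤ le le)) t ⁅ v ⁆ (ℕ.≤-trans (ℕ.≤-reflexive (card-singleton v)) 1≤mᴵ)

  fᴮ≤ : ∀ S t w → Kb.Kᵗ S (fᴮ t) ⁅ w ⁆ ≤ sumOver S λ σ → Kb.Kᵗ σ (λ B → indicator (atMost (suc d ℕ.* mᴮ) B) * fᴮ t B) ⁅ w ⁆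
  fᴮ≤ S t w = FirstPassage.firstPassage d 1≤d G degrees pre mᴮ (suc d ℕ.* mᴮ) (fᴮ t) (λ B → *-nonNeg (0≤indicator (not (atMost mᴮ B))) (0≤H t B)) (λ X le → not-small mᴮ X le (H t X))
   (λ c X _ lt → anti mᴮ X (pre c X) lt (0≤H t (pre c X)) (Kp.Kᵗ-mono t (λ I → *-monoˡ (indicator (not (atMost mᴵ I))) (0≤indicator (not (atMost mᴵ I))) (missed-anti G {I} {I} {X} {pre c X} (λ _ e → e) (λ x → pre-old c X))) ⁅ v ⁆))
   (λ c X comp le → ℕ.≤-trans (∣pre∣≤ c comp X) (ℕ.*-monoʳ-≤ (suc d) le)) S ⁅ w ⁆ (ℕ.≤-trans (ℕ.≤-reflexive (card-singleton w)) 1≤mᴮ)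

  fᴮ≤Z : ∀ S t w → Kb.Kᵗ S (fᴮ t) ⁅ w ⁆ ≤ Z S t w G
  fᴮ≤Z S t w = ≤-trans (fᴮ≤ S t w) (sumOver-mono S λ σ → begin
    Kb.Kᵗ σ (λ B → indicator (atMost m₂ B) * fᴮ t B) ⁅ w ⁆
     ≡⟨ Kᵗ-expand 1≤d G pre σ (λ B → indicator (atMost m₂ B) * fᴮ t B) ⁅ w ⁆ ⟩
    Σ (λ B → ψ G σ w B * (indicator (atMost m₂ B) * fᴮ t B)) A
     ≤⟨ Σ-mono A (λ B _ → *-monoˡ (ψ G σ w B) (0≤ψ G σ w B) (perB B)) ⟩
    Σ (λ B → ψ G σ w B * sumOver t (λ τ → Σ (λ I → φ G τ v I * term I B G) A)) A
     ≡⟨ Σ-cong (λ B → trans (sumOver-*ˡ t (ψ G σ w B) (λ τ → Σ (λ I → φ G τ v I * term I B G) A)) (cong-sum t λ τ → trans (sym (Σ-*ˡ (ψ G σ w B) (λ I → φ G τ v I * term I B G) A)) (Σ-cong (λ I → solve 3 (λ p f e → p :* (f :* e) := f :* p :* e) refl (ψ G σ w B) (φ G τ v I) (term I B G)) A))) A ⟩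
    Σ (λ B → sumOver t (λ τ → Σ (λ I → φ G τ v I * ψ G σ w B * term I B G) A)) A
     ≡⟨ Σ-sumOver t (λ B τ → Σ (λ I → φ G τ v I * ψ G σ w B * term I B G) A) A ⟩
    sumOver t (λ τ → Σ (λ B → Σ (λ I → φ G τ v I * ψ G σ w B * term I B G) A) A) ∎)
   where
   open ≤-Reasoning
   A = allSubsets n
   m₂ = suc d ℕ.* mᴮ
   cong-sum : ∀ t {f g : ℕ → ℚ} → (∀ τ → f τ ≡ g τ) → sumOver t f ≡ sumOver t g
   cong-sum zero h = refl
   cong-sum (suc t) h = cong₂ _+_ (cong-sum t h) (h (suc t))
   sizes : ∀ B I → indicator (atMost m₂ B) * (indicator (not (atMost mᴮ B)) * (indicator (atMost (mᴵ ℕ.+ mᴵ) I) * fᴵ B I)) ≡ indicator (sizeI I ∧ sizeB B) * missed G I B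
   sizes B I = go (atMost m₂ B) (not (atMost mᴮ B)) (atMost (mᴵ ℕ.+ mᴵ) I) (not (atMost mᴵ I)) (missed G I B)
    where
    go : ∀ a b c e x → indicator a * (indicator b * (indicator c * (indicator e * x))) ≡ indicator ((e ∧ c) ∧ (b ∧ a)) * x
    go true true true true x = solve 1 (λ x → con 1ℚ :* (con 1ℚ :* (con 1ℚ :* (con 1ℚ :* x))) := con 1ℚ :* x) refl x
    go true true true false x = solve 1 (λ x → con 1ℚ :* (con 1ℚ :* (con 1ℚ :* (con 0ℚ :* x))) := con 0ℚ :* x) refl x
    go true true false true x = solve 1 (λ x → con 1ℚ :* (con 1ℚ :* (con 0ℚ :* (con 1ℚ :* x))) := con 0ℚ :* x) refl x
    go true true false false x = solve 1 (λ x → con 1ℚ :* (con 1ℚ :* (con 0ℚ :* (con 0ℚ :* x))) := con 0ℚ :* x) refl x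
    go true false true true x = solve 1 (λ x → con 1ℚ :* (con 0ℚ :* (con 1ℚ :* (con 1ℚ :* x))) := con 0ℚ :* x) refl x
    go true false c false x = trans (solve 2 (λ c x → con 1ℚ :* (con 0ℚ :* (c :* (con 0ℚ :* x))) := con 0ℚ :* x) refl (indicator c) x) refl
    go true false false true x = solve 1 (λ x → con 1ℚ :* (con 0ℚ :* (con 0ℚ :* (con 1ℚ :* x))) := con 0ℚ :* x) refl x
    go false true true true x = solve 1 (λ x → con 0ℚ :* (con 1ℚ :* (con 1ℚ :* (con 1ℚ :* x))) := con 0ℚ :* x) refl x
    go false false true true x = solve 1 (λ x → con 0ℚ :* (con 0ℚ :* (con 1ℚ :* (con 1ℚ :* x))) := con 0ℚ :* x) refl x
    go false b c false x = solve 3 (λ b c x → con 0ℚ :* (b :* (c :* (con 0ℚ :* x))) := con 0ℚ :* x) refl (indicator b) (indicator c) x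
    go false b false true x = solve 2 (λ b x → con 0ℚ :* (b :* (con 0ℚ :* (con 1ℚ :* x))) := con 0ℚ :* x) refl (indicator b) x
   perB : ∀ B → indicator (atMost m₂ B) * fᴮ t B ≤ sumOver t (λ τ → Σ (λ I → φ G τ v I * term I B G) A)
   perB B = begin
    α * (β * H t B)
     ≤⟨ *-monoˡ α 0≤α (*-monoˡ β 0≤β (H≤ t B)) ⟩
    α * (β * sumOver t (λ τ → Kp.Kᵗ τ g ⁅ v ⁆))
     ≡⟨ trans (cong (α *_) (sumOver-*ˡ t β (λ τ → Kp.Kᵗ τ g ⁅ v ⁆))) (sumOver-*ˡ t α (λ τ → β * Kp.Kᵗ τ g ⁅ v ⁆)) ⟩
    sumOver t (λ τ → α * (β * Kp.Kᵗ τ g ⁅ v ⁆))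
     ≤⟨ sumOver-mono t (λ τ → ≤-trans (≤-reflexive (trans (cong (α *_) (sym (Kp.Kᵗ-* τ β g ⁅ v ⁆))) (sym (Kp.Kᵗ-* τ α (λ I → β * g I) ⁅ v ⁆))))
        (≤-trans (Kp.Kᵗ-mono τ (λ I → ≤-trans (≤-reflexive (sizes B I)) (covered I B)) ⁅ v ⁆) (≤-reflexive (Kᵗ-expand 1≤d G push τ (λ I → term I B G) ⁅ v ⁆)))) ⟩
    sumOver t (λ τ → Σ (λ I → φ G τ v I * term I B G) A) ∎
    where
    α = indicator (atMost m₂ B)
    β = indicator (not (atMost mᴮ B))
    0≤α = 0≤indicator (atMost m₂ B)
    0≤β = 0≤indicator (not (atMost mᴮ B))
    g : Subset n → ℚ
    g I = indicator (atMost (mᴵ ℕ.+ mᴵ) I) * fᴵ B I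

  pᴵ pᴮ : ℕ → ℕ → ℚ
  pᴵ t _ = 2ℚ * recip (1ℚ + ρ ^ t * recip (ι (mᴵ ℕ.+ mᴵ)))
  pᴮ s t = 2ℚ * (pgf (recip (1ℚ + ρ ^ t * recip (ι (mᴮ ℕ.+ mᴮ)))) ^ d) ^ s

  I-small : ∀ t → Kp.Kᵗ t (λ Y → indicator (atMost mᴵ Y)) ⁅ v ⁆ ≤ pᴵ t 0
  I-small t = Potential.small-unlikely d 3≤d M′ 1≤M′ 0≤ρ G reg push mᴵ (privates G) (λ c X → card-mono {X = X} {push c X} (λ x → push-old c X))
   (λ 0≤z z≤1 X → Ex-push 0≤z z≤1 G reg X) (λ X le → privates-deficit {M′} M-rate X (ℕ.≤-trans (ℕ.*-monoʳ-≤ (suc d) le) mᴵ≪m₁)) 1≤mᴵ t ⁅ v ⁆ (ℕ.≤-reflexive (sym (card-singleton v)))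

  B-small : ∀ s t w → Kb.Kᵗ (s ℕ.+ t) (λ Y → indicator (atMost mᴮ Y)) ⁅ w ⁆ ≤ pᴮ s t
  B-small s t w = Potential.small-very-unlikely d 3≤d M′ 1≤M′ 0≤ρ G reg pre mᴮ (boundary G) (λ c X → card-mono {X = X} {pre c X} (λ x → pre-old c X))
   (λ 0≤z z≤1 X → Ex-pre 0≤z z≤1 G reg X) (λ X le → boundary-deficit {M′} M-rate X (ℕ.≤-trans le mᴮ≤m₁)) 1≤mᴮ (λ X 1≤X le → boundary≥d M≥2d X 1≤X (ℕ.≤-trans le mᴮ≤m₁)) s t ⁅ w ⁆ (ℕ.≤-reflexive (sym (card-singleton w)))
   where
   mᴮ≤m₁ : mᴮ ℕ.≤ m₁
   mᴮ≤m₁ = ℕ.≤-trans (ℕ.≤-trans (ℕ.m≤n*m mᴮ (suc d)) mᴮ≤mᴵ) (ℕ.≤-trans (ℕ.m≤n*m mᴵ (suc d)) mᴵ≪m₁)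

  all? : Subset n → Bool
  all? X = X ≡ˢ ⊤

  -- The first `t′` rounds build `I`, two rounds are for joining, and the last `s ℕ.+ t` give the
  -- backward sets. If `I` is large, then a vertex uninformed at the end has a small backward set,
  -- or a large one that two rounds fail to join to `I`.
  unfinished≤ : ∀ s t t′ → EH G ((s ℕ.+ t) ℕ.+ (2 ℕ.+ t′)) (λ cs → indicator (not (all? (informed v cs)))) ≤ pᴵ t′ 0 + ∑ℚ (λ w → pᴮ s t + Z (s ℕ.+ t) t′ w G)
  unfinished≤ s t t′ = begin
    EH G (S ℕ.+ (2 ℕ.+ t′)) (λ cs → indicator (not (all? (informed v cs))))
     ≡⟨ trans (EH-++ G S (2 ℕ.+ t′) _) (EH-cong G S λ as → EH-++ G 2 t′ (λ bcs → indicator (not (all? (informed v (as Vec.++ bcs)))))) ⟩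
    EH G S (λ as → EH G 2 (λ bs → EH G t′ (λ cs → indicator (not (all? (informed v (as Vec.++ (bs Vec.++ cs))))))))
     ≤⟨ EH-mono G S (λ as → EH-mono G 2 λ bs → EH-mono G t′ λ cs → pointwise as bs cs) ⟩
    EH G S (λ as → EH G 2 (λ bs → EH G t′ (λ cs → p cs + ∑ℚ (λ w → q w as + g w as bs cs))))
     ≡⟨ EH-cong G S (λ as → trans (EH-cong G 2 λ bs → EH-+ G t′ p (λ cs → ∑ℚ (λ w → q w as + g w as bs cs))) (trans (EH-+ G 2 (λ _ → EH G t′ p) (λ bs → EH G t′ (λ cs → ∑ℚ (λ w → q w as + g w as bs cs)))) (cong₂ _+_ (EH-const G degrees 2 (EH G t′ p))
        (trans (EH-cong G 2 λ bs → trans (EH-∑ G degrees t′ (λ w cs → q w as + g w as bs cs)) (∑ℚ-cong λ w → trans (EH-+ G t′ (λ _ → q w as) (g w as bs)) (cong (_+ EH G t′ (g w as bs)) (EH-const G degrees t′ (q w as)))))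
         (trans (EH-∑ G degrees 2 (λ w bs → q w as + EH G t′ (g w as bs))) (∑ℚ-cong λ w → trans (EH-+ G 2 (λ _ → q w as) (λ bs → EH G t′ (g w as bs))) (cong (_+ EH G 2 (λ bs → EH G t′ (g w as bs))) (EH-const G degrees 2 (q w as))))))))) ⟩
    EH G S (λ as → EH G t′ p + ∑ℚ (λ w → q w as + EH G 2 (λ bs → EH G t′ (g w as bs))))
     ≡⟨ trans (EH-+ G S (λ _ → EH G t′ p) (λ as → ∑ℚ (λ w → q w as + EH G 2 (λ bs → EH G t′ (g w as bs))))) (cong₂ _+_ (EH-const G degrees S (EH G t′ p)) (trans (EH-∑ G degrees S (λ w as → q w as + EH G 2 (λ bs → EH G t′ (g w as bs))))
        (∑ℚ-cong λ w → EH-+ G S (q w) (λ as → EH G 2 (λ bs → EH G t′ (g w as bs)))))) ⟩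
    EH G t′ p + ∑ℚ (λ w → EH G S (q w) + EH G S (λ as → EH G 2 (λ bs → EH G t′ (g w as bs))))
     ≤⟨ +-mono-≤ (≤-trans (≤-reflexive (EH-informed G t′ v (λ Y → indicator (atMost mᴵ Y)))) (I-small t′))
        (∑ℚ-mono λ w → +-mono-≤ (≤-trans (≤-reflexive (EH-back G S ⁅ w ⁆ (λ Y → indicator (atMost mᴮ Y)))) (B-small s t w)) (last w)) ⟩
    pᴵ t′ 0 + ∑ℚ (λ w → pᴮ s t + Z S t′ w G) ∎
   where
   open ≤-Reasoning
   S = s ℕ.+ t
   p : History n t′ → ℚ
   p cs = indicator (atMost mᴵ (informed v cs))
   q : Fin n → History n S → ℚ
   q w as = indicator (atMost mᴮ (back as ⁅ w ⁆))
   g : Fin n → History n S → History n 2 → History n t′ → ℚ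
   g w as bs cs = indicator (not (atMost mᴮ (back as ⁅ w ⁆))) * (indicator (not (atMost mᴵ (informed v cs))) * indicator (disj (back bs (back as ⁅ w ⁆)) (informed v cs)))
   0≤q : ∀ w as → 0ℚ ≤ q w as
   0≤q w as = 0≤indicator (atMost mᴮ (back as ⁅ w ⁆))
   0≤g : ∀ w as bs cs → 0ℚ ≤ g w as bs cs
   0≤g w as bs cs = *-nonNeg (0≤indicator (not (atMost mᴮ (back as ⁅ w ⁆)))) (*-nonNeg (0≤indicator (not (atMost mᴵ (informed v cs)))) (0≤indicator (disj (back bs (back as ⁅ w ⁆)) (informed v cs))))
   last : ∀ w → EH G S (λ as → EH G 2 (λ bs → EH G t′ (g w as bs))) ≤ Z S t′ w G
   last w = ≤-trans (≤-reflexive (trans (EH-cong G S λ as → inner as) (EH-back G S ⁅ w ⁆ (fᴮ t′)))) (fᴮ≤Z S t′ w)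
    where
    inner : ∀ as → EH G 2 (λ bs → EH G t′ (g w as bs)) ≡ fᴮ t′ (back as ⁅ w ⁆)
    inner as = trans (EH-cong G 2 λ bs → EH-* G t′ β (λ cs → α cs * e bs cs)) (trans (EH-* G 2 β (λ bs → EH G t′ (λ cs → α cs * e bs cs))) (cong (β *_)
      (trans (EH-swap G 2 t′ (λ bs cs → α cs * e bs cs)) (trans (EH-cong G t′ λ cs → EH-* G 2 (α cs) (λ bs → e bs cs)) (EH-informed G t′ v (fᴵ (back as ⁅ w ⁆)))))))
     where
     β = indicator (not (atMost mᴮ (back as ⁅ w ⁆)))
     α : History n t′ → ℚ
     α cs = indicator (not (atMost mᴵ (informed v cs)))
     e : History n 2 → History n t′ → ℚ
     e bs cs = indicator (disj (back bs (back as ⁅ w ⁆)) (informed v cs))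
   pointwise : ∀ as bs cs → indicator (not (all? (informed v (as Vec.++ (bs Vec.++ cs))))) ≤ p cs + ∑ℚ (λ w → q w as + g w as bs cs)
   pointwise as bs cs = go (bool-cases (all? X)) (bool-cases (atMost mᴵ (informed v cs)))
    where
    X = informed v (as Vec.++ (bs Vec.++ cs))
    0≤sum : 0ℚ ≤ ∑ℚ (λ w → q w as + g w as bs cs)
    0≤sum = ∑ℚ-nonNeg λ w → +-nonNeg (0≤q w as) (0≤g w as bs cs)
    0≤p : 0ℚ ≤ p cs
    0≤p = 0≤indicator (atMost mᴵ (informed v cs))
    go : _ → _ → indicator (not (all? X)) ≤ p cs + ∑ℚ (λ w → q w as + g w as bs cs)
    go (inj₁ done) _ = ≤-trans (≤-reflexive (cong (λ b → indicator (not b)) done)) (+-nonNeg 0≤p 0≤sum)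
    go (inj₂ _) (inj₁ small) = ≤-trans (≤-trans (indicator≤1 (not (all? X))) (≤-reflexive (sym (cong indicator small)))) (p≤p+q 0≤sum)
    go (inj₂ open′) (inj₂ large) = ≤-trans (≤-trans (indicator≤1 (not (all? X))) (found (Fin.any? λ w → lookup X w Bool.≟ false))) (subst (_≤ p cs + ∑ℚ (λ w → q w as + g w as bs cs)) (+-identityˡ _) (+-monoˡ-≤ _ 0≤p))
     where
     found : Dec (∃[ w ] lookup X w ≡ false) → 1ℚ ≤ ∑ℚ (λ w → q w as + g w as bs cs)
     found (no none) = contradiction (subset-ext λ w → trans (notfalse (lookup X w) λ e → none (w , e)) (sym (Vec.lookup-replicate w true))) (does-false (Vec.≡-dec Bool._≟_ X ⊤) open′)
      where
      notfalse : ∀ b → ¬ (b ≡ false) → b ≡ true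
      notfalse true _ = refl
      notfalse false h = contradiction refl h
     found (yes (w , w∉)) = ≤-trans one (term≤∑ℚ (λ w → q w as + g w as bs cs) (λ w → +-nonNeg (0≤q w as) (0≤g w as bs cs)) w)
      where
      apart : Disjoint ⁅ w ⁆ X
      apart x e = subst (λ y → lookup X y ≡ false) (≡ᵇ⇒≡ (trans (sym (lookup-singleton w x)) e)) w∉
      apart′ : Disjoint (back bs (back as ⁅ w ⁆)) (informed v cs)
      apart′ = back-informed v bs cs (back as ⁅ w ⁆) (back-informed v as (bs Vec.++ cs) ⁅ w ⁆ apart)
      one : 1ℚ ≤ q w as + g w as bs cs
      one = case (bool-cases (atMost mᴮ (back as ⁅ w ⁆)))
       where
       case : _ → 1ℚ ≤ q w as + g w as bs cs
       case (inj₁ e) = ≤-trans (≤-reflexive (sym (cong indicator e))) (p≤p+q (0≤g w as bs cs))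
       case (inj₂ e) = ≤-trans (≤-reflexive (sym (trans (cong₂ (λ x y → indicator (not x) * (indicator (not y) * indicator (disj (back bs (back as ⁅ w ⁆)) (informed v cs)))) e large)
        (cong (λ b → 1ℚ * (1ℚ * indicator b)) (true-does (disjoint? (back bs (back as ⁅ w ⁆)) (informed v cs)) apart′))))) (subst (_≤ q w as + g w as bs cs) (+-identityˡ (g w as bs cs)) (+-monoˡ-≤ (g w as bs cs) (0≤q w as)))

 all? : Subset n → Bool
 all? X = X ≡ˢ ⊤

 pᴵ : ℕ → ℚ
 pᴵ t = 2ℚ * recip (1ℚ + ρ ^ t * recip (ι (mᴵ ℕ.+ mᴵ)))

 pᴮ : ℕ → ℕ → ℚ
 pᴮ s t = 2ℚ * (pgf (recip (1ℚ + ρ ^ t * recip (ι (mᴮ ℕ.+ mᴮ)))) ^ d) ^ s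

 -- A graph that is not sparse is charged to its number of violations, which is then at least 1 and
 -- thus exceeds any probability.
 late-completion : ∀ s t t′ → 0ℚ ≤ pᴵ t′ → 0ℚ ≤ pᴮ s t →
  Σ (λ G → EH G ((s ℕ.+ t) ℕ.+ (2 ℕ.+ t′)) (λ cs → indicator (not (all? (informed v cs))))) ℒ ≤
  (2ℚ * ½ ^ (h ℕ.* M) + pᴵ t′ + ι n * (pᴮ s t + ι (s ℕ.+ t) * (ι t′ * γ))) * tot n d 1≤d
 late-completion s t t′ 0≤pᴵ 0≤pᴮ = begin
   Σ bad ℒ
    ≤⟨ Σ-mono ℒ (λ G G∈ → pt G (regularGraphs-sound n d G∈)) ⟩
   Σ (λ G → vio G + (pᴵ t′ + ∑ℚ (λ w → pᴮ s t + Z S t′ w G))) ℒ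
    ≡⟨ trans (Σ-+ vio (λ G → pᴵ t′ + ∑ℚ (λ w → pᴮ s t + Z S t′ w G)) ℒ) (cong (Σ vio ℒ +_) (trans (Σ-+ (λ _ → pᴵ t′) (λ G → ∑ℚ (λ w → pᴮ s t + Z S t′ w G)) ℒ)
       (cong₂ _+_ (Σ-const (pᴵ t′) ℒ) (trans (Σ-∑-swap (λ G w → pᴮ s t + Z S t′ w G) ℒ) (∑ℚ-cong λ w → trans (Σ-+ (λ _ → pᴮ s t) (Z S t′ w) ℒ) (cong (_+ Σ (Z S t′ w) ℒ) (Σ-const (pᴮ s t) ℒ))))))) ⟩
   Σ vio ℒ + (τ * pᴵ t′ + ∑ℚ (λ w → τ * pᴮ s t + Σ (Z S t′ w) ℒ))
    ≤⟨ +-mono-≤ (violations-bound n d 1≤d M m₁ h hd small very-small 1≤n) (+-monoʳ-≤ (τ * pᴵ t′) (≤-trans (∑ℚ-mono λ w → +-monoʳ-≤ (τ * pᴮ s t) (Z-bound S t′ w)) (≤-reflexive (∑ℚ-const n (τ * pᴮ s t + ι S * (ι t′ * (γ * τ))))))) ⟩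
   2ℚ * ½ ^ (h ℕ.* M) * τ + (τ * pᴵ t′ + ι n * (τ * pᴮ s t + ι S * (ι t′ * (γ * τ))))
    ≡⟨ solve 8 (λ x t p n b s u g → x :* t :+ (t :* p :+ n :* (t :* b :+ s :* (u :* (g :* t)))) := (x :+ p :+ n :* (b :+ s :* (u :* g))) :* t) refl (2ℚ * ½ ^ (h ℕ.* M)) τ (pᴵ t′) (ι n) (pᴮ s t) (ι S) (ι t′) γ ⟩
   (2ℚ * ½ ^ (h ℕ.* M) + pᴵ t′ + ι n * (pᴮ s t + ι S * (ι t′ * γ))) * τ ∎
  where
  open ≤-Reasoning
  S = s ℕ.+ t
  τ = tot n d 1≤d
  bad vio : Graph n → ℚ
  bad G = EH G (S ℕ.+ (2 ℕ.+ t′)) (λ cs → indicator (not (all? (informed v cs))))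
  vio = violations n d 1≤d M m₁ h hd small very-small 1≤n
  0≤vio : ∀ G → 0ℚ ≤ vio G
  0≤vio G = Σ-nonNeg (λ X → *-nonNeg (0≤indicator (atMost m₁ X)) (0≤indicator (dense n d 1≤d (index n d 1≤d M m₁ h hd small very-small 1≤n ∣ X ∣) X G))) (allSubsets n)
  pt : ∀ G → Regular d G → bad G ≤ vio G + (pᴵ t′ + ∑ℚ (λ w → pᴮ s t + Z S t′ w G))
  pt G reg with sparse-or-violated n d 1≤d M m₁ h hd small very-small 1≤n G
  ... | inj₁ sp = ≤-trans (SparseCase.unfinished≤ G reg sp s t t′) (subst (_≤ vio G + (pᴵ t′ + ∑ℚ (λ w → pᴮ s t + Z S t′ w G))) (+-identityˡ _) (+-monoˡ-≤ _ (0≤vio G)))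
  ... | inj₂ one = ≤-trans (≤-trans (≤-trans (EH-mono G (S ℕ.+ (2 ℕ.+ t′)) λ cs → indicator≤1 (not (all? (informed v cs)))) (≤-reflexive (EH-const G (RegularGraph.degrees G reg) (S ℕ.+ (2 ℕ.+ t′)) 1ℚ))) one)
    (p≤p+q (+-nonNeg 0≤pᴵ (∑ℚ-nonNeg λ w → +-nonNeg 0≤pᴮ (0≤Z S t′ w G))))

-- Choice of the parameters.

module Parameters where

 open import Data.Nat.Base using (_+_; _*_; _^_; _≤_; _<_; _∸_; z≤n; s≤s)
 open import Data.Nat.DivMod using (_/_; m/n*n≤m; m≡m%n+[m/n]*n; m%n<n; *-/-assoc; /-monoˡ-≤; m*n/n≡m; m≥n⇒m/n>0)
 open ℕ.≤-Reasoning

 n≤2^n : ∀ n → n ≤ 2 ^ n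
 n≤2^n zero = z≤n
 n≤2^n (suc n) = ℕ.≤-trans (ℕ.+-mono-≤ (ℕ.m^n>0 2 n) (n≤2^n n)) (ℕ.≤-reflexive (cong (2 ^ n +_) (sym (ℕ.+-identityʳ (2 ^ n)))))

 square≤2^ : ∀ j → (4 + j) * (4 + j) ≤ 2 ^ (4 + j)
 square≤2^ zero = ℕ.≤-refl
 square≤2^ (suc j) = begin
  (5 + j) * (5 + j) ≤⟨ ℕ.m≤m+n _ (j * j + 6 * j + 7) ⟩
  (5 + j) * (5 + j) + (j * j + 6 * j + 7) ≡⟨ ring j ⟩
  2 * ((4 + j) * (4 + j)) ≤⟨ ℕ.*-monoʳ-≤ 2 (square≤2^ j) ⟩
  2 ^ (5 + j) ∎
  where
  ring : ∀ j → (5 + j) * (5 + j) + (j * j + 6 * j + 7) ≡ 2 * ((4 + j) * (4 + j))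
  ring = ℕ-solve-∀

 halves : ∀ Λ → Λ ≤ 2 * (Λ / 2) + 1
 halves Λ = begin
  Λ ≡⟨ m≡m%n+[m/n]*n Λ 2 ⟩
  _ ≤⟨ ℕ.+-monoˡ-≤ (Λ / 2 * 2) (ℕ.s≤s⁻¹ (m%n<n Λ 2)) ⟩
  1 + Λ / 2 * 2 ≡⟨ trans (ℕ.+-comm 1 (Λ / 2 * 2)) (cong (_+ 1) (ℕ.*-comm (Λ / 2) 2)) ⟩
  2 * (Λ / 2) + 1 ∎

 -- Uses `y² ≤ 2 ^ y` at `y = Λ/2`; `y ≥ 3c + 4` makes one factor `y` cover the constant and also
 -- puts `y` in the range of that inequality.
 linear≤exponential : ∀ c Λ → 2 * (3 * c + 4) ≤ Λ → c * Λ ≤ 2 ^ (Λ / 2)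
 linear≤exponential c Λ big = begin
   c * Λ ≤⟨ ℕ.*-monoʳ-≤ c (halves Λ) ⟩
   c * (2 * y + 1) ≤⟨ ℕ.*-monoʳ-≤ c (ℕ.+-monoʳ-≤ (2 * y) 1≤y) ⟩
   c * (2 * y + y) ≡⟨ ring c y ⟩
   3 * c * y ≤⟨ ℕ.*-monoˡ-≤ y (ℕ.≤-trans (ℕ.m≤m+n (3 * c) 4) y≥) ⟩
   y * y ≡⟨ cong (λ e → e * e) (sym split) ⟩
   (4 + j) * (4 + j) ≤⟨ square≤2^ j ⟩
   2 ^ (4 + j) ≡⟨ cong (2 ^_) split ⟩
   2 ^ y ∎
  where
  y = Λ / 2
  y≥ : 3 * c + 4 ≤ y
  y≥ = subst (_≤ y) (trans (cong (_/ 2) (ℕ.*-comm 2 (3 * c + 4))) (m*n/n≡m (3 * c + 4) 2)) (/-monoˡ-≤ 2 big)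
  4≤y : 4 ≤ y
  4≤y = ℕ.≤-trans (ℕ.m≤n+m 4 (3 * c)) y≥
  1≤y : 1 ≤ y
  1≤y = ℕ.≤-trans (s≤s z≤n) 4≤y
  j = y ∸ 4
  split : 4 + j ≡ y
  split = ℕ.m+[n∸m]≡n 4≤y
  ring : ∀ c y → c * (2 * y + y) ≡ 3 * c * y
  ring = ℕ-solve-∀

 half-product : ∀ Λ → 2 ^ (Λ / 2) * 2 ^ (Λ / 2) ≤ 2 ^ Λ
 half-product Λ = ℕ.≤-trans (ℕ.≤-reflexive (sym (ℕ.^-distribˡ-+-* 2 (Λ / 2) (Λ / 2)))) (ℕ.^-monoʳ-≤ 2 (ℕ.≤-trans (ℕ.≤-reflexive (two (Λ / 2))) (m/n*n≤m Λ 2)))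
  where
  two : ∀ x → x + x ≡ x * 2
  two = ℕ-solve-∀

 sq-cancel-ℕ : ∀ {a b} → a * a ≤ b * b → a ≤ b
 sq-cancel-ℕ {a} {b} h with a ℕ.≤? b
 ... | yes le = le
 ... | no gt = contradiction h (ℕ.<⇒≱ (ℕ.*-mono-< (ℕ.≰⇒> gt) (ℕ.≰⇒> gt)))

 square-root : ∀ X → 1 ≤ X → ∃[ R ] (X ≤ R * R × R * R ≤ 4 * X × 1 ≤ R)
 square-root X 1≤X with lastTrue {P = λ R → R * R < X} (λ R → R * R ℕ.<? X) 1≤X X (λ lt → ℕ.<-irrefl refl (ℕ.≤-<-trans (ℕ.m≤m*n X X {{ℕ.>-nonZero 1≤X}}) lt))
 ... | zero , lt , ge = 1 , ℕ.≮⇒≥ ge , ℕ.≤-trans 1≤X (ℕ.m≤n*m X 4) , ℕ.≤-refl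
 ... | suc r , lt , ge = suc (suc r) , ℕ.≮⇒≥ ge , (begin
   suc (suc r) * suc (suc r) ≤⟨ ℕ.m≤m+n _ (3 * (r * r) + 4 * r) ⟩
   suc (suc r) * suc (suc r) + (3 * (r * r) + 4 * r) ≡⟨ ring r ⟩
   4 * (suc r * suc r) ≤⟨ ℕ.*-monoʳ-≤ 4 (ℕ.<⇒≤ lt) ⟩
   4 * X ∎) , s≤s z≤n
  where
  ring : ∀ r → suc (suc r) * suc (suc r) + (3 * (r * r) + 4 * r) ≡ 4 * (suc r * suc r)
  ring = ℕ-solve-∀

 module Constants (d : ℕ) where
  -- `h` only has to satisfy `64d ≤ 2 ^ h`. With `M = 12(d + 1)v`, `κ` is chosen so that
  -- `8hM = κv ≤ Λ`: the square of the price `2 ^ (2hM)` of the union bound is then at most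
  -- `2 ^ (Λ/2)`.
  h A κ : ℕ
  h = 64 * d
  A = 24 * (h * suc d)
  κ = 4 * A
  c₁ c₂ threshold : ℕ
  c₁ = 64 * (d * (suc d * (suc d * suc d))) * (64 * (d * (suc d * (suc d * suc d)))) * (4 * (16 * (d * d * 4 * (d * d)))) * 2
  c₂ = 14 * (d * d)
  threshold = 2 * (3 * c₁ + 4) + (2 * (3 * c₂ + 4) + κ * (d + 6))

 module Choice (d : ℕ) (3≤d : 3 ≤ d) (Λ n : ℕ) (2^Λ≤n : 2 ^ Λ ≤ n) (big : Constants.threshold d ≤ Λ) where

  open Constants d

  private
   instance
    d≢0 : ℕ.NonZero d
    d≢0 = ℕ.>-nonZero (ℕ.≤-trans (s≤s z≤n) 3≤d)
    κ≢0 : ℕ.NonZero κ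
    κ≢0 = ℕ.m*n≢0 4 A {{_}} {{ℕ.m*n≢0 24 (h * suc d) {{_}} {{ℕ.m*n≢0 h (suc d) {{ℕ.m*n≢0 64 d}} }} }}

  1≤d : 1 ≤ d
  1≤d = ℕ.≤-trans (s≤s z≤n) 3≤d

  1≤n : 1 ≤ n
  1≤n = ℕ.≤-trans (ℕ.m^n>0 2 Λ) 2^Λ≤n

  -- The 6 in `M′` makes the loss `3/M′` equal to `1/(2v)`, and `M` exceeds `M′` as `deficit`
  -- demands. `k` is `d²` times `4(Λ + 1)` because `θ ^ (d²) ≤ ½`, so `θ ^ k ≤ ½ ^ (4(Λ + 1))`. `X`
  -- is four times the left-hand side of `enough`.
  v M′ M k X : ℕ
  v = Λ / κ
  M′ = 6 * v
  M = 2 * (suc d * M′)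
  k = d * d * (4 * suc Λ)
  X = 16 * (k * (d * (d * n)))

  d+6≤v : d + 6 ≤ v
  d+6≤v = subst (_≤ v) (trans (cong (_/ κ) (ℕ.*-comm κ (d + 6))) (m*n/n≡m (d + 6) κ)) (/-monoˡ-≤ κ (ℕ.≤-trans (ℕ.≤-trans (ℕ.m≤n+m (κ * (d + 6)) (2 * (3 * c₂ + 4))) (ℕ.m≤n+m _ (2 * (3 * c₁ + 4)))) big))

  1≤v : 1 ≤ v
  1≤v = ℕ.≤-trans (ℕ.≤-trans 1≤d (ℕ.m≤m+n d 6)) d+6≤v

  36≤M′ : 36 ≤ M′
  36≤M′ = ℕ.*-monoʳ-≤ 6 (ℕ.≤-trans (ℕ.m≤n+m 6 d) d+6≤v)

  1≤M′ : 1 ≤ M′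
  1≤M′ = ℕ.≤-trans (s≤s z≤n) 36≤M′

  d≤M′ : d ≤ M′
  d≤M′ = ℕ.≤-trans (ℕ.≤-trans (ℕ.m≤m+n d 6) d+6≤v) (ℕ.m≤n*m v 6)

  M≥dd : d * suc d ≤ M
  M≥dd = ℕ.≤-trans (ℕ.≤-reflexive (ℕ.*-comm d (suc d))) (ℕ.≤-trans (ℕ.*-monoʳ-≤ (suc d) d≤M′) (ℕ.m≤n*m (suc d * M′) 2))

  M≥2d : 2 * d ≤ M
  M≥2d = ℕ.*-monoʳ-≤ 2 (ℕ.≤-trans d≤M′ (ℕ.m≤n*m M′ (suc d)))

  M≥16 : 16 ≤ M
  M≥16 = ℕ.≤-trans (ℕ.≤-trans (ℕ.m≤n+m 16 20) 36≤M′) (ℕ.≤-trans (ℕ.m≤n*m M′ (suc d)) (ℕ.m≤n*m (suc d * M′) 2))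

  instance
   M≢0 : ℕ.NonZero M
   M≢0 = ℕ.>-nonZero (ℕ.≤-trans (s≤s z≤n) M≥16)

  hd : 64 * d ≤ 2 ^ h
  hd = n≤2^n (64 * d)

  κv≤Λ : κ * v ≤ Λ
  κv≤Λ = ℕ.≤-trans (ℕ.≤-reflexive (ℕ.*-comm κ v)) (m/n*n≤m Λ κ)

  Λ≤2κv : Λ ≤ 2 * (κ * v)
  Λ≤2κv = begin
   Λ ≡⟨ m≡m%n+[m/n]*n Λ κ ⟩
   _ ≤⟨ ℕ.+-monoˡ-≤ (v * κ) (ℕ.<⇒≤ (m%n<n Λ κ)) ⟩
   κ + v * κ ≤⟨ ℕ.+-monoˡ-≤ (v * κ) (ℕ.m≤n*m κ v {{ℕ.>-nonZero 1≤v}}) ⟩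
   v * κ + v * κ ≡⟨ ring v κ ⟩
   2 * (κ * v) ∎
   where
   ring : ∀ v κ → v * κ + v * κ ≡ 2 * (κ * v)
   ring = ℕ-solve-∀

  1≤Λ : 1 ≤ Λ
  1≤Λ = ℕ.≤-trans (ℕ.≤-trans (s≤s z≤n) (ℕ.m≤n+m 8 (2 * (3 * c₁)))) (ℕ.≤-trans (ℕ.≤-reflexive (sym (ℕ.*-distribˡ-+ 2 (3 * c₁) 4))) (ℕ.≤-trans (ℕ.m≤m+n _ _) big))

  1≤k : 1 ≤ k
  1≤k = ℕ.*-mono-≤ (ℕ.*-mono-≤ 1≤d 1≤d) (s≤s z≤n)

  1≤X : 1 ≤ X
  1≤X = ℕ.*-mono-≤ {1} {16} (s≤s z≤n) (ℕ.*-mono-≤ 1≤k (ℕ.*-mono-≤ 1≤d (ℕ.*-mono-≤ 1≤d 1≤n)))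

  root = square-root X 1≤X

  -- `mᴵ` is larger than `mᴮ` by the factor that `out≥` needs when `B` has jumped to `suc d * mᴮ`,
  -- and `m₁` leaves room for `I` together with its multiply called neighbours.
  R mᴮ mᴵ m₁ R₀ : ℕ
  R = proj₁ root
  mᴮ = 2 * R
  mᴵ = 8 * (suc d * (suc d * mᴮ))
  m₁ = suc d * mᴵ
  R₀ = 8 * (suc d * (suc d * R))

  X≤RR : X ≤ R * R
  X≤RR = proj₁ (proj₂ root)

  RR≤4X : R * R ≤ 4 * X
  RR≤4X = proj₁ (proj₂ (proj₂ root))

  1≤R : 1 ≤ R
  1≤R = proj₂ (proj₂ (proj₂ root))

  1≤mᴮ : 1 ≤ mᴮ
  1≤mᴮ = ℕ.*-mono-≤ {1} {2} (s≤s z≤n) 1≤R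

  2R₀≤ : 2 * R₀ ≤ mᴵ
  2R₀≤ = ℕ.≤-reflexive (ring d R)
   where
   ring : ∀ d R → 2 * (8 * (suc d * (suc d * R))) ≡ 8 * (suc d * (suc d * (2 * R)))
   ring = ℕ-solve-∀

  private
   sucΛ≤ : suc Λ ≤ 2 * Λ
   sucΛ≤ = ℕ.≤-trans (ℕ.+-monoˡ-≤ Λ 1≤Λ) (ℕ.≤-reflexive (cong (Λ +_) (sym (ℕ.+-identityʳ Λ))))
   2^½≤n : 2 ^ (Λ / 2) ≤ n
   2^½≤n = ℕ.≤-trans (ℕ.≤-trans (ℕ.m≤m*n _ (2 ^ (Λ / 2)) {{ℕ.>-nonZero (ℕ.m^n>0 2 (Λ / 2))}}) (half-product Λ)) 2^Λ≤n

  -- Compared by squares, since `m₁` is a multiple of a square root: its square is of order `nΛ`.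
  -- One factor `n` is kept; of the other, at least `2 ^ Λ`, half the exponent pays for the multiple
  -- of `Λ` and half for the square of `2 ^ (2hM)`.
  very-small : 4 * d * m₁ * 2 ^ (2 * (h * M)) ≤ n
  very-small = sq-cancel-ℕ (begin
    4 * d * m₁ * P * (4 * d * m₁ * P) ≡⟨ ring₁ d R P ⟩
    D * D * (R * R) * (P * P) ≤⟨ ℕ.*-monoˡ-≤ (P * P) (ℕ.*-monoʳ-≤ (D * D) RR≤4X) ⟩
    D * D * (4 * X) * (P * P) ≡⟨ ring₂ (D * D) d (suc Λ) n (P * P) ⟩
    D * D * (4 * (16 * (d * d * 4 * (d * d)))) * suc Λ * (P * P) * n ≤⟨ ℕ.*-monoˡ-≤ n (ℕ.*-mono-≤ lin PP) ⟩
    2 ^ (Λ / 2) * 2 ^ (Λ / 2) * n ≤⟨ ℕ.*-monoˡ-≤ n (ℕ.≤-trans (half-product Λ) 2^Λ≤n) ⟩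
    n * n ∎)
   where
   P = 2 ^ (2 * (h * M))
   D = 64 * (d * (suc d * (suc d * suc d)))
   ring₁ : ∀ d R P → 4 * d * (suc d * (8 * (suc d * (suc d * (2 * R))))) * P * (4 * d * (suc d * (8 * (suc d * (suc d * (2 * R))))) * P)
    ≡ 64 * (d * (suc d * (suc d * suc d))) * (64 * (d * (suc d * (suc d * suc d)))) * (R * R) * (P * P)
   ring₁ = ℕ-solve-∀
   ring₂ : ∀ e d l n p → e * (4 * (16 * (d * d * (4 * l) * (d * (d * n))))) * p ≡ e * (4 * (16 * (d * d * 4 * (d * d)))) * l * p * n
   ring₂ = ℕ-solve-∀
   lin : D * D * (4 * (16 * (d * d * 4 * (d * d)))) * suc Λ ≤ 2 ^ (Λ / 2)
   lin = ℕ.≤-trans (ℕ.*-monoʳ-≤ (D * D * (4 * (16 * (d * d * 4 * (d * d))))) sucΛ≤) (ℕ.≤-trans (ℕ.≤-reflexive (sym (ℕ.*-assoc (D * D * (4 * (16 * (d * d * 4 * (d * d))))) 2 Λ)))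
    (linear≤exponential c₁ Λ (ℕ.≤-trans (ℕ.m≤m+n (2 * (3 * c₁ + 4)) _) big)))
   PP : P * P ≤ 2 ^ (Λ / 2)
   PP = ℕ.≤-trans (ℕ.≤-reflexive (sym (ℕ.^-distribˡ-+-* 2 (2 * (h * M)) (2 * (h * M))))) (ℕ.^-monoʳ-≤ 2 (subst (_≤ Λ / 2) (m*n/n≡m (2 * (h * M) + 2 * (h * M)) 2) (/-monoˡ-≤ 2 (ℕ.≤-trans (ℕ.≤-reflexive (ring₃ h d v)) κv≤Λ))))
    where
    ring₃ : ∀ h d v → (2 * (h * (2 * (suc d * (6 * v)))) + 2 * (h * (2 * (suc d * (6 * v))))) * 2 ≡ 4 * (24 * (h * suc d)) * v
    ring₃ = ℕ-solve-∀

  1≤m₁ : 1 ≤ m₁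
  1≤m₁ = ℕ.*-mono-≤ {1} {suc d} (s≤s z≤n) (ℕ.*-mono-≤ {1} {8} (s≤s z≤n) (ℕ.*-mono-≤ {1} {suc d} (s≤s z≤n) (ℕ.*-mono-≤ {1} {suc d} (s≤s z≤n) 1≤mᴮ)))

  small : 4 * m₁ + 4 * d ≤ n
  small = ℕ.≤-trans (begin
    4 * m₁ + 4 * d ≤⟨ ℕ.+-mono-≤ (ℕ.≤-trans (ℕ.*-monoʳ-≤ 4 (ℕ.m≤n*m m₁ d)) (ℕ.≤-reflexive (sym (ℕ.*-assoc 4 d m₁)))) (ℕ.m≤m*n (4 * d) m₁ {{ℕ.>-nonZero 1≤m₁}}) ⟩
    4 * d * m₁ + 4 * d * m₁ ≡⟨ two (4 * d * m₁) ⟩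
    4 * d * m₁ * 2 ≤⟨ ℕ.*-monoʳ-≤ (4 * d * m₁) 2≤P ⟩
    4 * d * m₁ * 2 ^ (2 * (h * M)) ∎) very-small
   where
   two : ∀ x → x + x ≡ x * 2
   two = ℕ-solve-∀
   2≤P : 2 ≤ 2 ^ (2 * (h * M))
   2≤P = ℕ.≤-trans (ℕ.≤-trans (ℕ.*-mono-≤ {2} {2} ℕ.≤-refl (ℕ.*-mono-≤ (ℕ.*-mono-≤ {1} {64} (s≤s z≤n) 1≤d) (ℕ.≤-trans (s≤s z≤n) M≥16))) ℕ.≤-refl) (n≤2^n (2 * (h * M)))

  Y : ℕ
  Y = d * (k + k) + (d + d * d)

  2Y≤R : 2 * Y ≤ R
  2Y≤R = sq-cancel-ℕ (ℕ.≤-trans (begin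
    2 * Y * (2 * Y) ≤⟨ ℕ.*-mono-≤ (ℕ.*-monoʳ-≤ 2 Y≤) (ℕ.*-monoʳ-≤ 2 Y≤) ⟩
    2 * (d * d * d * 10 * suc Λ) * (2 * (d * d * d * 10 * suc Λ)) ≡⟨ ring₁ d (suc Λ) ⟩
    d * d * d * d * 64 * suc Λ * (d * d * suc Λ) * 6 + d * d * d * d * 16 * suc Λ * (d * d * suc Λ) ≤⟨ ℕ.+-monoʳ-≤ (d * d * d * d * 64 * suc Λ * (d * d * suc Λ) * 6) (ℕ.*-monoˡ-≤ (d * d * suc Λ) (ℕ.*-monoˡ-≤ (suc Λ) (ℕ.*-monoʳ-≤ (d * d * d * d) (ℕ.m≤m+n 16 48)))) ⟩
    d * d * d * d * 64 * suc Λ * (d * d * suc Λ) * 6 + d * d * d * d * 64 * suc Λ * (d * d * suc Λ) ≡⟨ ring₂ (d * d * d * d * 64 * suc Λ) (d * d) (suc Λ) ⟩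
    d * d * d * d * 64 * suc Λ * (7 * (d * d) * suc Λ) ≤⟨ ℕ.*-monoʳ-≤ (d * d * d * d * 64 * suc Λ) lin ⟩
    d * d * d * d * 64 * suc Λ * n ≡⟨ ring₃ d (suc Λ) n ⟩
    X ∎) X≤RR)
   where
   ring₁ : ∀ d l → 2 * (d * d * d * 10 * l) * (2 * (d * d * d * 10 * l)) ≡ d * d * d * d * 64 * l * (d * d * l) * 6 + d * d * d * d * 16 * l * (d * d * l)
   ring₁ = ℕ-solve-∀
   ring₂ : ∀ a b l → a * (b * l) * 6 + a * (b * l) ≡ a * (7 * b * l)
   ring₂ = ℕ-solve-∀
   ring₃ : ∀ d l n → d * d * d * d * 64 * l * n ≡ 16 * (d * d * (4 * l) * (d * (d * n)))
   ring₃ = ℕ-solve-∀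
   Y≤ : Y ≤ d * d * d * 10 * suc Λ
   Y≤ = begin
    d * (k + k) + (d + d * d) ≤⟨ ℕ.+-monoʳ-≤ (d * (k + k)) (ℕ.+-mono-≤ one two) ⟩
    d * (k + k) + (d * d * d * suc Λ + d * d * d * suc Λ) ≡⟨ ring d (suc Λ) ⟩
    d * d * d * 10 * suc Λ ∎
    where
    ring : ∀ d l → d * (d * d * (4 * l) + d * d * (4 * l)) + (d * d * d * l + d * d * d * l) ≡ d * d * d * 10 * l
    ring = ℕ-solve-∀
    two : d * d ≤ d * d * d * suc Λ
    two = ℕ.≤-trans (ℕ.m≤m*n (d * d) d) (ℕ.m≤m*n (d * d * d) (suc Λ))
    one : d ≤ d * d * d * suc Λ
    one = ℕ.≤-trans (ℕ.m≤m*n d d) two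
   lin : 7 * (d * d) * suc Λ ≤ n
   lin = ℕ.≤-trans (ℕ.*-monoʳ-≤ (7 * (d * d)) sucΛ≤) (ℕ.≤-trans (ℕ.≤-reflexive (ring (d * d) Λ)) (ℕ.≤-trans
    (linear≤exponential c₂ Λ (ℕ.≤-trans (ℕ.≤-trans (ℕ.m≤m+n (2 * (3 * c₂ + 4)) (κ * (d + 6))) (ℕ.m≤n+m _ (2 * (3 * c₁ + 4)))) big)) 2^½≤n))
    where
    ring : ∀ e l → 7 * e * (2 * l) ≡ 14 * e * l
    ring = ℕ-solve-∀

  -- Because `2Y ≤ R`, each of the two subtractions costs at most a factor 2, and together they use
  -- up the factor 4 reserved in `X`.
  enough : 2 * ((k + k) * (d * (d * n))) ≤ (R₀ ∸ (k + k)) * (R ∸ Y)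
  enough = ℕ.*-cancelˡ-≤ 4 (begin
    4 * (2 * ((k + k) * (d * (d * n)))) ≡⟨ ring k (d * (d * n)) ⟩
    X ≤⟨ X≤RR ⟩
    R * R ≤⟨ ℕ.*-mono-≤ (half (k + k) kk≤Y) (half Y ℕ.≤-refl) ⟩
    2 * (R ∸ (k + k)) * (2 * (R ∸ Y)) ≤⟨ ℕ.*-monoˡ-≤ (2 * (R ∸ Y)) (ℕ.*-monoʳ-≤ 2 (ℕ.∸-monoˡ-≤ (k + k) R≤R₀)) ⟩
    2 * (R₀ ∸ (k + k)) * (2 * (R ∸ Y)) ≡⟨ ring′ (R₀ ∸ (k + k)) (R ∸ Y) ⟩
    4 * ((R₀ ∸ (k + k)) * (R ∸ Y)) ∎)
   where
   ring : ∀ k e → 4 * (2 * ((k + k) * e)) ≡ 16 * (k * e)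
   ring = ℕ-solve-∀
   ring′ : ∀ a b → 2 * a * (2 * b) ≡ 4 * (a * b)
   ring′ = ℕ-solve-∀
   kk≤Y : k + k ≤ Y
   kk≤Y = ℕ.≤-trans (ℕ.m≤n*m (k + k) d) (ℕ.m≤m+n (d * (k + k)) _)
   R≤R₀ : R ≤ R₀
   R≤R₀ = ℕ.≤-trans (ℕ.m≤n*m R (suc d)) (ℕ.≤-trans (ℕ.m≤n*m (suc d * R) (suc d)) (ℕ.m≤n*m (suc d * (suc d * R)) 8))
   half : ∀ j → j ≤ Y → R ≤ 2 * (R ∸ j)
   half j j≤Y = begin
    R ≡⟨ sym (ℕ.m+n∸n≡m R (2 * j)) ⟩
    R + 2 * j ∸ 2 * j ≤⟨ ℕ.∸-monoˡ-≤ (2 * j) (ℕ.+-monoʳ-≤ R (ℕ.≤-trans (ℕ.*-monoʳ-≤ 2 j≤Y) 2Y≤R)) ⟩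
    R + R ∸ 2 * j ≡⟨ cong (_∸ 2 * j) (cong (R +_) (sym (ℕ.+-identityʳ R))) ⟩
    2 * R ∸ 2 * j ≡⟨ sym (ℕ.*-distribˡ-∸ 2 R j) ⟩
    2 * (R ∸ j) ∎

  mᴵ*mᴮ≤ : mᴵ * mᴮ ≤ 2048 * (suc d * suc d) * (d * d * (4 * (d * d))) * (n * suc Λ)
  mᴵ*mᴮ≤ = begin
   mᴵ * mᴮ ≡⟨ ring d R ⟩
   32 * (suc d * suc d) * (R * R) ≤⟨ ℕ.*-monoʳ-≤ (32 * (suc d * suc d)) RR≤4X ⟩
   32 * (suc d * suc d) * (4 * X) ≡⟨ ring′ d (suc Λ) n ⟩
   2048 * (suc d * suc d) * (d * d * (4 * (d * d))) * (n * suc Λ) ∎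
   where
   ring : ∀ d R → 8 * (suc d * (suc d * (2 * R))) * (2 * R) ≡ 32 * (suc d * suc d) * (R * R)
   ring = ℕ-solve-∀
   ring′ : ∀ d l n → 32 * (suc d * suc d) * (4 * (16 * (d * d * (4 * l) * (d * (d * n))))) ≡ 2048 * (suc d * suc d) * (d * d * (4 * (d * d))) * (n * l)
   ring′ = ℕ-solve-∀

  mᴵ≤n : 2 * mᴵ ≤ n
  mᴵ≤n = ℕ.≤-trans (ℕ.≤-trans (ℕ.*-monoˡ-≤ mᴵ (ℕ.m≤m+n 2 2)) (ℕ.≤-trans (ℕ.*-monoʳ-≤ 4 (ℕ.m≤n*m mᴵ (suc d))) (ℕ.m≤m+n (4 * m₁) (4 * d)))) small

  mᴮ≤n : 2 * mᴮ ≤ n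
  mᴮ≤n = ℕ.≤-trans (ℕ.*-monoʳ-≤ 2 (ℕ.≤-trans (ℕ.m≤n*m mᴮ (suc d)) (ℕ.≤-trans (ℕ.m≤n*m (suc d * mᴮ) (suc d)) (ℕ.m≤n*m (suc d * (suc d * mᴮ)) 8)))) mᴵ≤n

-- Numerical estimates for the rates.

module Estimates where

 open RealBound using (r̂; q̂; x̂)

 open Rationals

 0≤2 : 0ℚ ≤ 1ℚ + 1ℚ
 0≤2 = nonNegative⁻¹ 2ℚ

 ι-2 : ι 2 ≡ 1ℚ + 1ℚ
 ι-2 = trans (ι-suc 1) (cong (1ℚ +_) ι-1)

 double≡ : ∀ m → ι (2 ℕ.* m) ≡ 2ℚ * ι m
 double≡ m = trans (ι-* 2 m) (cong (_* ι m) ι-2)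

 -- (1 - x)ⁿ(1 + x)ⁿ ≤ 1
 half-power : ∀ x n → 0ℚ ≤ x → x ≤ 1ℚ → 1ℚ ≤ ι n * x → (1ℚ - x) ^ n ≤ ½
 half-power x n 0≤x x≤1 h = *-cancelʳ 2ℚ (positive⁻¹ 2ℚ) (≤-trans
  (*-monoˡ ((1ℚ - x) ^ n) (^-nonNeg (p≤q⇒0≤q-p x≤1) n) (≤-trans (+-monoʳ-≤ 1ℚ h) (bernoulli⁺ x 0≤x n)))
  (subst (_≤ 1ℚ) (*-^ (1ℚ - x) (1ℚ + x) n) (^≤1 (*-nonNeg (p≤q⇒0≤q-p x≤1) (+-nonNeg 0≤1 0≤x))
   (≤-by (x * x) (sq-nonNeg x) (solve 1 (λ x → (con 1ℚ :- x) :* (con 1ℚ :+ x) :+ x :* x := con 1ℚ) refl x)) n)))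

 ^-cancel-≤ : ∀ {x a b} → 1ℚ < x → x ^ a ≤ x ^ b → a ℕ.≤ b
 ^-cancel-≤ {x} {a} {b} 1<x h = ℕ.≮⇒≥ λ b<a → <⇒≱
  (subst (_< x * x ^ b) (*-identityˡ (x ^ b)) (ℚ.*-monoˡ-<-pos (x ^ b) {{ℚ.positive (0<^ (ℚ.<-trans 0<1 1<x) b)}} 1<x))
  (≤-trans (^-mono-exp (<⇒≤ 1<x) b<a) h)

 exponent-< : ∀ {x} c k m → 1ℚ ≤ x → 1ℚ + 1ℚ ≤ x ^ c → x ^ k ≤ ι (2 ℕ.^ m) → k ℕ.< c ℕ.* suc m
 exponent-< {x} c k m 1≤x h le = ℕ.≰⇒> λ cm≤k → ℕ.<⇒≱ (ℕ.^-monoʳ-< 2 ℕ.≤-refl (ℕ.n<1+n m)) (ι-cancel-≤ (begin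
  ι (2 ℕ.^ suc m) ≡⟨ trans (ι-^ 2 (suc m)) (cong (_^ suc m) ι-2) ⟩
  2ℚ ^ suc m ≤⟨ ^-mono 0≤2 h (suc m) ⟩
  (x ^ c) ^ suc m ≡⟨ sym (^-* x c (suc m)) ⟩
  x ^ (c ℕ.* suc m) ≤⟨ ^-mono-exp 1≤x cm≤k ⟩
  x ^ k ≤⟨ le ⟩
  ι (2 ℕ.^ m) ∎))
  where open ≤-Reasoning

 recip-ratio : ∀ {y} W l → 1 ℕ.≤ W → 1 ℕ.≤ l → ι (W ℕ.* l) ≤ y → recip (1ℚ + y * recip (ι W)) ≤ recip (ι l)
 recip-ratio {y} W l 1≤W 1≤l h = recip-anti (0<ι 1≤l) (≤-trans
  (≤*recip (0<ι 1≤W) (≤-trans (≤-reflexive (trans (*-comm (ι l) (ι W)) (sym (ι-* W l)))) h))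
  (subst (y * recip (ι W) ≤_) (+-comm (y * recip (ι W)) 1ℚ) (p≤p+q 0≤1)))

 ½^*2^ : ∀ k → ½ ^ k * ι (2 ℕ.^ k) ≡ 1ℚ
 ½^*2^ k = trans (cong (½ ^ k *_) (trans (ι-^ 2 k) (cong (_^ k) ι-2))) (trans (sym (*-^ ½ 2ℚ k)) (1^ k))

 ≤recip : ∀ {p r} → 0ℚ < r → p * r ≤ 1ℚ → p ≤ recip r
 ≤recip {p} {r} 0<r h = subst (p ≤_) (*-identityˡ (recip r)) (≤*recip 0<r h)

 1/≡recip : ∀ d .{{_ : ℕ.NonZero d}} → ℤ.+ 1 ℚ./ d ≡ recip (ι d)
 1/≡recip (suc k) = 1/suc≡recip k

 module Rates (d : ℕ) (3≤d : 3 ℕ.≤ d) where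

  open Rate d 3≤d 1 ℕ.≤-refl using (1≤d; r)
  open Expectation d 1≤d using (δ; 0≤δ; δ≤1; δ*d)
  open OneRound d 1≤d using (pgf; 0≤pgf; pgf≤1)
  open Defs.Ratio d 3≤d using (2/3≤1-1/d; 0<1-1/d; d≢0)

  q x D θ : ℚ
  q = pgf 0ℚ
  x = recip q
  D = x ^ d
  θ = pgf (pgf 0ℚ)

  q≡1-δ : q ≡ 1ℚ - δ
  q≡1-δ = solve 1 (λ e → con 1ℚ :- (con 1ℚ :- con 0ℚ) :* e := con 1ℚ :- e) refl δ

  θ≡1-δ² : θ ≡ 1ℚ - δ * δ
  θ≡1-δ² = solve 1 (λ e → con 1ℚ :- (con 1ℚ :- (con 1ℚ :- (con 1ℚ :- con 0ℚ) :* e)) :* e := con 1ℚ :- e :* e) refl δ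

  q̂≡q : q̂ d 3≤d ≡ q
  q̂≡q = trans (cong (λ t → 1ℚ - t) (1/≡recip d)) (sym q≡1-δ)

  x̂≡x : x̂ d 3≤d ≡ x
  x̂≡x = cong recip q̂≡q

  r≡2q : r ≡ 2ℚ * q
  r≡2q = begin
   1ℚ + ι (d ℕ.∸ 2) * δ ≡⟨ cong (λ t → 1ℚ + t * δ) ι-∸ ⟩
   1ℚ + (ι d - 2ℚ) * δ ≡⟨ solve 2 (λ n e → con 1ℚ :+ (n :- con 2ℚ) :* e := con 1ℚ :+ e :* n :- con 2ℚ :* e) refl (ι d) δ ⟩
   1ℚ + δ * ι d - 2ℚ * δ ≡⟨ cong (λ t → 1ℚ + t - 2ℚ * δ) δ*d ⟩
   1ℚ + 1ℚ - 2ℚ * δ ≡⟨ solve 1 (λ e → con 1ℚ :+ con 1ℚ :- con 2ℚ :* e := con 2ℚ :* (con 1ℚ :- e)) refl δ ⟩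
   2ℚ * (1ℚ - δ) ≡⟨ cong (2ℚ *_) (sym q≡1-δ) ⟩
   2ℚ * q ∎
   where
   open ≡-Reasoning
   ι-∸ : ι (d ℕ.∸ 2) ≡ ι d - 2ℚ
   ι-∸ = trans (solve 2 (λ a b → a := a :+ b :- b) refl (ι (d ℕ.∸ 2)) 2ℚ)
    (cong (_- 2ℚ) (trans (cong (ι (d ℕ.∸ 2) +_) (sym ι-2)) (trans (sym (ι-+ (d ℕ.∸ 2) 2)) (cong ι (ℕ.m∸n+n≡m (ℕ.≤-trans (ℕ.n≤1+n 2) 3≤d))))))

  r̂≡r : r̂ d 3≤d ≡ r
  r̂≡r = trans (cong ((ℤ.+ 2 ℚ./ 1) *_) q̂≡q) (sym r≡2q)

  ⅔≤q : ℤ.+ 2 ℚ./ 3 ≤ q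
  ⅔≤q = subst (ℤ.+ 2 ℚ./ 3 ≤_) q̂≡q 2/3≤1-1/d

  0<q : 0ℚ < q
  0<q = subst (0ℚ <_) q̂≡q 0<1-1/d

  0≤q : 0ℚ ≤ q
  0≤q = <⇒≤ 0<q

  q≤1 : q ≤ 1ℚ
  q≤1 = pgf≤1 ≤-refl 0≤1

  δ≤q : δ ≤ q
  δ≤q = ≤-trans (≤-trans (≤-reflexive (trans (solve 1 (λ e → e := con 1ℚ :- (con 1ℚ :- e)) refl δ) (cong (λ t → 1ℚ - t) (sym q≡1-δ))))
   (+-monoʳ-≤ 1ℚ (neg-antimono-≤ ⅔≤q))) (≤-trans (≤-by {ℤ.+ 1 ℚ./ 3} (ℤ.+ 1 ℚ./ 3) (nonNegative⁻¹ (ℤ.+ 1 ℚ./ 3)) refl) ⅔≤q)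

  4/3≤r : ℤ.+ 4 ℚ./ 3 ≤ r
  4/3≤r = subst (ℤ.+ 4 ℚ./ 3 ≤_) (sym r≡2q) (*-monoˡ 2ℚ 0≤2 ⅔≤q)

  1≤r : 1ℚ ≤ r
  1≤r = ≤-trans (≤-by {1ℚ} (ℤ.+ 1 ℚ./ 3) (nonNegative⁻¹ (ℤ.+ 1 ℚ./ 3)) refl) 4/3≤r

  1≤x : 1ℚ ≤ x
  1≤x = recip-anti 0<q q≤1

  q^d≤½ : q ^ d ≤ ½
  q^d≤½ = subst (λ t → t ^ d ≤ ½) (sym q≡1-δ) (half-power δ d 0≤δ δ≤1 (≤-reflexive (sym (trans (*-comm (ι d) δ) δ*d))))

  θ^dd≤½ : θ ^ (d ℕ.* d) ≤ ½
  θ^dd≤½ = subst (λ t → t ^ (d ℕ.* d) ≤ ½) (sym θ≡1-δ²) (half-power (δ * δ) (d ℕ.* d) (*-nonNeg 0≤δ 0≤δ) (≤-trans (p*q≤p 0≤δ δ≤1) δ≤1)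
   (≤-reflexive (sym (trans (cong (_* (δ * δ)) (ι-* d d)) (trans (solve 2 (λ n e → n :* n :* (e :* e) := e :* n :* (e :* n)) refl (ι d) δ) (cong₂ _*_ δ*d δ*d))))))

  D*q^d≡1 : D * q ^ d ≡ 1ℚ
  D*q^d≡1 = trans (sym (*-^ x q d)) (trans (cong (_^ d) (recip-*ˡ 0<q)) (1^ d))

  2≤D : 1ℚ + 1ℚ ≤ D
  2≤D = *-cancelʳ ½ (positive⁻¹ ½) (subst (_≤ D * ½) D*q^d≡1 (*-monoˡ D (≤-trans 0≤1 (1≤^ 1≤x d)) q^d≤½))

  1≤D : 1ℚ ≤ D
  1≤D = 1≤^ 1≤x d

  D^*q^ : ∀ s → D ^ s * (q ^ d) ^ s ≡ 1ℚ
  D^*q^ s = trans (sym (*-^ D (q ^ d) s)) (trans (cong (_^ s) D*q^d≡1) (1^ s))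

  γ≤ : ∀ l → ½ ^ (d ℕ.* d ℕ.* l) + θ ^ (d ℕ.* d ℕ.* l) ≤ 2ℚ * ½ ^ l
  γ≤ l = ≤-trans (+-mono-≤
    (^-anti-exp (nonNegative⁻¹ ½) (≤-by {½} ½ (nonNegative⁻¹ ½) refl) (ℕ.m≤n*m l (d ℕ.* d) {{ℕ.m*n≢0 d d}}))
    (≤-trans (≤-reflexive (^-* θ (d ℕ.* d) l)) (^-mono (^-nonNeg (0≤pgf 0≤q q≤1) (d ℕ.* d)) θ^dd≤½ l)))
   (≤-reflexive (solve 1 (λ h → h :+ h := con 2ℚ :* h) refl (½ ^ l)))

  -- Since `δ ≤ q`, a small `z` costs only a relative factor `1 + z`; the product of these factors
  -- stays below 2 in `backward≤`.
  pgf≤ : ∀ {z} → 0ℚ ≤ z → pgf z ≤ q * (1ℚ + z)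
  pgf≤ {z} 0≤z = ≤-by (z * (q - δ)) (*-nonNeg 0≤z (p≤q⇒0≤q-p δ≤q))
   (solve 2 (λ z e → (con 1ℚ :- (con 1ℚ :- z) :* e) :+ z :* ((con 1ℚ :- (con 1ℚ :- con 0ℚ) :* e) :- e) := (con 1ℚ :- (con 1ℚ :- con 0ℚ) :* e) :* (con 1ℚ :+ z)) refl z δ)

  -- `r ≥ 4/3` because `d ≥ 3`, and `4/3 - 3/36 = 5/4`.
  5/4≤ρ : ∀ M′ (1≤M′ : 1 ℕ.≤ M′) → 36 ℕ.≤ M′ → ℤ.+ 5 ℚ./ 4 ≤ Rate.ρ d 3≤d M′ 1≤M′
  5/4≤ρ M′ 1≤M′ 36≤M′ = +-mono-≤ 4/3≤r (neg-antimono-≤ (*-monoˡ (1ℚ + 1ℚ + 1ℚ) (nonNegative⁻¹ (1ℚ + 1ℚ + 1ℚ))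
   (≤-trans (recip-anti (0<ι {36} (ℕ.z<s)) (ι-mono 36≤M′)) (≤-reflexive (sym (1/suc≡recip 35))))))

open Estimates

-- Lengths of the phases and the resulting error terms.

module RunningTimes (d : ℕ) (3≤d : 3 ℕ.≤ d) (n Λ v κ mᴵ mᴮ c : ℕ)
 (44≤Λ : 44 ℕ.≤ Λ) (n<2^ : n ℕ.< 2 ℕ.^ suc Λ) (1≤n : 1 ℕ.≤ n) (36≤M′ : 36 ℕ.≤ 6 ℕ.* v) (1≤M′ : 1 ℕ.≤ 6 ℕ.* v) (Λ≤2κv : Λ ℕ.≤ 2 ℕ.* (κ ℕ.* v))
 (6dΛ≤ : 6 ℕ.* d ℕ.* Λ ℕ.≤ 2 ℕ.^ Λ) (6Λ≤ : 6 ℕ.* Λ ℕ.≤ 2 ℕ.^ Λ)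
 (1≤mᴵ : 1 ℕ.≤ mᴵ) (1≤mᴮ : 1 ℕ.≤ mᴮ) (mᴵ≤n : 2 ℕ.* mᴵ ℕ.≤ n) (mᴮ≤n : 2 ℕ.* mᴮ ℕ.≤ n)
 (n≤mm : n ℕ.≤ mᴵ ℕ.* mᴮ) (mm≤ : mᴵ ℕ.* mᴮ ℕ.≤ c ℕ.* (n ℕ.* suc Λ)) (c≤Λ : 2 ℕ.^ (36 ℕ.* κ) ℕ.* (48 ℕ.* d ℕ.* c) ℕ.≤ Λ) where

 open Rationals
 open Rate d 3≤d (6 ℕ.* v) 1≤M′ using (1≤d; r; ρ; 0≤s) renaming (s to σ)
 open Expectation d 1≤d using (δ; 0≤δ; δ≤1; δ*d)
 open OneRound d 1≤d using (pgf; 0≤pgf; pgf≤1)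
 open Rates d 3≤d

 1≤Λ : 1 ℕ.≤ Λ
 1≤Λ = ℕ.≤-trans (ℕ.z<s) 44≤Λ

 ℓ : ℚ
 ℓ = recip (ι Λ)

 0≤ℓ : 0ℚ ≤ ℓ
 0≤ℓ = <⇒≤ (recip-pos (0<ι 1≤Λ))

 5/4≤ : ℤ.+ 5 ℚ./ 4 ≤ ρ
 5/4≤ = 5/4≤ρ (6 ℕ.* v) 1≤M′ 36≤M′

 1≤ρ : 1ℚ ≤ ρ
 1≤ρ = ≤-trans (≤-by {1ℚ} (ℤ.+ 1 ℚ./ 4) (nonNegative⁻¹ (ℤ.+ 1 ℚ./ 4)) refl) 5/4≤

 0≤ρ : 0ℚ ≤ ρ
 0≤ρ = 1≤⇒0≤ 1≤ρ

 2≤ρ⁴ : 1ℚ + 1ℚ ≤ ρ ^ 4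
 2≤ρ⁴ = ≤-trans (≤-by {1ℚ + 1ℚ} (ℤ.+ 113 ℚ./ 256) (nonNegative⁻¹ (ℤ.+ 113 ℚ./ 256)) refl) (^-mono {ℤ.+ 5 ℚ./ 4} (nonNegative⁻¹ (ℤ.+ 5 ℚ./ 4)) 5/4≤ 4)

 module _ where
  open ℕ.≤-Reasoning

  n*≤ : ∀ w → w ℕ.≤ 2 ℕ.^ Λ → n ℕ.* w ℕ.≤ 2 ℕ.^ suc (2 ℕ.* Λ)
  n*≤ w w≤ = begin
   n ℕ.* w ≤⟨ ℕ.*-mono-≤ (ℕ.<⇒≤ n<2^) w≤ ⟩
   2 ℕ.^ suc Λ ℕ.* 2 ℕ.^ Λ ≡⟨ sym (ℕ.^-distribˡ-+-* 2 (suc Λ) Λ) ⟩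
   2 ℕ.^ (suc Λ ℕ.+ Λ) ≡⟨ cong (2 ℕ.^_) (cong (λ t → suc (Λ ℕ.+ t)) (sym (ℕ.+-identityʳ Λ))) ⟩
   2 ℕ.^ suc (2 ℕ.* Λ) ∎

  Λ≤2^ : Λ ℕ.≤ 2 ℕ.^ Λ
  Λ≤2^ = ℕ.≤-trans (ℕ.m≤n*m Λ 6) 6Λ≤

  -- After `suc k` rounds `ω`, started at `1/(2m)`, has reached `w`. The bound `9Λ` comes from
  -- `ρ ^ 4 ≥ 2` and a target of at most `2 ^ (2Λ + 1)`.
  ρ-log : ∀ m w → 1 ℕ.≤ m → 1 ℕ.≤ w → 2 ℕ.* m ℕ.≤ n → w ℕ.≤ 2 ℕ.^ Λ →
   ∃[ k ] (ρ ^ k ≤ ι ((m ℕ.+ m) ℕ.* w) × ι ((m ℕ.+ m) ℕ.* w) ≤ ρ ^ suc k × suc k ℕ.≤ 9 ℕ.* Λ)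
  ρ-log m w 1≤m 1≤w m≤n w≤ = k , lo , <⇒≤ (proj₂ (proj₂ lg)) , ℕ.≤-trans (exponent-< 4 k (suc (2 ℕ.* Λ)) 1≤ρ 2≤ρ⁴ (≤-trans lo (ι-mono Y≤)))
    (begin
     4 ℕ.* suc (suc (2 ℕ.* Λ)) ≡⟨ ring Λ ⟩
     8 ℕ.+ 8 ℕ.* Λ ≤⟨ ℕ.+-monoˡ-≤ (8 ℕ.* Λ) (ℕ.≤-trans (ℕ.m≤m+n 8 36) 44≤Λ) ⟩
     9 ℕ.* Λ ∎)
   where
   Y : ℕ
   Y = (m ℕ.+ m) ℕ.* w
   lg : ∃[ k ] (ρ ^ k ≤ ι Y × ι Y < ρ ^ suc k)
   lg = logarithm ρ 4 (ℕ.z<s) (subst (λ t → 1ℚ + t ≤ ρ) (1/suc≡recip 3) 5/4≤) (ι Y) (1≤ι (ℕ.*-mono-≤ (ℕ.≤-trans 1≤m (ℕ.m≤m+n m m)) 1≤w))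
   k : ℕ
   k = proj₁ lg
   lo : ρ ^ k ≤ ι Y
   lo = proj₁ (proj₂ lg)
   Y≤ : Y ℕ.≤ 2 ℕ.^ suc (2 ℕ.* Λ)
   Y≤ = ℕ.≤-trans (ℕ.*-monoˡ-≤ w (ℕ.≤-trans (ℕ.≤-reflexive (cong (m ℕ.+_) (sym (ℕ.+-identityʳ m)))) m≤n)) (n*≤ w w≤)
   ring : ∀ l → 4 ℕ.* suc (suc (2 ℕ.* l)) ≡ 8 ℕ.+ 8 ℕ.* l
   ring = ℕ-solve-∀

  1≤6dΛ : 1 ℕ.≤ 6 ℕ.* d ℕ.* Λ
  1≤6dΛ = ℕ.*-mono-≤ (ℕ.*-mono-≤ {1} {6} (ℕ.z<s) 1≤d) 1≤Λ

  abstract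
   logᴵ : ∃[ k ] (ρ ^ k ≤ ι ((mᴵ ℕ.+ mᴵ) ℕ.* Λ) × ι ((mᴵ ℕ.+ mᴵ) ℕ.* Λ) ≤ ρ ^ suc k × suc k ℕ.≤ 9 ℕ.* Λ)
   logᴵ = ρ-log mᴵ Λ 1≤mᴵ 1≤Λ mᴵ≤n Λ≤2^
   -- The target is `6dΛ` and not `Λ`, because up to `3dΛ` factors `1 + zᴮ` must have a product of
   -- at most 2.
   logᴮ : ∃[ k ] (ρ ^ k ≤ ι ((mᴮ ℕ.+ mᴮ) ℕ.* (6 ℕ.* d ℕ.* Λ)) × ι ((mᴮ ℕ.+ mᴮ) ℕ.* (6 ℕ.* d ℕ.* Λ)) ≤ ρ ^ suc k × suc k ℕ.≤ 9 ℕ.* Λ)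
   logᴮ = ρ-log mᴮ (6 ℕ.* d ℕ.* Λ) 1≤mᴮ 1≤6dΛ mᴮ≤n 6dΛ≤
   -- With `nΛ` in place of `n` the sum over the `n` targets is of order `1/Λ`.
   logˢ : ∃[ k ] (D ^ k ≤ ι (n ℕ.* Λ) × ι (n ℕ.* Λ) < D ^ suc k)
   logˢ = logarithm D 1 ℕ.≤-refl (subst (λ t → 1ℚ + t ≤ D) (1/suc≡recip 0) 2≤D) (ι (n ℕ.* Λ)) (1≤ι (ℕ.*-mono-≤ 1≤n 1≤Λ))

  kᴵ kᴮ : ℕ
  kᴵ = proj₁ logᴵ
  kᴮ = proj₁ logᴮ

  s′ : ℕ
  s′ = proj₁ logˢ

  s≤3Λ : suc s′ ℕ.≤ 3 ℕ.* Λ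
  s≤3Λ = ℕ.≤-trans (exponent-< 1 s′ (suc (2 ℕ.* Λ)) 1≤D (subst (1ℚ + 1ℚ ≤_) (sym (*-identityʳ D)) 2≤D) (≤-trans (proj₁ (proj₂ logˢ)) (ι-mono (n*≤ Λ Λ≤2^))))
   (begin
    1 ℕ.* suc (suc (2 ℕ.* Λ)) ≡⟨ ring Λ ⟩
    2 ℕ.+ 2 ℕ.* Λ ≤⟨ ℕ.+-monoˡ-≤ (2 ℕ.* Λ) (ℕ.≤-trans (ℕ.m≤m+n 2 42) 44≤Λ) ⟩
    3 ℕ.* Λ ∎)
   where
   ring : ∀ l → 1 ℕ.* suc (suc (2 ℕ.* l)) ≡ 2 ℕ.+ 2 ℕ.* l
   ring = ℕ-solve-∀

  rounds≤ : suc s′ ℕ.+ suc kᴮ ℕ.≤ 12 ℕ.* Λ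
  rounds≤ = ℕ.≤-trans (ℕ.+-mono-≤ s≤3Λ (proj₂ (proj₂ (proj₂ logᴮ)))) (ℕ.≤-reflexive (sym (ℕ.*-distribʳ-+ Λ 3 9)))

  exponents≤ : kᴵ ℕ.+ kᴮ ℕ.≤ v ℕ.* (36 ℕ.* κ)
  exponents≤ = begin
   kᴵ ℕ.+ kᴮ ≤⟨ ℕ.+-mono-≤ (ℕ.≤-trans (ℕ.n≤1+n kᴵ) (proj₂ (proj₂ (proj₂ logᴵ)))) (ℕ.≤-trans (ℕ.n≤1+n kᴮ) (proj₂ (proj₂ (proj₂ logᴮ)))) ⟩
   9 ℕ.* Λ ℕ.+ 9 ℕ.* Λ ≤⟨ ℕ.+-mono-≤ (ℕ.*-monoʳ-≤ 9 Λ≤2κv) (ℕ.*-monoʳ-≤ 9 Λ≤2κv) ⟩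
   _ ≡⟨ ring κ v ⟩
   v ℕ.* (36 ℕ.* κ) ∎
   where
   ring : ∀ k v → 9 ℕ.* (2 ℕ.* (k ℕ.* v)) ℕ.+ 9 ℕ.* (2 ℕ.* (k ℕ.* v)) ≡ v ℕ.* (36 ℕ.* k)
   ring = ℕ-solve-∀

  growth≤ : (mᴵ ℕ.+ mᴵ) ℕ.* Λ ℕ.* ((mᴮ ℕ.+ mᴮ) ℕ.* (6 ℕ.* d ℕ.* Λ)) ℕ.* 2 ℕ.^ (36 ℕ.* κ) ℕ.≤ n ℕ.* Λ ℕ.^ 4
  growth≤ = begin
   (mᴵ ℕ.+ mᴵ) ℕ.* Λ ℕ.* ((mᴮ ℕ.+ mᴮ) ℕ.* (6 ℕ.* d ℕ.* Λ)) ℕ.* P ≡⟨ ring₁ mᴵ mᴮ Λ d P ⟩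
   24 ℕ.* d ℕ.* (Λ ℕ.* Λ) ℕ.* P ℕ.* (mᴵ ℕ.* mᴮ) ≤⟨ ℕ.*-monoʳ-≤ (24 ℕ.* d ℕ.* (Λ ℕ.* Λ) ℕ.* P) (ℕ.≤-trans mm≤ (ℕ.*-monoʳ-≤ c (ℕ.*-monoʳ-≤ n (ℕ.+-monoˡ-≤ Λ 1≤Λ)))) ⟩
   24 ℕ.* d ℕ.* (Λ ℕ.* Λ) ℕ.* P ℕ.* (c ℕ.* (n ℕ.* (Λ ℕ.+ Λ))) ≡⟨ ring₂ d Λ P c n ⟩
   P ℕ.* (48 ℕ.* d ℕ.* c) ℕ.* (n ℕ.* (Λ ℕ.* (Λ ℕ.* Λ))) ≤⟨ ℕ.*-monoˡ-≤ (n ℕ.* (Λ ℕ.* (Λ ℕ.* Λ))) c≤Λ ⟩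
   Λ ℕ.* (n ℕ.* (Λ ℕ.* (Λ ℕ.* Λ))) ≡⟨ ring₃ Λ n ⟩
   n ℕ.* Λ ℕ.^ 4 ∎
   where
   P = 2 ℕ.^ (36 ℕ.* κ)
   ring₁ : ∀ a b l d p → (a ℕ.+ a) ℕ.* l ℕ.* ((b ℕ.+ b) ℕ.* (6 ℕ.* d ℕ.* l)) ℕ.* p ≡ 24 ℕ.* d ℕ.* (l ℕ.* l) ℕ.* p ℕ.* (a ℕ.* b)
   ring₁ = ℕ-solve-∀
   ring₂ : ∀ d l p c n → 24 ℕ.* d ℕ.* (l ℕ.* l) ℕ.* p ℕ.* (c ℕ.* (n ℕ.* (l ℕ.+ l))) ≡ p ℕ.* (48 ℕ.* d ℕ.* c) ℕ.* (n ℕ.* (l ℕ.* (l ℕ.* l)))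
   ring₂ = ℕ-solve-∀
   ring₃ : ∀ l n → l ℕ.* (n ℕ.* (l ℕ.* (l ℕ.* l))) ≡ n ℕ.* (l ℕ.* (l ℕ.* (l ℕ.* (l ℕ.* 1))))
   ring₃ = ℕ-solve-∀

  joint≤ : 2 ℕ.* (n ℕ.* (12 ℕ.* Λ ℕ.* (9 ℕ.* Λ ℕ.* Λ))) ℕ.≤ 2 ℕ.^ (4 ℕ.* suc Λ)
  joint≤ = begin
   2 ℕ.* (n ℕ.* (12 ℕ.* Λ ℕ.* (9 ℕ.* Λ ℕ.* Λ))) ≡⟨ ring₁ n Λ ⟩
   n ℕ.* (6 ℕ.* Λ ℕ.* (6 ℕ.* Λ ℕ.* (6 ℕ.* Λ))) ≤⟨ ℕ.*-mono-≤ (ℕ.<⇒≤ n<2^) (ℕ.*-mono-≤ 6Λ≤P (ℕ.*-mono-≤ 6Λ≤P 6Λ≤P)) ⟩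
   P ℕ.* (P ℕ.* (P ℕ.* P)) ≡⟨ ring₂ P ⟩
   P ℕ.^ 4 ≡⟨ ℕ.^-*-assoc 2 (suc Λ) 4 ⟩
   2 ℕ.^ (suc Λ ℕ.* 4) ≡⟨ cong (2 ℕ.^_) (ℕ.*-comm (suc Λ) 4) ⟩
   2 ℕ.^ (4 ℕ.* suc Λ) ∎
   where
   P = 2 ℕ.^ suc Λ
   6Λ≤P : 6 ℕ.* Λ ℕ.≤ P
   6Λ≤P = ℕ.≤-trans 6Λ≤ (ℕ.^-monoʳ-≤ 2 (ℕ.n≤1+n Λ))
   ring₁ : ∀ n l → 2 ℕ.* (n ℕ.* (12 ℕ.* l ℕ.* (9 ℕ.* l ℕ.* l))) ≡ n ℕ.* (6 ℕ.* l ℕ.* (6 ℕ.* l ℕ.* (6 ℕ.* l)))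
   ring₁ = ℕ-solve-∀
   ring₂ : ∀ p → p ℕ.* (p ℕ.* (p ℕ.* p)) ≡ p ℕ.* (p ℕ.* (p ℕ.* (p ℕ.* 1)))
   ring₂ = ℕ-solve-∀

 open ≤-Reasoning

 D^s′≤ : D ^ s′ ≤ ι n * ι Λ ^ 4
 D^s′≤ = ≤-trans (proj₁ (proj₂ logˢ)) (≤-trans (≤-reflexive (ι-* n Λ)) (*-monoˡ (ι n) (0≤ι n)
  (≤-trans (≤-reflexive (sym (*-identityʳ (ι Λ)))) (*-monoˡ (ι Λ) (0≤ι Λ) (1≤^ (1≤ι 1≤Λ) 3)))))

 -- Passing from `ρ` to `r` costs a factor `1 + y` per round with `y = 1/(2v)`, hence at most 2 for
 -- every `v` rounds. There are at most `36κv` of them, so the whole cost is the constant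
 -- `2 ^ (36κ)`, which one power of `Λ` absorbs.
 r^k≤ : r ^ (kᴵ ℕ.+ kᴮ) ≤ ι n * ι Λ ^ 4
 r^k≤ = begin
   r ^ e ≤⟨ ^-mono (1≤⇒0≤ 1≤r) r≤ e ⟩
   (ρ * (1ℚ + y)) ^ e ≡⟨ *-^ ρ (1ℚ + y) e ⟩
   ρ ^ e * (1ℚ + y) ^ e ≤⟨ *-mono (^-nonNeg 0≤ρ e) ρ^e≤ (^-nonNeg (+-nonNeg 0≤1 0≤y) e) y^e≤ ⟩
   ι Yᴵ * ι Yᴮ * ι (2 ℕ.^ w) ≡⟨ trans (cong (_* ι (2 ℕ.^ w)) (sym (ι-* Yᴵ Yᴮ))) (sym (ι-* (Yᴵ ℕ.* Yᴮ) (2 ℕ.^ w))) ⟩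
   ι (Yᴵ ℕ.* Yᴮ ℕ.* 2 ℕ.^ w) ≤⟨ ι-mono growth≤ ⟩
   ι (n ℕ.* Λ ℕ.^ 4) ≡⟨ trans (ι-* n (Λ ℕ.^ 4)) (cong (ι n *_) (ι-^ Λ 4)) ⟩
   ι n * ι Λ ^ 4 ∎
  where
  e = kᴵ ℕ.+ kᴮ
  w = 36 ℕ.* κ
  Yᴵ = (mᴵ ℕ.+ mᴵ) ℕ.* Λ
  Yᴮ = (mᴮ ℕ.+ mᴮ) ℕ.* (6 ℕ.* d ℕ.* Λ)
  y : ℚ
  y = (1ℚ + 1ℚ + 1ℚ) * σ
  0≤y : 0ℚ ≤ y
  0≤y = *-nonNeg (nonNegative⁻¹ (1ℚ + 1ℚ + 1ℚ)) 0≤s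
  r≤ : r ≤ ρ * (1ℚ + y)
  r≤ = ≤-by (y * (ρ - 1ℚ)) (*-nonNeg 0≤y (p≤q⇒0≤q-p 1≤ρ)) (solve 2 (λ r y → r :+ y :* (r :- y :- con 1ℚ) := (r :- y) :* (con 1ℚ :+ y)) refl r y)
  ρ^e≤ : ρ ^ e ≤ ι Yᴵ * ι Yᴮ
  ρ^e≤ = ≤-trans (≤-reflexive (^-+ ρ kᴵ kᴮ)) (*-mono (^-nonNeg 0≤ρ kᴵ) (proj₁ (proj₂ logᴵ)) (^-nonNeg 0≤ρ kᴮ) (proj₁ (proj₂ logᴮ)))
  1≤v : 1 ℕ.≤ v
  1≤v = ℕ.n≢0⇒n>0 λ { refl → contradiction 1≤M′ λ () }
  vy≤½ : ι v * y ≤ ½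
  vy≤½ = ≤-trans (≤-reflexive (solve 2 (λ v s → v :* (con (1ℚ + 1ℚ + 1ℚ) :* s) := con (1ℚ + 1ℚ + 1ℚ) :* v :* s) refl (ι v) σ))
   (*recip≤ (0<ι 1≤M′) (≤-reflexive (trans (cong (_* ι v) three) (sym (trans (cong (½ *_) (ι-* 6 v)) (sym (*-assoc ½ (ι 6) (ι v))))))))
   where
   three : 1ℚ + 1ℚ + 1ℚ ≡ ½ * ι 6
   three = sym (trans (cong (½ *_) (trans (double≡ 3) (cong (2ℚ *_) (trans (ι-suc 2) (cong (1ℚ +_) ι-2))))) refl)
  y≤1 : y ≤ 1ℚ
  y≤1 = ≤-trans (p≤q*p 0≤y (1≤ι 1≤v)) (≤-trans vy≤½ (≤-by {½} ½ (nonNegative⁻¹ ½) refl))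
  y^e≤ : (1ℚ + y) ^ e ≤ ι (2 ℕ.^ w)
  y^e≤ = begin
   (1ℚ + y) ^ e ≤⟨ ^-mono-exp (p≤p+q 0≤y) exponents≤ ⟩
   (1ℚ + y) ^ (v ℕ.* w) ≡⟨ ^-* (1ℚ + y) v w ⟩
   ((1ℚ + y) ^ v) ^ w ≤⟨ ^-mono (^-nonNeg (+-nonNeg 0≤1 0≤y) v) (^-≤2 y v 0≤y y≤1 vy≤½) w ⟩
   2ℚ ^ w ≡⟨ sym (trans (ι-^ 2 w) (cong (_^ w) ι-2)) ⟩
   ι (2 ℕ.^ w) ∎

 n≤r^ : ι n ≤ r ^ (suc kᴵ ℕ.+ suc kᴮ)
 n≤r^ = begin
  ι n ≤⟨ ι-mono (ℕ.≤-trans n≤mm (ℕ.*-mono-≤ (ℕ.≤-trans (ℕ.m≤m+n mᴵ mᴵ) (ℕ.m≤m*n (mᴵ ℕ.+ mᴵ) Λ {{ℕ.>-nonZero 1≤Λ}})) (ℕ.≤-trans (ℕ.m≤m+n mᴮ mᴮ) (ℕ.m≤m*n (mᴮ ℕ.+ mᴮ) (6 ℕ.* d ℕ.* Λ) {{ℕ.>-nonZero 1≤6dΛ}})))) ⟩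
  ι ((mᴵ ℕ.+ mᴵ) ℕ.* Λ ℕ.* ((mᴮ ℕ.+ mᴮ) ℕ.* (6 ℕ.* d ℕ.* Λ))) ≡⟨ ι-* ((mᴵ ℕ.+ mᴵ) ℕ.* Λ) ((mᴮ ℕ.+ mᴮ) ℕ.* (6 ℕ.* d ℕ.* Λ)) ⟩
  ι ((mᴵ ℕ.+ mᴵ) ℕ.* Λ) * ι ((mᴮ ℕ.+ mᴮ) ℕ.* (6 ℕ.* d ℕ.* Λ)) ≤⟨ *-mono (0≤ι ((mᴵ ℕ.+ mᴵ) ℕ.* Λ)) (proj₁ (proj₂ (proj₂ logᴵ))) (0≤ι ((mᴮ ℕ.+ mᴮ) ℕ.* (6 ℕ.* d ℕ.* Λ))) (proj₁ (proj₂ (proj₂ logᴮ))) ⟩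
  ρ ^ suc kᴵ * ρ ^ suc kᴮ ≡⟨ sym (^-+ ρ (suc kᴵ) (suc kᴮ)) ⟩
  ρ ^ (suc kᴵ ℕ.+ suc kᴮ) ≤⟨ ^-mono 0≤ρ (≤-by ((1ℚ + 1ℚ + 1ℚ) * σ) (*-nonNeg (nonNegative⁻¹ (1ℚ + 1ℚ + 1ℚ)) 0≤s) (solve 2 (λ r y → r :- y :+ y := r) refl r ((1ℚ + 1ℚ + 1ℚ) * σ))) (suc kᴵ ℕ.+ suc kᴮ) ⟩
  r ^ (suc kᴵ ℕ.+ suc kᴮ) ∎

 n≤D^ : ι n ≤ D ^ suc s′
 n≤D^ = ≤-trans (ι-mono (ℕ.m≤m*n n Λ {{ℕ.>-nonZero 1≤Λ}})) (<⇒≤ (proj₂ (proj₂ logˢ)))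

 zᴵ zᴮ : ℚ
 zᴵ = recip (1ℚ + ρ ^ suc kᴵ * recip (ι (mᴵ ℕ.+ mᴵ)))
 zᴮ = recip (1ℚ + ρ ^ suc kᴮ * recip (ι (mᴮ ℕ.+ mᴮ)))

 0≤z : ∀ t m → 1 ℕ.≤ m → 0ℚ ≤ recip (1ℚ + ρ ^ t * recip (ι (m ℕ.+ m)))
 0≤z t m 1≤m = <⇒≤ (recip-pos (<-≤-trans 0<1 (p≤p+q (*-nonNeg (^-nonNeg 0≤ρ t) (<⇒≤ (recip-pos (0<ι (ℕ.≤-trans 1≤m (ℕ.m≤m+n m m)))))))))

 zᴵ≤ℓ : zᴵ ≤ ℓ
 zᴵ≤ℓ = recip-ratio (mᴵ ℕ.+ mᴵ) Λ (ℕ.≤-trans 1≤mᴵ (ℕ.m≤m+n mᴵ mᴵ)) 1≤Λ (proj₁ (proj₂ (proj₂ logᴵ)))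

 zᴮ≤ : zᴮ ≤ recip (ι (6 ℕ.* d ℕ.* Λ))
 zᴮ≤ = recip-ratio (mᴮ ℕ.+ mᴮ) (6 ℕ.* d ℕ.* Λ) (ℕ.≤-trans 1≤mᴮ (ℕ.m≤m+n mᴮ mᴮ)) 1≤6dΛ (proj₁ (proj₂ (proj₂ logᴮ)))

 0≤zᴮ : 0ℚ ≤ zᴮ
 0≤zᴮ = 0≤z (suc kᴮ) mᴮ 1≤mᴮ

 zᴮ≤1 : zᴮ ≤ 1ℚ
 zᴮ≤1 = ≤-trans zᴮ≤ (recip≤1 (1≤ι 1≤6dΛ))

 backward≤ : ι n * (2ℚ * (pgf zᴮ ^ d) ^ suc s′) ≤ 2ℚ * 2ℚ * ℓ
 backward≤ = begin
   ι n * (2ℚ * (pgf zᴮ ^ d) ^ s) ≤⟨ *-monoˡ (ι n) (0≤ι n) (*-monoˡ 2ℚ 0≤2 power) ⟩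
   ι n * (2ℚ * ((q ^ d) ^ s * 2ℚ)) ≡⟨ solve 2 (λ n u → n :* (con 2ℚ :* (u :* con 2ℚ)) := con 2ℚ :* con 2ℚ :* (n :* u)) refl (ι n) ((q ^ d) ^ s) ⟩
   2ℚ * 2ℚ * (ι n * (q ^ d) ^ s) ≤⟨ *-monoˡ (2ℚ * 2ℚ) (nonNegative⁻¹ (2ℚ * 2ℚ)) nu≤ ⟩
   2ℚ * 2ℚ * ℓ ∎
  where
  s = suc s′
  nu≤ : ι n * (q ^ d) ^ s ≤ ℓ
  nu≤ = ≤recip (0<ι 1≤Λ) (begin
   ι n * (q ^ d) ^ s * ι Λ ≡⟨ solve 3 (λ n u l → n :* u :* l := n :* l :* u) refl (ι n) ((q ^ d) ^ s) (ι Λ) ⟩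
   ι n * ι Λ * (q ^ d) ^ s ≤⟨ *-monoʳ ((q ^ d) ^ s) (^-nonNeg (^-nonNeg 0≤q d) s) (≤-trans (≤-reflexive (sym (ι-* n Λ))) (<⇒≤ (proj₂ (proj₂ logˢ)))) ⟩
   D ^ s * (q ^ d) ^ s ≡⟨ D^*q^ s ⟩
   1ℚ ∎)
  dsz≤½ : ι (d ℕ.* s) * zᴮ ≤ ½
  dsz≤½ = begin
   ι (d ℕ.* s) * zᴮ ≤⟨ *-mono (0≤ι (d ℕ.* s)) (ι-mono (ℕ.*-monoʳ-≤ d s≤3Λ)) 0≤zᴮ zᴮ≤ ⟩
   ι (d ℕ.* (3 ℕ.* Λ)) * recip (ι (6 ℕ.* d ℕ.* Λ)) ≤⟨ *recip≤ (0<ι 1≤6dΛ) (≤-reflexive (sym half)) ⟩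
   ½ ∎
   where
   ring : ∀ d l → 6 ℕ.* d ℕ.* l ≡ 2 ℕ.* (d ℕ.* (3 ℕ.* l))
   ring = ℕ-solve-∀
   half : ½ * ι (6 ℕ.* d ℕ.* Λ) ≡ ι (d ℕ.* (3 ℕ.* Λ))
   half = trans (cong (λ t → ½ * ι t) (ring d Λ)) (trans (cong (½ *_) (double≡ (d ℕ.* (3 ℕ.* Λ)))) (solve 1 (λ t → con ½ :* (con 2ℚ :* t) := t) refl (ι (d ℕ.* (3 ℕ.* Λ)))))
  power : (pgf zᴮ ^ d) ^ s ≤ (q ^ d) ^ s * 2ℚ
  power = begin
   (pgf zᴮ ^ d) ^ s ≡⟨ sym (^-* (pgf zᴮ) d s) ⟩
   pgf zᴮ ^ (d ℕ.* s) ≤⟨ ^-mono (0≤pgf 0≤zᴮ zᴮ≤1) (pgf≤ 0≤zᴮ) (d ℕ.* s) ⟩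
   (q * (1ℚ + zᴮ)) ^ (d ℕ.* s) ≡⟨ *-^ q (1ℚ + zᴮ) (d ℕ.* s) ⟩
   q ^ (d ℕ.* s) * (1ℚ + zᴮ) ^ (d ℕ.* s) ≤⟨ *-monoˡ (q ^ (d ℕ.* s)) (^-nonNeg 0≤q (d ℕ.* s)) (^-≤2 zᴮ (d ℕ.* s) 0≤zᴮ zᴮ≤1 dsz≤½) ⟩
   q ^ (d ℕ.* s) * 2ℚ ≡⟨ cong (_* 2ℚ) (^-* q d s) ⟩
   (q ^ d) ^ s * 2ℚ ∎

 -- `½ ^ (4(Λ + 1))` is less than the inverse fourth power of `n`, which outweighs `n` targets and
 -- of order `Λ²` pairs of times.
 join≤ : let k = d ℕ.* d ℕ.* (4 ℕ.* suc Λ) in ι n * (ι (suc s′ ℕ.+ suc kᴮ) * (ι (suc kᴵ) * (½ ^ k + θ ^ k))) ≤ ℓ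
 join≤ = ≤recip (0<ι 1≤Λ) (begin
   ι n * (ι S * (ι (suc kᴵ) * γ)) * ι Λ ≤⟨ *-monoʳ (ι Λ) (0≤ι Λ) (*-monoˡ (ι n) (0≤ι n) (*-mono (0≤ι S) (ι-mono rounds≤) (*-nonNeg (0≤ι (suc kᴵ)) 0≤γ) (*-mono (0≤ι (suc kᴵ)) (ι-mono (proj₂ (proj₂ (proj₂ logᴵ)))) 0≤γ (γ≤ (4 ℕ.* suc Λ))))) ⟩
   ι n * (ι (12 ℕ.* Λ) * (ι (9 ℕ.* Λ) * (2ℚ * h))) * ι Λ ≡⟨ solve 5 (λ n a b h l → n :* (a :* (b :* (con 2ℚ :* h))) :* l := h :* (con 2ℚ :* (n :* (a :* (b :* l))))) refl (ι n) (ι (12 ℕ.* Λ)) (ι (9 ℕ.* Λ)) h (ι Λ) ⟩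
   h * (2ℚ * (ι n * (ι (12 ℕ.* Λ) * (ι (9 ℕ.* Λ) * ι Λ)))) ≡⟨ cong (h *_) (sym (trans (double≡ (n ℕ.* (12 ℕ.* Λ ℕ.* (9 ℕ.* Λ ℕ.* Λ)))) (cong (2ℚ *_) (trans (ι-* n (12 ℕ.* Λ ℕ.* (9 ℕ.* Λ ℕ.* Λ))) (cong (ι n *_) (trans (ι-* (12 ℕ.* Λ) (9 ℕ.* Λ ℕ.* Λ)) (cong (ι (12 ℕ.* Λ) *_) (ι-* (9 ℕ.* Λ) Λ)))))))) ⟩
   h * ι (2 ℕ.* (n ℕ.* (12 ℕ.* Λ ℕ.* (9 ℕ.* Λ ℕ.* Λ)))) ≤⟨ *-monoˡ h (^-nonNeg (nonNegative⁻¹ ½) (4 ℕ.* suc Λ)) (ι-mono joint≤) ⟩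
   h * ι (2 ℕ.^ (4 ℕ.* suc Λ)) ≡⟨ ½^*2^ (4 ℕ.* suc Λ) ⟩
   1ℚ ∎)
  where
  S = suc s′ ℕ.+ suc kᴮ
  k = d ℕ.* d ℕ.* (4 ℕ.* suc Λ)
  h : ℚ
  h = ½ ^ (4 ℕ.* suc Λ)
  γ : ℚ
  γ = ½ ^ k + θ ^ k
  0≤γ : 0ℚ ≤ γ
  0≤γ = +-nonNeg (^-nonNeg (nonNegative⁻¹ ½) k) (^-nonNeg (0≤pgf 0≤q q≤1) k)

-- The two tails of the broadcast time.

module Tails where

 open SparsityBound

 open import Data.Nat.DivMod using (_/_; m/n*n≤m; m/n<m; m≥n⇒m/n>0)
 open Rationals

 joinConstant : ℕ → ℕ
 joinConstant d = 2048 ℕ.* (suc d ℕ.* suc d) ℕ.* (d ℕ.* d ℕ.* (4 ℕ.* (d ℕ.* d)))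

 growthConstant : ℕ → ℕ
 growthConstant d = 2 ℕ.^ (36 ℕ.* Parameters.Constants.κ d) ℕ.* (48 ℕ.* d ℕ.* joinConstant d)

 module Upper (d : ℕ) (3≤d : 3 ℕ.≤ d) (Λ n : ℕ) (2^Λ≤n : 2 ℕ.^ Λ ℕ.≤ n) (n<2^ : n ℕ.< 2 ℕ.^ suc Λ)
  (big : Parameters.Constants.threshold d ℕ.≤ Λ) (44≤Λ : 44 ℕ.≤ Λ) (c≤Λ : growthConstant d ℕ.≤ Λ) where

  open Parameters.Constants d using (h; κ; c₁; c₂)
  private
   module P = Parameters.Choice d 3≤d Λ n 2^Λ≤n big
  open P using (1≤d; 1≤n; M; M′; 1≤M′; mᴵ; mᴮ; R; 1≤mᴮ; k; X)

  private
   instance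
    d≢0 : ℕ.NonZero d
    d≢0 = ℕ.>-nonZero 1≤d

  1≤mᴵ : 1 ℕ.≤ mᴵ
  1≤mᴵ = ℕ.*-mono-≤ {1} {8} (ℕ.z<s) (ℕ.*-mono-≤ {1} {suc d} (ℕ.z<s) (ℕ.*-mono-≤ {1} {suc d} (ℕ.z<s) 1≤mᴮ))

  n≤mm : n ℕ.≤ mᴵ ℕ.* mᴮ
  n≤mm = ℕ.≤-trans (ℕ.≤-trans (ℕ.m≤n*m n d) (ℕ.≤-trans (ℕ.m≤n*m (d ℕ.* n) d) (ℕ.≤-trans (ℕ.m≤n*m (d ℕ.* (d ℕ.* n)) k {{ℕ.>-nonZero P.1≤k}}) (ℕ.m≤n*m (k ℕ.* (d ℕ.* (d ℕ.* n))) 16))))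
   (ℕ.≤-trans P.X≤RR (ℕ.*-mono-≤ (ℕ.≤-trans R≤mᴮ (ℕ.≤-trans (ℕ.m≤n*m mᴮ (suc d)) (ℕ.≤-trans (ℕ.m≤n*m (suc d ℕ.* mᴮ) (suc d)) (ℕ.m≤n*m (suc d ℕ.* (suc d ℕ.* mᴮ)) 8)))) R≤mᴮ))
   where
   R≤mᴮ : R ℕ.≤ mᴮ
   R≤mᴮ = ℕ.m≤n*m R 2

  6dΛ≤ : 6 ℕ.* d ℕ.* Λ ℕ.≤ 2 ℕ.^ Λ
  6dΛ≤ = ℕ.≤-trans (ℕ.*-monoˡ-≤ Λ (ℕ.*-mono-≤ {6} {14} (ℕ.m≤m+n 6 8) (ℕ.m≤m*n d d)))
   (ℕ.≤-trans (Parameters.linear≤exponential c₂ Λ (ℕ.≤-trans (ℕ.≤-trans (ℕ.m≤m+n (2 ℕ.* (3 ℕ.* c₂ ℕ.+ 4)) (κ ℕ.* (d ℕ.+ 6))) (ℕ.m≤n+m _ (2 ℕ.* (3 ℕ.* c₁ ℕ.+ 4)))) big))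
    (ℕ.^-monoʳ-≤ 2 (ℕ.≤-trans (ℕ.m≤m*n (Λ / 2) 2) (m/n*n≤m Λ 2))))

  6Λ≤ : 6 ℕ.* Λ ℕ.≤ 2 ℕ.^ Λ
  6Λ≤ = ℕ.≤-trans (ℕ.*-monoˡ-≤ Λ (ℕ.m≤m*n 6 d)) 6dΛ≤

  open RunningTimes d 3≤d n Λ P.v κ mᴵ mᴮ (joinConstant d) 44≤Λ n<2^ 1≤n P.36≤M′ 1≤M′ P.Λ≤2κv 6dΛ≤ 6Λ≤ 1≤mᴵ 1≤mᴮ P.mᴵ≤n P.mᴮ≤n n≤mm P.mᴵ*mᴮ≤ c≤Λ public

  Λ≤2^hM : Λ ℕ.≤ 2 ℕ.^ (h ℕ.* M)
  Λ≤2^hM = begin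
    Λ ≤⟨ P.Λ≤2κv ⟩
    2 ℕ.* (κ ℕ.* P.v) ≡⟨ ring h d P.v ⟩
    16 ℕ.* (h ℕ.* M) ≤⟨ Parameters.linear≤exponential 16 (h ℕ.* M) large ⟩
    2 ℕ.^ (h ℕ.* M / 2) ≤⟨ ℕ.^-monoʳ-≤ 2 (ℕ.≤-trans (ℕ.m≤m*n (h ℕ.* M / 2) 2) (m/n*n≤m (h ℕ.* M) 2)) ⟩
    2 ℕ.^ (h ℕ.* M) ∎
   where
   open ℕ.≤-Reasoning
   ring : ∀ h d v → 2 ℕ.* (4 ℕ.* (24 ℕ.* (h ℕ.* suc d)) ℕ.* v) ≡ 16 ℕ.* (h ℕ.* (2 ℕ.* (suc d ℕ.* (6 ℕ.* v))))
   ring = ℕ-solve-∀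
   large : 104 ℕ.≤ h ℕ.* M
   large = ℕ.≤-trans (ℕ.m≤m+n 104 920) (ℕ.*-mono-≤ (ℕ.*-monoʳ-≤ 64 1≤d) P.M≥16)

  sparsity≤ : ½ ^ (h ℕ.* M) ≤ ℓ
  sparsity≤ = ≤recip (0<ι 1≤Λ) (≤-trans (*-monoˡ (½ ^ (h ℕ.* M)) (^-nonNeg (nonNegative⁻¹ ½) (h ℕ.* M)) (ι-mono Λ≤2^hM)) (≤-reflexive (½^*2^ (h ℕ.* M))))

  horizon : ℕ
  horizon = (suc s′ ℕ.+ suc kᴮ) ℕ.+ (2 ℕ.+ suc kᴵ)

  open Expectation d 1≤d using (EH)
  open OneRound d 1≤d using (pgf; 0≤pgf)

  -- `9 = 2 + 2 + 4 + 1`, for sparsity, forward growth, backward growth and joining.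
  late-unlikely : (v : Fin n) → Σ (λ G → EH G horizon (λ cs → indicator (not (informed v cs ≡ˢ ⊤)))) (regularGraphs n d) ≤ (ℤ.+ 9 ℚ./ 1) * ℓ * ι (length (regularGraphs n d))
  late-unlikely v = ≤-trans (F.late-completion (suc s′) (suc kᴮ) (suc kᴵ) (*-nonNeg 0≤2 (0≤z (suc kᴵ) mᴵ 1≤mᴵ)) (*-nonNeg 0≤2 (^-nonNeg (^-nonNeg (0≤pgf 0≤zᴮ zᴮ≤1) d) (suc s′))))
    (*-monoʳ (ι (length (regularGraphs n d))) (0≤ι (length (regularGraphs n d))) (begin
     2ℚ * ½ ^ (h ℕ.* M) + 2ℚ * zᴵ + ι n * (B + J) ≡⟨ cong (2ℚ * ½ ^ (h ℕ.* M) + 2ℚ * zᴵ +_) (*-distribˡ-+ (ι n) B J) ⟩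
     2ℚ * ½ ^ (h ℕ.* M) + 2ℚ * zᴵ + (ι n * B + ι n * J)
      ≤⟨ +-mono-≤ (+-mono-≤ (*-monoˡ 2ℚ 0≤2 sparsity≤) (*-monoˡ 2ℚ 0≤2 zᴵ≤ℓ)) (+-mono-≤ backward≤ join≤) ⟩
     2ℚ * ℓ + 2ℚ * ℓ + (2ℚ * 2ℚ * ℓ + ℓ)
      ≡⟨ solve 1 (λ l → con 2ℚ :* l :+ con 2ℚ :* l :+ (con 2ℚ :* con 2ℚ :* l :+ l) := con (ℤ.+ 9 ℚ./ 1) :* l) refl ℓ ⟩
     (ℤ.+ 9 ℚ./ 1) * ℓ ∎))
   where
   open ≤-Reasoning
   module F = FastSpread n d 3≤d 1≤n v M M′ P.m₁ h mᴮ mᴵ P.R₀ R k {{P.M≢0}} 1≤M′ 0≤ρ ℕ.≤-refl P.M≥2d P.M≥dd P.M≥16 P.hd P.small P.very-small 1≤mᴮ ℕ.≤-refl ℕ.≤-refl P.2R₀≤ ℕ.≤-refl P.1≤k P.enough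
   B J : ℚ
   B = 2ℚ * (pgf zᴮ ^ d) ^ suc s′
   J = ι (suc s′ ℕ.+ suc kᴮ) * (ι (suc kᴵ) * F.γ)

 module Lower (d : ℕ) (3≤d : 3 ℕ.≤ d) (Λ n : ℕ) (1≤Λ : 1 ℕ.≤ Λ) (Λ≤n : Λ ℕ.≤ n) (2≤n : 2 ℕ.≤ n) where

  open Rate d 3≤d 1 ℕ.≤-refl using (1≤d; r)
  open Expectation d 1≤d using (EH)
  open Estimates.Rates d 3≤d

  private
   ℓ : ℚ
   ℓ = recip (ι Λ)
   0≤ℓ : 0ℚ ≤ ℓ
   0≤ℓ = <⇒≤ (recip-pos (0<ι 1≤Λ))
   1≤Y : 1ℚ ≤ ι n * ℓ
   1≤Y = ≤*recip (0<ι 1≤Λ) (≤-trans (≤-reflexive (*-identityˡ (ι Λ))) (ι-mono Λ≤n))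

  abstract
   logʳ : ∃[ k ] (r ^ k ≤ ι n * ℓ × ι n * ℓ < r ^ suc k)
   logʳ = logarithm r 3 (ℕ.z<s) (subst (λ t → 1ℚ + t ≤ r) (1/suc≡recip 2) 4/3≤r) (ι n * ℓ) 1≤Y
   logᴰ : ∃[ k ] (D ^ k ≤ ι n * ℓ × ι n * ℓ < D ^ suc k)
   logᴰ = logarithm D 1 ℕ.≤-refl (subst (λ t → 1ℚ + t ≤ D) (1/suc≡recip 0) 2≤D) (ι n * ℓ) 1≤Y

  t₁ t₂ : ℕ
  t₁ = proj₁ logʳ
  t₂ = proj₁ logᴰ

  below-n : ι n * ℓ ≤ ι n
  below-n = p*q≤p (0≤ι n) (recip≤1 (1≤ι 1≤Λ))

  above : ∀ {y} → ι n * ℓ < y → ι n ≤ y * ι Λ ^ 4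
  above {y} h = ≤-trans (≤-trans (≤-reflexive (sym (trans (*-assoc (ι n) ℓ (ι Λ)) (trans (cong (ι n *_) (recip-*ˡ (0<ι 1≤Λ))) (*-identityʳ (ι n)))))) (*-monoʳ (ι Λ) (0≤ι Λ) (<⇒≤ h)))
   (*-monoˡ y (≤-trans (*-nonNeg (0≤ι n) 0≤ℓ) (<⇒≤ h)) (≤-trans (≤-reflexive (sym (*-identityʳ (ι Λ)))) (*-monoˡ (ι Λ) (0≤ι Λ) (1≤^ (1≤ι 1≤Λ) 3))))

  -- `14 = 12 + 2`: Markov's inequality at `n/2` informed vertices, and Chebyshev's for the spared
  -- among the others.
  early-unlikely : (G : Graph n) → Regular d G → (v : Fin n) → EH G (t₂ ℕ.+ t₁) (λ cs → indicator (informed v cs ≡ˢ ⊤)) ≤ (ℤ.+ 14 ℚ./ 1) * ℓ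
  early-unlikely G reg v = ≤-trans (SlowSpread.early-completion 3≤d G reg t₂ t₁ v m 1≤m m<n (0<^ 0<q d))
    (≤-trans (+-mono-≤ first second) (≤-reflexive (solve 1 (λ l → con (ℤ.+ 12 ℚ./ 1) :* l :+ con 2ℚ :* l := con (ℤ.+ 14 ℚ./ 1) :* l) refl ℓ)))
   where
   m : ℕ
   m = n / 2
   1≤m : 1 ℕ.≤ m
   1≤m = m≥n⇒m/n>0 2≤n
   m<n : m ℕ.< n
   m<n = m/n<m n 2 {{ℕ.>-nonZero (ℕ.≤-trans (ℕ.z<s) 2≤n)}} ℕ.≤-refl
   4ℚ : ℚ
   4ℚ = 1ℚ + (1ℚ + 1ℚ + 1ℚ)
   first : r ^ t₁ * 4ℚ * recip (ι m) ≤ (ℤ.+ 12 ℚ./ 1) * ℓ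
   first = *recip≤ (0<ι 1≤m) (begin
     r ^ t₁ * 4ℚ ≤⟨ *-monoʳ 4ℚ (nonNegative⁻¹ 4ℚ) (≤-trans (proj₁ (proj₂ logʳ)) (*-monoʳ ℓ 0≤ℓ (ι-mono n≤3m))) ⟩
     ι (3 ℕ.* m) * ℓ * 4ℚ ≡⟨ cong (λ t → t * ℓ * 4ℚ) (trans (ι-* 3 m) (cong (_* ι m) (trans (ι-suc 2) (cong (1ℚ +_) ι-2)))) ⟩
     (1ℚ + 2ℚ) * ι m * ℓ * 4ℚ ≡⟨ solve 2 (λ m l → con (1ℚ + 2ℚ) :* m :* l :* con 4ℚ := con (ℤ.+ 12 ℚ./ 1) :* l :* m) refl (ι m) ℓ ⟩
     (ℤ.+ 12 ℚ./ 1) * ℓ * ι m ∎)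
    where
    open ≤-Reasoning
    n≤3m : n ℕ.≤ 3 ℕ.* m
    n≤3m = ℕ.≤-trans (Parameters.halves n) (ℕ.≤-trans (ℕ.+-monoʳ-≤ (2 ℕ.* m) 1≤m) (ℕ.≤-reflexive (ring m)))
     where
     ring : ∀ m → 2 ℕ.* m ℕ.+ m ≡ 3 ℕ.* m
     ring = ℕ-solve-∀
   second : recip (ι (n ℕ.∸ m) * (q ^ d) ^ t₂) ≤ 2ℚ * ℓ
   second = subst (_≤ 2ℚ * ℓ) (*-identityˡ (recip (ι (n ℕ.∸ m) * (q ^ d) ^ t₂))) (*recip≤ (*-pos (0<ι (ℕ.m<n⇒0<n∸m m<n)) 0<u) (begin
     1ℚ ≡⟨ sym (D^*q^ t₂) ⟩
     D ^ t₂ * u ≤⟨ *-monoʳ u (<⇒≤ 0<u) (≤-trans (proj₁ (proj₂ logᴰ)) (*-monoʳ ℓ 0≤ℓ (ι-mono n≤))) ⟩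
     ι (2 ℕ.* (n ℕ.∸ m)) * ℓ * u ≡⟨ cong (λ t → t * ℓ * u) (double≡ (n ℕ.∸ m)) ⟩
     2ℚ * ι (n ℕ.∸ m) * ℓ * u ≡⟨ solve 3 (λ n l u → con 2ℚ :* n :* l :* u := con 2ℚ :* l :* (n :* u)) refl (ι (n ℕ.∸ m)) ℓ u ⟩
     2ℚ * ℓ * (ι (n ℕ.∸ m) * u) ∎))
    where
    open ≤-Reasoning
    u : ℚ
    u = (q ^ d) ^ t₂
    0<u : 0ℚ < u
    0<u = 0<^ (0<^ 0<q d) t₂
    n≤ : n ℕ.≤ 2 ℕ.* (n ℕ.∸ m)
    n≤ = ℕ.≤-trans (ℕ.≤-reflexive (sym (trans (cong (ℕ._∸ n) (cong (n ℕ.+_) (ℕ.+-identityʳ n))) (ℕ.m+n∸n≡m n n)))) (ℕ.≤-trans (ℕ.∸-monoʳ-≤ (2 ℕ.* n) (ℕ.≤-trans (ℕ.≤-reflexive (ℕ.*-comm 2 m)) (m/n*n≤m n 2))) (ℕ.≤-reflexive (sym (ℕ.*-distribˡ-∸ 2 n m))))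

-- Broadcast times and their probabilities in terms of informed sets.

module BroadcastTimes where

 open Rationals

 private variable
  n t τ e T₀ : ℕ

 completedNow≡ : ∀ v (cs : History n t) → completedNow v cs ≡ (if informed v cs ≡ˢ ⊤ then just t else nothing)
 completedNow≡ {t = t} v cs = cong (λ b → if b then just t else nothing) (isYes≗does (Vec.≡-dec Bool._≟_ (informed v cs) ⊤))

 completedNow-complete : ∀ v (cs : History n t) → (informed v cs ≡ˢ ⊤) ≡ true → completedNow v cs ≡ just t
 completedNow-complete {t = t} v cs h = trans (completedNow≡ v cs) (cong (λ b → if b then just t else nothing) h)

 completedNow-incomplete : ∀ v (cs : History n t) → (informed v cs ≡ˢ ⊤) ≡ false → completedNow v cs ≡ nothing
 completedNow-incomplete {t = t} v cs h = trans (completedNow≡ v cs) (cong (λ b → if b then just t else nothing) h)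

 completedNow-just : ∀ v (cs : History n t) → completedNow v cs ≡ just T₀ → T₀ ≡ t
 completedNow-just v cs h with bool-cases (informed v cs ≡ˢ ⊤)
 ... | inj₁ e with trans (sym h) (completedNow-complete v cs e)
 ... | refl = refl
 completedNow-just v cs h | inj₂ e with trans (sym h) (completedNow-incomplete v cs e)
 ... | ()

 <∣>-cases : ∀ (a b : Maybe ℕ) → a <∣> b ≡ just T₀ → a ≡ just T₀ ⊎ (a ≡ nothing × b ≡ just T₀)
 <∣>-cases (just _) b h = inj₁ h
 <∣>-cases nothing b h = inj₂ (refl , h)

 <∣>-just : ∀ (a b : Maybe ℕ) {s} → b ≡ just s → ∃[ T₀ ] a <∣> b ≡ just T₀
 <∣>-just (just x) b h = x , refl
 <∣>-just nothing b h = _ , h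

 broadcastTime-≤ : ∀ v (cs : History n t) → broadcastTime v cs ≡ just T₀ → T₀ ℕ.≤ t
 broadcastTime-≤ v [] h = ℕ.≤-reflexive (completedNow-just v [] h)
 broadcastTime-≤ v (c ∷ cs) h with <∣>-cases (broadcastTime v cs) (completedNow v (c ∷ cs)) h
 ... | inj₁ h′ = ℕ.m≤n⇒m≤1+n (broadcastTime-≤ v cs h′)
 ... | inj₂ (_ , h′) = ℕ.≤-reflexive (completedNow-just v (c ∷ cs) h′)

 broadcastTime-complete : ∀ v (cs : History n t) → (informed v cs ≡ˢ ⊤) ≡ true → ∃[ T₀ ] broadcastTime v cs ≡ just T₀
 broadcastTime-complete v [] h = _ , completedNow-complete v [] h
 broadcastTime-complete v (c ∷ cs) h = <∣>-just (broadcastTime v cs) (completedNow v (c ∷ cs)) (completedNow-complete v (c ∷ cs) h)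

 incomplete-before : ∀ v (c : Round n) (cs : History n t) → (informed v (c ∷ cs) ≡ˢ ⊤) ≡ false → (informed v cs ≡ˢ ⊤) ≡ false
 incomplete-before {n = n} v c cs h = false-does (Vec.≡-dec Bool._≟_ (informed v cs) ⊤) λ all →
  does-false (Vec.≡-dec Bool._≟_ (informed v (c ∷ cs)) ⊤) h (subset-ext λ w → trans
   (push-old c (informed v cs) (trans (cong (λ X → lookup X w) all) (Vec.lookup-replicate w true))) (sym (Vec.lookup-replicate w true)))

 broadcastTime-incomplete : ∀ v (cs : History n t) → (informed v cs ≡ˢ ⊤) ≡ false → broadcastTime v cs ≡ nothing
 broadcastTime-incomplete v [] h = completedNow-incomplete v [] h
 broadcastTime-incomplete v (c ∷ cs) h = trans (cong (_<∣> completedNow v (c ∷ cs)) (broadcastTime-incomplete v cs (incomplete-before v c cs h)))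
  (completedNow-incomplete v (c ∷ cs) h)

 broadcastTime-> : ∀ v (as : History n e) (bs : History n τ) → (informed v bs ≡ˢ ⊤) ≡ false → broadcastTime v (as Vec.++ bs) ≡ just T₀ → τ ℕ.< T₀
 broadcastTime-> v [] bs h h′ with trans (sym h′) (broadcastTime-incomplete v bs h)
 ... | ()
 broadcastTime-> {e = suc e} {τ = τ} v (c ∷ as) bs h h′ with <∣>-cases (broadcastTime v (as Vec.++ bs)) (completedNow v (c ∷ as Vec.++ bs)) h′
 ... | inj₁ h″ = broadcastTime-> v as bs h h″
 ... | inj₂ (_ , h″) = subst (τ ℕ.<_) (sym (completedNow-just v (c ∷ as Vec.++ bs) h″)) (ℕ.s≤s (ℕ.m≤n+m τ e))

 -- The decidable set of times through which closeness to `C ln n`, a statement about reals, is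
 -- certified in `ProbabilityAtLeast`.
 between : ℕ → ℕ → ℕ → Bool
 between a b s = does (a ℕ.<? s) ∧ does (s ℕ.≤? b)

 between-sound : ∀ a b s → T (between a b s) → a ℕ.< s × s ℕ.≤ b
 between-sound a b s h with bool-cases (does (a ℕ.<? s)) | bool-cases (does (s ℕ.≤? b))
 ... | inj₁ p | inj₁ q = does-true (a ℕ.<? s) p , does-true (s ℕ.≤? b) q
 ... | inj₁ p | inj₂ q = contradiction (subst T (cong₂ _∧_ p q) h) λ ()
 ... | inj₂ p | _ = contradiction (subst T (cong (_∧ does (s ℕ.≤? b)) p) h) λ ()

 between-complete : ∀ {a b s} → a ℕ.< s → s ℕ.≤ b → between a b s ≡ true
 between-complete {a} {b} {s} p q = cong₂ _∧_ (true-does (a ℕ.<? s) p) (true-does (s ℕ.≤? b) q)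

 within early late : ∀ {n e τ} → Fin n → History n e → History n τ → ℚ
 within {e = e} {τ} v as bs = indicator (maybe (between τ (e ℕ.+ τ)) false (broadcastTime v (as Vec.++ bs)))
 early v as bs = indicator (informed v bs ≡ˢ ⊤)
 late v as bs = indicator (not (informed v (as Vec.++ bs) ≡ˢ ⊤))

 three-events : ∀ v (as : History n e) (bs : History n τ) → 1ℚ ≤ within v as bs + late v as bs + early v as bs
 three-events {e = e} {τ} v as bs with bool-cases (informed v bs ≡ˢ ⊤) | bool-cases (informed v (as Vec.++ bs) ≡ˢ ⊤)
 ... | inj₁ p | _ = subst (λ b → 1ℚ ≤ within v as bs + late v as bs + indicator b) (sym p)
  (subst (_≤ within v as bs + late v as bs + 1ℚ) (+-identityˡ 1ℚ) (+-monoˡ-≤ 1ℚ (+-nonNeg (0≤indicator (maybe (between τ (e ℕ.+ τ)) false (broadcastTime v (as Vec.++ bs)))) (0≤indicator (not (informed v (as Vec.++ bs) ≡ˢ ⊤))))))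
 ... | inj₂ p | inj₂ q = ≤-trans (subst (λ b → 1ℚ ≤ within v as bs + indicator (not b)) (sym q)
  (subst (_≤ within v as bs + 1ℚ) (+-identityˡ 1ℚ) (+-monoˡ-≤ 1ℚ (0≤indicator (maybe (between τ (e ℕ.+ τ)) false (broadcastTime v (as Vec.++ bs)))))))
  (p≤p+q (0≤indicator (informed v bs ≡ˢ ⊤)))
 ... | inj₂ p | inj₁ q = ≤-trans (≤-reflexive (sym in-time)) (≤-trans (p≤p+q (0≤indicator (not (informed v (as Vec.++ bs) ≡ˢ ⊤)))) (p≤p+q (0≤indicator (informed v bs ≡ˢ ⊤))))
  where
  time = broadcastTime-complete v (as Vec.++ bs) q
  in-time : within v as bs ≡ 1ℚ
  in-time = trans (cong (λ m → indicator (maybe (between τ (e ℕ.+ τ)) false m)) (proj₂ time))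
   (cong indicator (between-complete (broadcastTime-> v as bs p (proj₂ time)) (broadcastTime-≤ v (as Vec.++ bs) (proj₂ time))))

 module _ {d n : ℕ} (1≤d : 1 ℕ.≤ d) (v : Fin n) (e τ : ℕ) (α β : ℚ) where

  open Expectation d 1≤d

  private
   𝒢 : List (Graph n)
   𝒢 = regularGraphs n d
   F Lt : History n (e ℕ.+ τ) → ℚ
   F cs = indicator (maybe (between τ (e ℕ.+ τ)) false (broadcastTime v cs))
   Lt cs = indicator (not (informed v cs ≡ˢ ⊤))

  -- The early tail is bounded for each graph, the late one only on average over graphs; the first
  -- is therefore integrated graph by graph and the second enters after summation.
  probability-between : 1 ℕ.≤ length 𝒢 →
   Σ (λ G → EH G (e ℕ.+ τ) (λ cs → indicator (not (informed v cs ≡ˢ ⊤)))) 𝒢 ≤ α * ι (length 𝒢) →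
   (∀ G → Regular d G → EH G τ (λ cs → indicator (informed v cs ≡ˢ ⊤)) ≤ β) →
   1ℚ - (α + β) ≤ probability d v (e ℕ.+ τ) (between τ (e ℕ.+ τ))
  probability-between 1≤N rarely-late rarely-early = ≤-trans (≤*recip (0<ι 1≤N) total) (≤-reflexive (sym (average≡ (λ G → average F (histories G (e ℕ.+ τ))) 𝒢 1≤N)))
   where
   open ≤-Reasoning
   N : ℚ
   N = ι (length 𝒢)
   each : ∀ G → Regular d G → 1ℚ - β ≤ EH G (e ℕ.+ τ) F + EH G (e ℕ.+ τ) Lt
   each G reg = begin
     1ℚ - β ≡⟨ sym (EH-const G deg e (1ℚ - β)) ⟩
     EH G e (λ as → 1ℚ - β) ≤⟨ EH-mono G e inner ⟩
     EH G e (λ as → EH G τ (λ bs → F (as Vec.++ bs) + Lt (as Vec.++ bs))) ≡⟨ sym (EH-++ G e τ (λ cs → F cs + Lt cs)) ⟩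
     EH G (e ℕ.+ τ) (λ cs → F cs + Lt cs) ≡⟨ EH-+ G (e ℕ.+ τ) F Lt ⟩
     EH G (e ℕ.+ τ) F + EH G (e ℕ.+ τ) Lt ∎
    where
    deg = proj₂ (proj₂ reg)
    inner : ∀ as → 1ℚ - β ≤ EH G τ (λ bs → F (as Vec.++ bs) + Lt (as Vec.++ bs))
    inner as = ≤-trans (+-monoˡ-≤ (- β) (begin
      1ℚ ≡⟨ sym (EH-const G deg τ 1ℚ) ⟩
      EH G τ (λ _ → 1ℚ) ≤⟨ EH-mono G τ (three-events v as) ⟩
      EH G τ (λ bs → F (as Vec.++ bs) + Lt (as Vec.++ bs) + early v as bs) ≡⟨ EH-+ G τ (λ bs → F (as Vec.++ bs) + Lt (as Vec.++ bs)) (early v as) ⟩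
      EH G τ (λ bs → F (as Vec.++ bs) + Lt (as Vec.++ bs)) + EH G τ (early v as) ≤⟨ +-monoʳ-≤ (EH G τ (λ bs → F (as Vec.++ bs) + Lt (as Vec.++ bs))) (rarely-early G reg) ⟩
      EH G τ (λ bs → F (as Vec.++ bs) + Lt (as Vec.++ bs)) + β ∎))
     (≤-reflexive (solve 2 (λ x b → x :+ b :- b := x) refl (EH G τ (λ bs → F (as Vec.++ bs) + Lt (as Vec.++ bs))) β))
   S : ℚ
   S = Σ (λ G → average F (histories G (e ℕ.+ τ))) 𝒢
   summed : N * (1ℚ - β) ≤ S + α * N
   summed = begin
    N * (1ℚ - β) ≡⟨ sym (Σ-const (1ℚ - β) 𝒢) ⟩
    Σ (λ _ → 1ℚ - β) 𝒢 ≤⟨ Σ-mono 𝒢 (λ G G∈ → ≤-trans (each G (regularGraphs-sound n d G∈)) (+-monoˡ-≤ (EH G (e ℕ.+ τ) Lt)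
                                               (≤-reflexive (sym (average-histories G (proj₂ (proj₂ (regularGraphs-sound n d G∈))) (e ℕ.+ τ) F))))) ⟩
    Σ (λ G → average F (histories G (e ℕ.+ τ)) + EH G (e ℕ.+ τ) Lt) 𝒢 ≡⟨ Σ-+ (λ G → average F (histories G (e ℕ.+ τ))) (λ G → EH G (e ℕ.+ τ) Lt) 𝒢 ⟩
    S + Σ (λ G → EH G (e ℕ.+ τ) Lt) 𝒢 ≤⟨ +-monoʳ-≤ S rarely-late ⟩
    S + α * N ∎
   total : (1ℚ - (α + β)) * N ≤ S
   total = 0≤q-p⇒p≤q (subst (0ℚ ≤_) (solve 4 (λ s a b n → s :+ a :* n :- n :* (con 1ℚ :- b) := s :- (con 1ℚ :- (a :+ b)) :* n) refl S α β N) (p≤q⇒0≤q-p summed))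

open Tails

open BroadcastTimes

-- Concentration of the broadcast time for large `n`.

module Concentration (d : ℕ) (3≤d : 3 ℕ.≤ d) where

 open Rationals
 open Growth.Rate d 3≤d 1 ℕ.≤-refl using (1≤d; r)
 open RealBound using (bound; constant)
 open Rates d 3≤d
 open Defs using (ProbabilityAtLeast; abs; fromℕ; fromℚ; lnℕ; lnlnℕ; C)

 binary-logarithm : ∀ n → 1 ℕ.≤ n → ∃[ Λ ] (2 ℕ.^ Λ ℕ.≤ n × n ℕ.< 2 ℕ.^ suc Λ)
 binary-logarithm n 1≤n with lastTrue {P = λ k → 2 ℕ.^ k ℕ.≤ n} (λ k → 2 ℕ.^ k ℕ.≤? n) 1≤n (suc n) (ℕ.<⇒≱ (Parameters.n≤2^n (suc n)))
 ... | Λ , le , gt = Λ , le , ℕ.≰⇒> gt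

 Near : ∀ n → 2 ℕ.≤ n → ℕ → Set
 Near n 2≤n s = abs (fromℕ s Defs.- C d 3≤d Defs.* lnℕ n 2≤n) Defs.≤ fromℚ (constant d 3≤d 4 5) Defs.* (lnlnℕ n 2≤n Defs.* lnlnℕ n 2≤n)

 -- The summand `d` ensures `d < n`, so that a regular graph exists; the others come from the
 -- parameters and the running times.
 large : ℕ
 large = Parameters.Constants.threshold d ℕ.+ (44 ℕ.+ (growthConstant d ℕ.+ d))

 module _ (n Λ : ℕ) (2≤n : 2 ℕ.≤ n) (2∣dn : 2 ∣ d ℕ.* n) (2^Λ≤n : 2 ℕ.^ Λ ℕ.≤ n) (n<2^ : n ℕ.< 2 ℕ.^ suc Λ) (big : large ℕ.≤ Λ) (v : Fin n) where

  private
   44+≤Λ : 44 ℕ.+ (growthConstant d ℕ.+ d) ℕ.≤ Λ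
   44+≤Λ = ℕ.≤-trans (ℕ.m≤n+m (44 ℕ.+ (growthConstant d ℕ.+ d)) (Parameters.Constants.threshold d)) big
   44≤Λ : 44 ℕ.≤ Λ
   44≤Λ = ℕ.≤-trans (ℕ.m≤m+n 44 (growthConstant d ℕ.+ d)) 44+≤Λ
   Λ≤n : Λ ℕ.≤ n
   Λ≤n = ℕ.≤-trans (Parameters.n≤2^n Λ) 2^Λ≤n
   d<n : d ℕ.< n
   d<n = ℕ.≤-trans (ℕ.+-mono-≤ {1} {44} (ℕ.z<s) (ℕ.m≤n+m d (growthConstant d))) (ℕ.≤-trans 44+≤Λ Λ≤n)

  open Upper d 3≤d Λ n 2^Λ≤n n<2^ (ℕ.≤-trans (ℕ.m≤m+n _ _) big) 44≤Λ (ℕ.≤-trans (ℕ.≤-trans (ℕ.m≤m+n (growthConstant d) d) (ℕ.m≤n+m _ 44)) 44+≤Λ)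
  open Lower d 3≤d Λ n 1≤Λ Λ≤n 2≤n

  τ : ℕ
  τ = t₂ ℕ.+ t₁

  τ≤horizon : τ ℕ.≤ horizon
  τ≤horizon = ℕ.≤-trans (ℕ.+-mono-≤ t₂≤ t₁≤) (ℕ.≤-trans (ℕ.m≤m+n _ 2) (ℕ.≤-reflexive (ring s′ kᴵ kᴮ)))
   where
   ring : ∀ s i b → suc s ℕ.+ (suc i ℕ.+ suc b) ℕ.+ 2 ≡ (suc s ℕ.+ suc b) ℕ.+ (2 ℕ.+ suc i)
   ring = ℕ-solve-∀
   1<2 : 1ℚ < 1ℚ + 1ℚ
   1<2 = ℚ.+-monoʳ-< 1ℚ 0<1
   1<r : 1ℚ < r
   1<r = <-≤-trans (ℚ.+-monoʳ-< 1ℚ (positive⁻¹ (ℤ.+ 1 ℚ./ 3))) 4/3≤r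
   t₂≤ : t₂ ℕ.≤ suc s′
   t₂≤ = ^-cancel-≤ (<-≤-trans 1<2 2≤D) (≤-trans (proj₁ (proj₂ logᴰ)) (≤-trans below-n n≤D^))
   t₁≤ : t₁ ℕ.≤ suc kᴵ ℕ.+ suc kᴮ
   t₁≤ = ^-cancel-≤ 1<r (≤-trans (proj₁ (proj₂ logʳ)) (≤-trans below-n n≤r^))

  e : ℕ
  e = horizon ℕ.∸ τ

  horizon≡ : horizon ≡ e ℕ.+ τ
  horizon≡ = sym (ℕ.m∸n+n≡m τ≤horizon)

  -- The additive 5 is made up of the two joining rounds and the three phases, each one round longer
  -- than its discrete logarithm.
  near : ∀ s → T (between τ (e ℕ.+ τ) s) → Near n 2≤n s
  near s h = bound d 3≤d 4 5 n Λ s (kᴵ ℕ.+ kᴮ) s′ (suc t₁) (suc t₂) 2≤n (ℕ.≤-trans (ℕ.m≤m+n 8 36) 44≤Λ) 2^Λ≤n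
    (ℕ.≤-trans (proj₂ (between-sound τ (e ℕ.+ τ) s h)) (ℕ.≤-trans (ℕ.≤-reflexive (sym horizon≡)) (ℕ.≤-reflexive (ring₁ s′ kᴵ kᴮ))))
    (subst (λ t → t ^ (kᴵ ℕ.+ kᴮ) ≤ ι n * ι Λ ^ 4) (sym r̂≡r) r^k≤)
    (subst (_≤ ι n * ι Λ ^ 4) (sym (x̂^ s′)) D^s′≤)
    (ℕ.≤-trans (ℕ.≤-reflexive (ring₂ t₁ t₂)) (ℕ.≤-trans (ℕ.s≤s (proj₁ (between-sound τ (e ℕ.+ τ) s h))) (ℕ.≤-trans (ℕ.≤-reflexive (ℕ.+-comm 1 s)) (ℕ.+-monoʳ-≤ s (ℕ.z<s)))))
    (subst (λ t → ι n ≤ t ^ suc t₁ * ι Λ ^ 4) (sym r̂≡r) (above (proj₂ (proj₂ logʳ))))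
    (subst (λ t → ι n ≤ t * ι Λ ^ 4) (sym (x̂^ (suc t₂))) (above (proj₂ (proj₂ logᴰ))))
   where
   ring₁ : ∀ s i b → (suc s ℕ.+ suc b) ℕ.+ (2 ℕ.+ suc i) ≡ i ℕ.+ b ℕ.+ s ℕ.+ 5
   ring₁ = ℕ-solve-∀
   ring₂ : ∀ a b → suc a ℕ.+ suc b ≡ suc (suc (b ℕ.+ a))
   ring₂ = ℕ-solve-∀
   x̂^ : ∀ j → RealBound.x̂ d 3≤d ^ (d ℕ.* j) ≡ D ^ j
   x̂^ j = trans (cong (_^ (d ℕ.* j)) x̂≡x) (^-* x d j)

  nonempty : 1 ℕ.≤ length (regularGraphs n d)
  nonempty = inhabited (regularGraphs-complete n d {proj₁ example} (proj₂ example))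
   where
   example : ∃[ G ] Regular {n} d G
   example = Circulant.regular-exists n d d<n 2∣dn
   inhabited : ∀ {A : Set} {a : A} {xs} → a ∈ xs → 1 ℕ.≤ length xs
   inhabited (here _) = ℕ.z<s
   inhabited (there _) = ℕ.z<s

  open Processes.Expectation d 1≤d using (EH)

  -- `23 = 9 + 14` collects the two tails.
  concentration : ∀ ε → (ℤ.+ 23 ℚ./ 1) ≤ ε * ι Λ → ProbabilityAtLeast d v (Near n 2≤n) (1ℚ - ε)
  concentration ε hε = e ℕ.+ τ , between τ (e ℕ.+ τ) , near ,
    ≤-trans (+-monoʳ-≤ 1ℚ (neg-antimono-≤ (≤-trans (≤-reflexive (solve 1 (λ l → con (ℤ.+ 9 ℚ./ 1) :* l :+ con (ℤ.+ 14 ℚ./ 1) :* l := con (ℤ.+ 23 ℚ./ 1) :* l) refl ℓ)) (*recip≤ {ℤ.+ 23 ℚ./ 1} {ε} (0<ι 1≤Λ) hε))))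
     (probability-between 1≤d v e τ ((ℤ.+ 9 ℚ./ 1) * ℓ) ((ℤ.+ 14 ℚ./ 1) * ℓ) nonempty
      (subst (λ t → FiniteSums.Σ (λ G → EH G t (λ cs → indicator (not (informed v cs GrowthOfProcesses.≡ˢ ⊤)))) (regularGraphs n d) ≤ (ℤ.+ 9 ℚ./ 1) * ℓ * ι (length (regularGraphs n d))) horizon≡ (late-unlikely v))
      (λ G reg → early-unlikely G reg v))

 sufficient : ∀ ε → 0ℚ < ε → ∃[ E ] (∀ Λ → E ℕ.≤ Λ → (ℤ.+ 23 ℚ./ 1) ≤ ε * ι Λ)
 sufficient ε 0<ε with ι-archimedes ((ℤ.+ 23 ℚ./ 1) * recip ε)
 ... | E , h = E , λ Λ E≤Λ → ≤-trans (≤-reflexive (sym (trans (solve 3 (λ e a i → e :* (a :* i) := a :* (e :* i)) refl ε (ℤ.+ 23 ℚ./ 1) (recip ε)) (trans (cong ((ℤ.+ 23 ℚ./ 1) *_) (recip-*ʳ 0<ε)) (*-identityʳ (ℤ.+ 23 ℚ./ 1))))))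
  (*-monoˡ ε (<⇒≤ 0<ε) (≤-trans h (ι-mono E≤Λ)))

 threshold-for : ∀ ε → 0ℚ < ε → ∃[ N ] (∀ n (2≤n : 2 ℕ.≤ n) → N ℕ.≤ n → 2 ∣ d ℕ.* n → (v : Fin n) → ProbabilityAtLeast d v (Near n 2≤n) (1ℚ - ε))
 threshold-for ε 0<ε = 2 ℕ.^ (large ℕ.+ E) , λ n 2≤n N≤n 2∣dn v → at n 2≤n N≤n 2∣dn v (binary-logarithm n (ℕ.≤-trans (ℕ.z<s) 2≤n))
  where
  E : ℕ
  E = proj₁ (sufficient ε 0<ε)
  at : ∀ n (2≤n : 2 ℕ.≤ n) → 2 ℕ.^ (large ℕ.+ E) ℕ.≤ n → 2 ∣ d ℕ.* n → (v : Fin n) → ∃[ Λ ] (2 ℕ.^ Λ ℕ.≤ n × n ℕ.< 2 ℕ.^ suc Λ) → ProbabilityAtLeast d v (Near n 2≤n) (1ℚ - ε)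
  at n 2≤n N≤n 2∣dn v (Λ , lo , hi) = concentration n Λ 2≤n 2∣dn lo hi (ℕ.≤-trans (ℕ.m≤m+n large E) large+E≤Λ) v ε (proj₂ (sufficient ε 0<ε) Λ (ℕ.≤-trans (ℕ.m≤n+m E large) large+E≤Λ))
   where
   large+E≤Λ : large ℕ.+ E ℕ.≤ Λ
   large+E≤Λ = ℕ.≮⇒≥ λ lt → ℕ.<-irrefl refl (ℕ.<-≤-trans hi (ℕ.≤-trans (ℕ.^-monoʳ-≤ 2 lt) N≤n))

open import Defs

theorem1 : (d : ℕ) (3≤d : 3 ℕ.≤ d) →
 Σ[ K ∈ ℝ ] (∀ (ε : ℚ) → 0ℚ ℚ.< ε →
  Σ[ N ∈ ℕ ] (∀ (n : ℕ) (2≤n : 2 ℕ.≤ n) → N ℕ.≤ n → 2 ∣ d ℕ.* n → (v : Fin n) →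
   ProbabilityAtLeast d v
    (λ T → abs (fromℕ T - C d 3≤d * lnℕ n 2≤n) ≤ K * (lnlnℕ n 2≤n * lnlnℕ n 2≤n))
    (1ℚ ℚ.- ε)))
theorem1 d 3≤d = Defs.fromℚ (RealBound.constant d 3≤d 4 5) , Concentration.threshold-for d 3≤d
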